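{- Let $H$ be a Borel graph with $\mathrm{asi}(H)<\infty$ and let $G_1$, $G_2$ be two spanning Borel subgraphs of $H$. Suppose that the maximum degree of $G_1$ is at most $\Delta\in\mathbb{N}$, where $\Delta\geq 2$. If every component of $G_2$ contains at least $2^{25}\,\Delta\log\Delta$ vertices, then there is a Borel $G_1$-independent complete section for $G_2$.
   Context: All graphs are undirected and simple; $\mathbb{N}=\{0,1,2,\dots\}$; $\log$ is the natural logarithm. A Borel graph is a graph $G$ whose vertex set $V(G)$ is a standard Borel space and whose adjacency relation is a Borel subset of $V(G)^2$. A spanning Borel subgraph of $H$ is a Borel graph $G$ with $V(G)=V(H)$ and $E(G)\subseteq E(H)$. All graphs considered are locally countable (every vertex has countably many neighbors). A set $I\subseteq V(G)$ is $G$-independent if no two vertices of $I$ are adjacent in $G$. A complete section for a graph $G$ is a set $S\subseteq V(G)$ that meets every connected component of $G$. A graph is component-finite if all its connected components are finite. $G[U]$ denotes the subgraph induced by $U\subseteq V(G)$. For a Borel graph $G$, the separation index $\mathrm{si}(G)$ is the smallest $s\in\mathbb{N}$ for which there is a partition $V(G)=U_0\sqcup\dots\sqcup U_s$ into $s+1$ Borel sets such that every $G[U_i]$ is component-finite ($\infty$ if no such $s$ exists). For $R\in\mathbb{N}$, $G^R$ is the graph on $V(G)$ in which two distinct vertices are adjacent iff they are joined by a path of at most $R$ edges in $G$. The asymptotic separation index is $\mathrm{asi}(G)=\sup_{R\in\mathbb{N}}\mathrm{si}(G^R)$. -}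

module Defs where

open import Level using (Level; 0ℓ; _⊔_) renaming (suc to lsuc)
open import Data.Nat as ℕ using (ℕ; zero; suc)
import Data.Nat.Properties as ℕ
open import Data.Integer as ℤ using (+_)
import Data.Integer.Properties as ℤ
open import Data.Rational as ℚ using (ℚ; 0ℚ; 1ℚ; _/_)
import Data.Rational.Properties as ℚ
open import Data.Rational.Unnormalised as ℚᵘ using (mkℚᵘ)
import Data.Rational.Unnormalised.Properties as ℚᵘ
open import Data.Fin using (Fin)
open import Data.List using (List; []; _∷_; length)
open import Data.List.Membership.Propositional using (_∈_; _∉_)
open import Data.List.Relation.Unary.All using (All)
open import Data.List.Relation.Unary.Unique.Propositional using (Unique)
open import Data.Maybe using (Maybe; just)
open import Data.Product using (Σ; ∃-syntax; _×_; _,_; uncurry)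
open import Data.Refinement using (Refinement; value)
open import Data.Sum using (inj₁; inj₂)
open import Function using (_on_; _⇔_)
open import Relation.Binary
  using (Rel; Symmetric; Irreflexive)
  renaming (_⇒_ to _⊑_)
open import Relation.Binary.Construct.Closure.ReflexiveTransitive using (Star)
open import Relation.Binary.PropositionalEquality
  using (_≡_; _≢_; refl; sym; trans; cong; subst)
open import Relation.Nullary using (¬_)
open import Relation.Unary using (Pred; _⊆_; _≐_; ∅; ∁; ⋃; _⟨×⟩_)

private
  variable
    ℓ : Level

-- A Dedekind cut, represented by its lower half.  No locatedness is required:
-- in classical logic (which the theorem assumes) it is automatic.
record ℝ : Set₁ where
  field
    lower     : Pred ℚ 0ℓ
    inhabited : ∃[ p ] lower p
    bounded   : ∃[ q ] ¬ lower q
    downward  : ∀ {p q} → p ℚ.≤ q → lower q → lower p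
    rounded   : ∀ {p} → lower p → ∃[ q ] (p ℚ.< q × lower q)

open ℝ

infix 4 _≤ᴿ_ _<ᴿ_ _≈ᴿ_

_≤ᴿ_ _<ᴿ_ _≈ᴿ_ : ℝ → ℝ → Set
x ≤ᴿ y = lower x ⊆ lower y
x <ᴿ y = ∃[ q ] (¬ lower x q × lower y q)
x ≈ᴿ y = lower x ≐ lower y

private
  p-1<p : ∀ p → p ℚ.- 1ℚ ℚ.< p
  p-1<p p = subst (p ℚ.- 1ℚ ℚ.<_) (ℚ.+-identityʳ p)
    (ℚ.+-monoʳ-< p (ℚ.negative⁻¹ (ℚ.- 1ℚ)))

  ∉⇒> : ∀ x {p q} → lower x p → ¬ lower x q → p ℚ.< q
  ∉⇒> x p∈x q∉x = ℚ.≰⇒> (λ q≤p → q∉x (downward x q≤p p∈x))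

fromℚ : ℚ → ℝ
fromℚ r = record
  { lower     = ℚ._< r
  ; inhabited = r ℚ.- 1ℚ , p-1<p r
  ; bounded   = r , ℚ.<-irrefl refl
  ; downward  = ℚ.≤-<-trans
  ; rounded   = λ p<r → let (q , p<q , q<r) = ℚ.<-dense p<r in q , p<q , q<r
  }

fromℕ : ℕ → ℝ
fromℕ n = fromℚ (+ n / 1)

infixl 6 _+ᴿ_

_+ᴿ_ : ℝ → ℝ → ℝ
x +ᴿ y = record
  { lower     = sums
  ; inhabited =
      let (p , p∈x) = inhabited x
          (q , q∈y) = inhabited y
      in p ℚ.+ q , p , q , p∈x , q∈y , refl
  ; bounded   =
      let (p , p∉x) = bounded x
          (q , q∉y) = bounded y
      in p ℚ.+ q , λ (r , s , r∈x , s∈y , eq) →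
           ℚ.<-irrefl (sym eq) (ℚ.+-mono-< (∉⇒> x r∈x p∉x) (∉⇒> y s∈y q∉y))
  ; downward  = down
  ; rounded   = λ (r , s , r∈x , s∈y , eq) →
      let (r′ , r<r′ , r′∈x) = rounded x r∈x
      in r′ ℚ.+ s
       , subst (ℚ._< r′ ℚ.+ s) (sym eq) (ℚ.+-monoˡ-< s r<r′)
       , r′ , s , r′∈x , s∈y , refl
  }
  where
  sums : Pred ℚ 0ℓ
  sums t = ∃[ r ] ∃[ s ] (lower x r × lower y s × t ≡ r ℚ.+ s)

  down : ∀ {p q} → p ℚ.≤ q → sums q → sums p
  down {p} {q} p≤q (r , s , r∈x , s∈y , refl) =
    p ℚ.- s , s , downward x p-s≤r r∈x , s∈y , sym (cancel p)
    where
    open import Algebra.Properties.AbelianGroup ℚ.+-0-abelianGroup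
      using (//-rightDividesˡ; //-rightDividesʳ)
    cancel : ∀ t → t ℚ.- s ℚ.+ s ≡ t
    cancel t = //-rightDividesˡ s t
    p-s≤r : p ℚ.- s ℚ.≤ r
    p-s≤r = subst (p ℚ.- s ℚ.≤_) (//-rightDividesʳ s r)
      (ℚ.+-monoˡ-≤ (ℚ.- s) p≤q)

infixr 7 _·_

_·_ : ℕ → ℝ → ℝ
zero  · x = fromℕ 0
suc n · x = x +ᴿ n · x

harmonic : ℕ → ℕ → ℚ
harmonic N zero    = 0ℚ
harmonic N (suc k) = harmonic N k ℚ.+ + 1 / suc (N ℕ.+ k)

-- Natural logarithm of n ≥ 1, as log n = ∫₁ⁿ dt/t: the supremum of the
-- lower Riemann sums over the subdivisions of [1,n] into (n-1)N intervals of
-- length 1/N.  The interval ending at 1 + (i+1)/N contributes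
-- (1/N) · 1/(1 + (i+1)/N) = 1/(N+i+1).  (The value at n = 0 is junk.)
lowerSum : ℕ → ℕ → ℚ
lowerSum n N = harmonic N (N ℕ.* (n ℕ.∸ 1))

private
  harmonic≤ : ∀ N k → harmonic (suc N) k ℚ.≤ ℚ.fromℚᵘ (mkℚᵘ (+ k) N)
  harmonic≤ N zero = ℚ.toℚᵘ-cancel-≤
    (ℚᵘ.≤-respʳ-≃ (ℚᵘ.≃-sym (ℚ.toℚᵘ-fromℚᵘ (mkℚᵘ (+ 0) N)))
      (ℚᵘ.≤-reflexive (ℚᵘ.*≡* refl)))
  harmonic≤ N (suc k) = ℚ.toℚᵘ-cancel-≤ (begin
    ℚ.toℚᵘ (harmonic (suc N) k ℚ.+ + 1 / suc (suc N ℕ.+ k))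
      ≃⟨ ℚ.toℚᵘ-homo-+ (harmonic (suc N) k) (+ 1 / suc (suc N ℕ.+ k)) ⟩
    ℚ.toℚᵘ (harmonic (suc N) k) ℚᵘ.+ ℚ.toℚᵘ (+ 1 / suc (suc N ℕ.+ k))
      ≤⟨ ℚᵘ.+-mono-≤ (ℚ.toℚᵘ-mono-≤ (harmonic≤ N k))
           (ℚᵘ.≤-reflexive (ℚ.toℚᵘ-fromℚᵘ (mkℚᵘ (+ 1) (suc N ℕ.+ k)))) ⟩
    ℚ.toℚᵘ (ℚ.fromℚᵘ (mkℚᵘ (+ k) N)) ℚᵘ.+ mkℚᵘ (+ 1) (suc N ℕ.+ k)
      ≤⟨ ℚᵘ.+-mono-≤ (ℚᵘ.≤-reflexive (ℚ.toℚᵘ-fromℚᵘ (mkℚᵘ (+ k) N))) 1/≤ ⟩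
    mkℚᵘ (+ k) N ℚᵘ.+ mkℚᵘ (+ 1) N
      ≃⟨ add ⟩
    mkℚᵘ (+ suc k) N
      ≃⟨ ℚ.toℚᵘ-fromℚᵘ (mkℚᵘ (+ suc k) N) ⟨
    ℚ.toℚᵘ (ℚ.fromℚᵘ (mkℚᵘ (+ suc k) N)) ∎)
    where
    open ℚᵘ.≤-Reasoning
    1/≤ : mkℚᵘ (+ 1) (suc N ℕ.+ k) ℚᵘ.≤ mkℚᵘ (+ 1) N
    1/≤ = ℚᵘ.*≤* (ℤ.*-monoˡ-≤-nonNeg (+ 1)
      (ℤ.+≤+ (ℕ.s≤s (ℕ.≤-trans (ℕ.m≤m+n N k) (ℕ.n≤1+n _)))))
    add : mkℚᵘ (+ k) N ℚᵘ.+ mkℚᵘ (+ 1) N ℚᵘ.≃ mkℚᵘ (+ suc k) N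
    add = ℚᵘ.*≡* (identity (+ k) (+ suc N))
      where
      open import Data.Integer.Tactic.RingSolver using (solve-∀)
      identity : ∀ x y → (x ℤ.* y ℤ.+ + 1 ℤ.* y) ℤ.* y
                       ≡ (+ 1 ℤ.+ x) ℤ.* (y ℤ.* y)
      identity = solve-∀

  lowerSum≤ : ∀ n N → lowerSum n (suc N) ℚ.≤ + (n ℕ.∸ 1) / 1
  lowerSum≤ n N = subst (lowerSum n (suc N) ℚ.≤_) (ℚ.fromℚᵘ-cong eq)
    (harmonic≤ N (suc N ℕ.* (n ℕ.∸ 1)))
    where
    m = n ℕ.∸ 1
    eq : mkℚᵘ (+ (suc N ℕ.* m)) N ℚᵘ.≃ mkℚᵘ (+ m) 0
    eq = ℚᵘ.*≡* (trans (ℤ.*-identityʳ (+ (suc N ℕ.* m)))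
           (trans (cong +_ (ℕ.*-comm (suc N) m)) (ℤ.pos-* m (suc N))))

log : ℕ → ℝ
log n = record
  { lower     = λ q → ∃[ N ] q ℚ.< lowerSum n (suc N)
  ; inhabited = lowerSum n 1 ℚ.- 1ℚ , 0 , p-1<p _
  ; bounded   = + (n ℕ.∸ 1) / 1 , λ (N , b<s) →
      ℚ.<-irrefl refl (ℚ.<-≤-trans b<s (lowerSum≤ n N))
  ; downward  = λ p≤q (N , q<s) → N , ℚ.≤-<-trans p≤q q<s
  ; rounded   = λ (N , p<s) →
      let (q , p<q , q<s) = ℚ.<-dense p<s in q , p<q , N , q<s
  }

module _ {A : Set} where

  AtMost : ℕ → Pred A ℓ → Set ℓ
  AtMost n P = ∃[ xs ] (length xs ℕ.≤ n × P ⊆ (_∈ xs))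

  Finite : Pred A ℓ → Set ℓ
  Finite P = ∃[ n ] AtMost n P

  -- Satisfied for every r when P is infinite.
  AtLeast : ℝ → Pred A ℓ → Set ℓ
  AtLeast r P = ∃[ xs ] (Unique xs × All P xs × r ≤ᴿ fromℕ (length xs))

  -- Maybe allows for the empty set.
  Countable : Pred A ℓ → Set ℓ
  Countable P = Σ (ℕ → Maybe A) λ f → ∀ {x} → P x → ∃[ n ] f n ≡ just x

record MeasurableSpace : Set₂ where
  field
    Carrier    : Set
    Measurable : Pred (Pred Carrier 0ℓ) (lsuc 0ℓ)
    respects   : ∀ {A B} → A ≐ B → Measurable A → Measurable B
    empty      : Measurable ∅
    complement : ∀ {A} → Measurable A → Measurable (∁ A)
    union      : ∀ {A : ℕ → Pred Carrier 0ℓ} →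
                 (∀ n → Measurable (A n)) → Measurable (⋃ ℕ A)

data Generated {X : Set} (𝓖 : Pred (Pred X 0ℓ) ℓ) :
               Pred (Pred X 0ℓ) (lsuc 0ℓ ⊔ ℓ) where
  base       : ∀ {A} → 𝓖 A → Generated 𝓖 A
  respects   : ∀ {A B} → A ≐ B → Generated 𝓖 A → Generated 𝓖 B
  empty      : Generated 𝓖 ∅
  complement : ∀ {A} → Generated 𝓖 A → Generated 𝓖 (∁ A)
  union      : ∀ {A : ℕ → Pred X 0ℓ} →
               (∀ n → Generated 𝓖 (A n)) → Generated 𝓖 (⋃ ℕ A)

_⊗_ : MeasurableSpace → MeasurableSpace → MeasurableSpace
X ⊗ Y = record
  { Carrier    = X.Carrier × Y.Carrier
  ; Measurable = Generated Rectangle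
  ; respects   = respects
  ; empty      = empty
  ; complement = complement
  ; union      = union
  }
  where
  module X = MeasurableSpace X
  module Y = MeasurableSpace Y
  Rectangle : Pred (Pred (X.Carrier × Y.Carrier) 0ℓ) (lsuc 0ℓ)
  Rectangle C = ∃[ A ] ∃[ B ]
    (X.Measurable A × Y.Measurable B × C ≐ (A ⟨×⟩ B))

record PolishMetric (X : Set) : Set₁ where
  field
    dist     : X → X → ℝ
    identity : ∀ {x y} → dist x y ≈ᴿ fromℚ 0ℚ ⇔ x ≡ y
    symmetry : ∀ {x y} → dist x y ≈ᴿ dist y x
    triangle : ∀ {x y z} → dist x z ≤ᴿ dist x y +ᴿ dist y z

  Open : Pred (Pred X 0ℓ) 0ℓ
  Open A = ∀ {x} → A x →
    ∃[ ε ] (0ℚ ℚ.< ε × (∀ {y} → dist x y <ᴿ fromℚ ε → A y))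

  Dense : Pred (Pred X 0ℓ) 0ℓ
  Dense A = ∀ x {ε} → 0ℚ ℚ.< ε → ∃[ y ] (A y × dist x y <ᴿ fromℚ ε)

  Cauchy : Pred (ℕ → X) 0ℓ
  Cauchy f = ∀ {ε} → 0ℚ ℚ.< ε →
    ∃[ N ] (∀ {m n} → N ℕ.≤ m → N ℕ.≤ n → dist (f m) (f n) <ᴿ fromℚ ε)

  _ConvergesTo_ : (ℕ → X) → X → Set
  f ConvergesTo x = ∀ {ε} → 0ℚ ℚ.< ε →
    ∃[ N ] (∀ {n} → N ℕ.≤ n → dist (f n) x <ᴿ fromℚ ε)

  field
    separable : ∃[ D ] (Countable D × Dense D)
    complete  : ∀ {f} → Cauchy f → ∃[ x ] f ConvergesTo x

record StandardBorelSpace : Set₂ where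
  field
    space        : MeasurableSpace
  open MeasurableSpace space public
  field
    polishMetric : PolishMetric Carrier
    isBorel      : Measurable ≐ Generated (PolishMetric.Open polishMetric)

record Graph (V : Set) : Set₁ where
  field
    Adj         : Rel V 0ℓ
    symmetric   : Symmetric Adj
    irreflexive : Irreflexive _≡_ Adj

open Graph public

module _ {V : Set} where

  Component : Graph V → V → Pred V 0ℓ
  Component G = Star (Adj G)

  ComponentFinite : Graph V → Set
  ComponentFinite G = ∀ v → Finite (Component G v)

  LocallyCountable : Graph V → Set
  LocallyCountable G = ∀ v → Countable (Adj G v)

  MaxDegreeAtMost : ℕ → Graph V → Set
  MaxDegreeAtMost d G = ∀ v → AtMost d (Adj G v)

  Independent : Graph V → Pred V 0ℓ → Set
  Independent G I = ∀ {u v} → I u → I v → ¬ Adj G u v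

  CompleteSection : Graph V → Pred V 0ℓ → Set
  CompleteSection G S = ∀ v → ∃[ w ] (Component G v w × S w)

  -- Refinement makes the membership proof irrelevant, so that a vertex of U
  -- occurs only once in the induced subgraph.
  _[_] : Graph V → (U : Pred V 0ℓ) → Graph (Refinement V U)
  G [ U ] = record
    { Adj         = Adj G on value
    ; symmetric   = symmetric G
    ; irreflexive = λ where refl → irreflexive G refl
    }

  -- Path G u v p: the list p enumerates the (distinct) vertices of a path
  -- from u to v, hence the number of edges is one less than length p.
  data Path (G : Graph V) : V → V → List V → Set where
    stop : ∀ {v} → Path G v v (v ∷ [])
    step : ∀ {u w v p} → Adj G u w → Path G w v p → u ∉ p →
           Path G u v (u ∷ p)

  JoinedWithin : Graph V → ℕ → Rel V 0ℓ
  JoinedWithin G R u v = ∃[ p ] (Path G u v p × length p ℕ.≤ suc R)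

private
  module Reversal {V : Set} (G : Graph V) where
    open import Data.List using (_∷ʳ_; reverse)
    open import Data.List.Properties
      using (unfold-reverse; length-reverse)
    open import Data.List.Membership.Propositional.Properties using (∈-++⁻)
    open import Data.List.Relation.Unary.Any using (here; there)
    open import Data.List.Relation.Unary.Any.Properties using (reverse⁻)

    snoc : ∀ {u v w p} → Path G u v p → Adj G v w → w ∉ p →
           Path G u w (p ∷ʳ w)
    snoc stop v~w w∉ =
      step v~w stop (λ where (here v≡w) → w∉ (here (sym v≡w)))
    snoc {u} {w = w} (step {p = p} u~x π u∉p) v~w w∉ =
      step u~x (snoc π v~w (λ w∈p → w∉ (there w∈p))) u∉
      where
      u∉ : u ∉ p ∷ʳ w
      u∉ u∈ with ∈-++⁻ p u∈
      ... | inj₁ u∈p        = u∉p u∈p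
      ... | inj₂ (here u≡w) = w∉ (here (sym u≡w))

    rev : ∀ {u v p} → Path G u v p → Path G v u (reverse p)
    rev stop = stop
    rev (step {u} {w} {v} {p} u~w π u∉p) =
      subst (Path G v u) (sym (unfold-reverse u p))
        (snoc (rev π) (symmetric G u~w) (λ u∈ → u∉p (reverse⁻ u∈)))

    joined-sym : ∀ {R} → Symmetric (JoinedWithin G R)
    joined-sym {R} (p , π , len) =
      reverse p , rev π , subst (ℕ._≤ suc R) (sym (length-reverse p)) len

_^_ : ∀ {V} → Graph V → ℕ → Graph V
G ^ R = record
  { Adj         = λ u v → u ≢ v × JoinedWithin G R u v
  ; symmetric   = λ (u≢v , j) →
      (λ v≡u → u≢v (sym v≡u)) , Reversal.joined-sym G j
  ; irreflexive = λ u≡v (u≢v , _) → u≢v u≡v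
  }

module _ (X : StandardBorelSpace) where
  open StandardBorelSpace X

  BorelAdjacency : Graph Carrier → Set₁
  BorelAdjacency G =
    MeasurableSpace.Measurable (space ⊗ space) (uncurry (Adj G))

  record BorelGraph : Set₁ where
    field
      graph : Graph Carrier
      borel : BorelAdjacency graph

  open BorelGraph public

  record BorelPartition (s : ℕ) : Set₁ where
    field
      part       : Fin (suc s) → Pred Carrier 0ℓ
      measurable : ∀ i → Measurable (part i)
      covers     : ∀ v → ∃[ i ] part i v
      disjoint   : ∀ {i j v} → part i v → part j v → i ≡ j

  Separates : Graph Carrier → ℕ → Set₁
  Separates G s = Σ (BorelPartition s) λ 𝒰 →
    ∀ i → ComponentFinite (G [ BorelPartition.part 𝒰 i ])

  SeparationIndexIs : Graph Carrier → ℕ → Set₁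
  SeparationIndexIs G s =
    Separates G s × (∀ t → Separates G t → s ℕ.≤ t)

module _ {X : StandardBorelSpace} where

  IsSpanningSubgraphOf : BorelGraph X → BorelGraph X → Set
  IsSpanningSubgraphOf G H = Adj (graph G) ⊑ Adj (graph H)

  infix 4 asi_≤_ asi_≡_ asi_<∞

  -- n is an upper bound for the separation indices si (G ^ R); in particular
  -- all of these are finite.
  asi_≤_ : BorelGraph X → ℕ → Set₁
  asi G ≤ n = ∀ R → ∃[ s ] (SeparationIndexIs X (graph G ^ R) s × s ℕ.≤ n)

  asi_≡_ : BorelGraph X → ℕ → Set₁
  asi G ≡ n = asi G ≤ n × (∀ m → asi G ≤ m → n ℕ.≤ m)

  asi_<∞ : BorelGraph X → Set₁
  asi G <∞ = ∃[ n ] asi G ≡ n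

module Submission where

-- The graph H is locally finite, so countably many Borel functions enumerate its components (Lusin–Novikov),
-- and sets defined by quantifying over a component of H are Borel.
--
-- Let 2^(L-1) ≤ Δ < 2^L. The components of G₂ being large, a Borel maximality argument gives disjoint
-- clusters of K = 2^22 Δ L vertices, each inside a component of G₂, such that every component of G₂
-- contains one. It remains to pick a vertex in each cluster so that no two picked vertices are adjacent
-- in G₁.
--
-- Activate every vertex with probability 1/64Δ. A cluster fails if a quarter of its vertices have active
-- neighbours in other clusters, or if none of its active vertices is free of such neighbours; this has
-- probability at most 2^(-2g) with g = 2^14 L. A cluster is bad if it fails or is adjacent to a failing one.
-- A union bound over short walks shows that large connected sets of bad clusters are so rare that the local
-- lemma excludes them. To make this Borel, the labels are fixed on one part of a finite partition with finite
-- classes (from asi(H) < ∞) after another, with the conditional probabilities kept small; on each class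
-- there are finitely many candidates, and the first good one is chosen.
--
-- Clusters that are not bad pick their first active vertex without active neighbours elsewhere. The bad ones
-- are treated part by part: the bad clusters near the current class are re-picked simultaneously by the local
-- lemma, except those that have lost a quarter of their vertices to the picks further away or, inductively,
-- to those of other such clusters. If a cluster of the current class were among the exceptions, its losses
-- would branch out to a large connected set of bad clusters.

open import Defs hiding (step; stop; respects; empty; complement; union; base; _^_; _[_])
open import Level using (0ℓ) renaming (suc to lsuc)
open import Axiom.ExcludedMiddle using (ExcludedMiddle)
open import Data.Nat as ℕ using (ℕ; zero; suc; _+_; _*_; _∸_; _≤_; _<_; z≤n; s≤s)
import Data.Nat.Properties as ℕₚ
open import Data.Fin as F using (Fin)
import Data.Fin.Properties as Fₚ
open import Data.List using (List; []; _∷_; _++_; length; map; concatMap; filter; take; upTo; allFin)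
import Data.List.Properties as Lₚ
open import Data.List.Membership.Propositional using (_∈_; _∉_; lose)
open import Data.List.Membership.Propositional.Properties using (∈-++⁺ˡ; ∈-++⁺ʳ; ∈-++⁻; ∈-map⁺; ∈-filter⁺; ∈-filter⁻; ∈-∃++; ∈-concatMap⁺; ∈-allFin; ∈-upTo⁺)
open import Data.List.Relation.Unary.Any using (Any; here; there)
open import Data.List.Relation.Unary.All as All using (All; []; _∷_)
import Data.List.Relation.Unary.All.Properties as Allₚ
open import Data.List.Relation.Unary.AllPairs using (AllPairs; []; _∷_)
open import Data.List.Relation.Unary.Unique.Propositional using (Unique)
import Data.List.Relation.Unary.Unique.Propositional.Properties as Uniqueₚ
open import Data.List.Relation.Binary.Permutation.Propositional as Perm using (_↭_; prep; swap; ↭-sym; ↭-trans; ↭-refl)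
import Data.List.Relation.Binary.Permutation.Propositional.Properties as Permₚ
open import Data.Maybe using (Maybe; just; nothing)
open import Data.Product using (Σ; ∃-syntax; _×_; _,_; proj₁; proj₂; uncurry)
open import Data.Sum using (_⊎_; inj₁; inj₂; [_,_]′)
open import Data.Empty using (⊥; ⊥-elim)
open import Data.Unit using (⊤; tt)
open import Function using (_∘_; id; case_of_)
open import Relation.Binary using (tri<; tri≈; tri>)
open import Relation.Binary.Construct.Closure.ReflexiveTransitive as Star using (Star; _◅_; _◅◅_)
open import Relation.Binary.PropositionalEquality using (_≡_; _≢_; refl; sym; trans; cong; cong₂; subst; subst₂)
open import Relation.Nullary using (¬_; Dec; yes; no)
open import Relation.Unary using (Pred; ∅)
open import Data.Integer as ℤ using (-[1+_])
import Data.Integer.Properties as ℤₚ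
open import Data.Rational as ℚ using (ℚ; 0ℚ; 1ℚ; _/_)
import Data.Rational.Properties as ℚₚ
open import Data.Rational.Unnormalised as ℚᵘ using (mkℚᵘ)
import Data.Rational.Unnormalised.Properties as ℚᵘₚ
open import Function.Bundles using (Equivalence; mk⇔)
open import Data.Maybe.Properties using (just-injective)
open import Data.Nat.Tactic.RingSolver using (solve-∀)
open import Algebra.Properties.AbelianGroup ℚₚ.+-0-abelianGroup using (//-rightDividesˡ)
open import Data.List.Membership.Propositional.Properties.WithK using (unique∧set⇒bag)
open import Data.List.Relation.Binary.BagAndSetEquality using (∼bag⇒↭)
open import Data.Refinement using () renaming (value to underlying; _,_ to _⊣_)
open import Data.Irrelevant using ([_])

-- Enumerations

-- Fixing the labels on one part after another costs every unwanted event a factor 4d in probability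
-- at each of the `t` parts, where d bounds the number of events that share a label with it. The
-- number `t` comes from asi(H) and can be any size, while a cluster fails with probability 2^(-2g),
-- a fixed power of 2^(-L). So failing clusters cannot be excluded by themselves. What is excluded
-- is that `M` points are reached by `n` steps through bad clusters: this forces `m` failing
-- clusters far from each other, which has probability about 2^(-2gm), and `m` may be taken
-- proportional to `t`. The bad set may still be infinite; the second phase only uses that it does
-- not branch fast. There is a circle to be closed. The excluded event looks at radius about 2r, so
-- that d is roughly G^(4r), and `m` and `M` have to grow with `r`; but losses that multiply by 64g
-- per layer exceed `M` after `r` layers, being exponential in `r` while `M` is linear in it. The
-- number of parts is the same for all distances between classes. Hence `t` is known before any
-- radius is chosen.

private
  -- Cantor's walk along the antidiagonals: from (s , 0) to (0 , s), then on to (s + 1 , 0).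
  advance : ℕ × ℕ → ℕ × ℕ
  advance (zero  , b) = suc b , 0
  advance (suc a , b) = a , suc b

  unpair′ : ℕ → ℕ × ℕ
  unpair′ zero    = 0 , 0
  unpair′ (suc n) = advance (unpair′ n)

  unpair-onto′ : ∀ s a b → a + b ≡ s → ∃[ n ] unpair′ n ≡ (a , b)
  unpair-onto′ s zero zero eq = 0 , refl
  unpair-onto′ s a (suc b) eq =
    let (n , e) = unpair-onto′ s (suc a) b (trans (sym (ℕₚ.+-suc a b)) eq)
    in suc n , cong advance e
  unpair-onto′ (suc s) (suc a) zero eq =
    let (n , e) = unpair-onto′ s zero a
                    (ℕₚ.suc-injective (trans (cong suc (sym (ℕₚ.+-identityʳ a))) eq))
    in suc n , cong advance e

abstract
  unpair : ℕ → ℕ × ℕ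
  unpair = unpair′

  pair : ℕ → ℕ → ℕ
  pair a b = proj₁ (unpair-onto′ (a + b) a b refl)

  unpair-pair : ∀ a b → unpair (pair a b) ≡ (a , b)
  unpair-pair a b = proj₂ (unpair-onto′ (a + b) a b refl)

-- The index types over which Borel sets may be quantified, see `m-∃` and `m-∀`.
record Enumerable (A : Set) : Set where
  field
    enum : ℕ → A
    onto : ∀ a → ∃[ n ] enum n ≡ a

open Enumerable {{...}} public

instance
  enum-ℕ : Enumerable ℕ
  enum-ℕ = record { enum = id ; onto = λ n → n , refl }

  enum-× : ∀ {A B} → {{Enumerable A}} → {{Enumerable B}} → Enumerable (A × B)
  enum-× = record
    { enum = λ n → let (i , j) = unpair n in enum i , enum j
    ; onto = λ (a , b) →
        let (i , ei) = onto a
            (j , ej) = onto b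
        in pair i j , trans (cong (λ (i , j) → enum i , enum j) (unpair-pair i j))
                            (cong₂ _,_ ei ej)
    }

private
  decode : ∀ {A} → {{Enumerable A}} → ℕ → ℕ → List A
  decode zero    c = []
  decode (suc l) c = let (a , c′) = unpair c in enum a ∷ decode l c′

  decode-onto : ∀ {A} → {{_ : Enumerable A}} → (xs : List A) →
                ∃[ c ] decode (length xs) c ≡ xs
  decode-onto [] = 0 , refl
  decode-onto (x ∷ xs) =
    let (i , ei) = onto x
        (c , ec) = decode-onto xs
    in pair i c , trans (cong (λ (i , c) → enum i ∷ decode (length xs) c) (unpair-pair i c))
                        (cong₂ _∷_ ei ec)

instance
  enum-List : ∀ {A} → {{Enumerable A}} → Enumerable (List A)
  enum-List = record
    { enum = λ n → let (l , c) = unpair n in decode l c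
    ; onto = λ xs →
        let (c , e) = decode-onto xs
        in pair (length xs) c , trans (cong (λ (l , c) → decode l c) (unpair-pair (length xs) c)) e
    }

-- Balls in a graph

module _ {V : Set} where

  Ball : (V → V → Set) → ℕ → V → V → Set
  Ball J zero    x y = x ≡ y
  Ball J (suc n) x y = x ≡ y ⊎ (∃[ z ] (J x z × Ball J n z y))

  module _ {J : V → V → Set} where

    ball-refl : ∀ n {x} → Ball J n x x
    ball-refl zero    = refl
    ball-refl (suc n) = inj₁ refl

    ball-edge : ∀ {x y} → J x y → Ball J 1 x y
    ball-edge e = inj₂ (_ , e , refl)

    ball-mono : ∀ {m n x y} → m ≤ n → Ball J m x y → Ball J n x y
    ball-mono {n = n} z≤n refl = ball-refl n
    ball-mono (s≤s m≤n) (inj₁ e)           = inj₁ e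
    ball-mono (s≤s m≤n) (inj₂ (z , e , b)) = inj₂ (z , e , ball-mono m≤n b)

    ball-trans : ∀ m {n x y z} → Ball J m x y → Ball J n y z → Ball J (m + n) x z
    ball-trans zero    refl b = b
    ball-trans (suc m) (inj₁ refl) b = ball-mono (ℕₚ.m≤n+m _ (suc m)) b
    ball-trans (suc m) (inj₂ (w , e , b)) b′ = inj₂ (w , e , ball-trans m b b′)

    ball-sym : (∀ {x y} → J x y → J y x) → ∀ n {x y} → Ball J n x y → Ball J n y x
    ball-sym sy zero    refl        = refl
    ball-sym sy (suc n) (inj₁ refl) = inj₁ refl
    ball-sym sy (suc n) {x} {y} (inj₂ (z , e , b)) =
      subst (λ k → Ball J k y x) (ℕₚ.+-comm n 1) (ball-trans n (ball-sym sy n b) (ball-edge (sy e)))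

    ball-star : ∀ n {x y} → Ball J n x y → Star J x y
    ball-star zero    refl        = Star.ε
    ball-star (suc n) (inj₁ refl) = Star.ε
    ball-star (suc n) (inj₂ (z , e , b)) = e ◅ ball-star n b

    ball-map : ∀ {J′ : V → V → Set} → (∀ {x y} → J x y → J′ x y) → ∀ n {x y} → Ball J n x y → Ball J′ n x y
    ball-map f zero    e        = e
    ball-map f (suc n) (inj₁ e) = inj₁ e
    ball-map f (suc n) (inj₂ (z , e , b)) = inj₂ (z , f e , ball-map f n b)

    module BallList (nb : V → List V) (nb-all : ∀ {x y} → J x y → y ∈ nb x) where

      ballList : ℕ → V → List V
      ballList zero    x = x ∷ []
      ballList (suc n) x = x ∷ concatMap (ballList n) (nb x)

      ∈-ballList : ∀ n {x y} → Ball J n x y → y ∈ ballList n x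
      ∈-ballList zero    refl               = here refl
      ∈-ballList (suc n) (inj₁ refl)        = here refl
      ∈-ballList (suc n) (inj₂ (z , e , b)) =
        there (∈-concatMap⁺ (ballList n) (lose (nb-all e) (∈-ballList n b)))

      length-concatMap : ∀ {d} (f : V → List V) → (∀ x → length (f x) ≤ d) → ∀ xs →
                         length (concatMap f xs) ≤ length xs * d
      length-concatMap f h [] = z≤n
      length-concatMap {d} f h (x ∷ xs) = subst (_≤ d + length xs * d) (sym (Lₚ.length-++ (f x)))
        (ℕₚ.+-mono-≤ (h x) (length-concatMap f h xs))

      length-ballList : ∀ {d} → (∀ x → length (nb x) ≤ d) → ∀ n x → length (ballList n x) ≤ suc d ℕ.^ n
      length-ballList h zero    x = s≤s z≤n
      length-ballList {d} h (suc n) x = ℕₚ.+-mono-≤ (ℕₚ.m^n>0 (suc d) n)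
        (ℕₚ.≤-trans (length-concatMap (ballList n) (length-ballList h n) (nb x))
                    (ℕₚ.*-monoˡ-≤ (suc d ℕ.^ n) (h x)))

-- Lists without repetitions

module _ {A : Set} where

  unique-length : ∀ {xs zs : List A} → Unique xs → (∀ {x} → x ∈ xs → x ∈ zs) → length xs ≤ length zs
  unique-length {[]} _ _ = z≤n
  unique-length {x ∷ xs} (x∉ ∷ u) sub with ∈-∃++ (sub (here refl))
  ... | as , bs , refl = subst (suc (length xs) ≤_) (sym (trans (Lₚ.length-++ as) (ℕₚ.+-suc (length as) (length bs))))
      (s≤s (subst (length xs ≤_) (Lₚ.length-++ as) (unique-length u rest)))
    where
    rest : ∀ {y} → y ∈ xs → y ∈ as ++ bs
    rest {y} i with ∈-++⁻ as (sub (there i))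
    ... | inj₁ j           = ∈-++⁺ˡ j
    ... | inj₂ (here refl) = ⊥-elim (All.lookup x∉ i refl)
    ... | inj₂ (there j)   = ∈-++⁺ʳ as j

-- Counting assignments

sumTo : ℕ → (ℕ → ℕ) → ℕ
sumTo zero    G = 0
sumTo (suc k) G = sumTo k G + G k

private
  +-middle : ∀ a b c d → (a + b) + (c + d) ≡ (a + c) + (b + d)
  +-middle = solve-∀

sumTo-mono : ∀ k {F G : ℕ → ℕ} → (∀ a → F a ≤ G a) → sumTo k F ≤ sumTo k G
sumTo-mono zero    h = z≤n
sumTo-mono (suc k) h = ℕₚ.+-mono-≤ (sumTo-mono k h) (h k)

sumTo-cong : ∀ k {F G : ℕ → ℕ} → (∀ a → F a ≡ G a) → sumTo k F ≡ sumTo k G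
sumTo-cong zero    h = refl
sumTo-cong (suc k) h = cong₂ _+_ (sumTo-cong k h) (h k)

sumTo-+ : ∀ k (F G : ℕ → ℕ) → sumTo k (λ a → F a + G a) ≡ sumTo k F + sumTo k G
sumTo-+ zero    F G = refl
sumTo-+ (suc k) F G = trans (cong (_+ (F k + G k)) (sumTo-+ k F G))
  (+-middle (sumTo k F) (sumTo k G) (F k) (G k))

sumTo-* : ∀ k m (F : ℕ → ℕ) → sumTo k (λ a → m * F a) ≡ m * sumTo k F
sumTo-* zero    m F = sym (ℕₚ.*-zeroʳ m)
sumTo-* (suc k) m F = trans (cong (_+ m * F k) (sumTo-* k m F)) (sym (ℕₚ.*-distribˡ-+ m (sumTo k F) (F k)))

sumTo-const : ∀ k m → sumTo k (λ _ → m) ≡ k * m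
sumTo-const zero    m = refl
sumTo-const (suc k) m = trans (cong (_+ m) (sumTo-const k m)) (ℕₚ.+-comm (k * m) m)

sumTo-zero : ∀ k → sumTo k (λ _ → 0) ≡ 0
sumTo-zero k = trans (sumTo-const k 0) (ℕₚ.*-zeroʳ k)

sumTo-swap : ∀ j k (F : ℕ → ℕ → ℕ) →
             sumTo j (λ a → sumTo k (λ b → F a b)) ≡ sumTo k (λ b → sumTo j (λ a → F a b))
sumTo-swap zero    k F = sym (sumTo-zero k)
sumTo-swap (suc j) k F = trans (cong (_+ sumTo k (F j)) (sumTo-swap j k F))
  (sym (sumTo-+ k (λ b → sumTo j (λ a → F a b)) (F j)))

sumTo-pos : ∀ k {F} → 0 < sumTo k F → ∃[ a ] (a < k × 0 < F a)
sumTo-pos (suc k) {F} p with F k in eq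
... | suc m = k , ℕₚ.≤-refl , subst (0 <_) (sym eq) (s≤s z≤n)
... | zero  =
  let (a , a<k , q) = sumTo-pos k (subst (0 <_) (ℕₚ.+-identityʳ (sumTo k F)) p)
  in a , ℕₚ.m<n⇒m<1+n a<k , q

module _ {A : Set} where

  sumL : List A → (A → ℕ) → ℕ
  sumL []       F = 0
  sumL (x ∷ xs) F = F x + sumL xs F

  sumL-≤ : ∀ xs {F : A → ℕ} {m} → (∀ x → x ∈ xs → F x ≤ m) → sumL xs F ≤ length xs * m
  sumL-≤ []       h = z≤n
  sumL-≤ (x ∷ xs) h = ℕₚ.+-mono-≤ (h x (here refl)) (sumL-≤ xs (λ y i → h y (there i)))

  sumL-mono : ∀ xs {F G : A → ℕ} → (∀ x → x ∈ xs → F x ≤ G x) → sumL xs F ≤ sumL xs G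
  sumL-mono []       h = z≤n
  sumL-mono (x ∷ xs) h = ℕₚ.+-mono-≤ (h x (here refl)) (sumL-mono xs (λ y i → h y (there i)))

  sumL-* : ∀ m xs (F : A → ℕ) → sumL xs (λ x → m * F x) ≡ m * sumL xs F
  sumL-* m []       F = sym (ℕₚ.*-zeroʳ m)
  sumL-* m (x ∷ xs) F = trans (cong (m * F x +_) (sumL-* m xs F)) (sym (ℕₚ.*-distribˡ-+ m (F x) (sumL xs F)))

  ∈-sumL : ∀ {x xs} (F : A → ℕ) → x ∈ xs → F x ≤ sumL xs F
  ∈-sumL F (here refl) = ℕₚ.m≤m+n _ _
  ∈-sumL F (there i)   = ℕₚ.≤-trans (∈-sumL F i) (ℕₚ.m≤n+m _ _)

-- Tail estimates

pow-* : ∀ a b n → (a * b) ℕ.^ n ≡ a ℕ.^ n * b ℕ.^ n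
pow-* a b zero    = refl
pow-* a b (suc n) = trans (cong (a * b *_) (pow-* a b n)) (ℕₚ.[m*n]*[o*p]≡[m*o]*[n*p] a b (a ℕ.^ n) (b ℕ.^ n))

-- Bernoulli's inequality 1 + e/P ≤ (1 + 1/P)^e without denominators, so that all estimates stay in
-- ℕ.
bernoulli : ∀ P e → (P + e) * P ℕ.^ e ≤ P * suc P ℕ.^ e
bernoulli P zero    = ℕₚ.≤-reflexive (cong (_* 1) (ℕₚ.+-identityʳ P))
bernoulli P (suc e) = begin
  (P + suc e) * (P * P ℕ.^ e)          ≡⟨ ℕₚ.*-assoc (P + suc e) P _ ⟨
  (P + suc e) * P * P ℕ.^ e            ≤⟨ ℕₚ.*-monoˡ-≤ (P ℕ.^ e) (ℕₚ.m≤m+n ((P + suc e) * P) e) ⟩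
  ((P + suc e) * P + e) * P ℕ.^ e      ≡⟨ arith P e (P ℕ.^ e) ⟩
  suc P * ((P + e) * P ℕ.^ e)          ≤⟨ ℕₚ.*-monoʳ-≤ (suc P) (bernoulli P e) ⟩
  suc P * (P * suc P ℕ.^ e)            ≡⟨ arith₂ P (suc P ℕ.^ e) ⟩
  P * (suc P * suc P ℕ.^ e)            ∎
  where
  open ℕₚ.≤-Reasoning
  arith : ∀ P e x → ((P + suc e) * P + e) * x ≡ suc P * ((P + e) * x)
  arith = solve-∀
  arith₂ : ∀ P x → suc P * (P * x) ≡ P * (suc P * x)
  arith₂ = solve-∀

-- (1 + 1/2D)^s ≤ 1 + s/D for s ≤ D
exponential : ∀ D s → s ≤ D → D * suc (2 * D) ℕ.^ s ≤ (2 * D) ℕ.^ s * (D + s)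
exponential D zero    _ = ℕₚ.≤-reflexive (trans (ℕₚ.*-identityʳ D) (sym (trans (ℕₚ.*-identityˡ (D + 0)) (ℕₚ.+-identityʳ D))))
exponential D (suc s) s<D = begin
  D * (suc (2 * D) * suc (2 * D) ℕ.^ s)         ≡⟨ arith₁ D (suc (2 * D) ℕ.^ s) ⟩
  suc (2 * D) * (D * suc (2 * D) ℕ.^ s)         ≤⟨ ℕₚ.*-monoʳ-≤ (suc (2 * D)) (exponential D s (ℕₚ.<⇒≤ s<D)) ⟩
  suc (2 * D) * ((2 * D) ℕ.^ s * (D + s))       ≡⟨ arith₂ D s ((2 * D) ℕ.^ s) ⟩
  (2 * D) ℕ.^ s * (2 * D * (D + s) + (D + s))   ≤⟨ ℕₚ.*-monoʳ-≤ ((2 * D) ℕ.^ s)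
                                                     (ℕₚ.+-monoʳ-≤ (2 * D * (D + s)) (ℕₚ.+-monoʳ-≤ D (ℕₚ.<⇒≤ s<D))) ⟩
  (2 * D) ℕ.^ s * (2 * D * (D + s) + (D + D))   ≡⟨ arith₃ D s ((2 * D) ℕ.^ s) ⟩
  2 * D * (2 * D) ℕ.^ s * (D + suc s)           ∎
  where
  open ℕₚ.≤-Reasoning
  arith₁ : ∀ D x → D * (suc (2 * D) * x) ≡ suc (2 * D) * (D * x)
  arith₁ = solve-∀
  arith₂ : ∀ D s x → suc (2 * D) * (x * (D + s)) ≡ x * (2 * D * (D + s) + (D + s))
  arith₂ = solve-∀
  arith₃ : ∀ D s x → x * (2 * D * (D + s) + (D + D)) ≡ 2 * D * x * (D + suc s)
  arith₃ = solve-∀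

double-suc : ∀ P → 0 < P → 2 * P ℕ.^ P ≤ suc P ℕ.^ P
double-suc (suc p) _ = ℕₚ.*-cancelˡ-≤ (suc p) (begin
  suc p * (2 * suc p ℕ.^ suc p)           ≡⟨ arith (suc p) (suc p ℕ.^ suc p) ⟩
  (suc p + suc p) * suc p ℕ.^ suc p       ≤⟨ bernoulli (suc p) (suc p) ⟩
  suc p * suc (suc p) ℕ.^ suc p           ∎)
  where
  open ℕₚ.≤-Reasoning
  arith : ∀ P x → P * (2 * x) ≡ (P + P) * x
  arith = solve-∀

-- This is (1 - 1/k)^k ≤ 1/2 for k = p + 2: of k vertices, each active with probability 1/k, none is
-- active with probability at most 1/2.
double-pred : ∀ p → 2 * suc p ℕ.^ suc (suc p) ≤ suc (suc p) ℕ.^ suc (suc p)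
double-pred p = ℕₚ.*-cancelˡ-≤ (suc p) (begin
  suc p * (2 * x)                              ≡⟨ arith (suc p) x ⟩
  (suc p + suc p) * x                          ≤⟨ ℕₚ.*-monoˡ-≤ x (ℕₚ.+-monoʳ-≤ (suc p) (ℕₚ.n≤1+n (suc p))) ⟩
  (suc p + suc (suc p)) * x                    ≤⟨ bernoulli (suc p) (suc (suc p)) ⟩
  suc p * suc (suc p) ℕ.^ suc (suc p)          ∎)
  where
  open ℕₚ.≤-Reasoning
  x = suc p ℕ.^ suc (suc p)
  arith : ∀ P x → P * (2 * x) ≡ (P + P) * x
  arith = solve-∀

-- The opposite direction, (1 + 1/2j)^j ≤ 2, which bounds the moment generating function in `tail`
-- from above.
double-half : ∀ j → 0 < j → suc (2 * j) ℕ.^ j ≤ 2 * (2 * j) ℕ.^ j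
double-half j 0<j = ℕₚ.*-cancelˡ-≤ j {{ℕ.>-nonZero 0<j}} (begin
  j * suc (2 * j) ℕ.^ j         ≤⟨ exponential j j ℕₚ.≤-refl ⟩
  (2 * j) ℕ.^ j * (j + j)       ≡⟨ arith j ((2 * j) ℕ.^ j) ⟩
  j * (2 * (2 * j) ℕ.^ j)       ∎)
  where
  open ℕₚ.≤-Reasoning
  arith : ∀ j x → x * (j + j) ≡ j * (2 * x)
  arith = solve-∀

sumTo-first : ∀ k F → sumTo (suc k) F ≡ F 0 + sumTo k (F ∘ suc)
sumTo-first zero    F = sym (ℕₚ.+-identityʳ (F 0))
sumTo-first (suc k) F = trans (cong (_+ F (suc k)) (sumTo-first k F)) (ℕₚ.+-assoc (F 0) _ _)

-- Positions, words and separated families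

module _ {V : Set} where

  nth : List V → ℕ → V → V
  nth []       i       x = x
  nth (y ∷ ys) zero    x = y
  nth (y ∷ ys) (suc i) x = nth ys i x

  nth-∈ : ∀ {ys : List V} {y} x → y ∈ ys → ∃[ i ] (i < length ys × nth ys i x ≡ y)
  nth-∈ x (here refl) = 0 , s≤s z≤n , refl
  nth-∈ x (there i)   = let (j , lt , e) = nth-∈ x i in suc j , s≤s lt , e

-- The alphabet of the walks in the union bound: `just i` is a jump to one of `a` places, `nothing`
-- marks the current place.
letters : ℕ → List (Maybe ℕ)
letters a = nothing ∷ map just (upTo a)

words : ℕ → ℕ → List (List (Maybe ℕ))
words a zero    = [] ∷ []
words a (suc l) = concatMap (λ w → map (_∷ w) (letters a)) (words a l)

Letter : ℕ → Maybe ℕ → Set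
Letter a nothing  = ⊤
Letter a (just i) = i < a

∈-letters : ∀ {a} x → Letter a x → x ∈ letters a
∈-letters nothing  _  = here refl
∈-letters (just i) lt = there (∈-map⁺ just (∈-upTo⁺ lt))

∈-words : ∀ {a} w → All (Letter a) w → w ∈ words a (length w)
∈-words []      []       = here refl
∈-words {a} (x ∷ w) (lx ∷ lw) = ∈-concatMap⁺ (λ w → map (_∷ w) (letters a))
  (lose (∈-words w lw) (∈-map⁺ (_∷ w) (∈-letters x lx)))

length-words : ∀ a l → length (words a l) ≤ suc a ℕ.^ l
length-words a zero    = s≤s z≤n
length-words a (suc l) = ℕₚ.≤-trans (len (words a l))
  (ℕₚ.≤-trans (ℕₚ.*-monoˡ-≤ (suc a) (length-words a l)) (ℕₚ.≤-reflexive (ℕₚ.*-comm (suc a ℕ.^ l) (suc a))))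
  where
  len : ∀ ws → length (concatMap (λ w → map (_∷ w) (letters a)) ws) ≤ length ws * suc a
  len [] = z≤n
  len (w ∷ ws) = subst (_≤ suc a + length ws * suc a) (sym (Lₚ.length-++ (map (_∷ w) (letters a))))
    (ℕₚ.+-mono-≤ (ℕₚ.≤-reflexive (trans (Lₚ.length-map (_∷ w) (letters a))
      (cong suc (trans (Lₚ.length-map just (upTo a)) (Lₚ.length-upTo a))))) (len ws))

allPairs-insert : ∀ {V : Set} {R : V → V → Set} → (∀ {x y} → R x y → R y x) → ∀ {z} xs ys →
                  AllPairs R (xs ++ ys) → All (R z) (xs ++ ys) → AllPairs R (xs ++ z ∷ ys)
allPairs-insert sy []       ys p       a       = a ∷ p
allPairs-insert sy (x ∷ xs) ys (h ∷ p) (r ∷ a) =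
  Allₚ.++⁺ (Allₚ.++⁻ˡ xs h) (sy r ∷ Allₚ.++⁻ʳ xs h) ∷ allPairs-insert sy xs ys p a

all-insert : ∀ {V : Set} {P : V → Set} {z} xs ys → P z → All P (xs ++ ys) → All P (xs ++ z ∷ ys)
all-insert xs ys p a = Allₚ.++⁺ (Allₚ.++⁻ˡ xs a) (p ∷ Allₚ.++⁻ʳ xs a)

twice : ℕ → ℕ
twice zero    = 0
twice (suc j) = suc (suc (twice j))

nth-inside : ∀ {V : Set} (ys : List V) {i} x → i < length ys → nth ys i x ∈ ys
nth-inside (y ∷ ys) {zero}  x _        = here refl
nth-inside (y ∷ ys) {suc i} x (s≤s lt) = there (nth-inside ys x lt)

nth-injective : ∀ {V : Set} {ys : List V} {i j} x → Unique ys → i < length ys → j < length ys →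
                nth ys i x ≡ nth ys j x → i ≡ j
nth-injective {ys = y ∷ ys} {zero}  {zero}  x u        li       lj       e = refl
nth-injective {ys = y ∷ ys} {zero}  {suc j} x (n ∷ u)  li       (s≤s lj) e = ⊥-elim (All.lookup n (nth-inside ys x lj) e)
nth-injective {ys = y ∷ ys} {suc i} {zero}  x (n ∷ u)  (s≤s li) lj       e = ⊥-elim (All.lookup n (nth-inside ys x li) (sym e))
nth-injective {ys = y ∷ ys} {suc i} {suc j} x (n ∷ u)  (s≤s li) (s≤s lj) e = cong suc (nth-injective x u li lj e)

-- The lists of two members of `ls` are disjoint, since a common element would make the members
-- related by `join`; hence the lengths add up.
separated-union : ∀ {A : Set} {R : A → A → Set} {Q : A → Set} {q} → (∀ {x y z} → R x z → R y z → R x y) → ∀ {ls} →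
                  AllPairs (λ v w → ¬ R v w) ls →
                  All (λ v → ∃[ zs ] (length zs ≡ q × Unique zs × All (λ z → R v z × Q z) zs)) ls →
                  ∃[ zs ] (length zs ≡ length ls * q × Unique zs × (∀ {z} → z ∈ zs → ∃[ v ] (v ∈ ls × R v z × Q z)))
separated-union join [] [] = [] , refl , [] , λ ()
separated-union join {v ∷ ls} (far ∷ ap) ((zs , len , u , al) ∷ als) =
  let (zs′ , len′ , u′ , h) = separated-union join ap als
  in zs ++ zs′ , trans (Lₚ.length-++ zs) (cong₂ _+_ len len′) ,
     Uniqueₚ.++⁺ u u′ (λ (i , i′) →
       let (v′ , iv′ , s′ , _) = h i′ in All.lookup far iv′ (join (proj₁ (All.lookup al i)) s′)) ,
     λ i → [ (λ i → v , here refl , All.lookup al i) ,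
             (λ i → let (v′ , iv′ , rest) = h i in v′ , there iv′ , rest) ]′ (∈-++⁻ zs i)

-- The logarithm

abstract
  frac : ℕ → ℕ → ℚ
  frac a d = ℤ.+ a / suc d

  frac-+ : ∀ a b d → frac a d ℚ.+ frac b d ≡ frac (a + b) d
  frac-+ a b d = ℚₚ.toℚᵘ-injective
    (ℚᵘₚ.≃-trans (ℚₚ.toℚᵘ-homo-+ (frac a d) (frac b d))
    (ℚᵘₚ.≃-trans (ℚᵘₚ.+-cong (ℚₚ.toℚᵘ-fromℚᵘ (mkℚᵘ (ℤ.+ a) d)) (ℚₚ.toℚᵘ-fromℚᵘ (mkℚᵘ (ℤ.+ b) d)))
    (ℚᵘₚ.≃-trans (ℚᵘ.*≡* (trans (cong₂ (λ x y → (x ℤ.+ y) ℤ.* ℤ.+ suc d) (sym (ℤₚ.pos-* a (suc d))) (sym (ℤₚ.pos-* b (suc d))))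
        (trans (sym (ℤₚ.pos-* (a * suc d + b * suc d) (suc d)))
          (trans (cong ℤ.+_ (arith a b (suc d))) (ℤₚ.pos-* (a + b) (suc d * suc d))))))
      (ℚᵘₚ.≃-sym (ℚₚ.toℚᵘ-fromℚᵘ (mkℚᵘ (ℤ.+ (a + b)) d))))))
    where
    arith : ∀ a b d → (a * d + b * d) * d ≡ (a + b) * (d * d)
    arith = solve-∀

  frac-≤ : ∀ {a b c d} → a * suc d ≤ c * suc b → frac a b ℚ.≤ frac c d
  frac-≤ {a} {b} {c} {d} le = ℚₚ.toℚᵘ-cancel-≤
    (ℚᵘₚ.≤-respˡ-≃ (ℚᵘₚ.≃-sym (ℚₚ.toℚᵘ-fromℚᵘ (mkℚᵘ (ℤ.+ a) b)))
    (ℚᵘₚ.≤-respʳ-≃ (ℚᵘₚ.≃-sym (ℚₚ.toℚᵘ-fromℚᵘ (mkℚᵘ (ℤ.+ c) d)))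
      (ℚᵘ.*≤* (subst₂ ℤ._≤_ (ℤₚ.pos-* a (suc d)) (ℤₚ.pos-* c (suc b)) (ℤ.+≤+ le)))))

  frac-<⁻ : ∀ {a b c d} → frac a b ℚ.< frac c d → a * suc d < c * suc b
  frac-<⁻ {a} {b} {c} {d} lt = ℕₚ.≰⇒> λ le → ℚₚ.<-irrefl refl (ℚₚ.<-≤-trans lt (frac-≤ {c} {d} {a} {b} le))

  frac-< : ∀ {a b c d} → a * suc d < c * suc b → frac a b ℚ.< frac c d
  frac-< {a} {b} {c} {d} lt = ℚₚ.toℚᵘ-cancel-<
    (ℚᵘₚ.<-respˡ-≃ (ℚᵘₚ.≃-sym (ℚₚ.toℚᵘ-fromℚᵘ (mkℚᵘ (ℤ.+ a) b)))
    (ℚᵘₚ.<-respʳ-≃ (ℚᵘₚ.≃-sym (ℚₚ.toℚᵘ-fromℚᵘ (mkℚᵘ (ℤ.+ c) d)))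
      (ℚᵘ.*<* (subst₂ ℤ._<_ (ℤₚ.pos-* a (suc d)) (ℤₚ.pos-* c (suc b)) (ℤ.+<+ lt)))))

  frac-def : ∀ a d → frac a d ≡ ℤ.+ a / suc d
  frac-def a d = refl

private
  -- The `b` added terms have denominators at most a + b + 1, so each is at least 1/(D + 1).
  harmonic-block : ∀ a D b → a + b ≤ D → harmonic 1 a ℚ.+ frac b D ℚ.≤ harmonic 1 (a + b)
  harmonic-block a D zero    le = subst (λ i → harmonic 1 a ℚ.+ frac 0 D ℚ.≤ harmonic 1 i) (sym (ℕₚ.+-identityʳ a))
    (subst (harmonic 1 a ℚ.+ frac 0 D ℚ.≤_) (ℚₚ.+-identityʳ (harmonic 1 a))
      (ℚₚ.+-monoʳ-≤ (harmonic 1 a) (subst (frac 0 D ℚ.≤_) (frac-def 0 0) (frac-≤ {0} {D} {0} {0} z≤n))))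
  harmonic-block a D (suc b) le = subst (λ i → harmonic 1 a ℚ.+ frac (suc b) D ℚ.≤ harmonic 1 i) (sym (ℕₚ.+-suc a b))
    (subst (ℚ._≤ harmonic 1 (a + b) ℚ.+ ℤ.+ 1 / suc (suc (a + b)))
      (trans (ℚₚ.+-assoc (harmonic 1 a) (frac b D) (frac 1 D))
        (cong (harmonic 1 a ℚ.+_) (trans (frac-+ b 1 D) (cong (λ i → frac i D) (ℕₚ.+-comm b 1)))))
      (ℚₚ.+-mono-≤ (harmonic-block a D b (ℕₚ.≤-trans (ℕₚ.+-monoʳ-≤ a (ℕₚ.n≤1+n b)) le))
        (subst (frac 1 D ℚ.≤_) (frac-def 1 (suc (a + b)))
          (frac-≤ {1} {D} {1} {suc (a + b)} (ℕₚ.*-monoʳ-≤ 1 (s≤s (subst (_≤ D) (ℕₚ.+-suc a b) le)))))))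

  -- 1/2 + 1/3 + … + 1/2^j ≥ j/2
  harmonic-dyadic : ∀ j → frac j 1 ℚ.≤ harmonic 1 (2 ℕ.^ j ∸ 1)
  harmonic-dyadic zero    = subst (ℚ._≤ 0ℚ) (sym (frac-def 0 1)) ℚₚ.≤-refl
  harmonic-dyadic (suc j) = subst₂ ℚ._≤_ (trans (frac-+ j 1 1) (cong (λ i → frac i 1) (ℕₚ.+-comm j 1)))
    (cong (harmonic 1) (split (2 ℕ.^ j) (ℕₚ.m^n>0 2 j)))
    (ℚₚ.≤-trans (ℚₚ.+-mono-≤ (harmonic-dyadic j) (frac-≤ {1} {1} {2 ℕ.^ j} {2 ℕ.^ j ∸ 1 + 2 ℕ.^ j} (halves (2 ℕ.^ j) (ℕₚ.m^n>0 2 j))))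
      (harmonic-block (2 ℕ.^ j ∸ 1) (2 ℕ.^ j ∸ 1 + 2 ℕ.^ j) (2 ℕ.^ j) ℕₚ.≤-refl))
    where
    split : ∀ p → 0 < p → p ∸ 1 + p ≡ 2 * p ∸ 1
    split (suc p) _ = cong (p +_) (sym (ℕₚ.+-identityʳ (suc p)))
    halves : ∀ p → 0 < p → 1 * suc (p ∸ 1 + p) ≤ p * 2
    halves (suc p) _ = ℕₚ.≤-reflexive (arith p)
      where
      arith : ∀ p → 1 * suc (p + suc p) ≡ suc p * 2
      arith = solve-∀

  harmonic-mono : ∀ {a b} → a ≤ b → harmonic 1 a ℚ.≤ harmonic 1 b
  harmonic-mono {a} {b} le = subst₂ ℚ._≤_
    (trans (cong (harmonic 1 a ℚ.+_) (frac-0 b)) (ℚₚ.+-identityʳ (harmonic 1 a))) (cong (harmonic 1) (ℕₚ.m+[n∸m]≡n le))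
    (ℚₚ.≤-trans (ℚₚ.+-monoʳ-≤ (harmonic 1 a) (frac-≤ {0} {b} {b ∸ a} {b} z≤n))
      (harmonic-block a b (b ∸ a) (ℕₚ.≤-reflexive (ℕₚ.m+[n∸m]≡n le))))
    where
    frac-0 : ∀ d → frac 0 d ≡ 0ℚ
    frac-0 d = ℚₚ.≤-antisym (subst (frac 0 d ℚ.≤_) (frac-def 0 0) (frac-≤ {0} {d} {0} {0} z≤n))
                            (subst (ℚ._≤ frac 0 d) (frac-def 0 0) (frac-≤ {0} {0} {0} {d} z≤n))

-- The Riemann sum with step 1 (the witness 0) is 1/2 + ... + 1/Δ and at least j/2, which exceeds (j
-- + 1)/8 for j ≥ 1. With L = j + 1 this is log Δ > L/8; the 8 is the ratio of the 2^25 of the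
-- theorem to the 2^22 in the cluster size.
log-lower : ∀ Δ j → 1 ≤ j → 2 ℕ.^ j ≤ Δ → ℝ.lower (log Δ) (frac (suc j) 7)
log-lower Δ j 1≤j le = 0 , ℚₚ.<-≤-trans (frac-< {suc j} {7} {j} {1} (lt j 1≤j))
    (ℚₚ.≤-trans (harmonic-dyadic j) (harmonic-mono
      (subst (2 ℕ.^ j ∸ 1 ≤_) (sym (ℕₚ.*-identityˡ (Δ ∸ 1))) (ℕₚ.∸-monoˡ-≤ 1 le))))
  where
  lt : ∀ j → 1 ≤ j → suc j * 2 < j * 8
  lt (suc i) _ = subst (suc (suc (suc i) * 2) ≤_) (arith i) (ℕₚ.m≤m+n _ (6 * i + 3))
    where
    arith : ∀ i → suc (suc (suc i) * 2) + (6 * i + 3) ≡ suc i * 8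
    arith = solve-∀

private
  -- The multiple `0 · x` is the cut of 0, which contains negative rationals only; this is why some
  -- `t` below 0 has to be carried along.
  ·-lower : ∀ x {a d} n {t} → ℝ.lower x (frac a d) → t ℚ.< 0ℚ → ℝ.lower (n · x) (frac (n * a) d ℚ.+ t)
  ·-lower x {a} {d} zero {t} _ t<0 = subst (ℚ._< ℤ.+ 0 / 1) (sym (trans (cong (ℚ._+ t) (frac-0 d)) (ℚₚ.+-identityˡ t))) t<0
    where
    frac-0 : ∀ d → frac 0 d ≡ 0ℚ
    frac-0 d = ℚₚ.≤-antisym (subst (frac 0 d ℚ.≤_) (frac-def 0 0) (frac-≤ {0} {d} {0} {0} z≤n))
                            (subst (ℚ._≤ frac 0 d) (frac-def 0 0) (frac-≤ {0} {0} {0} {d} z≤n))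
  ·-lower x {a} {d} (suc n) {t} p t<0 = frac a d , frac (n * a) d ℚ.+ t , p , ·-lower x n p t<0 ,
    trans (cong (ℚ._+ t) (sym (frac-+ a (n * a) d))) (ℚₚ.+-assoc (frac a d) (frac (n * a) d) t)

-- The choice t = -1 in `·-lower` accounts for `suc len` in place of `len`. The loss is harmless,
-- because the conclusion is strict and compares integers.
multiple-bound : ∀ x {a d} n len → ℝ.lower x (frac a d) → n · x ≤ᴿ fromℕ len → n * a < suc len * suc d
multiple-bound x {a} {d} n len p le = subst (_< suc len * suc d) (ℕₚ.*-identityʳ (n * a))
    (frac-<⁻ {n * a} {d} {suc len} {0} (subst₂ ℚ._<_ back (trans (cong (ℚ._+ frac 1 0) (sym (frac-def len 0)))
       (trans (frac-+ len 1 0) (cong (λ i → frac i 0) (ℕₚ.+-comm len 1))))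
      (ℚₚ.+-monoˡ-< (frac 1 0) (le (·-lower x n p neg)))))
  where
  neg : ℚ.- frac 1 0 ℚ.< 0ℚ
  neg = subst (λ q → ℚ.- q ℚ.< 0ℚ) (sym (frac-def 1 0)) (ℚₚ.negative⁻¹ (ℚ.- 1ℚ))
  back : frac (n * a) d ℚ.+ ℚ.- frac 1 0 ℚ.+ frac 1 0 ≡ frac (n * a) d
  back = //-rightDividesˡ (frac 1 0) (frac (n * a) d)

-- The choice of the constants

n<2^n : ∀ n → n < 2 ℕ.^ n
n<2^n zero    = s≤s z≤n
n<2^n (suc n) = ℕₚ.≤-trans (ℕₚ.+-mono-≤ (ℕₚ.m^n>0 2 n) (n<2^n n)) (ℕₚ.≤-reflexive (cong (2 ℕ.^ n +_) (sym (ℕₚ.+-identityʳ (2 ℕ.^ n)))))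

twice-≡ : ∀ r → twice r ≡ 2 * r
twice-≡ zero    = refl
twice-≡ (suc r) = trans (cong (λ i → suc (suc i)) (twice-≡ r)) (cong suc (sym (ℕₚ.+-suc r (r + 0))))

private
  pow-+ : ∀ a b → 2 ℕ.^ a * 2 ℕ.^ b ≡ 2 ℕ.^ (a + b)
  pow-+ a b = sym (ℕₚ.^-distribˡ-+-* 2 a b)

  pow-mono : ∀ {a b} → a ≤ b → 2 ℕ.^ a ≤ 2 ℕ.^ b
  pow-mono = ℕₚ.^-monoʳ-≤ 2

-- The exponents 8, 6 and 14 are variables, as powers with literal exponents would be unfolded.
module Constants (Δ L t : ℕ) (2≤L : 2 ≤ L) (Δ<2^L : Δ < 2 ℕ.^ L) (1≤t : 1 ≤ t)
  (e₆ e₈ e₁₄ : ℕ) (e₆≡ : e₆ ≡ 6) (e₈≡ : e₈ ≡ 8) (e₁₄≡ : e₁₄ ≡ 14) where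
  open ℕₚ.≤-Reasoning

  -- A cluster of `K` vertices fails with probability at most 2^(-2g); `G` exceeds the degree of the
  -- graph `J` on the clustered points. `r` counts the layers of losses in the second phase, `ρ` is
  -- the radius on which `Grow` depends, `m` the number of far failing clusters found when `M`
  -- points are reached. In `r`, the term 5L pays for the factor G^6 ≤ 2^(84L) in `M` and t for the
  -- factor t in `m`, as 64g ≥ 2^20.
  g K G r ρ m M : ℕ
  g = 2 ℕ.^ e₁₄ * L
  K = 2 ℕ.^ e₈ * Δ * g
  G = suc (K + Δ)
  r = 5 * L + t
  ρ = twice r + 4
  m = ρ * t
  M = suc (m * G ℕ.^ 6)

  private
    1≤L : 1 ≤ L
    1≤L = ℕₚ.≤-trans (s≤s z≤n) 2≤L

    q : ℕ
    q = e₈ + e₁₄ + (L + L)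

    G≤ : G ≤ 2 ℕ.^ (14 * L)
    G≤ = begin
      suc (K + Δ)                          ≡⟨ sym (ℕₚ.+-suc K Δ) ⟩
      K + suc Δ                            ≤⟨ ℕₚ.+-mono-≤ K≤ (ℕₚ.≤-trans Δ<2^L (pow-mono (ℕₚ.≤-trans (ℕₚ.m≤m+n L L) (ℕₚ.m≤n+m (L + L) (e₈ + e₁₄))))) ⟩
      2 ℕ.^ q + 2 ℕ.^ q                    ≡⟨ cong (2 ℕ.^ q +_) (sym (ℕₚ.+-identityʳ _)) ⟩
      2 ℕ.^ suc q                          ≤⟨ pow-mono exps ⟩
      2 ℕ.^ (14 * L)                       ∎
      where
      arith : ∀ c d Δ L → c * Δ * (d * L) ≡ c * d * (Δ * L)
      arith = solve-∀
      K≤ : K ≤ 2 ℕ.^ q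
      K≤ = begin
        2 ℕ.^ e₈ * Δ * (2 ℕ.^ e₁₄ * L)               ≡⟨ arith (2 ℕ.^ e₈) (2 ℕ.^ e₁₄) Δ L ⟩
        2 ℕ.^ e₈ * 2 ℕ.^ e₁₄ * (Δ * L)               ≤⟨ ℕₚ.*-monoʳ-≤ (2 ℕ.^ e₈ * 2 ℕ.^ e₁₄) (ℕₚ.*-mono-≤ (ℕₚ.<⇒≤ Δ<2^L) (ℕₚ.<⇒≤ (n<2^n L))) ⟩
        2 ℕ.^ e₈ * 2 ℕ.^ e₁₄ * (2 ℕ.^ L * 2 ℕ.^ L)   ≡⟨ cong₂ _*_ (pow-+ e₈ e₁₄) (pow-+ L L) ⟩
        2 ℕ.^ (e₈ + e₁₄) * 2 ℕ.^ (L + L)             ≡⟨ pow-+ (e₈ + e₁₄) (L + L) ⟩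
        2 ℕ.^ q                                      ∎
      -- Here 2 ≤ L is used to absorb the constant, 23 ≤ 12 L.
      exps : suc q ≤ 14 * L
      exps = begin
        suc (e₈ + e₁₄ + (L + L))   ≡⟨ cong₂ (λ a b → suc (a + b + (L + L))) e₈≡ e₁₄≡ ⟩
        23 + (L + L)               ≤⟨ ℕₚ.+-monoˡ-≤ (L + L) (ℕₚ.≤-trans (ℕₚ.n≤1+n 23) (ℕₚ.*-monoʳ-≤ 12 2≤L)) ⟩
        12 * L + (L + L)           ≡⟨ arith₂ L ⟩
        14 * L                     ∎
        where
        arith₂ : ∀ L → 12 * L + (L + L) ≡ 14 * L
        arith₂ = solve-∀

    G^≤ : ∀ e → G ℕ.^ e ≤ 2 ℕ.^ (14 * L * e)
    G^≤ e = ℕₚ.≤-trans (ℕₚ.^-monoˡ-≤ e G≤) (ℕₚ.≤-reflexive (ℕₚ.^-*-assoc 2 (14 * L) e))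

    1≤ρ : 1 ≤ ρ
    1≤ρ = ℕₚ.≤-trans (s≤s z≤n) (ℕₚ.m≤n+m 4 (twice r))

    m< : m < 2 ℕ.^ (3 + r + r)
    m< = begin-strict
      ρ * t                          <⟨ ℕₚ.*-monoʳ-< ρ {{ℕ.>-nonZero 1≤ρ}} (ℕₚ.<-≤-trans (n<2^n t) (pow-mono (ℕₚ.m≤n+m t (5 * L)))) ⟩
      ρ * 2 ℕ.^ r                    ≤⟨ ℕₚ.*-monoˡ-≤ (2 ℕ.^ r) ρ≤ ⟩
      2 ℕ.^ (3 + r) * 2 ℕ.^ r        ≡⟨ pow-+ (3 + r) r ⟩
      2 ℕ.^ (3 + r + r)              ∎
      where
      ρ≤ : ρ ≤ 2 ℕ.^ (3 + r)
      ρ≤ = begin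
        twice r + 4          ≡⟨ cong (_+ 4) (twice-≡ r) ⟩
        2 * r + 4            ≡⟨ arith r ⟩
        2 * (2 + r)          ≤⟨ ℕₚ.*-monoʳ-≤ 2 (ℕₚ.<⇒≤ (n<2^n (2 + r))) ⟩
        2 ℕ.^ (3 + r)        ∎
        where
        arith : ∀ r → 2 * r + 4 ≡ 2 * (2 + r)
        arith = solve-∀

  large : m * G ℕ.^ 6 < M
  large = ℕₚ.≤-refl

  M≤ : M ≤ (2 ℕ.^ e₆ * g) ℕ.^ r
  M≤ = begin
    suc (m * G ℕ.^ 6)                              ≤⟨ ℕₚ.≤-<-trans (ℕₚ.*-monoʳ-≤ m (G^≤ 6)) (ℕₚ.*-monoˡ-< (2 ℕ.^ (14 * L * 6)) {{ℕ.>-nonZero (ℕₚ.m^n>0 2 (14 * L * 6))}} m<) ⟩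
    2 ℕ.^ (3 + r + r) * 2 ℕ.^ (14 * L * 6)         ≡⟨ pow-+ (3 + r + r) (14 * L * 6) ⟩
    2 ℕ.^ (3 + r + r + 14 * L * 6)                 ≤⟨ pow-mono exps ⟩
    2 ℕ.^ ((e₆ + e₁₄) * r)                         ≡⟨ sym (ℕₚ.^-*-assoc 2 (e₆ + e₁₄) r) ⟩
    (2 ℕ.^ (e₆ + e₁₄)) ℕ.^ r                       ≤⟨ ℕₚ.^-monoˡ-≤ r base ⟩
    (2 ℕ.^ e₆ * g) ℕ.^ r                           ∎
    where
    exps : 3 + r + r + 14 * L * 6 ≤ (e₆ + e₁₄) * r
    exps = begin
      3 + r + r + 14 * L * 6             ≡⟨ arith₁ r L ⟩
      3 * 1 + 84 * L + (r + r)           ≤⟨ ℕₚ.+-monoˡ-≤ (r + r) (ℕₚ.+-mono-≤ (ℕₚ.*-mono-≤ (ℕₚ.m≤m+n 3 15) 1≤t) (ℕₚ.*-monoˡ-≤ L (ℕₚ.m≤m+n 84 6))) ⟩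
      18 * t + 90 * L + (r + r)          ≡⟨ arith₂ L t ⟩
      20 * (5 * L + t)                   ≡⟨ cong₂ (λ a b → (a + b) * (5 * L + t)) (sym e₆≡) (sym e₁₄≡) ⟩
      (e₆ + e₁₄) * (5 * L + t)           ∎
      where
      arith₁ : ∀ r L → 3 + r + r + 14 * L * 6 ≡ 3 * 1 + 84 * L + (r + r)
      arith₁ = solve-∀
      arith₂ : ∀ L t → 18 * t + 90 * L + ((5 * L + t) + (5 * L + t)) ≡ 20 * (5 * L + t)
      arith₂ = solve-∀
    base : 2 ℕ.^ (e₆ + e₁₄) ≤ 2 ℕ.^ e₆ * g
    base = begin
      2 ℕ.^ (e₆ + e₁₄)               ≡⟨ sym (pow-+ e₆ e₁₄) ⟩
      2 ℕ.^ e₆ * 2 ℕ.^ e₁₄           ≡⟨ cong (2 ℕ.^ e₆ *_) (sym (ℕₚ.*-identityʳ (2 ℕ.^ e₁₄))) ⟩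
      2 ℕ.^ e₆ * (2 ℕ.^ e₁₄ * 1)     ≤⟨ ℕₚ.*-monoʳ-≤ (2 ℕ.^ e₆) (ℕₚ.*-monoʳ-≤ (2 ℕ.^ e₁₄) 1≤L) ⟩
      2 ℕ.^ e₆ * (2 ℕ.^ e₁₄ * L)     ∎

  -- The first factor counts the words of the union bound, the second is the loss over `t` stages of
  -- derandomization with one factor 2 to spare, and the right side is the gain from `m` independent
  -- failures. In units of L m the exponents on the left are 3 * 127 for the words, 28 for the
  -- stages because m = ρ t, and 3 for the rest.
  strong : suc (G ℕ.^ 9) ℕ.^ (3 * m) * (2 * (4 * G ℕ.^ (ρ + ρ)) ℕ.^ t) ≤ (2 ℕ.^ (2 * g)) ℕ.^ m
  strong = begin
    suc (G ℕ.^ 9) ℕ.^ (3 * m) * (2 * (4 * G ℕ.^ (ρ + ρ)) ℕ.^ t)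
      ≤⟨ ℕₚ.*-mono-≤ (ℕₚ.^-monoˡ-≤ (3 * m) first) (ℕₚ.*-monoʳ-≤ 2 (ℕₚ.^-monoˡ-≤ t (ℕₚ.*-monoʳ-≤ 4 (G^≤ (ρ + ρ))))) ⟩
    (2 ℕ.^ (127 * L)) ℕ.^ (3 * m) * (2 * (2 ℕ.^ 2 * 2 ℕ.^ (14 * L * (ρ + ρ))) ℕ.^ t)
      ≡⟨ cong₂ (λ x y → x * (2 * y)) (ℕₚ.^-*-assoc 2 (127 * L) (3 * m))
           (trans (cong (ℕ._^ t) (pow-+ 2 (14 * L * (ρ + ρ)))) (ℕₚ.^-*-assoc 2 (2 + 14 * L * (ρ + ρ)) t)) ⟩
    2 ℕ.^ (127 * L * (3 * m)) * 2 ℕ.^ suc ((2 + 14 * L * (ρ + ρ)) * t)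
      ≡⟨ pow-+ (127 * L * (3 * m)) (suc ((2 + 14 * L * (ρ + ρ)) * t)) ⟩
    2 ℕ.^ (127 * L * (3 * m) + suc ((2 + 14 * L * (ρ + ρ)) * t))
      ≤⟨ pow-mono exps ⟩
    2 ℕ.^ (2 * g * m)                    ≡⟨ sym (ℕₚ.^-*-assoc 2 (2 * g) m) ⟩
    (2 ℕ.^ (2 * g)) ℕ.^ m                ∎
    where
    first : suc (G ℕ.^ 9) ≤ 2 ℕ.^ (127 * L)
    first = begin
      suc (G ℕ.^ 9)                        ≤⟨ ℕₚ.+-mono-≤ (ℕₚ.m^n>0 2 (14 * L * 9)) (G^≤ 9) ⟩
      2 ℕ.^ (14 * L * 9) + 2 ℕ.^ (14 * L * 9) ≡⟨ cong (2 ℕ.^ (14 * L * 9) +_) (sym (ℕₚ.+-identityʳ _)) ⟩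
      2 ℕ.^ suc (14 * L * 9)               ≤⟨ pow-mono (ℕₚ.≤-trans (ℕₚ.+-monoˡ-≤ (14 * L * 9) 1≤L) (ℕₚ.≤-reflexive (arith L))) ⟩
      2 ℕ.^ (127 * L)                      ∎
      where
      arith : ∀ L → L + 14 * L * 9 ≡ 127 * L
      arith = solve-∀
    t≤m : t ≤ m
    t≤m = ℕₚ.≤-trans (ℕₚ.≤-reflexive (sym (ℕₚ.*-identityˡ t))) (ℕₚ.*-monoˡ-≤ t 1≤ρ)
    t≤Lm : t ≤ L * m
    t≤Lm = ℕₚ.≤-trans t≤m (ℕₚ.≤-trans (ℕₚ.≤-reflexive (sym (ℕₚ.*-identityˡ m))) (ℕₚ.*-monoˡ-≤ m 1≤L))
    exps : 127 * L * (3 * m) + suc ((2 + 14 * L * (ρ + ρ)) * t) ≤ 2 * g * m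
    exps = begin
      127 * L * (3 * m) + suc ((2 + 14 * L * (ρ + ρ)) * t)   ≡⟨ arith₁ L ρ t ⟩
      409 * (L * (ρ * t)) + (1 + 2 * t)                      ≤⟨ ℕₚ.+-monoʳ-≤ (409 * (L * m)) (ℕₚ.+-mono-≤ (ℕₚ.≤-trans 1≤t t≤Lm) (ℕₚ.*-monoʳ-≤ 2 t≤Lm)) ⟩
      409 * (L * m) + (L * m + 2 * (L * m))                  ≡⟨ arith₂ (L * m) ⟩
      412 * (L * m)                                          ≤⟨ ℕₚ.*-monoˡ-≤ (L * m) enough ⟩
      2 * 2 ℕ.^ e₁₄ * (L * m)                                ≡⟨ arith₃ (2 ℕ.^ e₁₄) L m ⟩
      2 * (2 ℕ.^ e₁₄ * L) * m                                ∎
      where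
      arith₁ : ∀ L ρ t → 127 * L * (3 * (ρ * t)) + suc ((2 + 14 * L * (ρ + ρ)) * t) ≡ 409 * (L * (ρ * t)) + (1 + 2 * t)
      arith₁ = solve-∀
      arith₂ : ∀ x → 409 * x + (x + 2 * x) ≡ 412 * x
      arith₂ = solve-∀
      enough : 412 ≤ 2 * 2 ℕ.^ e₁₄
      enough = subst (λ e → 412 ≤ 2 * 2 ℕ.^ e) (sym e₁₄≡) (ℕₚ.m≤m+n 412 32356)
      arith₃ : ∀ p L m → 2 * p * (L * m) ≡ 2 * (p * L) * m
      arith₃ = solve-∀

private
  size-bound : ∀ e e₈ e₁₄ → e ≡ 3 + (e₈ + e₁₄) → ∀ Δ L len → 2 ℕ.^ e * Δ * L < suc len * 8 →
               2 ℕ.^ e₈ * Δ * (2 ℕ.^ e₁₄ * L) ≤ len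
  size-bound e e₈ e₁₄ refl Δ L len lt = ℕ.s≤s⁻¹ (ℕₚ.*-cancelʳ-< 8 (2 ℕ.^ e₈ * Δ * (2 ℕ.^ e₁₄ * L)) (suc len)
    (subst (_< suc len * 8) eq lt))
    where
    arith : ∀ p q Δ L → 2 * (2 * (2 * (p * q))) * Δ * L ≡ p * Δ * (q * L) * 8
    arith = solve-∀
    eq : 2 ℕ.^ (3 + (e₈ + e₁₄)) * Δ * L ≡ 2 ℕ.^ e₈ * Δ * (2 ℕ.^ e₁₄ * L) * 8
    eq = trans (cong (λ x → 2 * (2 * (2 * x)) * Δ * L) (ℕₚ.^-distribˡ-+-* 2 e₈ e₁₄)) (arith (2 ℕ.^ e₈) (2 ℕ.^ e₁₄) Δ L)

-- Radii 1/(n + 1) in metric spaces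

private
  -- The index of half the radius: 1/(half n + 1) = 1/(2n + 2).
  half : ℕ → ℕ
  half n = n + suc n

  abstract
    radius : ℕ → ℚ
    radius n = ℤ.+ 1 / suc n

    radius>0 : ∀ n → 0ℚ ℚ.< radius n
    radius>0 n = ℚₚ.positive⁻¹ (radius n) {{ℚₚ.normalize-pos 1 (suc n)}}

    radiusᵘ : ∀ n → ℚ.toℚᵘ (radius n) ℚᵘ.≃ mkℚᵘ (ℤ.+ 1) n
    radiusᵘ n = ℚₚ.toℚᵘ-fromℚᵘ (mkℚᵘ (ℤ.+ 1) n)

    radius-antitone : ∀ {m n} → m ≤ n → radius n ℚ.≤ radius m
    radius-antitone {m} {n} m≤n = ℚₚ.toℚᵘ-cancel-≤
      (ℚᵘₚ.≤-respˡ-≃ (ℚᵘₚ.≃-sym (radiusᵘ n)) (ℚᵘₚ.≤-respʳ-≃ (ℚᵘₚ.≃-sym (radiusᵘ m))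
        (ℚᵘ.*≤* (ℤₚ.*-monoˡ-≤-nonNeg (ℤ.+ 1) (ℤ.+≤+ (s≤s m≤n))))))

    radius-half : ∀ n → radius (half n) ℚ.+ radius (half n) ≡ radius n
    radius-half n = ℚₚ.toℚᵘ-injective
      (ℚᵘₚ.≃-trans (ℚₚ.toℚᵘ-homo-+ (radius (half n)) (radius (half n)))
      (ℚᵘₚ.≃-trans (ℚᵘₚ.+-cong (radiusᵘ (half n)) (radiusᵘ (half n)))
      (ℚᵘₚ.≃-trans (ℚᵘ.*≡* (cong ℤ.+_ (arith n)))
                   (ℚᵘₚ.≃-sym (radiusᵘ n)))))
      where
      arith : ∀ n → (1 * suc (n + suc n) + 1 * suc (n + suc n)) * suc n
                  ≡ 1 * (suc (n + suc n) * suc (n + suc n))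
      arith = solve-∀

    archimedean : ∀ {ε} → 0ℚ ℚ.< ε → ∃[ n ] radius n ℚ.< ε
    archimedean {ℚ.mkℚ (ℤ.+ zero) d c} (ℚ.*<* (ℤ.+<+ ()))
    archimedean {ε@(ℚ.mkℚ (ℤ.+ suc a) d c)} _ = suc d , ℚₚ.toℚᵘ-cancel-<
      (ℚᵘₚ.<-respˡ-≃ (ℚᵘₚ.≃-sym (radiusᵘ (suc d)))
        (ℚᵘ.*<* (ℤ.+<+ (ℕₚ.<-≤-trans (subst (_< suc (suc d)) (sym (ℕₚ.*-identityˡ (suc d))) ℕₚ.≤-refl)
                                     (ℕₚ.m≤m+n (suc (suc d)) (a * suc (suc d)))))))
    archimedean {ℚ.mkℚ -[1+ a ] d c} (ℚ.*<* ())

-- Classical principles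

module Development (em : ExcludedMiddle 0ℓ) (em₁ : ExcludedMiddle (lsuc 0ℓ)) where

  dne : {P : Set} → ¬ ¬ P → P
  dne {P} nn with em {P}
  ... | yes p = p
  ... | no ¬p = ⊥-elim (nn ¬p)

  ¬∀⇒∃¬ : {A : Set} {P : A → Set} → ¬ (∀ a → P a) → ∃[ a ] ¬ P a
  ¬∀⇒∃¬ {A} {P} h = dne λ k → h λ a → dne λ np → k (a , np)

  least : (P : ℕ → Set) → ∀ {n} → P n → ∃[ m ] (P m × (∀ j → j < m → ¬ P j))
  least P {n} pn with em {∃[ j ] (j < n × P j)}
  ... | no none = n , pn , λ j j<n pj → none (j , j<n , pj)
  ... | yes (j , j<n , pj) = go n j j<n pj
    where
    go : ∀ b j → j < b → P j → ∃[ m ] (P m × (∀ j → j < m → ¬ P j))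
    go (suc b) j (s≤s j≤b) pj with em {∃[ i ] (i < j × P i)}
    ... | no none = j , pj , λ i i<j pi → none (i , i<j , pi)
    ... | yes (i , i<j , pi) = go b i (ℕₚ.<-≤-trans i<j j≤b) pi

  least-unique : (P : ℕ → Set) → ∀ {m n} →
                 P m → (∀ j → j < m → ¬ P j) → P n → (∀ j → j < n → ¬ P j) → m ≡ n
  least-unique P {m} {n} pm lm pn ln with ℕₚ.<-cmp m n
  ... | tri< m<n _ _ = ⊥-elim (ln m m<n pm)
  ... | tri≈ _ e _   = e
  ... | tri> _ _ n<m = ⊥-elim (lm n n<m pn)

  -- Borel sets under countable quantifiers

  module Meas (𝓜 : MeasurableSpace) where
    open MeasurableSpace 𝓜 renaming (respects to resp)

    m-iff : ∀ {A B : Pred Carrier 0ℓ} → (∀ x → A x → B x) → (∀ x → B x → A x) →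
            Measurable A → Measurable B
    m-iff f g = resp ((λ {x} → f x) , (λ {x} → g x))

    m-const : (P : Set) → Measurable (λ _ → P)
    m-const P with em {P}
    ... | yes p = m-iff (λ _ _ → p) (λ _ _ ()) (complement empty)
    ... | no ¬p = m-iff (λ _ ()) (λ _ p → ¬p p) empty

    m-¬ : ∀ {A : Pred Carrier 0ℓ} → Measurable A → Measurable (λ x → ¬ A x)
    m-¬ = complement

    m-∃ : {I : Set} {{_ : Enumerable I}} {A : I → Pred Carrier 0ℓ} →
          (∀ i → Measurable (A i)) → Measurable (λ x → ∃[ i ] A i x)
    m-∃ {A = A} m = m-iff
      (λ x (n , a) → enum n , a)
      (λ x (i , a) → let (n , e) = onto i in n , subst (λ i → A i x) (sym e) a)
      (union {A = λ n → A (enum n)} (λ n → m (enum n)))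

    m-∀ : {I : Set} {{_ : Enumerable I}} {A : I → Pred Carrier 0ℓ} →
          (∀ i → Measurable (A i)) → Measurable (λ x → ∀ i → A i x)
    m-∀ m = m-iff (λ x h i → dne (λ na → h (i , na))) (λ x h (i , na) → na (h i))
              (m-¬ (m-∃ (λ i → m-¬ (m i))))

    m-⊎ : ∀ {A B : Pred Carrier 0ℓ} → Measurable A → Measurable B →
          Measurable (λ x → A x ⊎ B x)
    m-⊎ {A} {B} a b = m-iff to from (m-∃ {A = C} c)
      where
      C : ℕ → Pred Carrier 0ℓ
      C zero    = A
      C (suc _) = B
      c : ∀ n → Measurable (C n)
      c zero    = a
      c (suc _) = b
      to : ∀ x → ∃[ n ] C n x → A x ⊎ B x
      to x (zero  , p) = inj₁ p
      to x (suc _ , p) = inj₂ p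
      from : ∀ x → A x ⊎ B x → ∃[ n ] C n x
      from x (inj₁ p) = 0 , p
      from x (inj₂ p) = 1 , p

    m-× : ∀ {A B : Pred Carrier 0ℓ} → Measurable A → Measurable B →
          Measurable (λ x → A x × B x)
    m-× a b = m-iff
      (λ x h → dne (λ na → h (inj₁ na)) , dne (λ nb → h (inj₂ nb)))
      (λ { x (p , q) (inj₁ na) → na p ; x (p , q) (inj₂ nb) → nb q })
      (m-¬ (m-⊎ (m-¬ a) (m-¬ b)))

    m-→ : ∀ {A B : Pred Carrier 0ℓ} → Measurable A → Measurable B →
          Measurable (λ x → A x → B x)
    m-→ {A} a b = m-iff
      (λ { x (inj₁ na) p → ⊥-elim (na p) ; x (inj₂ q) _ → q })
      (λ x h → case em {A x} of λ { (yes p) → inj₂ (h p) ; (no np) → inj₁ np })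
      (m-⊎ (m-¬ a) b)

  -- Finite cardinalities

  module Lists {A : Set} where

    pigeonhole : ∀ {xs zs : List A} → Unique xs → length zs < length xs → ∃[ x ] (x ∈ xs × x ∉ zs)
    pigeonhole {xs} {zs} u lt = dne λ none →
      ℕₚ.<⇒≱ lt (unique-length u λ {x} i → dne λ n → none (x , i , n))

    ∉-unique : ∀ {x : A} {xs} → x ∉ xs → Unique xs → Unique (x ∷ xs)
    ∉-unique n u = All.tabulate (λ { i refl → n i }) ∷ u

    nub : List A → List A
    nub [] = []
    nub (x ∷ xs) with em {x ∈ nub xs}
    ... | yes _ = nub xs
    ... | no _  = x ∷ nub xs

    nub-unique : ∀ xs → Unique (nub xs)
    nub-unique [] = []
    nub-unique (x ∷ xs) with em {x ∈ nub xs}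
    ... | yes _ = nub-unique xs
    ... | no n  = ∉-unique n (nub-unique xs)

    ∈-nub⁺ : ∀ {y} xs → y ∈ xs → y ∈ nub xs
    ∈-nub⁺ (x ∷ xs) i with em {x ∈ nub xs}
    ∈-nub⁺ (x ∷ xs) (here refl) | yes j = j
    ∈-nub⁺ (x ∷ xs) (there i)   | yes j = ∈-nub⁺ xs i
    ∈-nub⁺ (x ∷ xs) (here refl) | no _  = here refl
    ∈-nub⁺ (x ∷ xs) (there i)   | no _  = there (∈-nub⁺ xs i)

    keep : (P : A → Set) → List A → List A
    keep P = filter (λ x → em {P x})

    ∈-keep⁺ : ∀ {P : A → Set} {x} xs → x ∈ xs → P x → x ∈ keep P xs
    ∈-keep⁺ {P} xs i p = ∈-filter⁺ (λ x → em {P x}) i p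

    ∈-keep⁻ : ∀ {P : A → Set} {x} xs → x ∈ keep P xs → x ∈ xs × P x
    ∈-keep⁻ {P} xs i = ∈-filter⁻ (λ x → em {P x}) {xs = xs} i

    keep-unique : ∀ {P : A → Set} {xs} → Unique xs → Unique (keep P xs)
    keep-unique {P} = Uniqueₚ.filter⁺ (λ x → em {P x})

    keep-split : ∀ (P : A → Set) xs → length (keep P xs) + length (keep (λ x → ¬ P x) xs) ≡ length xs
    keep-split P [] = refl
    keep-split P (x ∷ xs) with em {P x} | em {¬ P x}
    ... | yes p | yes np = ⊥-elim (np p)
    ... | yes p | no _   = cong suc (keep-split P xs)
    ... | no np | yes _  = trans (ℕₚ.+-suc _ _) (cong suc (keep-split P xs))
    ... | no np | no nnp = ⊥-elim (nnp np)

    AtLeastN : ℕ → Pred A 0ℓ → Set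
    AtLeastN n P = ∃[ zs ] (length zs ≡ n × Unique zs × All P zs)

    atLeast-mono : ∀ {n} {P Q : Pred A 0ℓ} → (∀ {x} → P x → Q x) → AtLeastN n P → AtLeastN n Q
    atLeast-mono f (zs , e , u , a) = zs , e , u , All.map f a

    atLeast : ∀ {n} {P : Pred A 0ℓ} zs → n ≤ length zs → Unique zs → All P zs → AtLeastN n P
    atLeast {n} zs le u a =
      take n zs , trans (Lₚ.length-take n zs) (ℕₚ.m≤n⇒m⊓n≡m le) , Uniqueₚ.take⁺ n u , Allₚ.take⁺ n a

    atLeast-remove : ∀ {n} {P : Pred A 0ℓ} p → AtLeastN (suc n) (λ x → P x ⊎ x ≡ p) → AtLeastN n P
    atLeast-remove {n} {P} p (zs , e , u , a) = atLeast (keep (λ x → x ≢ p) zs) le (keep-unique u)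
        (All.tabulate λ i → let (j , ne) = ∈-keep⁻ zs i in
          [ id , (λ eq → ⊥-elim (ne eq)) ]′ (All.lookup a j))
      where
      le : n ≤ length (keep (λ x → x ≢ p) zs)
      le with em {n ≤ length (keep (λ x → x ≢ p) zs)}
      ... | yes l = l
      ... | no ¬l with pigeonhole {zs} {p ∷ keep (λ x → x ≢ p) zs} u (subst (suc (length (keep (λ x → x ≢ p) zs)) <_) (sym e) (s≤s (ℕₚ.≰⇒> ¬l)))
      ... | x , i , ni = ⊥-elim (ni (there (∈-keep⁺ zs i λ { refl → ni (here refl) })))

    atLeast-or : ∀ {xs} n (P : Pred A 0ℓ) → Unique xs → ¬ AtLeastN n (λ x → x ∈ xs × P x) →
                 length xs < n + length (keep (λ x → ¬ P x) xs)
    atLeast-or {xs} n P u few = subst (_< n + length (keep (λ x → ¬ P x) xs)) (keep-split P xs)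
      (ℕₚ.+-monoˡ-< _ (ℕₚ.≰⇒> λ le → few (atLeast (keep P xs) le (keep-unique u) (All.tabulate (∈-keep⁻ xs)))))

    length-cover : ∀ {B : Set} {d} {xs : List A} (ys : List B) (f : B → List A) →
                   Unique xs → (∀ y → length (f y) ≤ d) → (∀ {x} → x ∈ xs → ∃[ y ] (y ∈ ys × x ∈ f y)) →
                   length xs ≤ length ys * d
    length-cover {d = d} {xs} ys f u h c = ℕₚ.≤-trans
      (unique-length {zs = concatMap f ys} u (λ i → let (y , j , k) = c i in ∈-concatMap⁺ f (lose j k)))
      (len ys)
      where
      len : ∀ ys → length (concatMap f ys) ≤ length ys * d
      len []       = z≤n
      len (y ∷ ys) = subst (_≤ d + length ys * d) (sym (Lₚ.length-++ (f y))) (ℕₚ.+-mono-≤ (h y) (len ys))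

  open Lists

  -- Probability by counting assignments

  module Counting {V : Set} (k : ℕ) where

    choose : {P : Set} → Dec P → ℕ → ℕ → ℕ
    choose (yes _) a b = a
    choose (no _)  a b = b

    infixl 8 _[_≔_]
    _[_≔_] : (V → ℕ) → V → ℕ → V → ℕ
    (f [ x ≔ a ]) y = choose (em {x ≡ y}) a (f y)

    ≔-same : ∀ f x a → (f [ x ≔ a ]) x ≡ a
    ≔-same f x a with em {x ≡ x}
    ... | yes _ = refl
    ... | no ne = ⊥-elim (ne refl)

    ≔-other : ∀ f {x} a {y} → x ≢ y → (f [ x ≔ a ]) y ≡ f y
    ≔-other f {x} a {y} x≢y with em {x ≡ y}
    ... | yes e = ⊥-elim (x≢y e)
    ... | no _  = refl

    ≔-cong : ∀ {f g} x a {y} → f y ≡ g y → (f [ x ≔ a ]) y ≡ (g [ x ≔ a ]) y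
    ≔-cong x a {y} e with em {x ≡ y}
    ... | yes _ = refl
    ... | no _  = e

    -- The expectation of F over the variables in xs, each uniform below k, multiplied by k^(length xs).
    E : List V → ((V → ℕ) → ℕ) → (V → ℕ) → ℕ
    E []       F f = F f
    E (x ∷ xs) F f = sumTo k (λ a → E xs F (f [ x ≔ a ]))

    total : List V → ℕ
    total xs = k ℕ.^ length xs

    E-mono : ∀ xs {F G : (V → ℕ) → ℕ} → (∀ g → F g ≤ G g) → ∀ f → E xs F f ≤ E xs G f
    E-mono []       h f = h f
    E-mono (x ∷ xs) h f = sumTo-mono k (λ a → E-mono xs h _)

    E-cong : ∀ xs {F G : (V → ℕ) → ℕ} → (∀ g → F g ≡ G g) → ∀ f → E xs F f ≡ E xs G f
    E-cong []       h f = h f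
    E-cong (x ∷ xs) h f = sumTo-cong k (λ a → E-cong xs h _)

    E-+ : ∀ xs (F G : (V → ℕ) → ℕ) f → E xs (λ g → F g + G g) f ≡ E xs F f + E xs G f
    E-+ []       F G f = refl
    E-+ (x ∷ xs) F G f = trans (sumTo-cong k (λ a → E-+ xs F G _)) (sumTo-+ k _ _)

    E-* : ∀ xs m (F : (V → ℕ) → ℕ) f → E xs (λ g → m * F g) f ≡ m * E xs F f
    E-* []       m F f = refl
    E-* (x ∷ xs) m F f = trans (sumTo-cong k (λ a → E-* xs m F _)) (sumTo-* k m _)

    E-const : ∀ xs m f → E xs (λ _ → m) f ≡ total xs * m
    E-const []       m f = sym (ℕₚ.*-identityˡ m)
    E-const (x ∷ xs) m f = trans (sumTo-cong k (λ a → E-const xs m _))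
      (trans (sumTo-const k (total xs * m)) (sym (ℕₚ.*-assoc k (total xs) m)))

    E-sumL : ∀ {A : Set} xs (T : List A) (F : A → (V → ℕ) → ℕ) f →
             E xs (λ g → sumL T (λ t → F t g)) f ≡ sumL T (λ t → E xs (F t) f)
    E-sumL xs []      F f = trans (E-const xs 0 f) (ℕₚ.*-zeroʳ (total xs))
    E-sumL xs (t ∷ T) F f = trans (E-+ xs (F t) _ f) (cong (E xs (F t) f +_) (E-sumL xs T F f))

    E-++ : ∀ xs ys (F : (V → ℕ) → ℕ) f → E (xs ++ ys) F f ≡ E xs (E ys F) f
    E-++ []       ys F f = refl
    E-++ (x ∷ xs) ys F f = sumTo-cong k (λ a → E-++ xs ys F _)

    E-pos : ∀ xs {F : (V → ℕ) → ℕ} {f} → 0 < E xs F f →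
            ∃[ g ] (0 < F g × (∀ y → y ∉ xs → g y ≡ f y) × (∀ y → y ∈ xs → g y < k))
    E-pos [] {f = f} p = f , p , (λ y _ → refl) , λ y ()
    E-pos (x ∷ xs) {F} {f} p with sumTo-pos k p
    ... | a , a<k , q with E-pos xs q
    ... | g , r , out , inn = g , r ,
        (λ y y∉ → trans (out y (y∉ ∘ there)) (≔-other f a (λ { refl → y∉ (here refl) }))) ,
        λ y y∈ → below y y∈ em
      where
      below : ∀ y → y ∈ x ∷ xs → Dec (y ∈ xs) → g y < k
      below y _           (yes i) = inn y i
      below y (there i)   (no n)  = ⊥-elim (n i)
      below y (here refl) (no n)  = subst (_< k) (sym (trans (out y n) (≔-same f y a))) a<k

    _DependsOn_ : ((V → ℕ) → ℕ) → (V → Set) → Set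
    F DependsOn D = ∀ {g h} → (∀ y → D y → g y ≡ h y) → F g ≡ F h

    Ext : ((V → ℕ) → ℕ) → Set
    Ext F = F DependsOn (λ _ → ⊤)

    dep-ext : ∀ {F D} → F DependsOn D → Ext F
    dep-ext d h = d (λ y _ → h y tt)

    -- The values on `xs` are overwritten before `F` is evaluated, so agreement is asked for outside
    -- `xs` only.
    E-dep : ∀ xs {F D} → F DependsOn D → ∀ {g h} → (∀ y → D y → y ∉ xs → g y ≡ h y) →
            E xs F g ≡ E xs F h
    E-dep [] d e = d (λ y dy → e y dy λ ())
    E-dep (x ∷ xs) d {g} {h} e = sumTo-cong k λ a → E-dep xs d λ y dy y∉ → agree a y dy y∉ em
      where
      agree : ∀ a y → _ → y ∉ xs → Dec (x ≡ y) → (g [ x ≔ a ]) y ≡ (h [ x ≔ a ]) y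
      agree a y dy y∉ (yes refl) = trans (≔-same g x a) (sym (≔-same h x a))
      agree a y dy y∉ (no x≢y)   = ≔-cong {g} {h} x a (e y dy λ { (here refl) → x≢y refl ; (there i) → y∉ i })

    E-depends : ∀ xs {F D} → F DependsOn D → E xs F DependsOn (λ y → D y × y ∉ xs)
    E-depends xs d h = E-dep xs d (λ y dy y∉ → h y (dy , y∉))

    E-skip : ∀ x xs {F D} → F DependsOn D → ¬ D x → ∀ f → E (x ∷ xs) F f ≡ k * E xs F f
    E-skip x xs d ¬dx f = trans
      (sumTo-cong k λ a → E-dep xs d λ y dy _ → ≔-other f a λ { refl → ¬dx dy })
      (sumTo-const k _)

    E-↭ : ∀ {xs ys} {F : (V → ℕ) → ℕ} → Ext F → xs ↭ ys → ∀ f → E xs F f ≡ E ys F f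
    E-↭ ext Perm.refl f = refl
    E-↭ ext (prep x p) f = sumTo-cong k (λ a → E-↭ ext p _)
    E-↭ ext (Perm.trans p q) f = trans (E-↭ ext p f) (E-↭ ext q f)
    E-↭ {x ∷ y ∷ xs} {_ ∷ _ ∷ ys} {F} ext (swap _ _ p) f with em {x ≡ y}
    ... | yes refl = sumTo-cong k (λ a → sumTo-cong k (λ b → E-↭ ext p _))
    ... | no x≢y = trans
        (sumTo-cong k (λ a → sumTo-cong k (λ b → trans (E-↭ ext p _)
          (E-dep ys ext (λ z _ _ → commute a b z em em)))))
        (sumTo-swap k k _)
      where
      commute : ∀ a b z → Dec (x ≡ z) → Dec (y ≡ z) → (f [ x ≔ a ] [ y ≔ b ]) z ≡ (f [ y ≔ b ] [ x ≔ a ]) z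
      commute a b z (yes refl) _ = trans (≔-other (f [ x ≔ a ]) b (x≢y ∘ sym))
        (trans (≔-same f x a) (sym (≔-same (f [ y ≔ b ]) x a)))
      commute a b z (no x≢z) (yes refl) = trans (≔-same (f [ x ≔ a ]) y b)
        (sym (trans (≔-other (f [ y ≔ b ]) a x≢z) (≔-same f y b)))
      commute a b z (no x≢z) (no y≢z) = trans (≔-other (f [ x ≔ a ]) b y≢z)
        (trans (≔-other f a x≢z) (sym (trans (≔-other (f [ y ≔ b ]) a x≢z) (≔-other f b y≢z))))

    -- The product rule for independent variables, with `total xs` as the denominator. Each variable
    -- of `xs` belongs to at most one of `D` and `D′`; the expectation of the other function does
    -- not depend on it and leaves the sum.
    E-independent : ∀ xs {F G D D′} → F DependsOn D → G DependsOn D′ →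
                    (∀ y → y ∈ xs → D y → ¬ D′ y) → ∀ f →
                    total xs * E xs (λ g → F g * G g) f ≡ E xs F f * E xs G f
    E-independent [] d d′ dis f = ℕₚ.*-identityˡ _
    E-independent (x ∷ xs) {F} {G} {D} d d′ dis f with em {D x}
    ... | no ¬dx = trans (trans (ℕₚ.*-assoc k (total xs) _)
          (cong (k *_) (trans (sym (sumTo-* k (total xs) _)) (sumTo-cong k λ a → trans
            (E-independent xs d d′ (λ y i → dis y (there i)) (f [ x ≔ a ]))
            (cong (_* E xs G (f [ x ≔ a ])) (E-dep xs d λ y dy _ → ≔-other f a λ { refl → ¬dx dy }))))))
        (trans (cong (k *_) (sumTo-* k (E xs F f) _))
          (trans (sym (ℕₚ.*-assoc k (E xs F f) _)) (cong (_* E (x ∷ xs) G f) (sym (E-skip x xs d ¬dx f)))))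
    ... | yes dx = trans (trans (ℕₚ.*-assoc k (total xs) _)
          (cong (k *_) (trans (sym (sumTo-* k (total xs) _)) (sumTo-cong k λ a → trans
            (E-independent xs d d′ (λ y i → dis y (there i)) (f [ x ≔ a ]))
            (trans (cong (E xs F (f [ x ≔ a ]) *_) (E-dep xs d′ λ y dy _ → ≔-other f a λ { refl → ¬dx dy }))
                   (ℕₚ.*-comm (E xs F (f [ x ≔ a ])) (E xs G f)))))))
        (trans (cong (k *_) (sumTo-* k (E xs G f) _))
          (trans (sym (ℕₚ.*-assoc k (E xs G f) _))
            (trans (cong (_* E (x ∷ xs) F f) (sym (E-skip x xs d′ ¬dx f))) (ℕₚ.*-comm (E (x ∷ xs) G f) (E (x ∷ xs) F f)))))
      where
      ¬dx : ¬ _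
      ¬dx = dis x (here refl) dx

    𝟙 : Set → ℕ
    𝟙 P = choose (em {P}) 1 0

    𝟙-yes : ∀ {P} → P → 𝟙 P ≡ 1
    𝟙-yes {P} p with em {P}
    ... | yes _ = refl
    ... | no ¬p = ⊥-elim (¬p p)

    𝟙-no : ∀ {P} → ¬ P → 𝟙 P ≡ 0
    𝟙-no {P} ¬p with em {P}
    ... | yes p = ⊥-elim (¬p p)
    ... | no _  = refl

    𝟙-pos : ∀ {P} → 0 < 𝟙 P → P
    𝟙-pos {P} h with em {P}
    ... | yes p = p

    𝟙-mono : ∀ {P Q} → (P → Q) → 𝟙 P ≤ 𝟙 Q
    𝟙-mono {P} {Q} f with em {P}
    ... | no _  = z≤n
    ... | yes p = ℕₚ.≤-reflexive (sym (𝟙-yes (f p)))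

    𝟙-⇔ : ∀ {P Q} → (P → Q) → (Q → P) → 𝟙 P ≡ 𝟙 Q
    𝟙-⇔ f g = ℕₚ.≤-antisym (𝟙-mono f) (𝟙-mono g)

    𝟙-× : ∀ P Q → 𝟙 (P × Q) ≡ 𝟙 P * 𝟙 Q
    𝟙-× P Q with em {P}
    ... | no ¬p = 𝟙-no (¬p ∘ proj₁)
    ... | yes p = trans (𝟙-⇔ proj₂ (λ q → p , q)) (sym (ℕₚ.+-identityʳ (𝟙 Q)))

    # : List V → ((V → ℕ) → Set) → (V → ℕ) → ℕ
    # xs P = E xs (λ g → 𝟙 (P g))

    _LocalOn_ : ((V → ℕ) → Set) → (V → Set) → Set
    P LocalOn D = ∀ {g h} → (∀ y → D y → g y ≡ h y) → P g → P h

    local-dep : ∀ {P D} → P LocalOn D → (λ g → 𝟙 (P g)) DependsOn D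
    local-dep l h = 𝟙-⇔ (l h) (l (λ y dy → sym (h y dy)))

    #-independent : ∀ xs {P Q D D′} → P LocalOn D → Q LocalOn D′ → (∀ y → y ∈ xs → D y → ¬ D′ y) →
                    ∀ f → total xs * # xs (λ g → P g × Q g) f ≡ # xs P f * # xs Q f
    #-independent xs {P} {Q} l l′ dis f =
      trans (cong (total xs *_) (E-cong xs (λ g → 𝟙-× (P g) (Q g)) f))
            (E-independent xs (local-dep l) (local-dep l′) dis f)

    #-mono : ∀ xs {P Q : (V → ℕ) → Set} → (∀ g → P g → Q g) → ∀ f → # xs P f ≤ # xs Q f
    #-mono xs h f = E-mono xs (λ g → 𝟙-mono (h g)) f

    #-union : ∀ {A : Set} xs {P Q : (V → ℕ) → Set} (T : List A) (R : A → (V → ℕ) → Set) →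
              (∀ g → P g → Q g ⊎ (∃[ t ] (t ∈ T × R t g))) → ∀ f →
              # xs P f ≤ # xs Q f + sumL T (λ t → # xs (R t) f)
    #-union xs {P} {Q} T R h f = ℕₚ.≤-trans (E-mono xs bound f) (ℕₚ.≤-reflexive
        (trans (E-+ xs _ _ f) (cong (# xs Q f +_) (E-sumL xs T (λ t g → 𝟙 (R t g)) f))))
      where
      bound : ∀ g → 𝟙 (P g) ≤ 𝟙 (Q g) + sumL T (λ t → 𝟙 (R t g))
      bound g with em {P g}
      ... | no _  = z≤n
      ... | yes p with h g p
      ... | inj₁ q = ℕₚ.≤-trans (ℕₚ.≤-reflexive (sym (𝟙-yes q))) (ℕₚ.m≤m+n _ _)
      ... | inj₂ (t , i , r) = ℕₚ.≤-trans (ℕₚ.≤-reflexive (sym (𝟙-yes r)))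
            (ℕₚ.≤-trans (∈-sumL (λ t → 𝟙 (R t g)) i) (ℕₚ.m≤n+m _ _))

    -- The local lemma

    module LocalLemma
      {Ev : Set} (0<k : 0 < k) (xs : List V) (f : V → ℕ) (d : ℕ) (0<d : 0 < d)
      (Ok : Pred Ev 0ℓ)
      (A : Ev → (V → ℕ) → Set) (D : Ev → V → Set) (local : ∀ e → A e LocalOn D e)
      (nb : Ev → List Ev) (nb-length : ∀ e → length (nb e) ≤ d)
      (shared : ∀ {e e′ y} → Ok e → Ok e′ → y ∈ xs → D e y → D e′ y → e′ ∈ nb e)
      (rare : ∀ e → Ok e → 4 * d * # xs (A e) f ≤ total xs)
      where

      Avoid : List Ev → (V → ℕ) → Set
      Avoid es g = ∀ e → e ∈ es → ¬ A e g

      private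
        N : List Ev → ℕ
        N es = # xs (Avoid es) f

        0<total : 0 < total xs
        0<total = ℕₚ.m^n>0 k {{ℕ.>-nonZero 0<k}} (length xs)

        Share : Ev → Ev → Set
        Share e e′ = ∃[ y ] (y ∈ xs × D e y × D e′ y)

        cancel-total : ∀ {a b} → a * total xs ≤ total xs * b → a ≤ b
        cancel-total {a} {b} h = ℕₚ.*-cancelʳ-≤ a b (total xs) {{ℕ.>-nonZero 0<total}}
          (ℕₚ.≤-trans h (ℕₚ.≤-reflexive (ℕₚ.*-comm (total xs) b)))

        avoid-local : ∀ es → Avoid es LocalOn (λ y → ∃[ e ] (e ∈ es × D e y))
        avoid-local es h av e i a = av e i (local e (λ y dy → sym (h y (e , i , dy))) a)

        arith₁ : ∀ d x → 4 * d * x ≡ 2 * (2 * d * x)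
        arith₁ = solve-∀

        arith₂ : ∀ d x → 2 * d * x ≡ d * (2 * x)
        arith₂ = solve-∀

      -- P (A e | Avoid S) ≤ 1 / 2d, by induction on S: the events of S that share no variable
      -- with e do not influence A e, and excluding the other ones at most halves the count.
      conditional-step : ∀ b → (∀ S e → length S < b → All Ok S → Ok e →
                           2 * d * # xs (λ g → A e g × Avoid S g) f ≤ N S) →
                         ∀ S e → length S ≤ b → All Ok S → Ok e →
                         2 * d * # xs (λ g → A e g × Avoid S g) f ≤ N S
      conditional-step b ih S e len ok oke = ℕₚ.*-cancelˡ-≤ 2 (begin
          2 * (2 * d * # xs (λ g → A e g × Avoid S g) f) ≡⟨ arith₁ d _ ⟨
          4 * d * # xs (λ g → A e g × Avoid S g) f
            ≤⟨ ℕₚ.*-monoʳ-≤ (4 * d) (#-mono xs (λ g (a , av) → a , λ e′ i → av e′ (proj₁ (∈-filter⁻ unshared i))) f) ⟩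
          4 * d * # xs (λ g → A e g × Avoid S₂ g) f      ≤⟨ far ⟩
          N S₂                                           ≤⟨ halves em ⟩
          2 * N S                                        ∎)
        where
        open ℕₚ.≤-Reasoning
        unshared : ∀ e′ → Dec (¬ Share e e′)
        unshared e′ = em
        S₂ = filter unshared S
        ok₂ : All Ok S₂
        ok₂ = Allₚ.filter⁺ unshared ok
        far : 4 * d * # xs (λ g → A e g × Avoid S₂ g) f ≤ N S₂
        far = cancel-total (begin
          4 * d * # xs (λ g → A e g × Avoid S₂ g) f * total xs   ≡⟨ ℕₚ.*-assoc (4 * d) _ (total xs) ⟩
          4 * d * (# xs (λ g → A e g × Avoid S₂ g) f * total xs) ≡⟨ cong (4 * d *_) (ℕₚ.*-comm _ (total xs)) ⟩
          4 * d * (total xs * # xs (λ g → A e g × Avoid S₂ g) f)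
            ≡⟨ cong (4 * d *_) (#-independent xs (local e) (avoid-local S₂)
                 (λ y i dy (e′ , i′ , dy′) → proj₂ (∈-filter⁻ unshared {xs = S} i′) (y , i , dy , dy′)) f) ⟩
          4 * d * (# xs (A e) f * N S₂)                          ≡⟨ ℕₚ.*-assoc (4 * d) _ (N S₂) ⟨
          4 * d * # xs (A e) f * N S₂                            ≤⟨ ℕₚ.*-monoˡ-≤ (N S₂) (rare e oke) ⟩
          total xs * N S₂                                        ∎)
        halves : Dec (Any (λ e′ → ¬ ¬ Share e e′) S) → N S₂ ≤ 2 * N S
        halves (no none) = subst (λ S′ → N S′ ≤ 2 * N S)
          (sym (Lₚ.filter-all unshared (All.map (λ h → dne h) (Allₚ.¬Any⇒All¬ S none)))) (ℕₚ.m≤m+n (N S) _)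
        -- Now `S₂` is shorter than `S`, so the induction hypothesis applies to it: each of the at
        -- most `d` shared events has conditional probability at most 1/2d, and together they remove
        -- at most half of `Avoid S₂`.
        halves (yes some) = ℕₚ.+-cancelʳ-≤ (N S₂) (N S₂) (2 * N S) (begin
            N S₂ + N S₂             ≡⟨ cong (N S₂ +_) (ℕₚ.+-identityʳ (N S₂)) ⟨
            2 * N S₂                ≤⟨ ℕₚ.*-monoʳ-≤ 2 (#-union xs T (λ e′ g → A e′ g × Avoid S₂ g) split f) ⟩
            2 * (N S + s)           ≡⟨ ℕₚ.*-distribˡ-+ 2 (N S) s ⟩
            2 * N S + 2 * s         ≤⟨ ℕₚ.+-monoʳ-≤ (2 * N S) 2s≤ ⟩
            2 * N S + N S₂          ∎)
          where
          in-S : ∀ e′ → Dec (e′ ∈ S)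
          in-S e′ = em
          T = filter in-S (nb e)
          s = sumL T (λ e′ → # xs (λ g → A e′ g × Avoid S₂ g) f)
          okT : ∀ e′ → e′ ∈ T → Ok e′
          okT e′ i = All.lookup ok (proj₂ (∈-filter⁻ in-S {xs = nb e} i))
          split : ∀ g → Avoid S₂ g → Avoid S g ⊎ (∃[ e′ ] (e′ ∈ T × A e′ g × Avoid S₂ g))
          split g av with em {∃[ e′ ] (e′ ∈ S × A e′ g)}
          ... | no none = inj₁ (λ e′ i a → none (e′ , i , a))
          ... | yes (e′ , i , a) with em {Share e e′}
          ... | no ns = ⊥-elim (av e′ (∈-filter⁺ unshared i ns) a)
          ... | yes (y , y∈ , dy , dy′) =
                inj₂ (e′ , ∈-filter⁺ in-S (shared oke (All.lookup ok i) y∈ dy dy′) i , a , av)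
          2s≤ : 2 * s ≤ N S₂
          2s≤ = ℕₚ.*-cancelˡ-≤ d {{ℕ.>-nonZero 0<d}} (begin
            d * (2 * s)         ≡⟨ arith₂ d s ⟨
            2 * d * s           ≡⟨ sumL-* (2 * d) T _ ⟨
            sumL T (λ e′ → 2 * d * # xs (λ g → A e′ g × Avoid S₂ g) f)
              ≤⟨ sumL-≤ T (λ e′ i → ih S₂ e′ (ℕₚ.<-≤-trans (Lₚ.filter-notAll unshared S some) len) ok₂ (okT e′ i)) ⟩
            length T * N S₂     ≤⟨ ℕₚ.*-monoˡ-≤ (N S₂) (ℕₚ.≤-trans (Lₚ.length-filter in-S (nb e)) (nb-length e)) ⟩
            d * N S₂            ∎)

      conditional : ∀ b S e → length S ≤ b → All Ok S → Ok e →
                    2 * d * # xs (λ g → A e g × Avoid S g) f ≤ N S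
      conditional zero    = conditional-step zero (λ S e ())
      conditional (suc b) = conditional-step (suc b) (λ { S e (s≤s len) → conditional b S e len })

      -- If no assignment avoided `e ∷ S`, then `A e` would fill all of `Avoid S`, against its
      -- conditional probability of at most 1/2d ≤ 1/2.
      avoidable : ∀ S → All Ok S → 0 < N S
      avoidable [] [] = subst (0 <_) (sym (trans (E-cong xs (λ g → 𝟙-yes (λ e ())) f)
        (trans (E-const xs 1 f) (ℕₚ.*-identityʳ (total xs))))) 0<total
      avoidable (e ∷ S) (oke ∷ ok) = ℕₚ.≰⇒> λ N≤0 → ℕₚ.<-irrefl refl (begin-strict
          N S                                            <⟨ ℕₚ.m<m+n (N S) (avoidable S ok) ⟩
          N S + N S                                      ≡⟨ cong (N S +_) (ℕₚ.+-identityʳ (N S)) ⟨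
          2 * N S                                        ≤⟨ ℕₚ.*-monoʳ-≤ 2 (split N≤0) ⟩
          2 * # xs (λ g → A e g × Avoid S g) f           ≤⟨ ℕₚ.*-monoˡ-≤ _ (ℕₚ.*-monoʳ-≤ 2 0<d) ⟩
          2 * d * # xs (λ g → A e g × Avoid S g) f       ≤⟨ conditional (length S) S e ℕₚ.≤-refl ok oke ⟩
          N S                                            ∎)
        where
        open ℕₚ.≤-Reasoning
        split : N (e ∷ S) ≤ 0 → N S ≤ # xs (λ g → A e g × Avoid S g) f
        split N≤0 = begin
          N S ≤⟨ #-union xs (e ∷ []) (λ e′ g → A e′ g × Avoid S g) cases f ⟩
          N (e ∷ S) + (# xs (λ g → A e g × Avoid S g) f + 0) ≤⟨ ℕₚ.+-mono-≤ N≤0 (ℕₚ.≤-reflexive (ℕₚ.+-identityʳ _)) ⟩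
          # xs (λ g → A e g × Avoid S g) f ∎
          where
          cases : ∀ g → Avoid S g → Avoid (e ∷ S) g ⊎ (∃[ e′ ] (e′ ∈ e ∷ [] × A e′ g × Avoid S g))
          cases g av with em {A e g}
          ... | yes a = inj₂ (e , here refl , a , av)
          ... | no ¬a = inj₁ λ { e′ (here refl) → ¬a ; e′ (there i) → av e′ i }

      local-lemma : ∀ S → All Ok S → ∃[ g ] ((∀ e → e ∈ S → ¬ A e g) ×
                    (∀ y → y ∉ xs → g y ≡ f y) × (∀ y → y ∈ xs → g y < k))
      local-lemma S ok = let (g , p , out , inn) = E-pos xs (avoidable S ok) in g , 𝟙-pos p , out , inn

  -- Large deviations of the active weight

  module Tails {V : Set} (k-1 : ℕ) where
    k = suc k-1
    open Counting {V} k public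

    E-mono-on : ∀ xs {F G : (V → ℕ) → ℕ} {f} → (∀ g → (∀ y → y ∉ xs → g y ≡ f y) → F g ≤ G g) →
                E xs F f ≤ E xs G f
    E-mono-on [] h = h _ (λ y _ → refl)
    E-mono-on (x ∷ xs) {F} {G} {f} h = sumTo-mono k λ a → E-mono-on xs λ g ag →
      h g λ y n → trans (ag y (n ∘ there)) (≔-other f a λ { refl → n (here refl) })

    module Weighted (Δ : ℕ) (0<Δ : 0 < Δ) (e : V → ℕ) (e≤Δ : ∀ y → e y ≤ Δ) where

      gain : (V → ℕ) → V → ℕ
      gain f y = choose (em {f y ≡ 0}) (e y) 0

      weight : List V → (V → ℕ) → ℕ
      weight xs f = sumL xs (gain f)

      private
        -- The base of the exponential moment is B/b = 1 + 1/2Δ. A vertex of weight e, active with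
        -- probability 1/k, has moment 1 + ((B/b)^e - 1)/k, at most 1 + e/kΔ by `exponential`, hence
        -- at most (R/P)^e with R/P = 1 + 1/kΔ.
        b B P R : ℕ
        b = 2 * Δ
        B = suc (2 * Δ)
        P = k * Δ
        R = suc P

        -- An active vertex lowers the threshold from t to `t ∸ e`, which is truncated at 0; `s` is
        -- the amount min (t , e) by which it really falls.
        split-at : ∀ t e → ∃[ s ] (s ≤ e × (t ∸ e) + s ≡ t)
        split-at t e with ℕₚ.≤-total t e
        ... | inj₁ t≤e = t , t≤e , cong (_+ t) (ℕₚ.m≤n⇒m∸n≡0 t≤e)
        ... | inj₂ e≤t = e , ℕₚ.≤-refl , ℕₚ.m∸n+n≡m e≤t

        one-step : ∀ s e → s ≤ e → e ≤ Δ → (B ℕ.^ s + k-1 * b ℕ.^ s) * P ℕ.^ e ≤ k * b ℕ.^ s * R ℕ.^ e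
        one-step s e s≤e e≤Δ = ℕₚ.*-cancelˡ-≤ Δ {{ℕ.>-nonZero 0<Δ}} (begin
          Δ * ((B ℕ.^ s + k-1 * b ℕ.^ s) * P ℕ.^ e)     ≡⟨ arith₁ Δ (B ℕ.^ s) k-1 (b ℕ.^ s) (P ℕ.^ e) ⟩
          (Δ * B ℕ.^ s + k-1 * Δ * b ℕ.^ s) * P ℕ.^ e
            ≤⟨ ℕₚ.*-monoˡ-≤ (P ℕ.^ e) (ℕₚ.+-monoˡ-≤ _ (exponential Δ s (ℕₚ.≤-trans s≤e e≤Δ))) ⟩
          (b ℕ.^ s * (Δ + s) + k-1 * Δ * b ℕ.^ s) * P ℕ.^ e ≡⟨ arith₂ Δ s k-1 (b ℕ.^ s) (P ℕ.^ e) ⟩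
          b ℕ.^ s * ((P + s) * P ℕ.^ e)
            ≤⟨ ℕₚ.*-monoʳ-≤ (b ℕ.^ s) (ℕₚ.*-monoˡ-≤ (P ℕ.^ e) (ℕₚ.+-monoʳ-≤ P s≤e)) ⟩
          b ℕ.^ s * ((P + e) * P ℕ.^ e)                 ≤⟨ ℕₚ.*-monoʳ-≤ (b ℕ.^ s) (bernoulli P e) ⟩
          b ℕ.^ s * (P * R ℕ.^ e)                       ≡⟨ arith₃ Δ k (b ℕ.^ s) (R ℕ.^ e) ⟩
          Δ * (k * b ℕ.^ s * R ℕ.^ e)                   ∎)
          where
          open ℕₚ.≤-Reasoning
          arith₁ : ∀ Δ x k y p → Δ * ((x + k * y) * p) ≡ (Δ * x + k * Δ * y) * p
          arith₁ = solve-∀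
          arith₂ : ∀ Δ s k y p → (y * (Δ + s) + k * Δ * y) * p ≡ y * ((suc k * Δ + s) * p)
          arith₂ = solve-∀
          arith₃ : ∀ Δ k y r → y * (k * Δ * r) ≡ Δ * (k * y * r)
          arith₃ = solve-∀

      -- The exponential moment method, carried out with integers.
      moment : ∀ xs → Unique xs → ∀ t f →
               # xs (λ g → t ≤ weight xs g) f * B ℕ.^ t * P ℕ.^ sumL xs e
               ≤ b ℕ.^ t * total xs * R ℕ.^ sumL xs e
      moment [] _ zero    f = ℕₚ.≤-reflexive (cong (λ i → i * 1 * 1) (𝟙-yes {0 ≤ 0} z≤n))
      moment [] _ (suc t) f = ℕₚ.≤-trans
        (ℕₚ.≤-reflexive (cong (λ i → i * B ℕ.^ suc t * 1) (𝟙-no {suc t ≤ 0} λ ()))) z≤n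
      moment (x ∷ xs) (x∉ ∷ u) t f = begin
          # (x ∷ xs) (λ g → t ≤ weight (x ∷ xs) g) f * B ℕ.^ t * P ℕ.^ (e x + Ex)
            ≤⟨ ℕₚ.*-monoˡ-≤ (P ℕ.^ (e x + Ex)) (ℕₚ.*-monoˡ-≤ (B ℕ.^ t) first) ⟩
          (M₀ + sumTo k-1 M) * B ℕ.^ t * P ℕ.^ (e x + Ex)
            ≡⟨ cong₂ (λ p q → (M₀ + sumTo k-1 M) * p * q)
                 (trans (cong (B ℕ.^_) (sym t≡)) (ℕₚ.^-distribˡ-+-* B t′ s)) (ℕₚ.^-distribˡ-+-* P (e x) Ex) ⟩
          (M₀ + sumTo k-1 M) * (B ℕ.^ t′ * B ℕ.^ s) * (P ℕ.^ e x * P ℕ.^ Ex)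
            ≡⟨ arith₁ M₀ (sumTo k-1 M) (B ℕ.^ t′) (B ℕ.^ s) (P ℕ.^ e x) (P ℕ.^ Ex) ⟩
          (M₀ * B ℕ.^ t′ * P ℕ.^ Ex * B ℕ.^ s + sumTo k-1 M * (B ℕ.^ t′ * B ℕ.^ s) * P ℕ.^ Ex) * P ℕ.^ e x
            ≤⟨ ℕₚ.*-monoˡ-≤ (P ℕ.^ e x) (ℕₚ.+-mono-≤ (ℕₚ.*-monoˡ-≤ (B ℕ.^ s) (moment xs u t′ _)) others) ⟩
          (b ℕ.^ t′ * T * R ℕ.^ Ex * B ℕ.^ s + k-1 * (b ℕ.^ t′ * b ℕ.^ s * T * R ℕ.^ Ex)) * P ℕ.^ e x
            ≡⟨ arith₂ (b ℕ.^ t′) T (R ℕ.^ Ex) (B ℕ.^ s) k-1 (b ℕ.^ s) (P ℕ.^ e x) ⟩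
          b ℕ.^ t′ * T * R ℕ.^ Ex * ((B ℕ.^ s + k-1 * b ℕ.^ s) * P ℕ.^ e x)
            ≤⟨ ℕₚ.*-monoʳ-≤ (b ℕ.^ t′ * T * R ℕ.^ Ex) (one-step s (e x) s≤ (e≤Δ x)) ⟩
          b ℕ.^ t′ * T * R ℕ.^ Ex * (k * b ℕ.^ s * R ℕ.^ e x)
            ≡⟨ arith₃ (b ℕ.^ t′) T (R ℕ.^ Ex) k (b ℕ.^ s) (R ℕ.^ e x) ⟩
          b ℕ.^ t′ * b ℕ.^ s * (k * T) * (R ℕ.^ e x * R ℕ.^ Ex)
            ≡⟨ cong₂ (λ p q → p * (k * T) * q)
                 (trans (sym (ℕₚ.^-distribˡ-+-* b t′ s)) (cong (b ℕ.^_) t≡)) (sym (ℕₚ.^-distribˡ-+-* R (e x) Ex)) ⟩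
          b ℕ.^ t * (k * T) * R ℕ.^ (e x + Ex) ∎
        where
        open ℕₚ.≤-Reasoning
        Ex = sumL xs e
        T = total xs
        t′ = t ∸ e x
        s = proj₁ (split-at t (e x))
        s≤ = proj₁ (proj₂ (split-at t (e x)))
        t≡ : t′ + s ≡ t
        t≡ = proj₂ (proj₂ (split-at t (e x)))
        M₀ = # xs (λ g → t′ ≤ weight xs g) (f [ x ≔ 0 ])
        M : ℕ → ℕ
        M a = # xs (λ g → t ≤ weight xs g) (f [ x ≔ suc a ])
        x∉xs : x ∉ xs
        x∉xs i = All.lookup x∉ i refl
        gain-0 : ∀ g {a} → g x ≡ suc a → gain g x ≡ 0
        gain-0 g eq with em {g x ≡ 0}
        ... | yes z = ⊥-elim (ℕₚ.0≢1+n (trans (sym z) eq))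
        ... | no _  = refl
        gain-≤ : ∀ g → gain g x ≤ e x
        gain-≤ g with em {g x ≡ 0}
        ... | yes _ = ℕₚ.≤-refl
        ... | no _  = z≤n
        first : # (x ∷ xs) (λ g → t ≤ weight (x ∷ xs) g) f ≤ M₀ + sumTo k-1 M
        first = ℕₚ.≤-trans (ℕₚ.≤-reflexive (sumTo-first k-1 _)) (ℕₚ.+-mono-≤
          (E-mono xs (λ g → 𝟙-mono λ le → ℕₚ.m≤n+o⇒m∸n≤o t (e x) (ℕₚ.≤-trans le (ℕₚ.+-monoˡ-≤ _ (gain-≤ g)))) _)
          (sumTo-mono k-1 λ a → E-mono-on xs λ g ag → 𝟙-mono λ le →
            subst (λ i → t ≤ i + weight xs g) (gain-0 g (trans (ag x x∉xs) (≔-same f x (suc a)))) le))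
        others : sumTo k-1 M * (B ℕ.^ t′ * B ℕ.^ s) * P ℕ.^ Ex ≤ k-1 * (b ℕ.^ t′ * b ℕ.^ s * T * R ℕ.^ Ex)
        others = begin
          sumTo k-1 M * (B ℕ.^ t′ * B ℕ.^ s) * P ℕ.^ Ex
            ≡⟨ arith₄ (sumTo k-1 M) (B ℕ.^ t′ * B ℕ.^ s) (P ℕ.^ Ex) ⟩
          (B ℕ.^ t′ * B ℕ.^ s * P ℕ.^ Ex) * sumTo k-1 M   ≡⟨ sumTo-* k-1 (B ℕ.^ t′ * B ℕ.^ s * P ℕ.^ Ex) M ⟨
          sumTo k-1 (λ a → B ℕ.^ t′ * B ℕ.^ s * P ℕ.^ Ex * M a)
            ≤⟨ sumTo-mono k-1 (λ a → ℕₚ.≤-trans (ℕₚ.≤-reflexive (each a)) (ℕₚ.≤-trans (moment xs u t _) (ℕₚ.≤-reflexive each′))) ⟩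
          sumTo k-1 (λ _ → b ℕ.^ t′ * b ℕ.^ s * T * R ℕ.^ Ex) ≡⟨ sumTo-const k-1 _ ⟩
          k-1 * (b ℕ.^ t′ * b ℕ.^ s * T * R ℕ.^ Ex) ∎
          where
          arith₄ : ∀ m p q → m * p * q ≡ p * q * m
          arith₄ = solve-∀
          each : ∀ a → B ℕ.^ t′ * B ℕ.^ s * P ℕ.^ Ex * M a ≡ M a * B ℕ.^ t * P ℕ.^ Ex
          each a = trans (sym (arith₄ (M a) (B ℕ.^ t′ * B ℕ.^ s) (P ℕ.^ Ex)))
            (cong (λ p → M a * p * P ℕ.^ Ex) (trans (sym (ℕₚ.^-distribˡ-+-* B t′ s)) (cong (B ℕ.^_) t≡)))
          each′ : b ℕ.^ t * T * R ℕ.^ Ex ≡ b ℕ.^ t′ * b ℕ.^ s * T * R ℕ.^ Ex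
          each′ = cong (λ p → p * T * R ℕ.^ Ex) (trans (cong (b ℕ.^_) (sym t≡)) (ℕₚ.^-distribˡ-+-* b t′ s))
        arith₁ : ∀ m n p q r z → (m + n) * (p * q) * (r * z) ≡ (m * p * z * q + n * (p * q) * z) * r
        arith₁ = solve-∀
        arith₂ : ∀ p T r q k s z → (p * T * r * q + k * (p * s * T * r)) * z ≡ p * T * r * ((q + k * s) * z)
        arith₂ = solve-∀
        arith₃ : ∀ p T r k s z → p * T * r * (k * s * z) ≡ p * s * (k * T) * (z * r)
        arith₃ = solve-∀

    -- A vertex is active when its label is 0. The members of `U` are all inactive with probability
    -- ((k - 1)/k)^|U|, by independence.
    nonzero : ∀ (U : V → Set) xs → Unique xs → ∀ f →
              # xs (λ g → ∀ y → y ∈ xs → U y → g y ≢ 0) f * k ℕ.^ length (keep U xs)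
              ≤ k-1 ℕ.^ length (keep U xs) * total xs
    nonzero U [] _ f = ℕₚ.*-monoˡ-≤ 1 (ℕₚ.≤-trans (𝟙-mono {Q = ⊤} (λ _ → tt)) (ℕₚ.≤-reflexive (𝟙-yes tt)))
    nonzero U (x ∷ xs) (x∉ ∷ u) f with em {U x}
    ... | yes ux = begin
        # (x ∷ xs) Q f * (k * k ℕ.^ n)                     ≤⟨ ℕₚ.*-monoˡ-≤ (k * k ℕ.^ n) drop ⟩
        sumTo k-1 M * (k * k ℕ.^ n)                        ≡⟨ arith₁ (sumTo k-1 M) k (k ℕ.^ n) ⟩
        k * (k ℕ.^ n * sumTo k-1 M)                        ≡⟨ cong (k *_) (sumTo-* k-1 (k ℕ.^ n) M) ⟨
        k * sumTo k-1 (λ a → k ℕ.^ n * M a)                ≤⟨ ℕₚ.*-monoʳ-≤ k (sumTo-mono k-1 λ a → each (f [ x ≔ suc a ])) ⟩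
        k * sumTo k-1 (λ a → k-1 ℕ.^ n * total xs)         ≡⟨ cong (k *_) (sumTo-const k-1 _) ⟩
        k * (k-1 * (k-1 ℕ.^ n * total xs))                 ≡⟨ arith₂ k k-1 (k-1 ℕ.^ n) (total xs) ⟩
        k-1 * k-1 ℕ.^ n * (k * total xs)                   ∎
      where
      open ℕₚ.≤-Reasoning
      n = length (keep U xs)
      Q : (V → ℕ) → Set
      Q g = ∀ y → y ∈ x ∷ xs → U y → g y ≢ 0
      Q′ : (V → ℕ) → Set
      Q′ g = ∀ y → y ∈ xs → U y → g y ≢ 0
      M : ℕ → ℕ
      M a = # xs Q′ (f [ x ≔ suc a ])
      each : ∀ f → k ℕ.^ n * # xs Q′ f ≤ k-1 ℕ.^ n * total xs
      each f = ℕₚ.≤-trans (ℕₚ.≤-reflexive (ℕₚ.*-comm (k ℕ.^ n) (# xs Q′ f))) (nonzero U xs u f)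
      zero-part : # xs Q (f [ x ≔ 0 ]) ≤ 0
      zero-part = ℕₚ.≤-trans (E-mono-on xs {G = λ _ → 0} λ g ag → ℕₚ.≤-reflexive (𝟙-no λ q →
        q x (here refl) ux (trans (ag x (λ i → All.lookup x∉ i refl)) (≔-same f x 0))))
        (ℕₚ.≤-reflexive (trans (E-const xs 0 _) (ℕₚ.*-zeroʳ (total xs))))
      drop : # (x ∷ xs) Q f ≤ sumTo k-1 M
      drop = ℕₚ.≤-trans (ℕₚ.≤-reflexive (sumTo-first k-1 _)) (ℕₚ.+-mono-≤ zero-part
        (sumTo-mono k-1 λ a → #-mono xs (λ g q y i → q y (there i)) _))
      arith₁ : ∀ m k p → m * (k * p) ≡ k * (p * m)
      arith₁ = solve-∀
      arith₂ : ∀ k j p t → k * (j * (p * t)) ≡ j * p * (k * t)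
      arith₂ = solve-∀
    ... | no _ = begin
        # (x ∷ xs) Q f * k ℕ.^ n                       ≤⟨ ℕₚ.*-monoˡ-≤ (k ℕ.^ n) (sumTo-mono k λ a → #-mono xs (λ g q y i → q y (there i)) _) ⟩
        sumTo k M * k ℕ.^ n                            ≡⟨ ℕₚ.*-comm (sumTo k M) (k ℕ.^ n) ⟩
        k ℕ.^ n * sumTo k M                            ≡⟨ sumTo-* k (k ℕ.^ n) M ⟨
        sumTo k (λ a → k ℕ.^ n * M a)                  ≤⟨ sumTo-mono k (λ a → each (f [ x ≔ a ])) ⟩
        sumTo k (λ a → k-1 ℕ.^ n * total xs)           ≡⟨ sumTo-const k _ ⟩
        k * (k-1 ℕ.^ n * total xs)                     ≡⟨ arith k (k-1 ℕ.^ n) (total xs) ⟩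
        k-1 ℕ.^ n * (k * total xs)                     ∎
      where
      open ℕₚ.≤-Reasoning
      n = length (keep U xs)
      Q : (V → ℕ) → Set
      Q g = ∀ y → y ∈ x ∷ xs → U y → g y ≢ 0
      Q′ : (V → ℕ) → Set
      Q′ g = ∀ y → y ∈ xs → U y → g y ≢ 0
      M : ℕ → ℕ
      M a = # xs Q′ (f [ x ≔ a ])
      each : ∀ f → k ℕ.^ n * # xs Q′ f ≤ k-1 ℕ.^ n * total xs
      each f = ℕₚ.≤-trans (ℕₚ.≤-reflexive (ℕₚ.*-comm (k ℕ.^ n) (# xs Q′ f))) (nonzero U xs u f)
      arith : ∀ k p t → k * (p * t) ≡ p * (k * t)
      arith = solve-∀

    module TailBound (Δ : ℕ) (0<Δ : 0 < Δ) (e : V → ℕ) (e≤Δ : ∀ y → e y ≤ Δ) (k≡ : k ≡ 64 * Δ) where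
      open Weighted Δ 0<Δ e e≤Δ

      -- The expected weight is at most 4gΔ, a sixteenth of the threshold kg. In the moment bound,
      -- (1 + 1/2Δ)^(kg) ≥ 2^(32g) as kg = 2Δ * 32g, and (1 + 1/kΔ)^(4kgΔ) ≤ 2^(8g) as kΔ = 2 *
      -- 32Δ²; the quotient is the 2^(24g).
      tail : ∀ xs → Unique xs → ∀ g → sumL xs e ≤ 4 * (k * g) * Δ → ∀ f →
             # xs (λ c → k * g ≤ weight xs c) f * 2 ℕ.^ (24 * g) ≤ total xs
      tail xs u g few f = cancel (W * 2 ℕ.^ (24 * g)) T (2 ℕ.^ (8 * g) * (b ℕ.^ t * P ℕ.^ E′)) (begin
          W * 2 ℕ.^ (24 * g) * (2 ℕ.^ (8 * g) * (b ℕ.^ t * P ℕ.^ E′))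
            ≡⟨ arith₁ W (2 ℕ.^ (24 * g)) (2 ℕ.^ (8 * g)) (b ℕ.^ t) (P ℕ.^ E′) ⟩
          W * (2 ℕ.^ (24 * g) * 2 ℕ.^ (8 * g) * b ℕ.^ t) * P ℕ.^ E′
            ≡⟨ cong (λ i → W * (i * b ℕ.^ t) * P ℕ.^ E′)
                 (trans (sym (ℕₚ.^-distribˡ-+-* 2 (24 * g) (8 * g))) (cong (2 ℕ.^_) (arith₂ g))) ⟩
          W * (2 ℕ.^ (32 * g) * b ℕ.^ t) * P ℕ.^ E′
            ≤⟨ ℕₚ.*-monoˡ-≤ (P ℕ.^ E′) (ℕₚ.*-monoʳ-≤ W growth) ⟩
          W * suc b ℕ.^ t * P ℕ.^ E′
            ≡⟨ cong (λ i → W * suc b ℕ.^ t * P ℕ.^ i) (sym (ℕₚ.m+[n∸m]≡n few)) ⟩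
          W * suc b ℕ.^ t * P ℕ.^ (sumL xs e + rest)
            ≡⟨ cong (W * suc b ℕ.^ t *_) (ℕₚ.^-distribˡ-+-* P (sumL xs e) rest) ⟩
          W * suc b ℕ.^ t * (P ℕ.^ sumL xs e * P ℕ.^ rest)
            ≡⟨ ℕₚ.*-assoc (W * suc b ℕ.^ t) _ _ ⟨
          W * suc b ℕ.^ t * P ℕ.^ sumL xs e * P ℕ.^ rest
            ≤⟨ ℕₚ.*-monoˡ-≤ (P ℕ.^ rest) (moment xs u t f) ⟩
          b ℕ.^ t * T * suc P ℕ.^ sumL xs e * P ℕ.^ rest
            ≤⟨ ℕₚ.*-monoʳ-≤ (b ℕ.^ t * T * suc P ℕ.^ sumL xs e) (ℕₚ.^-monoˡ-≤ rest (ℕₚ.n≤1+n P)) ⟩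
          b ℕ.^ t * T * suc P ℕ.^ sumL xs e * suc P ℕ.^ rest
            ≡⟨ ℕₚ.*-assoc (b ℕ.^ t * T) _ _ ⟩
          b ℕ.^ t * T * (suc P ℕ.^ sumL xs e * suc P ℕ.^ rest)
            ≡⟨ cong (b ℕ.^ t * T *_) (trans (sym (ℕₚ.^-distribˡ-+-* (suc P) (sumL xs e) rest))
                 (cong (suc P ℕ.^_) (ℕₚ.m+[n∸m]≡n few))) ⟩
          b ℕ.^ t * T * suc P ℕ.^ E′
            ≤⟨ ℕₚ.*-monoʳ-≤ (b ℕ.^ t * T) decay ⟩
          b ℕ.^ t * T * (2 ℕ.^ (8 * g) * P ℕ.^ E′)
            ≡⟨ arith₃ (b ℕ.^ t) T (2 ℕ.^ (8 * g)) (P ℕ.^ E′) ⟩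
          T * (2 ℕ.^ (8 * g) * (b ℕ.^ t * P ℕ.^ E′)) ∎) (positive (8 * g))
        where
        open ℕₚ.≤-Reasoning
        t = k * g
        b = 2 * Δ
        P = k * Δ
        T = total xs
        W = # xs (λ c → k * g ≤ weight xs c) f
        E′ = 4 * (k * g) * Δ
        rest = E′ ∸ sumL xs e
        j = 32 * (Δ * Δ)
        0<b : 0 < b
        0<b = ℕₚ.*-mono-< {0} {2} {0} {Δ} (s≤s z≤n) 0<Δ
        0<P : 0 < P
        0<P = ℕₚ.*-mono-< {0} {k} {0} {Δ} (s≤s z≤n) 0<Δ
        0<j : 0 < j
        0<j = ℕₚ.*-mono-< {0} {32} (s≤s z≤n) (ℕₚ.*-mono-< 0<Δ 0<Δ)
        positive : ∀ n → 0 < 2 ℕ.^ n * (b ℕ.^ t * P ℕ.^ E′)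
        positive n = ℕₚ.*-mono-< (ℕₚ.m^n>0 2 n)
          (ℕₚ.*-mono-< (ℕₚ.m^n>0 b {{ℕ.>-nonZero 0<b}} t) (ℕₚ.m^n>0 P {{ℕ.>-nonZero 0<P}} E′))
        cancel : ∀ x y z → x * z ≤ y * z → 0 < z → x ≤ y
        cancel x y z le 0<z = ℕₚ.*-cancelʳ-≤ x y z {{ℕ.>-nonZero 0<z}} le
        arith₁ : ∀ w p q r s → w * p * (q * (r * s)) ≡ w * (p * q * r) * s
        arith₁ = solve-∀
        arith₂ : ∀ g → 24 * g + 8 * g ≡ 32 * g
        arith₂ = solve-∀
        arith₃ : ∀ b T p q → b * T * (p * q) ≡ T * (p * (b * q))
        arith₃ = solve-∀
        arith₄ : ∀ Δ g → 64 * Δ * g ≡ 2 * Δ * (32 * g)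
        arith₄ = solve-∀
        arith₅ : ∀ Δ g → 4 * (64 * Δ * g) * Δ ≡ 32 * (Δ * Δ) * (8 * g)
        arith₅ = solve-∀
        arith₆ : ∀ Δ → 64 * Δ * Δ ≡ 2 * (32 * (Δ * Δ))
        arith₆ = solve-∀
        t≡ : t ≡ b * (32 * g)
        t≡ = trans (cong (_* g) k≡) (arith₄ Δ g)
        E′≡ : E′ ≡ j * (8 * g)
        E′≡ = trans (cong (λ k → 4 * (k * g) * Δ) k≡) (arith₅ Δ g)
        P≡ : P ≡ 2 * j
        P≡ = trans (cong (_* Δ) k≡) (arith₆ Δ)
        growth : 2 ℕ.^ (32 * g) * b ℕ.^ t ≤ suc b ℕ.^ t
        growth = begin
          2 ℕ.^ (32 * g) * b ℕ.^ t                 ≡⟨ cong (λ i → 2 ℕ.^ (32 * g) * b ℕ.^ i) t≡ ⟩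
          2 ℕ.^ (32 * g) * b ℕ.^ (b * (32 * g))    ≡⟨ cong (2 ℕ.^ (32 * g) *_) (sym (ℕₚ.^-*-assoc b b (32 * g))) ⟩
          2 ℕ.^ (32 * g) * (b ℕ.^ b) ℕ.^ (32 * g)  ≡⟨ pow-* 2 (b ℕ.^ b) (32 * g) ⟨
          (2 * b ℕ.^ b) ℕ.^ (32 * g)               ≤⟨ ℕₚ.^-monoˡ-≤ (32 * g) (double-suc b 0<b) ⟩
          (suc b ℕ.^ b) ℕ.^ (32 * g)               ≡⟨ ℕₚ.^-*-assoc (suc b) b (32 * g) ⟩
          suc b ℕ.^ (b * (32 * g))                 ≡⟨ cong (suc b ℕ.^_) (sym t≡) ⟩
          suc b ℕ.^ t                              ∎
        decay : suc P ℕ.^ E′ ≤ 2 ℕ.^ (8 * g) * P ℕ.^ E′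
        decay = begin
          suc P ℕ.^ E′                             ≡⟨ cong (suc P ℕ.^_) E′≡ ⟩
          suc P ℕ.^ (j * (8 * g))                  ≡⟨ ℕₚ.^-*-assoc (suc P) j (8 * g) ⟨
          (suc P ℕ.^ j) ℕ.^ (8 * g)                ≤⟨ ℕₚ.^-monoˡ-≤ (8 * g)
               (subst (λ p → suc p ℕ.^ j ≤ 2 * p ℕ.^ j) (sym P≡) (double-half j 0<j)) ⟩
          (2 * P ℕ.^ j) ℕ.^ (8 * g)                ≡⟨ pow-* 2 (P ℕ.^ j) (8 * g) ⟩
          2 ℕ.^ (8 * g) * (P ℕ.^ j) ℕ.^ (8 * g)    ≡⟨ cong (2 ℕ.^ (8 * g) *_) (ℕₚ.^-*-assoc P j (8 * g)) ⟩
          2 ℕ.^ (8 * g) * P ℕ.^ (j * (8 * g))      ≡⟨ cong (λ i → 2 ℕ.^ (8 * g) * P ℕ.^ i) (sym E′≡) ⟩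
          2 ℕ.^ (8 * g) * P ℕ.^ E′                 ∎

  -- The distribution of a single label

  module Marginals {V : Set} (k : ℕ) where
    open Counting {V} k

    private
      sum-𝟙-none : ∀ l (R : ℕ → Set) → (∀ a → a < l → ¬ R a) → sumTo l (λ a → 𝟙 (R a)) ≡ 0
      sum-𝟙-none zero    R h = refl
      sum-𝟙-none (suc l) R h = cong₂ _+_ (sum-𝟙-none l R (λ a lt → h a (ℕₚ.m<n⇒m<1+n lt))) (𝟙-no (h l ℕₚ.≤-refl))

      sum-𝟙 : ∀ l (R : ℕ → Set) → (∀ {a b} → a < l → b < l → R a → R b → a ≡ b) → sumTo l (λ a → 𝟙 (R a)) ≤ 1
      sum-𝟙 zero    R h = z≤n
      sum-𝟙 (suc l) R h = go em
        where
        go : Dec (R l) → sumTo l (λ a → 𝟙 (R a)) + 𝟙 (R l) ≤ 1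
        go (yes r) = ℕₚ.≤-reflexive (cong₂ _+_ (sum-𝟙-none l R λ a lt ra →
          ℕₚ.<-irrefl (h (ℕₚ.m<n⇒m<1+n lt) ℕₚ.≤-refl ra r) lt) (𝟙-yes r))
        go (no nr) = ℕₚ.≤-trans (ℕₚ.≤-reflexive (trans (cong (sumTo l (λ a → 𝟙 (R a)) +_) (𝟙-no nr)) (ℕₚ.+-identityʳ _)))
          (sum-𝟙 l R (λ la lb → h (ℕₚ.m<n⇒m<1+n la) (ℕₚ.m<n⇒m<1+n lb)))

    single : ∀ xs {e} → Unique xs → e ∈ xs → ∀ (R : ℕ → Set) → (∀ {a b} → a < k → b < k → R a → R b → a ≡ b) →
             ∀ f → # xs (λ g → R (g e)) f * k ≤ total xs
    single (x ∷ xs) {e} (n ∷ u) (here refl) R h f = begin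
      # (x ∷ xs) (λ g → R (g x)) f * k
        ≤⟨ ℕₚ.*-monoˡ-≤ k (sumTo-mono k λ a → ℕₚ.≤-trans (ℕₚ.≤-reflexive
             (E-dep xs {D = λ y → y ≡ x} (λ h → 𝟙-⇔ (subst R (h x refl)) (subst R (sym (h x refl)))) (λ _ _ _ → refl)))
             (value a)) ⟩
      sumTo k (λ a → total xs * 𝟙 (R a)) * k      ≡⟨ cong (_* k) (sumTo-* k (total xs) (λ a → 𝟙 (R a))) ⟩
      total xs * sumTo k (λ a → 𝟙 (R a)) * k      ≤⟨ ℕₚ.*-monoˡ-≤ k (ℕₚ.*-monoʳ-≤ (total xs) (sum-𝟙 k R h)) ⟩
      total xs * 1 * k                            ≡⟨ trans (cong (_* k) (ℕₚ.*-identityʳ (total xs))) (ℕₚ.*-comm (total xs) k) ⟩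
      k * total xs                                ∎
      where
      open ℕₚ.≤-Reasoning
      irrelevant : ∀ ys {F : (V → ℕ) → ℕ} → F DependsOn (_≡ x) → x ∉ ys → ∀ f → E ys F f ≡ total ys * F f
      irrelevant []       d n f = sym (ℕₚ.*-identityˡ _)
      irrelevant (y ∷ ys) {F} d n f = trans (E-skip y ys d (λ { refl → n (here refl) }) f)
        (trans (cong (k *_) (irrelevant ys d (n ∘ there) f)) (sym (ℕₚ.*-assoc k (total ys) (F f))))
      value : ∀ a → # xs (λ g → R (g x)) (f [ x ≔ a ]) ≤ total xs * 𝟙 (R a)
      value a = ℕₚ.≤-reflexive (trans
        (irrelevant xs (λ h → 𝟙-⇔ (subst R (h x refl)) (subst R (sym (h x refl)))) (λ i → All.lookup n i refl) (f [ x ≔ a ]))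
        (cong (total xs *_) (𝟙-⇔ (subst R (≔-same f x a)) (subst R (sym (≔-same f x a))))))
    single (x ∷ xs) {e} (n ∷ u) (there i) R h f = begin
      # (x ∷ xs) (λ g → R (g e)) f * k                             ≡⟨ ℕₚ.*-comm _ k ⟩
      k * # (x ∷ xs) (λ g → R (g e)) f                             ≡⟨ sumTo-* k k _ ⟨
      sumTo k (λ a → k * # xs (λ g → R (g e)) (f [ x ≔ a ]))
        ≤⟨ sumTo-mono k (λ a → ℕₚ.≤-trans (ℕₚ.≤-reflexive (ℕₚ.*-comm k _)) (single xs u i R h (f [ x ≔ a ]))) ⟩
      sumTo k (λ _ → total xs)                                     ≡⟨ sumTo-const k (total xs) ⟩
      k * total xs                                                 ∎
      where open ℕₚ.≤-Reasoning

  -- Souslin schemes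

  module SouslinSets where

    -- All that the schemes use of a topology: a countable family of sets which covers the space and
    -- separates points by disjoint members.
    record Space : Set₁ where
      field
        Pt   : Set
        base : ℕ → Pred Pt 0ℓ
        some : ∀ x → ∃[ n ] base n x
        sep  : ∀ {x y} → x ≢ y →
               ∃[ m ] ∃[ n ] (base m x × base n y × (∀ {z} → base m z → ¬ base n z))

    open Space

    infixr 7 _⊗ˢ_
    _⊗ˢ_ : Space → Space → Space
    S ⊗ˢ T = record
      { Pt   = Pt S × Pt T
      ; base = λ v (x , y) → base S (proj₁ (unpair v)) x × base T (proj₂ (unpair v)) y
      ; some = λ (x , y) →
          let (m , p) = some S x
              (n , q) = some T y
          in pair m n , box m n p q
      ; sep  = λ {p} {q} → separate p q
      }
      where
      box : ∀ m n {x y} → base S m x → base T n y →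
            base S (proj₁ (unpair (pair m n))) x × base T (proj₂ (unpair (pair m n))) y
      box m n {x} {y} p q =
        subst (λ (i , j) → base S i x × base T j y) (sym (unpair-pair m n)) (p , q)
      unbox : ∀ m n {x y} → base S (proj₁ (unpair (pair m n))) x × base T (proj₂ (unpair (pair m n))) y →
              base S m x × base T n y
      unbox m n {x} {y} = subst (λ (i , j) → base S i x × base T j y) (unpair-pair m n)
      Base : ℕ → Pred (Pt S × Pt T) 0ℓ
      Base v (x , y) = base S (proj₁ (unpair v)) x × base T (proj₂ (unpair v)) y
      separate : ∀ p q → p ≢ q →
                 ∃[ m ] ∃[ n ] (Base m p × Base n q × (∀ {z} → Base m z → ¬ Base n z))
      separate (x , y) (x′ , y′) p≢q with em {x ≡ x′}
      ... | no x≢x′ =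
        let (m , n , bm , bn , dis) = sep S x≢x′
            (i , bi) = some T y
            (j , bj) = some T y′
        in pair m i , pair n j , box m i bm bi , box n j bn bj ,
           λ b b′ → dis (proj₁ (unbox m i b)) (proj₁ (unbox n j b′))
      ... | yes refl =
        let (m , n , bm , bn , dis) = sep T (λ { refl → p≢q refl })
            (i , bi) = some S x
        in pair i m , pair i n , box i m bi bm , box i n bi bn ,
           λ b b′ → dis (proj₂ (unbox i m b)) (proj₂ (unbox i n b′))

    infix 4 _≈[_]_
    _≈[_]_ : (ℕ → ℕ) → ℕ → (ℕ → ℕ) → Set
    b ≈[ n ] b′ = ∀ i → i < n → b i ≡ b′ i

    -- A Souslin scheme, given by its relation Code between the points of A and
    -- the branches through the scheme that lead to them.
    record Souslin (S : Space) (A : Pred (Pt S) 0ℓ) : Set₁ where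
      field
        Code     : Pt S → (ℕ → ℕ) → Set
        sound    : ∀ {z b} → Code z b → A z
        complete : ∀ {z} → A z → ∃[ b ] Code z b
        -- Completeness of the scheme. A branch all of whose prefixes occur leads to a point of `A`,
        -- to which the points with long common prefixes converge; the branch itself is not claimed
        -- to be a code of that point.
        limit    : ∀ b → (∀ n → ∃[ z ] ∃[ b′ ] (Code z b′ × b′ ≈[ n ] b)) →
                   ∃[ z ] (A z × (∀ v → base S v z →
                     ∃[ n ] (∀ {z′ b′} → Code z′ b′ → b′ ≈[ n ] b → base S v z′)))

    open Souslin

    Injective : ∀ {S A} → Souslin S A → Set
    Injective σ = ∀ {z b b′} → Code σ z b → Code σ z b′ → ∀ i → b i ≡ b′ i

    bound : (f : ℕ → ℕ) → ∀ n → ∃[ N ] (∀ i → i < n → f i < N)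
    bound f zero = 0 , λ i ()
    bound f (suc n) with bound f n
    ... | N , h = N + suc (f n) , λ i → go i
      where
      go : ∀ i → i < suc n → f i < N + suc (f n)
      go i (s≤s i≤n) with ℕₚ.m≤n⇒m<n∨m≡n i≤n
      ... | inj₁ i<n  = ℕₚ.<-≤-trans (h i i<n) (ℕₚ.m≤m+n N _)
      ... | inj₂ refl = ℕₚ.m≤n+m (suc (f n)) N

    private
      cons : ℕ → (ℕ → ℕ) → ℕ → ℕ
      cons k b zero    = k
      cons k b (suc n) = b n

    module _ {S : Space} where

      s-resp : ∀ {A B : Pred (Pt S) 0ℓ} → (∀ z → A z → B z) → (∀ z → B z → A z) →
               Souslin S A → Souslin S B
      s-resp f g σ = record
        { Code     = Code σ
        ; sound    = λ c → f _ (sound σ c)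
        ; complete = λ b → complete σ (g _ b)
        ; limit    = λ b r → let (z , a , h) = limit σ b r in z , f z a , h
        }

      -- A branch interleaves one branch for each `A k`. The limits in the various `A k` coincide:
      -- disjoint basic neighbourhoods of two of them would both contain the points coded along a
      -- long prefix.
      s-⋂ : ∀ {A : ℕ → Pred (Pt S) 0ℓ} → (∀ k → Souslin S (A k)) →
            Souslin S (λ z → ∀ k → A k z)
      s-⋂ {A} σ = record
        { Code     = Code∩
        ; sound    = λ (β , c , _) k → sound (σ k) (c k)
        ; complete = λ a →
            (λ j → let (k , n) = unpair j in proj₁ (complete (σ k) (a k)) n) ,
            (λ k → proj₁ (complete (σ k) (a k))) ,
            (λ k → proj₂ (complete (σ k) (a k))) , λ j → refl
        ; limit    = lim
        }
        where
        Code∩ : Pt S → (ℕ → ℕ) → Set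
        Code∩ z b = Σ (ℕ → ℕ → ℕ) λ β → ((∀ k → Code (σ k) z (β k)) ×
                            (∀ j → b j ≡ β (proj₁ (unpair j)) (proj₂ (unpair j))))
        module _ (b : ℕ → ℕ) where
          b[_] : ℕ → ℕ → ℕ
          b[ k ] n = b (pair k n)
          component : ∀ k n → ∃[ N ] (∀ {z b′} → Code∩ z b′ → b′ ≈[ N ] b →
                        ∃[ b″ ] (Code (σ k) z b″ × b″ ≈[ n ] b[ k ]))
          component k n =
            let (N , h) = bound (pair k) n
            in N , λ { {z} {b′} (β , c , e) ag → β k , c k , λ i i<n →
                 trans (trans (cong (λ (p : ℕ × ℕ) → β (proj₁ p) (proj₂ p)) (sym (unpair-pair k i)))
                              (sym (e (pair k i))))
                       (ag (pair k i) (h i i<n)) }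
          module _ (r : ∀ n → ∃[ z ] ∃[ b′ ] (Code∩ z b′ × b′ ≈[ n ] b)) where
            lim-k : ∀ k → ∃[ z ] (A k z × (∀ v → base S v z →
                      ∃[ n ] (∀ {z′ b′} → Code (σ k) z′ b′ → b′ ≈[ n ] b[ k ] → base S v z′)))
            lim-k k = limit (σ k) b[ k ] λ n →
              let (N , h) = component k n
                  (z , b′ , c , ag) = r N
              in z , h c ag
            near : ∀ k v → base S v (proj₁ (lim-k k)) →
                   ∃[ N ] (∀ {z b′} → Code∩ z b′ → b′ ≈[ N ] b → base S v z)
            near k v bv =
              let (n , g) = proj₂ (proj₂ (lim-k k)) v bv
                  (N , h) = component k n
              in N , λ c ag → let (b″ , c″ , ag″) = h c ag in g c″ ag″
            same : ∀ k → proj₁ (lim-k k) ≡ proj₁ (lim-k 0)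
            same k = dne λ ne →
              let (v , w , bv , bw , dis) = sep S ne
                  (N , h)   = near k v bv
                  (N′ , h′) = near 0 w bw
                  (z , b′ , c , ag) = r (N + N′)
              in dis (h c (λ i i< → ag i (ℕₚ.<-≤-trans i< (ℕₚ.m≤m+n N N′))))
                     (h′ c (λ i i< → ag i (ℕₚ.<-≤-trans i< (ℕₚ.m≤n+m N′ N))))
            lim : ∃[ z ] ((∀ k → A k z) × (∀ v → base S v z →
                    ∃[ n ] (∀ {z′ b′} → Code∩ z′ b′ → b′ ≈[ n ] b → base S v z′)))
            lim = proj₁ (lim-k 0) , (λ k → subst (A k) (same k) (proj₁ (proj₂ (lim-k k)))) , near 0

      s-⋂-inj : ∀ {A : ℕ → Pred (Pt S) 0ℓ} (σ : ∀ k → Souslin S (A k)) →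
                (∀ k → Injective (σ k)) → Injective (s-⋂ σ)
      s-⋂-inj σ inj (β , c , e) (β′ , c′ , e′) j =
        trans (e j) (trans (inj _ (c _) (c′ _) _) (sym (e′ j)))

      -- The first digit names the member of the union. Codes therefore stay unique only if the
      -- members are disjoint, as `s-⋃-inj` demands.
      s-⋃ : ∀ {A : ℕ → Pred (Pt S) 0ℓ} → (∀ k → Souslin S (A k)) →
            Souslin S (λ z → ∃[ k ] A k z)
      s-⋃ {A} σ = record
        { Code     = Code∪
        ; sound    = λ {z} {b} c → b 0 , sound (σ (b 0)) c
        ; complete = λ (k , a) → let (b , c) = complete (σ k) a in cons k b , c
        ; limit    = λ b r →
            let (z , a , h) = limit (σ (b 0)) (b ∘ suc) λ n →
                  let (z , b′ , c , ag) = r (suc n)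
                  in z , shift b c ag
            in z , (b 0 , a) , λ v bv →
                 let (n , g) = h v bv
                 in suc n , λ c ag → let (b″ , c″ , ag″) = shift b c ag in g c″ ag″
        }
        where
        Code∪ : Pt S → (ℕ → ℕ) → Set
        Code∪ z b = Code (σ (b 0)) z (b ∘ suc)
        shift : ∀ b {n z b′} → Code∪ z b′ → b′ ≈[ suc n ] b →
                ∃[ b″ ] (Code (σ (b 0)) z b″ × b″ ≈[ n ] (b ∘ suc))
        shift b {z = z} {b′} c ag =
          b′ ∘ suc , subst (λ k → Code (σ k) z (b′ ∘ suc)) (ag 0 (s≤s z≤n)) c ,
          λ i i<n → ag (suc i) (s≤s i<n)

      s-⋃-inj : ∀ {A : ℕ → Pred (Pt S) 0ℓ} (σ : ∀ k → Souslin S (A k)) →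
                (∀ k → Injective (σ k)) → (∀ {i j z} → A i z → A j z → i ≡ j) →
                Injective (s-⋃ σ)
      s-⋃-inj σ inj dis {z} {b} {b′} c c′ zero    = dis (sound (σ (b 0)) c) (sound (σ (b′ 0)) c′)
      s-⋃-inj σ inj dis {z} {b} {b′} c c′ (suc i) =
        inj (b 0) c (subst (λ k → Code (σ k) z (b′ ∘ suc)) (sym (s-⋃-inj σ inj dis {z} {b} {b′} c c′ zero)) c′) i

      s-∩ : ∀ {A B : Pred (Pt S) 0ℓ} → Souslin S A → Souslin S B → Souslin S (λ z → A z × B z)
      s-∩ {A} {B} σ τ = s-resp (λ z h → h 0 , h 1) (λ { z (a , b) zero → a ; z (a , b) (suc _) → b })
        (s-⋂ {A = C} λ { zero → σ ; (suc _) → τ })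
        where
        C : ℕ → Pred (Pt S) 0ℓ
        C zero    = A
        C (suc _) = B

      s-∪ : ∀ {A B : Pred (Pt S) 0ℓ} → Souslin S A → Souslin S B → Souslin S (λ z → A z ⊎ B z)
      s-∪ {A} {B} σ τ = s-resp
        (λ { z (zero , a) → inj₁ a ; z (suc _ , b) → inj₂ b })
        (λ { z (inj₁ a) → 0 , a ; z (inj₂ b) → 1 , b })
        (s-⋃ {A = C} λ { zero → σ ; (suc _) → τ })
        where
        C : ℕ → Pred (Pt S) 0ℓ
        C zero    = A
        C (suc _) = B

      s-∃ : {I : Set} {{_ : Enumerable I}} {A : I → Pred (Pt S) 0ℓ} →
            (∀ i → Souslin S (A i)) → Souslin S (λ z → ∃[ i ] A i z)
      s-∃ {A = A} σ = s-resp (λ z (n , a) → enum n , a)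
        (λ z (i , a) → let (n , e) = onto i in n , subst (λ i → A i z) (sym e) a)
        (s-⋃ (λ n → σ (enum n)))

    record BorelSpace : Set₂ where
      field
        𝓜         : MeasurableSpace
      open MeasurableSpace 𝓜 public using (Carrier; Measurable)
      field
        basic     : ℕ → Pred Carrier 0ℓ
        basic-m   : ∀ n → Measurable (basic n)
        covered   : ∀ x → ∃[ n ] basic n x
        separated : ∀ {x y} → x ≢ y →
                 ∃[ m ] ∃[ n ] (basic m x × basic n y × (∀ {z} → basic m z → ¬ basic n z))

      space : Space
      space = record { Pt = Carrier ; base = basic ; some = covered ; sep = separated }

      open Meas 𝓜 public

    open BorelSpace using (𝓜; Carrier; Measurable; space)

    MeasurableDigits : (B : BorelSpace) → ∀ {A} → Souslin (space B) A → Set₁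
    MeasurableDigits B σ = ∀ i j → Measurable B (λ z → ∃[ b ] (Code σ z b × b i ≡ j))

    -- Each point has one code, and the digits are Borel functions of the point. The points with a
    -- given prefix then form a Borel set (`prefix-m`), on which the projection theorem is based.
    record GoodScheme (B : BorelSpace) (A : Pred (Carrier B) 0ℓ) : Set₁ where
      field
        scheme : Souslin (space B) A
        inj    : Injective scheme
        digits : MeasurableDigits B scheme

    open GoodScheme

    module _ {B : BorelSpace} where
      open BorelSpace B hiding (𝓜; Carrier; Measurable; space)

      g-meas : ∀ {A} → GoodScheme B A → Measurable B A
      g-meas γ = m-iff (λ z (j , b , c , _) → sound (scheme γ) c)
        (λ z a → let (b , c) = complete (scheme γ) a in b 0 , b , c , refl)
        (m-∃ (digits γ 0))

      prefix-m : ∀ {A} (γ : GoodScheme B A) → ∀ b n →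
                 Measurable B (λ z → ∃[ b′ ] (Code (scheme γ) z b′ × b′ ≈[ n ] b))
      prefix-m γ b n = m-iff
        (λ z (a , h) →
          let (b′ , c) = complete (scheme γ) a
          in b′ , c , λ i i<n →
             let (b″ , c″ , e) = h i i<n in trans (inj γ c c″ i) e)
        (λ z (b′ , c , h) → sound (scheme γ) c , λ i i<n → b′ , c , h i i<n)
        (m-× (g-meas γ) (m-∀ λ i → m-→ (m-const _) (digits γ i (b i))))

      g-resp : ∀ {A A′} → (∀ z → A z → A′ z) → (∀ z → A′ z → A z) → GoodScheme B A → GoodScheme B A′
      g-resp f g γ = record
        { scheme = s-resp f g (scheme γ) ; inj = inj γ ; digits = digits γ }

      g-⋂ : ∀ {A : ℕ → Pred (Carrier B) 0ℓ} → (∀ k → GoodScheme B (A k)) →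
            GoodScheme B (λ z → ∀ k → A k z)
      g-⋂ {A} γ = record
        { scheme = ∩
        ; inj    = s-⋂-inj (λ k → scheme (γ k)) (λ k → inj (γ k))
        ; digits = λ i j → m-iff
            (λ z (a , b , c , e) →
              let (b′ , c′) = complete ∩ a
                  (β , d , f) = c′
              in b′ , c′ , trans (f i) (trans (inj (γ _) (d _) c _) e))
            (λ z (b , (β , c , f) , e) → sound ∩ (β , c , f) , β _ , c _ , trans (sym (f i)) e)
            (m-× (m-∀ (λ k → g-meas (γ k))) (digits (γ (proj₁ (unpair i))) (proj₂ (unpair i)) j))
        }
        where
        ∩ : Souslin (space B) (λ z → ∀ k → A k z)
        ∩ = s-⋂ (λ k → scheme (γ k))

      g-⋃ : ∀ {A : ℕ → Pred (Carrier B) 0ℓ} → (∀ k → GoodScheme B (A k)) →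
            (∀ {i j z} → A i z → A j z → i ≡ j) → GoodScheme B (λ z → ∃[ k ] A k z)
      g-⋃ {A} γ dis = record
        { scheme = ∪
        ; inj    = s-⋃-inj (λ k → scheme (γ k)) (λ k → inj (γ k)) dis
        ; digits = dig
        }
        where
        ∪ : Souslin (space B) (λ z → ∃[ k ] A k z)
        ∪ = s-⋃ (λ k → scheme (γ k))
        dig : ∀ i j → Measurable B (λ z → ∃[ b ] (Code ∪ z b × b i ≡ j))
        dig zero j = m-iff
          (λ z a → let (b , c) = complete ∪ (j , a) in b , c , dis (sound (scheme (γ (b 0))) c) a)
          (λ { z (b , c , refl) → sound (scheme (γ (b 0))) c })
          (g-meas (γ j))
        dig (suc i) j = m-iff
          (λ z (k , b , c , e) → cons k b , c , e)
          (λ z (b , c , e) → b 0 , b ∘ suc , c , e)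
          (m-∃ (λ k → digits (γ k) i j))

    record BiSouslin (B : BorelSpace) (A : Pred (Carrier B) 0ℓ) : Set₁ where
      constructor bi
      field
        pos : GoodScheme B A
        neg : GoodScheme B (λ z → ¬ A z)

    open BiSouslin

    module _ {B : BorelSpace} where

      bi-resp : ∀ {A A′ : Pred (Carrier B) 0ℓ} → (∀ z → A z → A′ z) → (∀ z → A′ z → A z) →
                BiSouslin B A → BiSouslin B A′
      bi-resp f g β = bi (g-resp f g (pos β))
        (g-resp (λ z na b → na (g z b)) (λ z nb a → nb (f z a)) (neg β))

      bi-¬ : ∀ {A : Pred (Carrier B) 0ℓ} → BiSouslin B A → BiSouslin B (λ z → ¬ A z)
      bi-¬ β = bi (neg β) (g-resp (λ z a na → na a) (λ z → dne) (pos β))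

      -- To keep codes unique, the union is made disjoint by means of the least `n` with `A n`. The
      -- complements of the earlier sets are available as `neg`, which is why a scheme and one for
      -- the complement are built together.
      bi-⋃ : ∀ {A : ℕ → Pred (Carrier B) 0ℓ} → (∀ n → BiSouslin B (A n)) →
             BiSouslin B (λ z → ∃[ n ] A n z)
      bi-⋃ {A} β = bi
        (g-resp
          (λ z (n , h) → n , h 0)
          (λ z (n , a) →
            let (m , am , l) = least (λ n → A n z) a
            in m , λ { zero → am ; (suc j) → in-pick z m j am (l j) (j ℕₚ.<? m) })
          (g-⋃ (λ n → g-⋂ (first n))
            (λ {i} {j} {z} h h′ → least-unique (λ n → A n z)
              (h 0) (λ k k<i → out-pick z i k k<i (k ℕₚ.<? i) (h (suc k)))
              (h′ 0) (λ k k<j → out-pick z j k k<j (k ℕₚ.<? j) (h′ (suc k))))))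
        (g-resp (λ z h (n , a) → h n a) (λ z h n a → h (n , a)) (g-⋂ (λ n → neg (β n))))
        where
        -- For m ≥ n there is nothing to exclude, and `A n` is repeated so that the intersection
        -- runs over all of ℕ.
        pick : ∀ n m → Dec (m < n) → Pred (Carrier B) 0ℓ
        pick n m (yes _) z = ¬ A m z
        pick n m (no _)  z = A n z
        in-pick : ∀ z n m → A n z → (m < n → ¬ A m z) → ∀ d → pick n m d z
        in-pick z n m a l (yes m<n) = l m<n
        in-pick z n m a l (no _)    = a
        out-pick : ∀ z n m → m < n → ∀ d → pick n m d z → ¬ A m z
        out-pick z n m m<n (yes _)  h = h
        out-pick z n m m<n (no m≮n) h = λ _ → m≮n m<n
        First : ℕ → ℕ → Pred (Carrier B) 0ℓ
        First n zero    = A n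
        First n (suc m) = pick n m (m ℕₚ.<? n)
        first : ∀ n m → GoodScheme B (First n m)
        first n zero = pos (β n)
        first n (suc m) with m ℕₚ.<? n
        ... | yes _ = neg (β m)
        ... | no  _ = pos (β n)

      bi-∩ : ∀ {A A′ : Pred (Carrier B) 0ℓ} → BiSouslin B A → BiSouslin B A′ →
             BiSouslin B (λ z → A z × A′ z)
      bi-∩ {A} {A′} α β = bi-resp
        (λ z h → dne (λ na → h (0 , na)) , dne (λ nb → h (1 , nb)))
        (λ { z (a , b) (zero , na) → na a ; z (a , b) (suc _ , nb) → nb b })
        (bi-¬ (bi-⋃ {A = C} λ { zero → bi-¬ α ; (suc _) → bi-¬ β }))
        where
        C : ℕ → Pred (Carrier B) 0ℓ
        C zero    z = ¬ A z
        C (suc _) z = ¬ A′ z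

    private
      side : (ℕ → ℕ) → (ℕ → ℕ) → ℕ × ℕ → ℕ
      side β γ (zero  , n) = β n
      side β γ (suc _ , n) = γ n

    module _ {S T : Space} where

      s-⊗ : ∀ {A : Pred (Pt S) 0ℓ} {B : Pred (Pt T) 0ℓ} → Souslin S A → Souslin T B →
            Souslin (S ⊗ˢ T) (λ (x , y) → A x × B y)
      s-⊗ {A} {B} σ τ = record
        { Code     = Code⊗
        ; sound    = λ (β , γ , c , d , _) → sound σ c , sound τ d
        ; complete = λ (a , b) →
            let (β , c) = complete σ a
                (γ , d) = complete τ b
            in (λ j → side β γ (unpair j)) , β , γ , c , d , λ j → refl
        ; limit    = lim
        }
        where
        Code⊗ : Pt S × Pt T → (ℕ → ℕ) → Set
        Code⊗ (x , y) b = ∃[ β ] ∃[ γ ] (Code σ x β × Code τ y γ × (∀ j → b j ≡ side β γ (unpair j)))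
        lim : ∀ b → (∀ n → ∃[ z ] ∃[ b′ ] (Code⊗ z b′ × b′ ≈[ n ] b)) →
              ∃[ (x , y) ] ((A x × B y) × (∀ v → base (S ⊗ˢ T) v (x , y) →
                ∃[ n ] (∀ {z′ b′} → Code⊗ z′ b′ → b′ ≈[ n ] b → base (S ⊗ˢ T) v z′)))
        lim b r =
          let (x , a , h) = limit σ b₀ λ n →
                let (N , g) = cut 0 n
                    ((x , y) , b′ , (β , γ , c , d , e) , ag) = r N
                in x , β , c , λ i i<n →
                   trans (sym (trans (e (pair 0 i)) (cong (side β γ) (unpair-pair 0 i)))) (ag _ (g i i<n))
              (y , a′ , h′) = limit τ b₁ λ n →
                let (N , g) = cut 1 n
                    ((x , y) , b′ , (β , γ , c , d , e) , ag) = r N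
                in y , γ , d , λ i i<n →
                   trans (sym (trans (e (pair 1 i)) (cong (side β γ) (unpair-pair 1 i)))) (ag _ (g i i<n))
          in (x , y) , (a , a′) , λ v (bx , by) →
             let (n , g)   = h _ bx
                 (n′ , g′) = h′ _ by
                 (N , k)   = cut 0 n
                 (N′ , k′) = cut 1 n′
             in N + N′ , λ { {x′ , y′} {b′} (β , γ , c , d , e) ag →
                  g c (λ i i<n → trans (sym (trans (e (pair 0 i)) (cong (side β γ) (unpair-pair 0 i))))
                                       (ag _ (ℕₚ.<-≤-trans (k i i<n) (ℕₚ.m≤m+n N N′)))) ,
                  g′ d (λ i i<n → trans (sym (trans (e (pair 1 i)) (cong (side β γ) (unpair-pair 1 i))))
                                       (ag _ (ℕₚ.<-≤-trans (k′ i i<n) (ℕₚ.m≤n+m N′ N)))) }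
          where
          b₀ b₁ : ℕ → ℕ
          b₀ n = b (pair 0 n)
          b₁ n = b (pair 1 n)
          cut : ∀ k n → ∃[ N ] (∀ i → i < n → pair k i < N)
          cut k = bound (pair k)

      s-⊗-inj : ∀ {A : Pred (Pt S) 0ℓ} {B : Pred (Pt T) 0ℓ} (σ : Souslin S A) (τ : Souslin T B) →
                Injective σ → Injective τ → Injective (s-⊗ σ τ)
      s-⊗-inj σ τ i i′ (β , γ , c , d , e) (β′ , γ′ , c′ , d′ , e′) j =
        trans (e j) (trans (eq (unpair j)) (sym (e′ j)))
        where
        eq : ∀ p → side β γ p ≡ side β′ γ′ p
        eq (zero  , n) = i c c′ n
        eq (suc _ , n) = i′ d d′ n

      -- The scheme stays and the second coordinate is forgotten. A point may now have many codes,
      -- so there is no counterpart for `GoodScheme`.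
      s-proj : ∀ {P : Pred (Pt S × Pt T) 0ℓ} → Souslin (S ⊗ˢ T) P →
               Souslin S (λ x → ∃[ y ] P (x , y))
      s-proj {P} σ = record
        { Code     = λ x b → ∃[ y ] Code σ (x , y) b
        ; sound    = λ (y , c) → y , sound σ c
        ; complete = λ (y , p) → let (b , c) = complete σ p in b , y , c
        ; limit    = λ b r →
            let ((x , y) , p , h) = limit σ b λ n →
                  let (x , b′ , (y , c) , ag) = r n in (x , y) , b′ , c , ag
                (w , bw) = some T y
            in x , (y , p) , λ v bv →
               let (n , g) = h (pair v w)
                     (subst (λ (i , j) → base S i x × base T j y) (sym (unpair-pair v w)) (bv , bw))
               in n , λ {x′} (y′ , c) ag → proj₁
                    (subst (λ (i , j) → base S i x′ × base T j y′) (unpair-pair v w) (g c ag))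
        }

    module _ (B C : BorelSpace) where
      private
        module B = BorelSpace B
        module C = BorelSpace C
        𝓜⊗ : MeasurableSpace
        𝓜⊗ = B.𝓜 ⊗ C.𝓜
        module M⊗ = Meas 𝓜⊗
        module S⊗ = Space (B.space ⊗ˢ C.space)

      rectangle-m : ∀ {A A′} → B.Measurable A → C.Measurable A′ →
                    MeasurableSpace.Measurable 𝓜⊗ (λ (x , y) → A x × A′ y)
      rectangle-m a a′ = Generated.base (_ , _ , a , a′ , (id , id))

      infixr 7 _⊗ᴮ_
      _⊗ᴮ_ : BorelSpace
      _⊗ᴮ_ = record
        { 𝓜         = 𝓜⊗
        ; basic     = S⊗.base
        ; basic-m   = λ n → rectangle-m (B.basic-m _) (C.basic-m _)
        ; covered   = S⊗.some
        ; separated = S⊗.sep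
        }

      g-⊗ : ∀ {A A′} → GoodScheme B A → GoodScheme C A′ → GoodScheme _⊗ᴮ_ (λ (x , y) → A x × A′ y)
      g-⊗ {A} {A′} γ δ = record
        { scheme = prod
        ; inj    = s-⊗-inj (scheme γ) (scheme δ) (inj γ) (inj δ)
        ; digits = λ i j → dig i j (unpair i) refl
        }
        where
        prod : Souslin (B.space ⊗ˢ C.space) (λ (x , y) → A x × A′ y)
        prod = s-⊗ (scheme γ) (scheme δ)
        dig : ∀ i j p → unpair i ≡ p → Measurable _⊗ᴮ_ (λ z → ∃[ b ] (Code prod z b × b i ≡ j))
        dig i j (zero , n) eq = M⊗.m-iff
          (λ { (x , y) ((b , c , e) , a′) →
            let (b′ , c′) = complete (scheme δ) a′
            in (λ i → side b b′ (unpair i)) , (b , b′ , c , c′ , λ _ → refl) ,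
               trans (cong (side b b′) eq) e })
          (λ { (x , y) (b , (β , β′ , c , c′ , f) , e) →
            (β , c , trans (sym (trans (f i) (cong (side β β′) eq))) e) , sound (scheme δ) c′ })
          (rectangle-m (digits γ n j) (g-meas δ))
        dig i j (suc k , n) eq = M⊗.m-iff
          (λ { (x , y) (a , (b′ , c′ , e)) →
            let (b , c) = complete (scheme γ) a
            in (λ i → side b b′ (unpair i)) , (b , b′ , c , c′ , λ _ → refl) ,
               trans (cong (side b b′) eq) e })
          (λ { (x , y) (b , (β , β′ , c , c′ , f) , e) →
            sound (scheme γ) c , (β′ , c′ , trans (sym (trans (f i) (cong (side β β′) eq))) e) })
          (rectangle-m (g-meas γ) (digits δ n j))

      bi-⊗ : (∀ {A} → B.Measurable A → BiSouslin B A) → (∀ {A} → C.Measurable A → BiSouslin C A) →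
             ∀ {P} → Measurable _⊗ᴮ_ P → BiSouslin _⊗ᴮ_ P
      bi-⊗ β γ (Generated.base (A , A′ , a , a′ , (f , g))) =
        bi-resp (λ z → g) (λ z → f) (bi-∩ left right)
        where
        left : BiSouslin _⊗ᴮ_ (λ (x , y) → A x)
        left = bi (g-resp (λ z → proj₁) (λ z a → a , tt) (g-⊗ (pos (β a)) (pos (γ (C.m-const ⊤)))))
                  (g-resp (λ z → proj₁) (λ z a → a , tt) (g-⊗ (neg (β a)) (pos (γ (C.m-const ⊤)))))
        right : BiSouslin _⊗ᴮ_ (λ (x , y) → A′ y)
        right = bi (g-resp (λ z → proj₂) (λ z a → tt , a) (g-⊗ (pos (β (B.m-const ⊤))) (pos (γ a′))))
                   (g-resp (λ z → proj₂) (λ z a → tt , a) (g-⊗ (pos (β (B.m-const ⊤))) (neg (γ a′))))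
      bi-⊗ β γ (Generated.respects (f , g) m) = bi-resp (λ z → f) (λ z → g) (bi-⊗ β γ m)
      bi-⊗ β γ Generated.empty =
        bi-resp (λ { z (() , _) }) (λ z ()) (bi-⊗ β γ (Generated.base
          (∅ , ∅ , B.m-const ⊥ , C.m-const ⊥ , (id , id))))
      bi-⊗ β γ (Generated.complement m) = bi-¬ (bi-⊗ β γ m)
      bi-⊗ β γ (Generated.union m) = bi-⋃ (λ n → bi-⊗ β γ (m n))

  -- Separation by Borel sets

  module Separation where
    open SouslinSets
    open Souslin
    open GoodScheme
    open BiSouslin

    -- Separability is a statement about the existence of predicates and lives one level up, hence
    -- the second instance of excluded middle.
    ¬∀⇒∃¬₁ : {A : Set} {P : A → Set₁} → ¬ (∀ a → P a) → ∃[ a ] ¬ P a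
    ¬∀⇒∃¬₁ {A} {P} h with em₁ {∃[ a ] ¬ P a}
    ... | yes p = p
    ... | no k  = ⊥-elim (h λ a → dne₁ a (em₁ {P a}))
      where
      dne₁ : ∀ a → Dec (P a) → P a
      dne₁ a (yes p) = p
      dne₁ a (no ¬p) = ⊥-elim (k (a , ¬p))

    private
      set : (ℕ → ℕ) → ℕ → ℕ → ℕ → ℕ
      set b t j i with i ℕₚ.≟ t
      ... | yes _ = j
      ... | no  _ = b i

      set-= : ∀ b t j → set b t j t ≡ j
      set-= b t j with t ℕₚ.≟ t
      ... | yes _ = refl
      ... | no ne = ⊥-elim (ne refl)

      set-≢ : ∀ b t j {i} → i ≢ t → set b t j i ≡ b i
      set-≢ b t j {i} i≢t with i ℕₚ.≟ t
      ... | yes e = ⊥-elim (i≢t e)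
      ... | no  _ = refl

      set-< : ∀ b t j {i} → i < t → set b t j i ≡ b i
      set-< b t j i<t = set-≢ b t j (ℕₚ.<⇒≢ i<t)

      -- Dependent choices: step t sets the digit t and no later step changes it.
      branch : ∀ {ℓ} (P : (ℕ → ℕ) → ℕ → Set ℓ) → P (λ _ → 0) 0 →
               (∀ b t → P b t → ∃[ j ] P (set b t j) (suc t)) →
               ∃[ b ] (∀ t → ∃[ b′ ] (P b′ t × b′ ≈[ t ] b))
      branch P p₀ step = b , λ t → proj₁ (f t) , proj₂ (f t) , agree t
        where
        f : ∀ t → ∃[ b ] P b t
        f zero    = (λ _ → 0) , p₀
        f (suc t) = set (proj₁ (f t)) t (proj₁ (step _ t (proj₂ (f t)))) ,
                    proj₂ (step _ t (proj₂ (f t)))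
        b : ℕ → ℕ
        b t = proj₁ (f (suc t)) t
        agree : ∀ t → proj₁ (f t) ≈[ t ] b
        agree (suc t) i (s≤s i≤t) with ℕₚ.m≤n⇒m<n∨m≡n i≤t
        ... | inj₁ i<t  = trans (set-< (proj₁ (f t)) t _ i<t) (agree t i i<t)
        ... | inj₂ refl = refl

    module _ (B : BorelSpace) where
      open BorelSpace B

      Separable : (ℕ → Pred Carrier 0ℓ) → Set₁
      Separable A = Σ (ℕ → Pred Carrier 0ℓ) λ D →
        (∀ k → Measurable (D k)) × (∀ k {z} → A k z → D k z) × (∀ {z} → ¬ (∀ k → D k z))

      private
        sep-mono : ∀ {A A′ : ℕ → Pred Carrier 0ℓ} → (∀ k {z} → A k z → A′ k z) →
                   Separable A′ → Separable A
        sep-mono f (D , m , c , e) = D , m , (λ k a → c k (f k a)) , e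

        sep-pair : ∀ {A : ℕ → Pred Carrier 0ℓ} {V W} k l → Measurable V → Measurable W →
                   (∀ {z} → A k z → V z) → (∀ {z} → A l z → W z) → (∀ {z} → V z → ¬ W z) →
                   Separable A
        sep-pair {V = V} {W} k l mV mW fV fW dis =
          (λ i z → (i ≡ k → V z) × (i ≡ l → W z)) ,
          (λ i → m-× (m-→ (m-const _) mV) (m-→ (m-const _) mW)) ,
          (λ i a → (λ { refl → fV a }) , (λ { refl → fW a })) ,
          λ h → dis (proj₁ (h k) refl) (proj₂ (h l) refl)

      -- Novikov's generalized first separation theorem.
      novikov : ∀ {A : ℕ → Pred Carrier 0ℓ} → (∀ k → Souslin space (A k)) →
                (∀ {z} → ¬ (∀ k → A k z)) → Separable A
      novikov {A} σ none with em₁ {Separable A}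
      ... | yes s = s
      ... | no ns = ⊥-elim contradiction
        where
        -- The codes for all the `A k` are interleaved in one branch; digit i belongs to the code
        -- for `A (proj₁ (unpair i))`, and only the first t digits are prescribed.
        Part : (ℕ → ℕ) → ℕ → ℕ → Pred Carrier 0ℓ
        Part b t k z = ∃[ b′ ] (Code (σ k) z b′ ×
          (∀ i → i < t → proj₁ (unpair i) ≡ k → b′ (proj₂ (unpair i)) ≡ b i))

        -- The digit t subdivides the set with index `k₀` and leaves the others as they are. So the
        -- separating sets for all values j are united at `k₀` and intersected elsewhere.
        glue : ∀ b t → (∀ j → Separable (Part (set b t j) (suc t))) → Separable (Part b t)
        glue b t s = D , mD , cD , eD
          where
          k₀ = proj₁ (unpair t)
          n₀ = proj₂ (unpair t)
          D : ℕ → Pred Carrier 0ℓ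
          D k z = (k ≡ k₀ × ∃[ j ] proj₁ (s j) k z) ⊎ (k ≢ k₀ × (∀ j → proj₁ (s j) k z))
          mD : ∀ k → Measurable (D k)
          mD k = m-⊎ (m-× (m-const _) (m-∃ λ j → proj₁ (proj₂ (s j)) k))
                     (m-× (m-const _) (m-∀ λ j → proj₁ (proj₂ (s j)) k))
          cD : ∀ k {z} → Part b t k z → D k z
          cD k {z} (b′ , c , h) with k ℕₚ.≟ k₀
          ... | yes refl = inj₁ (refl , b′ n₀ , proj₁ (proj₂ (proj₂ (s (b′ n₀)))) k (b′ , c , new))
            where
            new : ∀ i → i < suc t → proj₁ (unpair i) ≡ k₀ → b′ (proj₂ (unpair i)) ≡ set b t (b′ n₀) i
            new i (s≤s i≤t) e with ℕₚ.m≤n⇒m<n∨m≡n i≤t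
            ... | inj₁ i<t  = trans (h i i<t e) (sym (set-< b t _ i<t))
            ... | inj₂ refl = sym (set-= b t _)
          ... | no k≢ = inj₂ (k≢ , λ j → proj₁ (proj₂ (proj₂ (s j))) k (b′ , c , new j))
            where
            new : ∀ j i → i < suc t → proj₁ (unpair i) ≡ k → b′ (proj₂ (unpair i)) ≡ set b t j i
            new j i (s≤s i≤t) e with ℕₚ.m≤n⇒m<n∨m≡n i≤t
            ... | inj₁ i<t  = trans (h i i<t e) (sym (set-< b t _ i<t))
            ... | inj₂ refl = ⊥-elim (k≢ (sym e))
          eD : ∀ {z} → ¬ (∀ k → D k z)
          eD {z} h with h k₀
          ... | inj₂ (ne , _)     = ne refl
          ... | inj₁ (_ , j , dj) = proj₂ (proj₂ (proj₂ (s j))) all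
            where
            all : ∀ k → proj₁ (s j) k z
            all k with h k
            ... | inj₂ (_ , a)    = a j
            ... | inj₁ (refl , _) = dj

        path : ∃[ b ] (∀ t → ∃[ b′ ] (¬ Separable (Part b′ t) × b′ ≈[ t ] b))
        path = branch (λ b t → ¬ Separable (Part b t))
          (λ s → ns (sep-mono (λ k a → let (b , c) = complete (σ k) a in b , c , λ i ()) s))
          (λ b t n → ¬∀⇒∃¬₁ (λ s → n (glue b t s)))

        insep : ∀ t → ¬ Separable (Part (proj₁ path) t)
        insep t s =
          let (b′ , n , ag) = proj₂ path t
          in n (sep-mono (λ { k (b″ , c , h) → b″ , c , λ i i<t e → trans (h i i<t e) (ag i i<t) }) s)

        module _ (b∞ : ℕ → ℕ) (insep : ∀ t → ¬ Separable (Part b∞ t)) where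
          part-∃ : ∀ t k → ∃[ z ] Part b∞ t k z
          part-∃ t k = dne λ none → insep t
            (sep-pair k k (m-const ⊥) (m-const ⊥) (λ a → none (_ , a)) (λ a → none (_ , a)) (λ ()))

          narrow : ∀ k n → ∃[ N ] (∀ {z} → Part b∞ N k z →
                     ∃[ b′ ] (Code (σ k) z b′ × b′ ≈[ n ] (λ i → b∞ (pair k i))))
          narrow k n =
            let (N , h) = bound (pair k) n
            in N , λ (b′ , c , g) → b′ , c , λ i i<n →
                 subst (λ p → proj₁ p ≡ k → b′ (proj₂ p) ≡ b∞ (pair k i)) (unpair-pair k i)
                       (g (pair k i) (h i i<n)) refl

          weaken : ∀ {t t′ k z} → t ≤ t′ → Part b∞ t′ k z → Part b∞ t k z
          weaken t≤t′ (b′ , c , h) = b′ , c , λ i i<t → h i (ℕₚ.<-≤-trans i<t t≤t′)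

          Limit : ℕ → Pred Carrier 0ℓ
          Limit k z = ∀ v → basic v z → ∃[ N ] (∀ {z′} → Part b∞ N k z′ → basic v z′)

          lim : ∀ k → ∃[ z ] (A k z × Limit k z)
          lim k = z , a , λ v bv → near v bv
            where
            realized : ∀ n → ∃[ z ] ∃[ b′ ] (Code (σ k) z b′ × b′ ≈[ n ] (λ i → b∞ (pair k i)))
            realized n with narrow k n
            ... | N , g with part-∃ N k
            ... | z , p = z , g p
            l = limit (σ k) (λ i → b∞ (pair k i)) realized
            z = proj₁ l
            a = proj₁ (proj₂ l)
            near : Limit k z
            near v bv with proj₂ (proj₂ l) v bv
            ... | n , g with narrow k n
            ... | N , g′ = N , λ p → g (proj₁ (proj₂ (g′ p))) (proj₂ (proj₂ (g′ p)))

          -- Disjoint basic neighbourhoods of two different limits would separate the parts far down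
          -- the inseparable branch, with the whole space at all other indices. The common limit
          -- then lies in every `A k`.
          same : ∀ k l {z z′} → Limit k z → Limit l z′ → z ≡ z′
          same k l {z} {z′} c c′ = dne λ ne →
            let (v , w , bv , bw , dis) = separated ne
                (N , g)   = c v bv
                (N′ , g′) = c′ w bw
            in insep (N + N′) (sep-pair k l (basic-m v) (basic-m w)
                 (λ p → g (weaken (ℕₚ.m≤m+n N N′) p)) (λ p → g′ (weaken (ℕₚ.m≤n+m N′ N) p)) dis)

          absurd : ⊥
          absurd with lim 0
          ... | z , _ , c = none λ k → in-A k (lim k)
            where
            in-A : ∀ k → ∃[ z ] (A k z × Limit k z) → A k z
            in-A k (z′ , a , c′) = subst (A k) (same k 0 c′ c) a

        contradiction : ⊥
        contradiction = absurd (proj₁ path) insep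

      lusin : ∀ {P Q : Pred Carrier 0ℓ} → Souslin space P → Souslin space Q →
              (∀ {z} → P z → ¬ Q z) →
              Σ (Pred Carrier 0ℓ) λ D → Measurable D × (∀ {z} → P z → D z) × (∀ {z} → Q z → ¬ D z)
      lusin {P} {Q} σ τ dis =
        let (D , m , c , e) = novikov {A} (λ { zero → σ ; (suc _) → τ }) (λ h → dis (h 0) (h 1))
        in D 0 , m 0 , c 0 , λ q d → e λ { zero → d ; (suc k) → c (suc k) q }
        where
        A : ℕ → Pred Carrier 0ℓ
        A zero    = P
        A (suc _) = Q

    -- Uniformization and projection

    module Uniformization (B : BorelSpace)
      (bs : ∀ {A} → BorelSpace.Measurable B A → BiSouslin B A)
      where
      open BorelSpace B
      private
        B² : BorelSpace
        B² = B ⊗ᴮ B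
        module B² = BorelSpace B²

      bs² : ∀ {P} → B².Measurable P → BiSouslin B² P
      bs² = bi-⊗ B B bs bs

      Functional : Pred (Carrier × Carrier) 0ℓ → Set
      Functional P = ∀ {x y y′} → P (x , y) → P (x , y′) → y ≡ y′

      -- P is covered by the sets P ∖ D_v, where D_v is Borel and contains all (x , y) ∈ P
      -- except those where y is the only point of the section P_x in the basic set v.
      decomposition :
        (∀ {x m n} → basic m x → basic n x →
          ∃[ k ] (basic k x × (∀ {z} → basic k z → basic m z × basic n z))) →
        ∀ {P} → B².Measurable P → (∀ x → ∃[ ys ] (∀ {y} → P (x , y) → y ∈ ys)) →
        Σ (ℕ → Pred (Carrier × Carrier) 0ℓ) λ Q → (∀ n → B².Measurable (Q n)) × (∀ n → Functional (Q n)) ×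
              (∀ n {z} → Q n z → P z) × (∀ {z} → P z → ∃[ n ] Q n z)
      decomposition refine {P} mP fin =
        (λ n z → P z × ¬ D n z) ,
        (λ n → B².m-× mP (B².m-¬ (mD n))) ,
        (λ n (p , nd) (p′ , nd′) → dne λ ne → nd (cD n (p , inj₂ (in-v nd p , other nd p nd′ p′ ne)))) ,
        (λ n → proj₁) ,
        λ p → let (n , nd) = ¬∀⇒∃¬ eD in n , p , nd
        where
        Twice : ℕ → Pred Carrier 0ℓ
        Twice v x = ∃[ (m , n) ] ((∀ {z} → basic m z → ¬ basic n z) ×
          (∃[ y ] (P (x , y) × basic v y × basic m y)) × (∃[ y ] (P (x , y) × basic v y × basic n y)))
        T : ℕ → Pred (Carrier × Carrier) 0ℓ
        T v (x , y) = P (x , y) × (¬ basic v y ⊎ (basic v y × Twice v x))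
        right : ∀ {A} → Measurable A → Souslin B².space (λ (x , y) → A y)
        right mA = s-resp (λ z → proj₂) (λ z a → tt , a)
          (s-⊗ (scheme (pos (bs (m-const ⊤)))) (scheme (pos (bs mA))))
        twice-s : ∀ v → Souslin space (Twice v)
        twice-s v = s-∃ λ (m , n) → s-∩ (scheme (pos (bs (m-const _))))
          (s-∩ (s-proj (s-∩ (scheme (pos (bs² mP))) (s-∩ (right (basic-m v)) (right (basic-m m)))))
               (s-proj (s-∩ (scheme (pos (bs² mP))) (s-∩ (right (basic-m v)) (right (basic-m n))))))
        souslin : ∀ v → Souslin B².space (T v)
        souslin v = s-∩ (scheme (pos (bs² mP)))
          (s-∪ (right (m-¬ (basic-m v)))
               (s-resp (λ z (a , b) → b , a) (λ z (a , b) → b , a)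
                 (s-⊗ (twice-s v) (scheme (pos (bs (basic-m v)))))))
        isolate : ∀ {y} ys → ∃[ v ] (basic v y × (∀ {z} → z ∈ ys → basic v z → z ≡ y))
        isolate {y} [] = let (v , b) = covered y in v , b , λ ()
        isolate {y} (x ∷ ys) with isolate {y} ys | em {x ≡ y}
        ... | v , b , h | yes refl = v , b , λ { (here refl) _ → refl ; (there i) → h i }
        ... | v , b , h | no x≢y =
          let (m , n , bm , bn , dis) = separated x≢y
              (k , bk , g) = refine b bn
          in k , bk , λ { (here refl) bz → ⊥-elim (dis bm (proj₂ (g bz))) ; (there i) bz → h i (proj₁ (g bz)) }
        -- The section of `P` at x is finite, so some basic set around y contains no other of its
        -- points. The membership in `T` fails for this basic set.
        empty-∩ : ∀ {z} → ¬ (∀ v → T v z)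
        empty-∩ {x , y} h =
          let (ys , c) = fin x
              (v , b , u) = isolate ys
          in case proj₂ (h v) of λ
               { (inj₁ nb) → nb b
               ; (inj₂ (_ , (m , n) , dis , (y₁ , p₁ , v₁ , m₁) , (y₂ , p₂ , v₂ , n₂))) →
                 dis m₁ (subst (basic n) (trans (u (c p₂) v₂) (sym (u (c p₁) v₁))) n₂) }
        sep = novikov B² souslin (λ {z} → empty-∩ {z})
        D = proj₁ sep
        mD : ∀ n → B².Measurable (D n)
        mD = proj₁ (proj₂ sep)
        cD : ∀ n {z} → T n z → D n z
        cD = proj₁ (proj₂ (proj₂ sep))
        eD : ∀ {z} → ¬ (∀ n → D n z)
        eD = proj₂ (proj₂ (proj₂ sep))
        in-v : ∀ {n x y} → ¬ D n (x , y) → P (x , y) → basic n y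
        in-v nd p = dne λ nb → nd (cD _ (p , inj₁ nb))
        other : ∀ {n x y y′} → ¬ D n (x , y) → P (x , y) → ¬ D n (x , y′) → P (x , y′) → y ≢ y′ →
                Twice n x
        other nd p nd′ p′ ne =
          let (v , w , bv , bw , dis) = separated ne
          in (v , w) , dis , (_ , p , in-v nd p , bv) , (_ , p′ , in-v nd′ p′ , bw)

      -- The Lusin–Souslin theorem for the projection of a functional set.
      projection : ∀ {P} → B².Measurable P → Functional P → Measurable (λ x → ∃[ y ] P (x , y))
      projection {P} mP fun = m-iff (λ x h → from x h) (λ x q m → to m _ 0 ((proj₁ q) , whole (proj₂ q)))
          (m-∀ (λ m → mK m (λ _ → 0) 0))
        where
        γ : GoodScheme B² P
        γ = pos (bs² mP)
        C : Carrier × Carrier → (ℕ → ℕ) → Set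
        C = Code (scheme γ)
        Q : (ℕ → ℕ) → ℕ → Pred Carrier 0ℓ
        Q b n x = ∃[ y ] ∃[ b′ ] (C (x , y) b′ × b′ ≈[ n ] b)
        souslin : ∀ b n → Souslin space (Q b n)
        souslin b n = s-proj (scheme (pos (bs² (prefix-m γ b n))))
        -- The point x determines y as `P` is functional, and the pair determines its code. So the
        -- projections for different next digits are disjoint Souslin sets, and Lusin's theorem
        -- applies to them.
        disjoint : ∀ b n {j j′} → j ≢ j′ → ∀ {x} → Q (set b n j) (suc n) x → ¬ Q (set b n j′) (suc n) x
        disjoint b n {j} {j′} j≢j′ (y , c , d , e) (y′ , c′ , d′ , e′) with fun (sound (scheme γ) d) (sound (scheme γ) d′)
        ... | refl = j≢j′ (trans (sym (trans (e n ℕₚ.≤-refl) (set-= b n j)))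
                       (trans (inj γ d d′ n) (trans (e′ n ℕₚ.≤-refl) (set-= b n j′))))
        E : ∀ b n j j′ → j ≢ j′ → Σ (Pred Carrier 0ℓ) λ D → Measurable D ×
            (∀ {z} → Q (set b n j) (suc n) z → D z) × (∀ {z} → Q (set b n j′) (suc n) z → ¬ D z)
        E b n j j′ ne = lusin B (souslin _ _) (souslin _ _) (disjoint b n ne)
        F : ∀ b n j → Pred Carrier 0ℓ
        F b n j x = ∀ j′ (ne : j ≢ j′) → proj₁ (E b n j j′ ne) x × ¬ proj₁ (E b n j′ j (ne ∘ sym)) x
        mF : ∀ b n j → Measurable (F b n j)
        mF b n j = m-∀ λ j′ → m-all j′ (em {j ≢ j′})
          where
          m-all : ∀ j′ → Dec (j ≢ j′) →
                  Measurable (λ x → (ne : j ≢ j′) → proj₁ (E b n j j′ ne) x × ¬ proj₁ (E b n j′ j (ne ∘ sym)) x)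
          m-all j′ (no k)  = m-iff (λ x _ ne → ⊥-elim (k ne)) (λ x _ → tt) (m-const ⊤)
          m-all j′ (yes ne) = m-iff (λ x h _ → h) (λ x h → h ne)
            (m-× (proj₁ (proj₂ (E b n j j′ ne))) (m-¬ (proj₁ (proj₂ (E b n j′ j (ne ∘ sym))))))
        inF : ∀ b n j {x} → Q (set b n j) (suc n) x → F b n j x
        inF b n j q j′ ne = proj₁ (proj₂ (proj₂ (E b n j j′ ne))) q , proj₂ (proj₂ (proj₂ (E b n j′ j (ne ∘ sym)))) q
        F-unique : ∀ b n {j j′ x} → F b n j x → F b n j′ x → j ≡ j′
        F-unique b n {j} {j′} f f′ = dne λ ne → proj₂ (f′ j (ne ∘ sym)) (proj₁ (f j′ ne))
        -- The closure of `Q b n`, written with basic sets only and therefore Borel.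
        Near : (ℕ → ℕ) → ℕ → Pred Carrier 0ℓ
        Near b n x = ∀ v → (∀ {z} → Q b n z → ¬ basic v z) → ¬ basic v x
        mNear : ∀ b n → Measurable (Near b n)
        mNear b n = m-∀ λ v → m-→ (m-const _) (m-¬ (basic-m v))
        -- Borel approximations from outside: x follows m more digits through the separating sets
        -- `F` and stays in the closures of the projections. The projection of `P` is the
        -- intersection over m.
        K : ℕ → (ℕ → ℕ) → ℕ → Pred Carrier 0ℓ
        K zero    b n x = ⊤
        K (suc m) b n x = ∃[ j ] (F b n j x × Near (set b n j) (suc n) x × K m (set b n j) (suc n) x)
        mK : ∀ m b n → Measurable (K m b n)
        mK zero    b n = m-const ⊤
        mK (suc m) b n = m-∃ λ j → m-× (mF b n j) (m-× (mNear _ _) (mK m _ _))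
        whole : ∀ {x y} → P (x , y) → ∃[ b′ ] (C (x , y) b′ × b′ ≈[ 0 ] (λ _ → 0))
        whole p = let (b , c) = complete (scheme γ) p in b , c , λ i ()
        to : ∀ m b n {x} → Q b n x → K m b n x
        to zero    b n q = tt
        to (suc m) b n (y , b′ , c , e) = b′ n , inF b n (b′ n) q′ , (λ v h → h q′) , to m _ _ q′
          where
          ext : ∀ i → i < suc n → b′ i ≡ set b n (b′ n) i
          ext i (s≤s i≤n) with ℕₚ.m≤n⇒m<n∨m≡n i≤n
          ... | inj₁ i<n  = trans (e i i<n) (sym (set-< b n _ i<n))
          ... | inj₂ refl = sym (set-= b n _)
          q′ : Q (set b n (b′ n)) (suc n) _
          q′ = y , b′ , c , ext
        from : ∀ x → (∀ m → K m (λ _ → 0) 0 x) → ∃[ y ] P (x , y)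
        from x h = finish
          where
          Step : (ℕ → ℕ) → ℕ → Set
          Step b n = (n ≡ 0 ⊎ Near b n x) × (∀ m → K m b n x)
          path : ∃[ b ] (∀ t → ∃[ b′ ] (Step b′ t × b′ ≈[ t ] b))
          -- The sets `F` for different digits are disjoint, so the digit found with m = 1 is the
          -- one that serves every larger m; all depths lie on a single branch.
          path = branch Step (inj₁ refl , h) λ { b t (_ , k) →
            let (j , f , near , _) = k 1
            in j , inj₂ near , λ m →
                 let (j′ , f′ , _ , k′) = k (suc m)
                 in subst (λ j → K m (set b t j) (suc t) x) (F-unique b t f′ f) k′ }
          b∞ : ℕ → ℕ
          b∞ = proj₁ path
          near∞ : ∀ t → Near b∞ (suc t) x
          near∞ t v out bx with proj₂ path (suc t)
          ... | b′ , (inj₂ near , _) , ag =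
            near v (λ { (y , b″ , c , e) → out (y , b″ , c , λ i i< → trans (e i i<) (ag i i<)) }) bx
          realized : ∀ t → ∃[ z ] ∃[ b′ ] (C z b′ × b′ ≈[ suc t ] b∞)
          realized t = dne λ none →
            let (v , bv) = covered x
            in near∞ t v (λ { {z} (y , b′ , c , e) → ⊥-elim (none ((z , y) , b′ , c , e)) }) bv
          finish : ∃[ y ] P (x , y)
          finish =
            let ((x′ , y) , p , l) = limit (scheme γ) b∞ λ n →
                  let (z , b′ , c , e) = realized n
                  in z , b′ , c , λ i i<n → e i (ℕₚ.m<n⇒m<1+n i<n)
                x′≡x = dne λ ne →
                  let (v , w , bv , bw , dis) = separated ne
                      (u , bu) = covered y
                      (n , g) = l (pair v u) (subst (λ (i , j) → basic i x′ × basic j y) (sym (unpair-pair v u)) (bv , bu))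
                  in near∞ n w (λ { {z} (y′ , b′ , c , e) →
                       dis (proj₁ (subst (λ (i , j) → basic i z × basic j y′) (unpair-pair v u)
                         (g c (λ i i<n → e i (ℕₚ.m<n⇒m<1+n i<n))))) }) bw
            in y , subst (λ x → P (x , y)) x′≡x p

  -- Standard Borel spaces and their Souslin schemes

  module Polish (X : StandardBorelSpace) where
    open SouslinSets
    open Separation
    open StandardBorelSpace X using (polishMetric; isBorel) renaming (space to 𝓧; Carrier to Pt; Measurable to Mble)
    open PolishMetric polishMetric hiding (complete)
    open ℝ
    open Meas 𝓧
    open GoodScheme

    private
      above : ∀ r {p q} → lower r p → ¬ lower r q → p ℚ.< q
      above r p∈ q∉ = ℚₚ.≰⇒> (λ q≤p → q∉ (downward r q≤p p∈))

      Near : ℕ → Pt → Pt → Set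
      Near n x y = dist x y <ᴿ fromℚ (radius n)

      -- The triangle inequality for x, y, x bounds twice the distance from below by 0.
      nonneg : ∀ x y {q} → q ℚ.< 0ℚ → lower (dist x y) q
      nonneg x y {q} q<0 = dne λ q∉ →
        let q+q<0 = subst (q ℚ.+ q ℚ.<_) (ℚₚ.+-identityʳ 0ℚ) (ℚₚ.+-mono-< q<0 q<0)
            (r , s , r∈ , s∈ , eq) = triangle {x} {y} {x} (proj₂ (Equivalence.from identity refl) q+q<0)
        in ℚₚ.<-irrefl (sym eq) (ℚₚ.+-mono-< (above (dist x y) r∈ q∉)
             (above (dist x y) (proj₂ symmetry s∈) q∉))

      tri-ℚ : ∀ {x y z p q} → ¬ lower (dist x y) p → ¬ lower (dist y z) q → ¬ lower (dist x z) (p ℚ.+ q)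
      tri-ℚ {x} {y} {z} p∉ q∉ t =
        let (r , s , r∈ , s∈ , eq) = triangle t
        in ℚₚ.<-irrefl (sym eq) (ℚₚ.+-mono-< (above (dist x y) r∈ p∉) (above (dist y z) s∈ q∉))

      near-refl : ∀ n {x} → Near n x x
      near-refl n = 0ℚ , (λ 0∈ → ℚₚ.<-irrefl refl (proj₁ (Equivalence.from identity refl) 0∈)) , radius>0 n

      near-sym : ∀ n {x y} → Near n x y → Near n y x
      near-sym n (q , q∉ , q<) = q , (λ q∈ → q∉ (proj₁ symmetry q∈)) , q<

      near-mono : ∀ {m n x y} → m ≤ n → Near n x y → Near m x y
      near-mono m≤n (q , q∉ , q<) = q , q∉ , ℚₚ.<-≤-trans q< (radius-antitone m≤n)

      near-trans : ∀ n {x y z} → Near (half n) x y → Near (half n) y z → Near n x z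
      near-trans n (p , p∉ , p<) (q , q∉ , q<) =
        p ℚ.+ q , tri-ℚ p∉ q∉ , subst (p ℚ.+ q ℚ.<_) (radius-half n) (ℚₚ.+-mono-< p< q<)

      near-sep : ∀ {x y} → x ≢ y → ∃[ n ] ¬ Near n x y
      near-sep {x} {y} x≢y = ¬∀⇒∃¬ λ all → x≢y (Equivalence.to identity
        ((λ {q} q∈ →
           let (q′ , q<q′ , q′∈) = rounded (dist x y) q∈
           in ℚₚ.<-≤-trans q<q′ (ℚₚ.≮⇒≥ λ 0<q′ →
                let (n , r<) = archimedean 0<q′
                    (p , p∉ , p<r) = all n
                in p∉ (downward (dist x y) (ℚₚ.<⇒≤ (ℚₚ.<-trans p<r r<)) q′∈)))
        , λ q<0 → nonneg x y q<0))

      ball-open : ∀ n x → Open (Near n x)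
      ball-open n x {y} (q , q∉ , q<) = radius n ℚ.- q ,
        subst (ℚ._< radius n ℚ.- q) (ℚₚ.+-inverseʳ q) (ℚₚ.+-monoˡ-< (ℚ.- q) q<) ,
        λ { {z} (p , p∉ , p<) → q ℚ.+ p , tri-ℚ q∉ p∉ ,
            subst (q ℚ.+ p ℚ.<_) (cancel (radius n) q) (ℚₚ.+-monoʳ-< q p<) }
        where
        cancel : ∀ r q → q ℚ.+ (r ℚ.- q) ≡ r
        cancel r q = trans (ℚₚ.+-comm q (r ℚ.- q)) (//-rightDividesˡ q r)

      OpenN : Pred Pt 0ℓ → Set
      OpenN A = ∀ {x} → A x → ∃[ n ] (∀ {y} → Near n x y → A y)

      open⇒ : ∀ {A} → Open A → OpenN A
      open⇒ o a = let (ε , 0<ε , h) = o a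
                      (n , r<ε) = archimedean 0<ε
                  in n , λ (q , q∉ , q<) → h (q , q∉ , ℚₚ.<-trans q< r<ε)

      ⇒open : ∀ {A} → OpenN A → Open A
      ⇒open o a = let (n , h) = o a in radius n , radius>0 n , h

      open-m : ∀ {A} → OpenN A → Mble A
      open-m o = proj₂ isBorel (Generated.base (⇒open o))

      ball-openN : ∀ n x → OpenN (Near n x)
      ball-openN n x = open⇒ (λ {y} → ball-open n x {y})

      D : Pred Pt 0ℓ
      D = proj₁ separable

      centre : ℕ → Maybe Pt
      centre = proj₁ (proj₁ (proj₂ separable))

      At : ℕ → ℕ → Pred Pt 0ℓ
      At n k x = ∃[ d ] (centre k ≡ just d × Near n d x)

      at-∃ : ∀ n x → ∃[ k ] At n k x
      at-∃ n x = let (d , d∈D , near) = proj₂ (proj₂ separable) x (radius>0 n)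
                     (k , e) = proj₂ (proj₁ (proj₂ separable)) d∈D
                 in k , d , e , near-sym n near

      at-open : ∀ n k → OpenN (At n k)
      at-open n k (d , e , near) = let (m , h) = ball-openN n d near in m , λ near′ → d , e , h near′

      at-near : ∀ n {k x y} → At (half n) k x → At (half n) k y → Near n x y
      at-near n (d , e , p) (d′ , e′ , p′) with trans (sym e) e′
      ... | refl = near-trans n (near-sym (half n) p) p′

      basis : ∀ {A} → OpenN A → ∀ {x} → A x → ∃[ n ] ∃[ k ] (At n k x × (∀ {y} → At n k y → A y))
      basis o a = let (n , h) = o a
                      (k , at) = at-∃ (half n) _
                  in half n , k , at , λ at′ → h (at-near n at at′)

    Basic : ℕ → Pred Pt 0ℓ
    Basic v = At (proj₁ (unpair v)) (proj₂ (unpair v))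

    private
      basic-open : ∀ v → OpenN (Basic v)
      basic-open v = at-open (proj₁ (unpair v)) (proj₂ (unpair v))

      basic-at : ∀ n k {x} → At n k x → Basic (pair n k) x
      basic-at n k {x} = subst (λ (n , k) → At n k x) (sym (unpair-pair n k))

      at-basic : ∀ n k {x} → Basic (pair n k) x → At n k x
      at-basic n k {x} = subst (λ (n , k) → At n k x) (unpair-pair n k)

    polish : BorelSpace
    polish = record
      { 𝓜         = 𝓧
      ; basic     = Basic
      ; basic-m   = λ v → open-m (basic-open v)
      ; covered   = λ x → let (k , a) = at-∃ 0 x in pair 0 k , basic-at 0 k a
      ; separated = λ {x} {y} x≢y →
          let (n , ¬near) = near-sep x≢y
              h = half (half n)
              (k , a)  = at-∃ h x
              (k′ , a′) = at-∃ h y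
          in pair h k , pair h k′ , basic-at h k a , basic-at h k′ a′ , λ b b′ →
             ¬near (near-trans n (at-near (half n) a (at-basic h k b))
                                 (near-sym (half n) (at-near (half n) a′ (at-basic h k′ b′))))
      }

    basic-refine : ∀ {x m n} → Basic m x → Basic n x →
                   ∃[ k ] (Basic k x × (∀ {z} → Basic k z → Basic m z × Basic n z))
    basic-refine {x} {m} {n} p q =
      let (i , j , a , h) = basis both (p , q)
      in pair i j , basic-at i j a , λ b → h (at-basic i j b)
      where
      both : OpenN (λ z → Basic m z × Basic n z)
      both (p , q) =
        let (i , f) = basic-open m p
            (j , g) = basic-open n q
        in i + j , λ near → f (near-mono (ℕₚ.m≤m+n i j) near) , g (near-mono (ℕₚ.m≤n+m j i) near)

    private
      -- Digit i is the index of the first centre within 1/(i + 1) of x. Taking the first one makes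
      -- the code a function of x with Borel digits.
      Code-X : Pt → (ℕ → ℕ) → Set
      Code-X x b = ∀ i → At i (b i) x × (∀ j → j < b i → ¬ At i j x)

      code-X : ∀ x → ∃[ b ] Code-X x b
      code-X x = (λ i → proj₁ (l i)) , λ i → proj₂ (l i)
        where
        l : ∀ i → ∃[ k ] (At i k x × (∀ j → j < k → ¬ At i j x))
        l i = least (λ k → At i k x) (proj₂ (at-∃ i x))

      code-X-inj : ∀ {x b b′} → Code-X x b → Code-X x b′ → ∀ i → b i ≡ b′ i
      code-X-inj {x} c c′ i = least-unique (λ k → At i k x)
        (proj₁ (c i)) (proj₂ (c i)) (proj₁ (c′ i)) (proj₂ (c′ i))

      -- The centres named by `b` form a Cauchy sequence: two of them are near one and the same
      -- point, whose code agrees with `b` beyond both indices.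
      limit-X : ∀ b → (∀ n → ∃[ z ] ∃[ b′ ] (Code-X z b′ × b′ ≈[ n ] b)) →
                ∃[ z ] (∀ n → ∃[ N ] (∀ {z′ b′} → Code-X z′ b′ → b′ ≈[ N ] b → Near n z z′))
      limit-X b r = z , close
        where
        at : ∀ i {z b′} → Code-X z b′ → b′ ≈[ suc i ] b → At i (b i) z
        at i {z} c ag = subst (λ k → At i k z) (ag i ℕₚ.≤-refl) (proj₁ (c i))
        d-at : ∀ i → ∃[ d ] (centre (b i) ≡ just d)
        d-at i = let (z , b′ , c , ag) = r (suc i)
                     (d , e , _) = at i c ag
                 in d , e
        d : ℕ → Pt
        d i = proj₁ (d-at i)
        d-near : ∀ i {z} → At i (b i) z → Near i (d i) z
        d-near i {z} (d′ , e , near) = subst (λ d → Near i d z)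
          (just-injective (trans (sym e) (proj₂ (d-at i)))) near
        prefix : ∀ {i N b′} → suc i ≤ N → b′ ≈[ N ] b → b′ ≈[ suc i ] b
        prefix le ag j j< = ag j (ℕₚ.<-≤-trans j< le)
        cauchy : Cauchy d
        cauchy {ε} 0<ε =
          let (n , r<ε) = archimedean 0<ε
              h = half n
          in h , λ {i} {j} h≤i h≤j →
             let (z , b′ , c , ag) = r (suc (i + j))
                 i-near = near-mono h≤i (d-near i (at i c (prefix (s≤s (ℕₚ.m≤m+n i j)) ag)))
                 j-near = near-mono h≤j (d-near j (at j c (prefix (s≤s (ℕₚ.m≤n+m j i)) ag)))
                 (q , q∉ , q<) = near-trans n i-near (near-sym h j-near)
             in q , q∉ , ℚₚ.<-trans q< r<ε
        z : Pt
        z = proj₁ (PolishMetric.complete polishMetric {d} (λ {ε} → cauchy {ε}))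
        close : ∀ n → ∃[ N ] (∀ {z′ b′} → Code-X z′ b′ → b′ ≈[ N ] b → Near n z z′)
        close n =
          let h = half n
              (N , conv) = proj₂ (PolishMetric.complete polishMetric {d} (λ {ε} → cauchy {ε})) (radius>0 h)
              i = N + h
          in suc i , λ c ag → near-trans n
               (near-sym h (conv (ℕₚ.m≤m+n N h)))
               (near-mono (ℕₚ.m≤n+m h N) (d-near i (at i c ag)))

      near-limit : ∀ {A z b} {C : Pt → (ℕ → ℕ) → Set} → OpenN A → A z →
                   (∀ n → ∃[ N ] (∀ {z′ b′} → C z′ b′ → b′ ≈[ N ] b → Near n z z′)) →
                   ∃[ N ] (∀ {z′ b′} → C z′ b′ → b′ ≈[ N ] b → A z′)
      near-limit o a h = let (n , g) = o a
                             (N , k) = h n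
                         in N , λ c ag → g (k c ag)

      digit-X : ∀ i j → Mble (λ z → ∃[ b ] (Code-X z b × b i ≡ j))
      digit-X i j = m-iff
        (λ z (a , l) → let (b , c) = code-X z
                       in b , c , least-unique (λ k → At i k z) (proj₁ (c i)) (proj₂ (c i)) a l)
        (λ { z (b , c , refl) → c i })
        (m-× (open-m (at-open i j)) (m-∀ λ k → m-→ (m-const _) (m-¬ (open-m (at-open i k)))))

      -- A limit inside the open set `U` would force points with long common prefixes into `U`.
      closed : ∀ {U} → OpenN U → GoodScheme polish (λ z → ¬ U z)
      closed {U} o = record
        { scheme = record
          { Code     = λ z b → ¬ U z × Code-X z b
          ; sound    = proj₁
          ; complete = λ {z} ¬u → let (b , c) = code-X z in b , ¬u , c
          ; limit    = λ b r →
              let (z , h) = limit-X b λ n → let (z , b′ , (_ , c) , ag) = r n in z , b′ , c , ag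
              in z ,
                 (λ u → let (N , g) = near-limit o u h
                            (z′ , b′ , (¬u , c) , ag) = r N
                        in ¬u (g c ag)) ,
                 λ v bv → let (N , g) = near-limit (basic-open v) bv h
                          in N , λ (_ , c) ag → g c ag
          }
        ; inj    = λ (_ , c) (_ , c′) → code-X-inj c c′
        ; digits = λ i j → m-iff (λ z (¬u , b , c , e) → b , (¬u , c) , e)
                                 (λ z (b , (¬u , c) , e) → ¬u , b , c , e)
                                 (m-× (m-¬ (open-m o)) (digit-X i j))
        }

      Inside : Pred Pt 0ℓ → ℕ → Pred Pt 0ℓ
      Inside U n x = ∀ {y} → Near n x y → U y

      inside-m : ∀ U n → Mble (Inside U n)
      inside-m U n = m-iff
        (λ x h {y} near → dne λ ¬u → h (y , ¬u , near-sym n near))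
        (λ x h (y , ¬u , near) → ¬u (h (near-sym n near)))
        (m-¬ (open-m {A = λ x → ∃[ y ] (¬ U y × Near n y x)}
          λ (y , ¬u , near) → let (m , g) = ball-openN n y near in m , λ near′ → y , ¬u , g near′))

      -- The first digit of the code of x ∈ U is the least n such that the ball of radius
      -- 1/(n+1) about x lies in U; this keeps the limits in U.
      opened : ∀ {U} → OpenN U → GoodScheme polish U
      opened {U} o = record
        { scheme = record
          { Code     = Code-U
          ; sound    = λ {x} {b} ((i , _) , _) → i (near-refl (b 0))
          ; complete = λ {x} u →
              let (n , h) = o u
                  (m , i , l) = least (λ n → Inside U n x) {n} h
                  (b , c) = code-X x
              in push m b , (i , l) , c
          ; limit    = λ b r →
              let (z , h) = limit-X (b ∘ suc) λ n →
                    let (z , b′ , (_ , c) , ag) = r (suc n) in z , b′ ∘ suc , c , λ i i< → ag (suc i) (s≤s i<)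
                  u = let (N , g) = h (b 0)
                          (z′ , b′ , ((i , _) , c) , ag) = r (suc N)
                      in i (subst (λ n → Near n z′ z) (sym (ag 0 (s≤s z≤n)))
                             (near-sym (b 0) (g c (λ i i< → ag (suc i) (s≤s i<)))))
              in z , u , λ v bv →
                 let (N , g) = near-limit (basic-open v) bv h
                 in suc N , λ (_ , c) ag → g c (λ i i< → ag (suc i) (s≤s i<))
          }
        ; inj    = λ { {x} ((i , l) , c) ((i′ , l′) , c′) zero →
                         least-unique (λ n → Inside U n x) (λ {y} → i {y}) l (λ {y} → i′ {y}) l′
                     ; ((i , l) , c) ((i′ , l′) , c′) (suc k) → code-X-inj c c′ k }
        ; digits = dig
        }
        where
        push : ℕ → (ℕ → ℕ) → ℕ → ℕ
        push k b zero    = k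
        push k b (suc n) = b n
        First : ℕ → Pred Pt 0ℓ
        First n x = Inside U n x × (∀ j → j < n → ¬ Inside U j x)
        Code-U : Pt → (ℕ → ℕ) → Set
        Code-U x b = First (b 0) x × Code-X x (b ∘ suc)
        first-m : ∀ n → Mble (First n)
        first-m n = m-× (inside-m U n) (m-∀ λ j → m-→ (m-const _) (m-¬ (inside-m U j)))
        dig : ∀ i j → Mble (λ z → ∃[ b ] (Code-U z b × b i ≡ j))
        dig zero j = m-iff
          (λ z f → let (b , c) = code-X z in push j b , (f , c) , refl)
          (λ { z (b , (f , _) , refl) → f })
          (first-m j)
        dig (suc i) j = m-iff
          (λ z ((n , f) , b , c , e) → push n b , (f , c) , e)
          (λ z (b , (f , c) , e) → (b 0 , f) , b ∘ suc , c , e)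
          (m-× (m-∃ first-m) (digit-X i j))

    biSouslin : ∀ {A} → Mble A → BiSouslin polish A
    biSouslin mA = go (proj₁ isBorel mA)
      where
      go : ∀ {A} → Generated Open A → BiSouslin polish A
      go (Generated.base o) = bi (opened (open⇒ o)) (closed (open⇒ o))
      go (Generated.respects (f , g) m) = bi-resp (λ z → f) (λ z → g) (go m)
      go Generated.empty = bi (opened (λ ())) (closed (λ ()))
      go (Generated.complement m) = bi-¬ (go m)
      go (Generated.union m) = bi-⋃ (λ n → go (m n))

  -- Countable Borel equivalence relations with an enumeration of their classes

  module Frames where

    -- The interface between descriptive set theory and combinatorics. The Borel maps `move`
    -- enumerate each class from any of its points, so that quantifiers over a class become
    -- countable; the sets `S` make equality Borel and give a Borel linear order.
    record Frame : Set₂ where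
      infix 4 _~_
      field
        𝓜       : MeasurableSpace
      open MeasurableSpace 𝓜 public using (Measurable) renaming (Carrier to Pt)
      field
        _~_     : Pt → Pt → Set
        ~-refl  : ∀ {x} → x ~ x
        ~-sym   : ∀ {x y} → x ~ y → y ~ x
        ~-trans : ∀ {x y z} → x ~ y → y ~ z → x ~ z
        move    : List ℕ → Pt → Pt
        move-m  : ∀ i {A} → Measurable A → Measurable (λ x → A (move i x))
        move-~  : ∀ i x → x ~ move i x
        reach   : ∀ {x y} → x ~ y → ∃[ i ] move i x ≡ y
        S       : ℕ → Pred Pt 0ℓ
        S-m     : ∀ n → Measurable (S n)
        S-sep   : ∀ {x y} → (∀ n → S n x → S n y) → x ≡ y

    module _ (X : StandardBorelSpace) (G : Graph (StandardBorelSpace.Carrier X)) where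
      private
        open Polish X
        open Separation
        open Uniformization polish biSouslin
        open Meas (StandardBorelSpace.space X)
        open StandardBorelSpace X using (Carrier; Measurable)

        𝓧² : MeasurableSpace
        𝓧² = StandardBorelSpace.space X ⊗ StandardBorelSpace.space X

        module M² = Meas 𝓧²

      module _
        (Q : ℕ → Pred (Carrier × Carrier) 0ℓ)
        (Q-m : ∀ n → MeasurableSpace.Measurable 𝓧² (Q n))
        (Q-fun : ∀ n → Functional (Q n))
        (Q-adj : ∀ n {z} → Q n z → Adj G (proj₁ z) (proj₂ z))
        (Q-onto : ∀ {x y} → Adj G x y → ∃[ n ] Q n (x , y))
        where
        private
          f′ : ∀ n x → Dec (∃[ y ] Q n (x , y)) → Carrier
          f′ n x (yes (y , _)) = y
          f′ n x (no _)        = x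

          f : ℕ → Carrier → Carrier
          f n x = f′ n x em

          -- The domain of the partial function `Q n` and its preimage of `A` are both projections
          -- of functional Borel sets.
          f-m : ∀ n {A} → Measurable A → Measurable (λ x → A (f n x))
          f-m n {A} mA = m-iff (λ x → to x em) (λ x → from x em)
            (m-⊎ (projection (M².m-× (Q-m n) right) (λ (q , _) (q′ , _) → Q-fun n q q′))
                 (m-× (m-¬ (projection (Q-m n) (Q-fun n))) mA))
            where
            right : MeasurableSpace.Measurable 𝓧² (λ (x , y) → A y)
            right = Generated.base (_ , _ , m-const ⊤ , mA , ((λ a → tt , a) , proj₂))
            Split : Carrier → Set
            Split x = (∃[ y ] (Q n (x , y) × A y)) ⊎ (¬ (∃[ y ] Q n (x , y)) × A x)
            to : ∀ x d → Split x → A (f′ n x d)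
            to x (yes (y , q)) (inj₁ (y′ , q′ , a)) = subst A (Q-fun n q′ q) a
            to x (yes e)       (inj₂ (ne , _))      = ⊥-elim (ne e)
            to x (no ne)       (inj₁ (y , q , _))   = ⊥-elim (ne (y , q))
            to x (no ne)       (inj₂ (_ , a))       = a
            from : ∀ x d → A (f′ n x d) → Split x
            from x (yes (y , q)) a = inj₁ (y , q , a)
            from x (no ne)       a = inj₂ (ne , a)

          f-onto : ∀ {x y} → Adj G x y → ∃[ n ] f n x ≡ y
          f-onto {x} {y} e = let (n , q) = Q-onto e in n , value n q em
            where
            value : ∀ n → Q n (x , y) → ∀ d → f′ n x d ≡ y
            value n q (yes (y′ , q′)) = Q-fun n q′ q
            value n q (no ne)         = ⊥-elim (ne (y , q))

          f-star : ∀ n x → Star (Adj G) x (f n x)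
          f-star n x = go em
            where
            go : ∀ d → Star (Adj G) x (f′ n x d)
            go (yes (y , q)) = Q-adj n q ◅ Star.ε
            go (no _)        = Star.ε

          g : List ℕ → Carrier → Carrier
          g []       x = x
          g (n ∷ ns) x = g ns (f n x)

          g-m : ∀ i {A} → Measurable A → Measurable (λ x → A (g i x))
          g-m []       mA = mA
          g-m (n ∷ ns) mA = f-m n (g-m ns mA)

          g-star : ∀ i x → Star (Adj G) x (g i x)
          g-star []       x = Star.ε
          g-star (n ∷ ns) x = f-star n x ◅◅ g-star ns (f n x)

          g-onto : ∀ {x y} → Star (Adj G) x y → ∃[ i ] g i x ≡ y
          g-onto Star.ε = [] , refl
          g-onto (e ◅ es) with f-onto e | g-onto es
          ... | n , refl | i , eq = n ∷ i , eq

        functional-frame : Frame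
        functional-frame = record
          { 𝓜       = StandardBorelSpace.space X
          ; _~_     = Component G
          ; ~-refl  = Star.ε
          ; ~-sym   = Star.reverse (symmetric G)
          ; ~-trans = _◅◅_
          ; move    = g
          ; move-m  = g-m
          ; move-~  = g-star
          ; reach   = g-onto
          ; S       = Basic
          ; S-m     = SouslinSets.BorelSpace.basic-m polish
          ; S-sep   = λ h → dne λ ne →
              let (m , n , bm , bn , dis) = SouslinSets.BorelSpace.separated polish ne
              in dis (h m bm) bn
          }

      abstract
        functional-cover : MeasurableSpace.Measurable 𝓧² (uncurry (Adj G)) →
          (∀ x → ∃[ ys ] (∀ {y} → Adj G x y → y ∈ ys)) →
          Σ (ℕ → Pred (Carrier × Carrier) 0ℓ) λ Q →
            (∀ n → MeasurableSpace.Measurable 𝓧² (Q n)) × (∀ n → Functional (Q n)) ×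
            (∀ n {z} → Q n z → uncurry (Adj G) z) × (∀ {z} → uncurry (Adj G) z → ∃[ n ] Q n z)
        functional-cover mG finite = decomposition (λ {x} {m} {n} → basic-refine {x} {m} {n}) mG finite

      component-frame : MeasurableSpace.Measurable 𝓧² (uncurry (Adj G)) →
                        (∀ x → ∃[ ys ] (∀ {y} → Adj G x y → y ∈ ys)) → Frame
      component-frame mG finite = functional-frame (proj₁ d) (proj₁ (proj₂ d)) (proj₁ (proj₂ (proj₂ d)))
          (proj₁ (proj₂ (proj₂ (proj₂ d)))) (proj₂ (proj₂ (proj₂ (proj₂ d))))
        where
        d = functional-cover mG finite

    -- Borel definability on a frame

    module FrameOps (𝓕 : Frame) where
      open Frame 𝓕
      open Meas 𝓜 public

      record Term : Set₁ where
        field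
          at   : Pt → Pt
          at-m : ∀ {A} → Measurable A → Measurable (λ x → A (at x))
          at-~ : ∀ x → x ~ at x

      open Term public

      mv : List ℕ → Term
      mv i = record { at = move i ; at-m = move-m i ; at-~ = move-~ i }

      self : Term
      self = record { at = id ; at-m = id ; at-~ = λ _ → ~-refl }

      _then_ : Term → Term → Term
      u then v = record
        { at   = λ x → at v (at u x)
        ; at-m = λ m → at-m u (at-m v m)
        ; at-~ = λ x → ~-trans (at-~ u x) (at-~ v (at u x))
        }

      -- A relation within classes is tested along pairs of Borel maps instead of in the product
      -- space. In this form it is closed under quantifiers over the class, which turn into
      -- quantifiers over `move`.
      Bor₂ : (Pt → Pt → Set) → Set₁
      Bor₂ R = ∀ u v → Measurable (λ x → R (at u x) (at v x))

      m-∃~ : ∀ {Q : Pt → Pt → Set} → (∀ {x z} → Q x z → x ~ z) →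
             (∀ k → Measurable (λ x → Q x (move k x))) → Measurable (λ x → ∃[ z ] Q x z)
      m-∃~ {Q} c m = m-iff (λ x (k , q) → move k x , q)
        (λ x (z , q) → let (k , e) = reach (c q) in k , subst (Q x) (sym e) q) (m-∃ m)

      m-∀~ : ∀ {Q : Pt → Pt → Set} → (∀ {x z} → ¬ Q x z → x ~ z) →
             (∀ k → Measurable (λ x → Q x (move k x))) → Measurable (λ x → ∀ z → Q x z)
      m-∀~ {Q} c m = m-iff
        (λ x h z → dne λ nq → let (k , e) = reach (c nq) in nq (subst (Q x) e (h k)))
        (λ x h k → h (move k x)) (m-∀ m)

      moves : List (List ℕ) → Pt → List Pt
      moves ks x = map (λ k → move k x) ks

      reach-all : ∀ {x zs} → All (x ~_) zs → ∃[ ks ] moves ks x ≡ zs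
      reach-all [] = [] , refl
      reach-all (r ∷ rs) =
        let (k , e)   = reach r
            (ks , es) = reach-all rs
        in k ∷ ks , cong₂ _∷_ e es

      m-∃L : ∀ {Q : Pt → List Pt → Set} → (∀ {x zs} → Q x zs → All (x ~_) zs) →
             (∀ ks → Measurable (λ x → Q x (moves ks x))) → Measurable (λ x → ∃[ zs ] Q x zs)
      m-∃L {Q} c m = m-iff (λ x (ks , q) → moves ks x , q)
        (λ x (zs , q) → let (ks , e) = reach-all (c q) in ks , subst (Q x) (sym e) q) (m-∃ m)

      m-All : ∀ {Q : Pt → Pt → Set} ks → (∀ k → Measurable (λ x → Q x (move k x))) →
              Measurable (λ x → All (Q x) (moves ks x))
      m-All []       m = m-iff (λ x _ → []) (λ x _ → tt) (m-const ⊤)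
      m-All (k ∷ ks) m = m-iff (λ x (q , qs) → q ∷ qs) (λ { x (q ∷ qs) → q , qs })
                               (m-× (m k) (m-All ks m))

      bor-≡ : Bor₂ _≡_
      bor-≡ i j = m-iff (λ x h → S-sep (λ n s → h n s)) (λ x e n s → subst (S n) e s)
        (m-∀ λ n → m-→ (at-m i (S-m n)) (at-m j (S-m n)))

      m-∈ : ∀ k ks → Measurable (λ x → move k x ∈ moves ks x)
      m-∈ k []        = m-iff (λ x ()) (λ x ()) (m-const ⊥)
      m-∈ k (k′ ∷ ks) = m-iff (λ x → [ here , there ]′) (λ { x (here e) → inj₁ e ; x (there i) → inj₂ i })
                              (m-⊎ (bor-≡ (mv k) (mv k′)) (m-∈ k ks))

      m-Unique : ∀ ks → Measurable (λ x → Unique (moves ks x))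
      m-Unique []       = m-iff (λ x _ → []) (λ x _ → tt) (m-const ⊤)
      m-Unique (k ∷ ks) = m-iff (λ x (q , qs) → q ∷ qs) (λ { x (q ∷ qs) → q , qs })
        (m-× (m-All {Q = λ x z → move k x ≢ z} ks (λ k′ → m-¬ (bor-≡ (mv k) (mv k′)))) (m-Unique ks))

      m-AtLeastN : ∀ n {Q : Pt → Pt → Set} → (∀ {x z} → Q x z → x ~ z) →
               (∀ k → Measurable (λ x → Q x (move k x))) → Measurable (λ x → AtLeastN n (Q x))
      m-AtLeastN n {Q} c m = m-∃L (λ (_ , _ , a) → All.map c a)
        (λ ks → m-× (m-iff (λ x e → trans (Lₚ.length-map _ ks) e) (λ x e → trans (sym (Lₚ.length-map _ ks)) e)
                           (m-const (length ks ≡ n)))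
                    (m-× (m-Unique ks) (m-All ks m)))

      pullback : ∀ {P : Pred (Pt × Pt) 0ℓ} → MeasurableSpace.Measurable (𝓜 ⊗ 𝓜) P →
                 Bor₂ (λ x y → P (x , y))
      pullback (Generated.base (A , B , a , b , (f , g))) i j =
        m-iff (λ x → g) (λ x → f) (m-× (at-m i a) (at-m j b))
      pullback (Generated.respects (f , g) m) i j = m-iff (λ x → f) (λ x → g) (pullback m i j)
      pullback Generated.empty i j = m-iff (λ x ()) (λ x ()) (m-const ⊥)
      pullback (Generated.complement m) i j = m-¬ (pullback m i j)
      pullback (Generated.union m) i j = m-∃ (λ n → pullback (m n) i j)

      infix 4 _≺_
      -- The lexicographic order of the sequences of memberships in the sets `S n`, where being a
      -- member comes before not being one.
      _≺_ : Pt → Pt → Set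
      x ≺ y = ∃[ n ] ((S n x × ¬ S n y) × (∀ m → m < n → (S m x → S m y) × (S m y → S m x)))

      bor-≺ : Bor₂ _≺_
      bor-≺ i j = m-∃ λ n → m-× (m-× (s i n) (m-¬ (s j n)))
        (m-∀ λ m → m-→ (m-const _) (m-× (m-→ (s i m) (s j m)) (m-→ (s j m) (s i m))))
        where
        s : ∀ u n → Measurable (λ x → S n (at u x))
        s u n = at-m u (S-m n)

      ≺-trans : ∀ {x y z} → x ≺ y → y ≺ z → x ≺ z
      ≺-trans (m , (xm , ¬ym) , lm) (n , (yn , ¬zn) , ln) with ℕₚ.<-cmp m n
      ... | tri< m<n _ _ = m , (xm , λ zm → ¬ym (proj₂ (ln m m<n) zm)) , λ k k<m →
            (λ xk → proj₁ (ln k (ℕₚ.<-trans k<m m<n)) (proj₁ (lm k k<m) xk)) ,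
            (λ zk → proj₂ (lm k k<m) (proj₂ (ln k (ℕₚ.<-trans k<m m<n)) zk))
      ... | tri≈ _ refl _ = ⊥-elim (¬ym yn)
      ... | tri> _ _ n<m = n , (proj₂ (lm n n<m) yn , ¬zn) , λ k k<n →
            (λ xk → proj₁ (ln k k<n) (proj₁ (lm k (ℕₚ.<-trans k<n n<m)) xk)) ,
            (λ zk → proj₂ (lm k (ℕₚ.<-trans k<n n<m)) (proj₂ (ln k k<n) zk))

      ≺-irrefl : ∀ {x} → ¬ x ≺ x
      ≺-irrefl (n , (s , ¬s) , _) = ¬s s

      ≺-total : ∀ {x y} → x ≢ y → x ≺ y ⊎ y ≺ x
      ≺-total {x} {y} x≢y with ¬∀⇒∃¬ {P = λ n → (S n x → S n y) × (S n y → S n x)}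
                                 (λ h → x≢y (S-sep (λ n → proj₁ (h n))))
      ... | n , d with least (λ n → ¬ ((S n x → S n y) × (S n y → S n x))) d
      ... | m , dm , l with em {S m x} | em {S m y}
      ... | yes sx | yes sy = ⊥-elim (dm ((λ _ → sy) , (λ _ → sx)))
      ... | yes sx | no ¬sy = inj₁ (m , (sx , ¬sy) , λ k k<m → dne (l k k<m))
      ... | no ¬sx | yes sy = inj₂ (m , (sy , ¬sx) , λ k k<m →
              let (f , g) = dne (l k k<m) in g , f)
      ... | no ¬sx | no ¬sy = ⊥-elim (dm ((λ s → ⊥-elim (¬sx s)) , (λ s → ⊥-elim (¬sy s))))

      minimum : ∀ {P : Pred Pt 0ℓ} ys → (∀ {z} → P z → z ∈ ys) → ∀ {x} → P x →
                ∃[ m ] (P m × (∀ z → P z → z ≢ m → m ≺ z))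
      minimum {P} ys cover {x} px =
        let (m , pm , h) = go ys in m , pm , λ z pz → h z (cover pz) pz
        where
        go : ∀ ys → ∃[ m ] (P m × (∀ z → z ∈ ys → P z → z ≢ m → m ≺ z))
        go [] = x , px , λ z ()
        go (y ∷ ys) with go ys | em {P y}
        ... | m , pm , h | no ¬py = m , pm ,
              λ { z (here refl) pz → ⊥-elim (¬py pz) ; z (there i) pz → h z i pz }
        ... | m , pm , h | yes py with em {y ≡ m}
        ... | yes refl = m , pm , λ { z (here refl) pz ne → ⊥-elim (ne refl) ; z (there i) pz → h z i pz }
        ... | no y≢m with ≺-total y≢m
        ... | inj₂ m≺y = m , pm , λ { z (here refl) pz _ → m≺y ; z (there i) pz → h z i pz }
        ... | inj₁ y≺m = y , py , λ { z (here refl) pz ne → ⊥-elim (ne refl)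
                                    ; z (there i) pz ne → below z i pz }
          where
          below : ∀ z → z ∈ ys → P z → y ≺ z
          below z i pz with em {z ≡ m}
          ... | yes refl = y≺m
          ... | no z≢m   = ≺-trans y≺m (h z i pz z≢m)

  open Frames

  module OnFrame (𝓕 : Frame) where
    open Frame 𝓕
    open FrameOps 𝓕

    -- Borel modification of a labelling, one class of a finite Borel equivalence relation at a time

    module Stages where

      iterate : (Pt → Pt → Set) → ℕ → Pt → Pt → Set
      iterate R zero    x y = x ≡ y
      iterate R (suc n) x y = ∃[ z ] (R x z × iterate R n z y)

      bor-Star : ∀ {R} → (∀ {x y} → R x y → x ~ y) → Bor₂ R → Bor₂ (Star R)
      bor-Star {R} c m u v = m-iff (λ x (n , i) → to n i) (λ x → from) (m-∃ (λ n → it n u v))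
        where
        it : ∀ n → Bor₂ (iterate R n)
        it zero    = bor-≡
        it (suc n) u v = m-∃~ (λ {x} (r , _) → ~-trans (at-~ u x) (c r)) (λ k → m-× (m u (mv k)) (it n (mv k) v))
        to : ∀ n {x y} → iterate R n x y → Star R x y
        to zero    refl        = Star.ε
        to (suc n) (z , r , i) = r ◅ to n i
        from : ∀ {x y} → Star R x y → ∃[ n ] iterate R n x y
        from Star.ε   = 0 , refl
        from (r ◅ rs) = let (n , i) = from rs in suc n , _ , r , i

      bor-Ball : ∀ {J} → (∀ {x y} → J x y → x ~ y) → Bor₂ J → ∀ n → Bor₂ (Ball J n)
      bor-Ball c m zero    = bor-≡
      bor-Ball c m (suc n) u v = m-⊎ (bor-≡ u v)
        (m-∃~ (λ {x} (r , _) → ~-trans (at-~ u x) (c r)) (λ k → m-× (m u (mv k)) (bor-Ball c m n (mv k) v)))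

      ball-~ : ∀ {J} → (∀ {x y} → J x y → x ~ y) → ∀ n {x y} → Ball J n x y → x ~ y
      ball-~ c zero    refl               = ~-refl
      ball-~ c (suc n) (inj₁ refl)        = ~-refl
      ball-~ c (suc n) (inj₂ (z , e , b)) = ~-trans (c e) (ball-~ c n b)

      BorelLabel : (Pt → ℕ) → Set₁
      BorelLabel c = ∀ l → Measurable (λ x → c x ≡ l)

      -- Labellings that depend on a point in a Borel way.
      BorelFamily : (Pt → Pt → ℕ) → Set₁
      BorelFamily φ = ∀ u l → Measurable (λ x → φ x (at u x) ≡ l)

      record LocalGraph : Set₁ where
        field
          J      : Pt → Pt → Set
          J-sym  : ∀ {x y} → J x y → J y x
          J-~    : ∀ {x y} → J x y → x ~ y
          J-bor  : Bor₂ J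
          nb     : Pt → List Pt
          nb-all : ∀ {x y} → J x y → y ∈ nb x

      module Stage (𝓖 : LocalGraph) (U : Pred Pt 0ℓ) (U-m : Measurable U) (a n : ℕ) (a≤n : a ≤ n) where
        open LocalGraph 𝓖
        open BallList nb nb-all

        -- Labels change within `a` of a class and conditions look as far as `n`. With classes more
        -- than 2n apart, a ≤ n ensures that no two zones meet and that the condition at a point of
        -- `U` sees changes from its own class only.
        Link : Pt → Pt → Set
        Link x y = U x × U y × Ball J (n + n) x y

        Class : Pt → Pt → Set
        Class = Star Link

        link-sym : ∀ {x y} → Link x y → Link y x
        link-sym (ux , uy , b) = uy , ux , ball-sym J-sym (n + n) b

        class-sym : ∀ {x y} → Class x y → Class y x
        class-sym = Star.reverse link-sym

        class-U : ∀ {x y} → U x → Class x y → U y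
        class-U ux Star.ε             = ux
        class-U ux ((_ , uy , _) ◅ c) = class-U uy c

        private
          class-~ : ∀ {x y} → Class x y → x ~ y
          class-~ Star.ε            = ~-refl
          class-~ ((_ , _ , b) ◅ c) = ~-trans (ball-~ J-~ (n + n) b) (class-~ c)

          class-bor : Bor₂ Class
          class-bor = bor-Star (λ (_ , _ , b) → ball-~ J-~ (n + n) b)
            (λ u v → m-× (at-m u U-m) (m-× (at-m v U-m) (bor-Ball J-~ J-bor (n + n) u v)))

        Zone : Pt → Pt → Set
        Zone x w = ∃[ z ] (Class x z × Ball J a z w)

        private
          zone-~ : ∀ {x w} → Zone x w → x ~ w
          zone-~ (z , c , b) = ~-trans (class-~ c) (ball-~ J-~ a b)

          zone-bor : Bor₂ Zone
          zone-bor u v = m-∃~ (λ {x} (c , _) → ~-trans (at-~ u x) (class-~ c))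
            (λ k → m-× (class-bor u (mv k)) (bor-Ball J-~ J-bor a (mv k) v))

        module _
          (finite : ∀ x → ∃[ ys ] (∀ {y} → Class x y → y ∈ ys))
          (c : Pt → ℕ) (c-bor : BorelLabel c)
          (Φ : (Pt → ℕ) → Pt → Set)
          (Φ-bor : ∀ φ → BorelFamily φ → ∀ u → Measurable (λ x → Φ (φ x) (at u x)))
          (Φ-local : ∀ {c₁ c₂ x} → (∀ w → Ball J n x w → c₁ w ≡ c₂ w) → Φ c₁ x → Φ c₂ x)
          (solve : ∀ x → U x → Σ (Pt → ℕ) λ c′ →
                   (∀ w → c′ w ≢ c w → Zone x w) × (∀ y → Class x y → Φ c′ y))
          where

          private
            -- A finite change of the labelling, given by moves from a base point and new labels.
            -- There are countably many such codes, and so the first valid one is a Borel choice.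
            Code : Set
            Code = List (List ℕ × ℕ)

            override : {P : Set} → Dec P → ℕ → ℕ → ℕ
            override (yes _) l k = l
            override (no _)  l k = k

            modify : Pt → Code → Pt → ℕ
            modify x []            w = c w
            modify x ((i , l) ∷ t) w = override (em {move i x ≡ w}) l (modify x t w)

            modify-bor : ∀ t v u l → Measurable (λ x → modify (at v x) t (at u x) ≡ l)
            modify-bor [] v u l = at-m u (c-bor l)
            modify-bor ((i , k) ∷ t) v u l = m-iff (λ x → to em) (λ x → from em)
              (m-⊎ (m-× (bor-≡ (v then mv i) u) (m-const (k ≡ l)))
                   (m-× (m-¬ (bor-≡ (v then mv i) u)) (modify-bor t v u l)))
              where
              to : ∀ {P : Set} {k l r} (d : Dec P) → (P × k ≡ l) ⊎ (¬ P × r ≡ l) → override d k r ≡ l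
              to (yes p) (inj₁ (_ , e))  = e
              to (yes p) (inj₂ (np , _)) = ⊥-elim (np p)
              to (no np) (inj₁ (p , _))  = ⊥-elim (np p)
              to (no np) (inj₂ (_ , e))  = e
              from : ∀ {P : Set} {k l r} (d : Dec P) → override d k r ≡ l → (P × k ≡ l) ⊎ (¬ P × r ≡ l)
              from (yes p) e = inj₁ (p , e)
              from (no np) e = inj₂ (np , e)

            Valid : Pt → Code → Set
            Valid x t = All (λ (i , _) → Zone x (move i x)) t × (∀ y → Class x y → Φ (modify x t) y)

            valid-bor : ∀ t → Measurable (λ x → Valid x t)
            valid-bor t = m-× (zones t)
              (m-∀~ (λ {x} h → dne λ ¬r → h (λ r → ⊥-elim (¬r (class-~ r))))
                    (λ k → m-→ (class-bor self (mv k)) (Φ-bor (λ x → modify x t) (λ u l → modify-bor t self u l) (mv k))))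
              where
              zones : ∀ t → Measurable (λ x → All (λ (i , _) → Zone x (move i x)) t)
              zones [] = m-iff (λ x _ → []) (λ x _ → tt) (m-const ⊤)
              zones ((i , _) ∷ t) = m-iff (λ x (q , qs) → q ∷ qs) (λ { x (q ∷ qs) → q , qs })
                (m-× (zone-bor self (mv i)) (zones t))

            modify-outside : ∀ {x w} t → All (λ (i , _) → Zone x (move i x)) t → ¬ Zone x w → modify x t w ≡ c w
            modify-outside [] [] out = refl
            modify-outside {x} {w} ((i , l) ∷ t) (z ∷ zs) out with em {move i x ≡ w}
            ... | yes refl = ⊥-elim (out z)
            ... | no _     = modify-outside t zs out

            encode : ∀ x (c′ : Pt → ℕ) ws → ∃[ t ] (All (λ (i , _) → Zone x (move i x)) t ×
                     (∀ w → Zone x w → w ∈ ws → modify x t w ≡ c′ w))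
            encode x c′ [] = [] , [] , λ w _ ()
            encode x c′ (w ∷ ws) with encode x c′ ws | em {Zone x w}
            ... | t , zs , h | no out = t , zs , λ { v z (here refl) → ⊥-elim (out z) ; v z (there i) → h v z i }
            ... | t , zs , h | yes zn with reach (zone-~ zn)
            ... | i , refl = (i , c′ w) ∷ t , zn ∷ zs , λ v z m → first v z m em
              where
              first : ∀ v → Zone x v → v ∈ w ∷ ws → ∀ d → override {move i x ≡ v} d (c′ w) (modify x t v) ≡ c′ v
              first v z m           (yes refl) = refl
              first v z (here refl) (no ne)    = ⊥-elim (ne refl)
              first v z (there m)   (no ne)    = h v z m

            valid-∃ : ∀ x → U x → ∃[ t ] Valid x t
            valid-∃ x ux with solve x ux | finite x
            ... | c′ , changes , good | ys , cover with encode x c′ (concatMap (ballList a) ys)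
            ... | t , zs , h = t , zs , λ y r → Φ-local (λ w _ → sym (same w em)) (good y r)
              where
              same : ∀ w → Dec (Zone x w) → modify x t w ≡ c′ w
              same w (yes zn@(z , r , b)) =
                h w zn (∈-concatMap⁺ (ballList a) (lose (cover r) (∈-ballList a b)))
              same w (no out) = trans (modify-outside t zs out) (sym (dne λ ne → out (changes w ne)))

            Best : Pt → ℕ → Set
            Best x m = Valid x (enum m) × (∀ j → j < m → ¬ Valid x (enum j))

            best-bor : ∀ m → Measurable (λ x → Best x m)
            best-bor m = m-× (valid-bor (enum m)) (m-∀ λ j → m-→ (m-const _) (m-¬ (valid-bor (enum j))))

            best-unique : ∀ {x m m′} → Best x m → Best x m′ → m ≡ m′
            best-unique {x} (v , l) (v′ , l′) = least-unique (λ m → Valid x (enum m)) v l v′ l′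

            best-∃ : ∀ x → U x → ∃[ m ] Best x m
            best-∃ x ux =
              let (t , v) = valid-∃ x ux
                  (m , e) = onto t
              in least (λ m → Valid x (enum m)) {m} (subst (Valid x) (sym e) v)

            -- The least point of its class. Codes are read from it, so that all points of a class
            -- use the same change.
            Root : Pt → Set
            Root y = U y × (∀ z → Class y z → z ≢ y → y ≺ z)

            root-bor : Measurable Root
            root-bor = m-× U-m (m-∀~ (λ {x} h → dne λ ¬r → h (λ r → ⊥-elim (¬r (class-~ r))))
              (λ k → m-→ (class-bor self (mv k)) (m-→ (m-¬ (bor-≡ (mv k) self)) (bor-≺ self (mv k)))))

            root-∃ : ∀ {x} → U x → ∃[ y ] (Root y × Class x y)
            root-∃ {x} ux =
              let (ys , cover) = finite x
                  (y , r , h) = minimum ys cover {x} Star.ε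
              in y , (class-U ux r , λ z s → h z (r ◅◅ s)) , r

            root-unique : ∀ {y y′} → Root y → Root y′ → Class y y′ → y ≡ y′
            root-unique (_ , h) (_ , h′) r = dne λ ne →
              ≺-irrefl (≺-trans (h _ r (ne ∘ sym)) (h′ _ (class-sym r) ne))

            zones-meet : ∀ {y y′ w} → U y → U y′ → Zone y w → Zone y′ w → Class y y′
            zones-meet {y} {y′} uy uy′ (z , r , b) (z′ , r′ , b′) =
              r ◅◅ ((class-U uy r , class-U uy′ r′ , ball-mono (ℕₚ.+-mono-≤ a≤n a≤n)
                (ball-trans a b (ball-sym J-sym a b′))) ◅ class-sym r′)

            Owner : Pt → Pt → Set
            Owner w y = Root y × Zone y w

            Value : Pt → ℕ → Set
            Value w l = (∃[ y ] (Owner w y × ∃[ m ] (Best y m × modify y (enum m) w ≡ l)))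
                        ⊎ (¬ (∃[ y ] Owner w y) × c w ≡ l)

            value-bor : ∀ l → Measurable (λ w → Value w l)
            value-bor l = m-⊎
              (m-∃~ (λ ((_ , z) , _) → ~-sym (zone-~ z))
                (λ k → m-× (owner k) (m-∃ λ m → m-× (at-m (mv k) (best-bor m)) (modify-bor (enum m) (mv k) self l))))
              (m-× (m-¬ (m-∃~ (λ (_ , z) → ~-sym (zone-~ z)) owner)) (c-bor l))
              where
              owner : ∀ k → Measurable (λ w → Owner w (move k w))
              owner k = m-× (at-m (mv k) root-bor) (zone-bor (mv k) self)

            owner-unique : ∀ {w y y′} → Owner w y → Owner w y′ → y ≡ y′
            owner-unique (r , z) (r′ , z′) = root-unique r r′ (zones-meet (proj₁ r) (proj₁ r′) z z′)

            value-unique : ∀ {w l l′} → Value w l → Value w l′ → l ≡ l′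
            value-unique {w} (inj₁ (y , o , m , b , e)) (inj₁ (y′ , o′ , m′ , b′ , e′)) with owner-unique o o′
            ... | refl with best-unique b b′
            ... | refl = trans (sym e) e′
            value-unique (inj₁ (y , o , _)) (inj₂ (no-owner , _)) = ⊥-elim (no-owner (y , o))
            value-unique (inj₂ (no-owner , _)) (inj₁ (y , o , _)) = ⊥-elim (no-owner (y , o))
            value-unique (inj₂ (_ , e)) (inj₂ (_ , e′)) = trans (sym e) e′

            value-∃ : ∀ w → Dec (∃[ y ] Owner w y) → ∃[ l ] Value w l
            value-∃ w (yes (y , o)) =
              let (m , b) = best-∃ y (proj₁ (proj₁ o)) in _ , inj₁ (y , o , m , b , refl)
            value-∃ w (no no-owner) = c w , inj₂ (no-owner , refl)

            c′ : Pt → ℕ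
            c′ w = proj₁ (value-∃ w em)

            c′-value : ∀ w → Value w (c′ w)
            c′-value w = proj₂ (value-∃ w em)

            agree : ∀ {x y m} → U x → Root y → Class x y → Best y m → ∀ w → Ball J n x w →
                    modify y (enum m) w ≡ c′ w
            agree {x} {y} {m} ux ry r b w bw = value-unique (is em) (c′-value w)
              where
              is : Dec (Zone y w) → Value w (modify y (enum m) w)
              is (yes zn) = inj₁ (y , (ry , zn) , m , b , refl)
              -- A zone that contains w has a point of `U` within n + a ≤ 2n of x, so it would be
              -- the zone of x's own class.
              is (no out) = inj₂ ((λ { (y′ , ry′ , z′ , r′ , b′) →
                  let xy′ = (ux , class-U (proj₁ ry′) r′ , ball-mono (ℕₚ.+-monoʳ-≤ n a≤n)
                              (ball-trans n bw (ball-sym J-sym a b′))) ◅ class-sym r′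
                  in out (subst (λ y → Zone y w) (root-unique ry′ ry (class-sym xy′ ◅◅ r)) (z′ , r′ , b′)) }) ,
                sym (modify-outside (enum m) (proj₁ (proj₁ b)) out))

          abstract
            stage : Σ (Pt → ℕ) λ c′ → BorelLabel c′ × (∀ x → U x → Φ c′ x) ×
                    (∀ w → c′ w ≢ c w → ∃[ y ] (U y × Ball J a y w))
            stage = c′ ,
              (λ l → m-iff (λ w v → value-unique (c′-value w) v) (λ { w refl → c′-value w }) (value-bor l)) ,
              (λ x ux →
                let (y , ry , r) = root-∃ ux
                    (m , b) = best-∃ y (proj₁ ry)
                in Φ-local (agree ux ry r b) (proj₂ (proj₁ b) x (class-sym r))) ,
              λ w ne → change w (c′-value w) ne
              where
              change : ∀ w {l} → Value w l → l ≢ c w → ∃[ y ] (U y × Ball J a y w)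
              change w (inj₁ (y , (ry , z , r , b) , _)) ne = z , class-U (proj₁ ry) r , b
              change w (inj₂ (_ , e)) ne = ⊥-elim (ne (sym e))

      record Partition (t : ℕ) (J : Pt → Pt → Set) (N : ℕ) : Set₁ where
        field
          ι      : Pt → ℕ
          ι-bor  : BorelLabel ι
          ι<     : ∀ x → ι x < t
          finite : ∀ i x → ∃[ ys ] (∀ {y} → Star (λ x y → ι x ≡ i × ι y ≡ i × Ball J N x y) x y → y ∈ ys)

    open Stages

    -- Disjoint clusters in large components

    module Clusters where

      record Clustering (J : Pt → Pt → Set) (K : ℕ) : Set₁ where
        field
          Cl        : Pt → Pt → Set
          cl-bor    : Bor₂ Cl
          cl-ball   : ∀ {y w} → Cl y w → Ball J K y w
          cl-centre : ∀ {y y′ w} → Cl y w → Cl y′ w → y ≡ y′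
          members   : Pt → List Pt
          mem-len   : ∀ y → length (members y) ≤ K
          mem-uniq  : ∀ y → Unique (members y)
          ∈-members : ∀ {y w} → Cl y w → w ∈ members y × length (members y) ≡ K
          members-∈ : ∀ {y w} → w ∈ members y → Cl y w
          dense     : ∀ v → ∃[ y ] ∃[ w ] (Star J v y × Cl y w)

      module _ (𝓖 : LocalGraph) (K : ℕ) (0<K : 0 < K)
        (large : ∀ x → AtLeastN K (Star (LocalGraph.J 𝓖) x))
        (t : ℕ) (parts : Partition t (LocalGraph.J 𝓖) ((K + K) + (K + K)))
        where
        open LocalGraph 𝓖
        open Partition parts

        private
          N = K + K

          IsCentre : (Pt → ℕ) → Pt → Set
          IsCentre c y = c y ≡ 1

          -- With centres more than N = 2K apart, their balls of radius K are disjoint, and the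
          -- clusters can be chosen inside these balls independently of each other.
          Separated : (Pt → ℕ) → Pt → Set
          Separated c x = ∀ y → Ball J N x y → IsCentre c x → IsCentre c y → x ≡ y

          Covered : (Pt → ℕ) → Pt → Set
          Covered c x = ∃[ y ] (IsCentre c y × Ball J N x y)

          Grows : (Pt → ℕ) → (Pt → ℕ) → Set
          Grows c c′ = ∀ {x} → IsCentre c x → IsCentre c′ x

          add : (Pt → ℕ) → Pt → Pt → ℕ
          add c x y with em {x ≡ y}
          ... | yes _ = 1
          ... | no _  = c y

          add-new : ∀ c x → IsCentre (add c x) x
          add-new c x with em {x ≡ x}
          ... | yes _ = refl
          ... | no ne = ⊥-elim (ne refl)

          add-old : ∀ c x → Grows c (add c x)
          add-old c x {y} e with em {x ≡ y}
          ... | yes _ = refl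
          ... | no _  = e

          add-only : ∀ c x {y} → IsCentre (add c x) y → x ≡ y ⊎ IsCentre c y
          add-only c x {y} e with em {x ≡ y}
          ... | yes p = inj₁ p
          ... | no _  = inj₂ e

          -- The greedy construction of a maximal separated set within one finite class: an
          -- uncovered point can be added without violating separation.
          fill : ∀ (P : Pt → Set) c → (∀ x → Separated c x) → ∀ ys →
                 Σ (Pt → ℕ) λ c′ → (∀ x → Separated c′ x) × Grows c c′ × (∀ w → c′ w ≢ c w → P w) ×
                                   (∀ y → y ∈ ys → P y → Covered c′ y)
          fill P c sep [] = c , sep , id , (λ w ne → ⊥-elim (ne refl)) , λ y ()
          fill P c sep (y ∷ ys) with fill P c sep ys
          ... | c′ , sep′ , g , ch , cov with em {P y × ¬ Covered c′ y}
          ... | no old = c′ , sep′ , g , ch , λ { z (here refl) p → dne (λ n → old (p , n)) ; z (there i) p → cov z i p }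
          ... | yes (py , unc) = add c′ y , sep″ , (λ e → add-old c′ y (g e)) , ch″ ,
              λ { z (here refl) p → z , add-new c′ z , ball-refl N
                ; z (there i) p → let (v , e , b) = cov z i p in v , add-old c′ y e , b }
            where
            sep″ : ∀ x → Separated (add c′ y) x
            sep″ x z b cx cz with add-only c′ y cx | add-only c′ y cz
            ... | inj₁ refl | inj₁ refl = refl
            ... | inj₁ refl | inj₂ cz′  = ⊥-elim (unc (z , cz′ , b))
            ... | inj₂ cx′  | inj₁ refl = ⊥-elim (unc (x , cx′ , ball-sym J-sym N b))
            ... | inj₂ cx′  | inj₂ cz′  = sep′ x z b cx′ cz′
            ch″ : ∀ w → add c′ y w ≢ c w → P w
            ch″ w ne with em {y ≡ w}
            ... | yes refl = py
            ... | no _     = ch w ne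

          record Centres (i : ℕ) : Set₁ where
            field
              c     : Pt → ℕ
              c-bor : BorelLabel c
              sep   : ∀ x → Separated c x
              cover : ∀ x → ι x < i → Covered c x

          module _ (i : ℕ) (C : Centres i) where
            open Centres C
            private
              U : Pred Pt 0ℓ
              U x = ι x ≡ i
              open Stage 𝓖 U (ι-bor i) 0 N z≤n
              Φ : (Pt → ℕ) → Pt → Set
              Φ c′ x = Covered c′ x × Separated c′ x × (IsCentre c x → IsCentre c′ x)
              Φ-bor : ∀ φ → BorelFamily φ → ∀ u → Measurable (λ x → Φ (φ x) (at u x))
              Φ-bor φ φb u = m-×
                (m-∃~ (λ {x} (_ , b) → ~-trans (at-~ u x) (ball-~ J-~ N b))
                      (λ k → m-× (φb (mv k) 1) (bor-Ball J-~ J-bor N u (mv k))))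
                (m-× (m-∀~ (λ {x} h → dne λ ¬r → h λ b → ⊥-elim (¬r (~-trans (at-~ u x) (ball-~ J-~ N b))))
                           (λ k → m-→ (bor-Ball J-~ J-bor N u (mv k)) (m-→ (φb u 1) (m-→ (φb (mv k) 1) (bor-≡ u (mv k))))))
                     (m-→ (at-m u (c-bor 1)) (φb u 1)))
              Φ-local : ∀ {c₁ c₂ x} → (∀ w → Ball J N x w → c₁ w ≡ c₂ w) → Φ c₁ x → Φ c₂ x
              Φ-local {x = x} e ((y , cy , b) , s , g) =
                (y , trans (sym (e y b)) cy , b) ,
                (λ z bz cx cz → s z bz (trans (e x (ball-refl N)) cx) (trans (e z bz) cz)) ,
                λ cx → trans (sym (e x (ball-refl N))) (g cx)
              solve : ∀ x → U x → Σ (Pt → ℕ) λ c′ → (∀ w → c′ w ≢ c w → Zone x w) × (∀ y → Class x y → Φ c′ y)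
              solve x ux with finite i x
              ... | ys , in-ys with fill (Class x) c sep ys
              ... | c′ , sep′ , g , ch , cov = c′ , (λ w ne → w , ch w ne , refl) ,
                    λ y r → cov y (in-ys r) r , sep′ y , g
            next-centres : Centres (suc i)
            next-centres = finish (stage (finite i) c c-bor Φ Φ-bor Φ-local solve)
              where
              finish : Σ (Pt → ℕ) (λ c′ → BorelLabel c′ × (∀ x → U x → Φ c′ x) ×
                         (∀ w → c′ w ≢ c w → ∃[ y ] (U y × Ball J 0 y w))) → Centres (suc i)
              finish (c′ , c′-bor , good , change) = record
                { c = c′ ; c-bor = c′-bor ; sep = λ x y b → sep″ x y b em em ; cover = cover″ }
                where
                same : ∀ {x} → ¬ U x → c′ x ≡ c x
                same {x} ¬u = dne λ ne → let (y , uy , e) = change x ne in ¬u (subst U e uy)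
                grows : ∀ {x} → Dec (U x) → IsCentre c x → IsCentre c′ x
                grows {x} (yes u) e = proj₂ (proj₂ (good x u)) e
                grows {x} (no ¬u) e = trans (same ¬u) e
                sep″ : ∀ x y → Ball J N x y → Dec (U x) → Dec (U y) → IsCentre c′ x → IsCentre c′ y → x ≡ y
                sep″ x y b (yes u) _ cx cy = proj₁ (proj₂ (good x u)) y b cx cy
                sep″ x y b _ (yes u) cx cy = sym (proj₁ (proj₂ (good y u)) x (ball-sym J-sym N b) cy cx)
                sep″ x y b (no ¬u) (no ¬v) cx cy = sep x y b (trans (sym (same ¬u)) cx) (trans (sym (same ¬v)) cy)
                cover″ : ∀ x → ι x < suc i → Covered c′ x
                cover″ x (s≤s le) = go (ℕₚ.m≤n⇒m<n∨m≡n le)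
                  where
                  go : ι x < i ⊎ ι x ≡ i → Covered c′ x
                  go (inj₂ e)  = proj₁ (good x e)
                  go (inj₁ lt) = let (y , cy , b) = cover x lt in y , grows em cy , b

          centres : ∀ i → Centres i
          centres zero = record
            { c = λ _ → 0 ; c-bor = λ l → m-const (0 ≡ l) ; sep = λ x y b () ; cover = λ x () }
          centres (suc i) = next-centres i (centres i)

          exit : ∀ {zs y x} → Star J y x → y ∈ zs → x ∉ zs → ∃[ u ] ∃[ v ] (u ∈ zs × J u v × v ∉ zs)
          exit Star.ε i n = ⊥-elim (n i)
          exit {zs} (_◅_ {j = z} e r) i n with em {z ∈ zs}
          ... | yes j = exit r j n
          ... | no nj = _ , z , i , e , nj

          -- While fewer than K points are known, the component has a point outside, and a path to
          -- it leaves the known set at a new neighbour. Thus each unit of radius yields a point.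
          ball-large : ∀ y j → j < K → ∃[ zs ] (length zs ≡ suc j × Unique zs × All (Ball J j y) zs × y ∈ zs)
          ball-large y zero _ = y ∷ [] , refl , [] ∷ [] , refl ∷ [] , here refl
          ball-large y (suc j) lt with ball-large y j (ℕₚ.<-trans (ℕₚ.n<1+n j) lt) | large y
          ... | zs , e , u , a , i | xs , ex , ux , ax
            with pigeonhole {xs = xs} {zs} ux (subst₂ _<_ (sym e) (sym ex) lt)
          ... | x , ix , nx with exit (All.lookup ax ix) i nx
          ... | p , v , ip , pv , nv = v ∷ zs , cong suc e , ∉-unique nv u ,
            subst (λ k → Ball J k y v) (ℕₚ.+-comm j 1) (ball-trans j (All.lookup a ip) (ball-edge {J = J} pv)) ∷
            All.map (ball-mono (ℕₚ.n≤1+n j)) a , there i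

          -- The cluster of a centre y consists of the first K points of its ball in the
          -- enumeration of the component of y.
          Seen : ℕ → Pt → Pt → Set
          Seen m y w = Ball J K y w × (∃[ j ] (j < m × move (enum j) y ≡ w))

          Full : ℕ → Pt → Set
          Full m y = AtLeastN K (Seen m y)

          FirstFull : ℕ → Pt → Set
          FirstFull m y = Full m y × (∀ j → j < m → ¬ Full j y)

          full-∃ : ∀ y → ∃[ m ] Full m y
          full-∃ y with ball-large y (ℕ.pred K) (ℕₚ.≤-reflexive (ℕₚ.suc-pred K {{ℕ.>-nonZero 0<K}}))
          ... | zs , e , u , a , _ with bounded zs (All.map (ball-~ J-~ _) a)
            where
            bounded : ∀ zs → All (y ~_) zs → ∃[ m ] (∀ {w} → w ∈ zs → ∃[ j ] (j < m × move (enum j) y ≡ w))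
            bounded [] [] = 0 , λ ()
            bounded (z ∷ zs) (r ∷ rs) with bounded zs rs | reach r
            ... | m , h | i , refl with onto i
            ... | j , refl = m + suc j , λ
              { (here refl) → j , ℕₚ.m≤n+m (suc j) m , refl
              ; (there k) → let (j′ , lt , e) = h k in j′ , ℕₚ.<-≤-trans lt (ℕₚ.m≤m+n m _) , e }
          ... | m , h = m , zs , trans e (ℕₚ.suc-pred K {{ℕ.>-nonZero 0<K}}) , u ,
                All.tabulate λ i → ball-mono (ℕₚ.pred[n]≤n {K}) (All.lookup a i) , h i

          module _ (C : Centres t) where
            open Centres C

            Cl : Pt → Pt → Set
            Cl y w = IsCentre c y × (∃[ m ] (FirstFull m y × Seen m y w))

            private
              -- Each step of the enumeration shows at most one new point. If more than K were seen
              -- at the first full stage, the stage before would have been full.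
              inside : ∀ {y zs} → length zs ≡ K → Unique zs → ∀ m → All (Seen m y) zs →
                       (∀ j → j < m → ¬ Full j y) → ∀ {w} → Seen m y w → w ∈ zs
              inside e u zero    a l (_ , _ , () , _)
              inside {y} {zs} e u (suc m) a l {w} s = dne λ n → l m ℕₚ.≤-refl
                (atLeast-remove (move (enum m) y) (w ∷ zs , cong suc e , ∉-unique n u , split s ∷ All.map split a))
                where
                split : ∀ {z} → Seen (suc m) y z → Seen m y z ⊎ z ≡ move (enum m) y
                split (b , j , s≤s le , refl) with ℕₚ.m≤n⇒m<n∨m≡n le
                ... | inj₁ lt   = inj₁ (b , j , lt , refl)
                ... | inj₂ refl = inj₂ refl

              cl-list′ : ∀ y → Dec (IsCentre c y) →
                         ∃[ zs ] (length zs ≤ K × Unique zs × (IsCentre c y → length zs ≡ K) ×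
                                  (∀ {w} → Cl y w → w ∈ zs) × (∀ {w} → w ∈ zs → Cl y w))
              cl-list′ y (no n) = [] , z≤n , [] , (λ cy → ⊥-elim (n cy)) , (λ (cy , _) → ⊥-elim (n cy)) , λ ()
              cl-list′ y (yes cy) with least (λ m → Full m y) (proj₂ (full-∃ y))
              ... | m , full@(zs , e , u , a) , l = zs , ℕₚ.≤-reflexive e , u , (λ _ → e) ,
                    (λ { (_ , m′ , (f′ , l′) , s) →
                      inside e u m a l (subst (λ m → Seen m y _) (least-unique (λ m → Full m y) f′ l′ full l) s) }) ,
                    λ i → cy , m , (full , l) , All.lookup a i

            cl-list : ∀ y → ∃[ zs ] (length zs ≤ K × Unique zs × (IsCentre c y → length zs ≡ K) ×
                                     (∀ {w} → Cl y w → w ∈ zs) × (∀ {w} → w ∈ zs → Cl y w))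
            cl-list y = cl-list′ y em

            private
              seen-bor : ∀ m → Bor₂ (Seen m)
              seen-bor m u v = m-× (bor-Ball J-~ J-bor K u v)
                (m-∃ λ j → m-× (m-const _) (bor-≡ (u then mv (enum j)) v))

              full-bor : ∀ m → Measurable (Full m)
              full-bor m = m-AtLeastN K (λ (b , _) → ball-~ J-~ K b) (λ k → seen-bor m self (mv k))

            make : Clustering J K
            make = record
              { Cl        = Cl
              ; cl-bor    = λ u v → m-× (at-m u (c-bor 1)) (m-∃ λ m → m-×
                  (at-m u (m-× (full-bor m) (m-∀ λ j → m-→ (m-const _) (m-¬ (full-bor j))))) (seen-bor m u v))
              ; cl-ball   = λ (_ , _ , _ , b , _) → b
              ; cl-centre = λ {y} {y′} (cy , _ , _ , b , _) (cy′ , _ , _ , b′ , _) →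
                  sep y y′ (ball-trans K b (ball-sym J-sym K b′)) cy cy′
              ; members   = λ y → proj₁ (cl-list y)
              ; mem-len   = λ y → proj₁ (proj₂ (cl-list y))
              ; mem-uniq  = λ y → proj₁ (proj₂ (proj₂ (cl-list y)))
              ; ∈-members = λ {y} r → proj₁ (proj₂ (proj₂ (proj₂ (proj₂ (cl-list y))))) r ,
                                      proj₁ (proj₂ (proj₂ (proj₂ (cl-list y)))) (proj₁ r)
              ; members-∈ = λ {y} → proj₂ (proj₂ (proj₂ (proj₂ (proj₂ (cl-list y)))))
              ; dense     = λ v →
                  let (y , cy , b) = cover v (ι< v)
                      (w , i) = nonempty (subst (0 <_) (sym (proj₁ (proj₂ (proj₂ (proj₂ (cl-list y)))) cy)) 0<K)
                  in y , w , ball-star N b , proj₂ (proj₂ (proj₂ (proj₂ (proj₂ (cl-list y))))) i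
              }
              where
              nonempty : ∀ {zs : List Pt} → 0 < length zs → ∃[ w ] w ∈ zs
              nonempty {z ∷ zs} _ = z , here refl

        abstract
          clustering : Clustering J K
          clustering = make (centres t)

    open Clusters

    -- The graph of clusters

    record Setting : Set₁ where
      field
        A        : Pt → Pt → Set
        A-sym    : ∀ {x y} → A x y → A y x
        A-irrefl : ∀ {x} → ¬ A x x
        A-~      : ∀ {x y} → A x y → x ~ y
        A-bor    : Bor₂ A
        Δ        : ℕ
        nbA      : Pt → List Pt
        nbA-all  : ∀ {x y} → A x y → y ∈ nbA x
        nbA-len  : ∀ x → length (nbA x) ≤ Δ
        J₂       : Pt → Pt → Set
        J₂-~     : ∀ {x y} → J₂ x y → x ~ y
        K        : ℕ
        0<K      : 0 < K
        clusters : Clustering J₂ K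

    module OnSetting (𝓢 : Setting) where
      open Setting 𝓢 public
      open Clustering clusters public

      cl-~ : ∀ {y w} → Cl y w → y ~ w
      cl-~ c = ball-~ J₂-~ K (cl-ball c)

      Clustered : Pt → Set
      Clustered x = ∃[ y ] Cl y x

      Same : Pt → Pt → Set
      Same x x′ = ∃[ y ] (Cl y x × Cl y x′)

      same-sym : ∀ {x y} → Same x y → Same y x
      same-sym (c , p , q) = c , q , p

      same-trans : ∀ {x y z} → Same x y → Same y z → Same x z
      same-trans (c , p , q) (c′ , p′ , q′) with cl-centre q p′
      ... | refl = c , p , q′

      same-refl : ∀ {x} → Clustered x → Same x x
      same-refl (c , p) = c , p , p

      same-~ : ∀ {x y} → Same x y → x ~ y
      same-~ (c , p , q) = ~-trans (~-sym (cl-~ p)) (cl-~ q)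

      clusteredʳ : ∀ {x y} → Same x y → Clustered y
      clusteredʳ (c , _ , q) = c , q

      clustered-bor : Measurable Clustered
      clustered-bor = m-∃~ (λ c → ~-sym (cl-~ c)) (λ k → cl-bor (mv k) self)

      same-bor : Bor₂ Same
      same-bor u v = m-∃~ (λ {x} (p , _) → ~-trans (at-~ u x) (~-sym (cl-~ p)))
        (λ k → m-× (cl-bor (mv k) u) (cl-bor (mv k) v))

      -- Adjacency of clusters without a quotient: a walk alternates between moves inside a cluster
      -- and `A`-edges to other clusters, so that adjacent clusters contain points at distance 1.
      J : Pt → Pt → Set
      J x x′ = Same x x′ ⊎ (Clustered x × Clustered x′ × A x x′)

      J-sym : ∀ {x y} → J x y → J y x
      J-sym (inj₁ s)           = inj₁ (same-sym s)
      J-sym (inj₂ (p , q , a)) = inj₂ (q , p , A-sym a)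

      J-~ : ∀ {x y} → J x y → x ~ y
      J-~ (inj₁ s)           = same-~ s
      J-~ (inj₂ (_ , _ , a)) = A-~ a

      private
        mates′ : ∀ x → Dec (Clustered x) → List Pt
        mates′ x (yes (y , _)) = members y
        mates′ x (no _)        = []

      mates : Pt → List Pt
      mates x = mates′ x em

      mates-unique : ∀ x → Unique (mates x)
      mates-unique x = go em
        where
        go : ∀ d → Unique (mates′ x d)
        go (yes (y , _)) = mem-uniq y
        go (no _)        = []

      mates-len : ∀ x → length (mates x) ≤ K
      mates-len x = go em
        where
        go : ∀ d → length (mates′ x d) ≤ K
        go (yes (y , _)) = mem-len y
        go (no _)        = z≤n

      mates-K : ∀ {x} → Clustered x → length (mates x) ≡ K
      mates-K {x} c = go em
        where
        go : ∀ d → length (mates′ x d) ≡ K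
        go (yes (y , p)) = proj₂ (∈-members p)
        go (no n)        = ⊥-elim (n c)

      ∈-mates : ∀ {x z} → Same x z → z ∈ mates x
      ∈-mates {x} {z} (c , p , q) = go em
        where
        go : ∀ d → z ∈ mates′ x d
        go (yes (y , p′)) = proj₁ (∈-members (subst (λ y → Cl y z) (cl-centre p p′) q))
        go (no n)         = ⊥-elim (n (c , p))

      mates-∈ : ∀ {x z} → z ∈ mates x → Same x z
      mates-∈ {x} {z} = go em
        where
        go : ∀ d → z ∈ mates′ x d → Same x z
        go (yes (y , p)) i = y , p , members-∈ i

      -- The degree of J is at most K + Δ.
      G : ℕ
      G = suc (K + Δ)

      nbJ : Pt → List Pt
      nbJ x = mates x ++ nbA x

      nbJ-all : ∀ {x y} → J x y → y ∈ nbJ x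
      nbJ-all (inj₁ s)               = ∈-++⁺ˡ (∈-mates s)
      nbJ-all {x} (inj₂ (_ , _ , a)) = ∈-++⁺ʳ (mates x) (nbA-all a)

      nbJ-len : ∀ x → length (nbJ x) ≤ K + Δ
      nbJ-len x = subst (_≤ K + Δ) (sym (Lₚ.length-++ (mates x))) (ℕₚ.+-mono-≤ (mates-len x) (nbA-len x))

      𝓙 : LocalGraph
      𝓙 = record
        { J = J ; J-sym = J-sym ; J-~ = J-~
        ; J-bor = λ u v → m-⊎ (same-bor u v)
            (m-× (at-m u clustered-bor) (m-× (at-m v clustered-bor) (A-bor u v)))
        ; nb = nbJ ; nb-all = nbJ-all }

      open BallList nbJ nbJ-all public

      ball-len : ∀ n x → length (ballList n x) ≤ G ℕ.^ n
      ball-len = length-ballList nbJ-len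

      degree : ∀ y {xs} → Unique xs → length (keep (λ z → A y z) xs) ≤ Δ
      degree y {xs} u = ℕₚ.≤-trans
        (unique-length (keep-unique u) (λ i → nbA-all (proj₂ (∈-keep⁻ xs i)))) (nbA-len y)

      module Process (k-1 g : ℕ) (0<g : 0 < g) (0<Δ : 0 < Δ) (k≡ : suc k-1 ≡ 64 * Δ)
                     (K≡ : K ≡ 4 * (suc k-1 * g)) (n M : ℕ) where

        module Random where
          open Tails {Pt} k-1

          -- Random activation

          -- A quarter of a cluster, by K = 4kg, and sixteen times the expected number of killed
          -- vertices.
          quarter : ℕ
          quarter = k * g

          -- The active vertices are those with label 0.
          Killed : (Pt → ℕ) → Pt → Set
          Killed c x = ∃[ y ] (A x y × Clustered y × ¬ Same x y × c y ≡ 0)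

          Hurt : (Pt → ℕ) → Pt → Set
          Hurt c x = AtLeastN quarter (λ z → Same x z × Killed c z)

          Available : (Pt → ℕ) → Pt → Set
          Available c x = c x ≡ 0 × ¬ Killed c x

          -- The clause `¬ Hurt` only depends on labels outside the cluster. Given those labels it
          -- leaves three quarters of the cluster unkilled, and the remaining randomness is that of
          -- the cluster's own labels.
          Stuck : (Pt → ℕ) → Pt → Set
          Stuck c x = ¬ Hurt c x × ¬ (∃[ z ] (Same x z × Available c z))

          Failing : (Pt → ℕ) → Pt → Set
          Failing c x = Clustered x × (Hurt c x ⊎ Stuck c x)

          private
            Outside : Pt → Pt → Set
            Outside x y = ¬ Same x y × Clustered y

            killed-local : ∀ x {c c′ z} → (∀ y → A z y × Outside x y → c y ≡ c′ y) → Same x z → Killed c z → Killed c′ z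
            killed-local x h s (y , a , q , ns , e) =
              y , a , q , ns , trans (sym (h y (a , (λ s′ → ns (same-trans (same-sym s) s′)) , q))) e

            hurt-outside : ∀ x {c c′} → (∀ y → Outside x y → c y ≡ c′ y) → Hurt c x → Hurt c′ x
            hurt-outside x h = atLeast-mono λ (s , kz) → s , killed-local x (λ y (_ , o) → h y o) s kz

            out-ball : ∀ {x y z} → Same x z → A z y → Clustered y → Ball J 2 x y
            out-ball s a q = inj₂ (_ , inj₁ s , inj₂ (_ , inj₂ (clusteredʳ s , q , a) , refl))

          failing-local : ∀ x → (λ c → Failing c x) LocalOn Ball J 2 x
          failing-local x {c} {c′} h (q , f) = q , go f
            where
            kl : ∀ {c c′ z} → (∀ y → Ball J 2 x y → c y ≡ c′ y) → Same x z → Killed c z → Killed c′ z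
            kl h s = killed-local x (λ y (a , _ , q) → h y (out-ball s a q)) s
            hl : ∀ {c c′} → (∀ y → Ball J 2 x y → c y ≡ c′ y) → Hurt c x → Hurt c′ x
            hl h = atLeast-mono λ (s , kz) → s , kl h s kz
            h′ : ∀ y → Ball J 2 x y → c′ y ≡ c y
            h′ y b = sym (h y b)
            go : Hurt c x ⊎ Stuck c x → Hurt c′ x ⊎ Stuck c′ x
            go (inj₁ hurt) = inj₁ (hl h hurt)
            go (inj₂ (nh , none)) = inj₂ ((λ hurt → nh (hl h′ hurt)) , λ (z , s , e , nk) →
              none (z , s , trans (h z (ball-mono {m = 1} (s≤s z≤n) (ball-edge {J = J} (inj₁ s)))) e , λ kz → nk (kl h s kz)))

          module Bound (x : Pt) (q : Clustered x) (xs : List Pt) (u : Unique xs)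
                       (covers : ∀ {y} → Ball J 2 x y → y ∈ xs) where
            private
              Hit : Pt → Pt → Set
              Hit y z = A y z × Outside x y

              -- The number of vertices in the cluster of x that y kills when active. Counting edges
              -- from the side of the cluster bounds the sum by KΔ, see `few`.
              e : Pt → ℕ
              e y = length (keep (Hit y) (mates x))

              e≤Δ : ∀ y → e y ≤ Δ
              e≤Δ y = ℕₚ.≤-trans (unique-length (keep-unique (mates-unique x))
                (λ i → nbA-all (proj₁ (proj₂ (∈-keep⁻ (mates x) i))))) (nbA-len y)

              open Weighted Δ 0<Δ e e≤Δ

              sum-0 : ∀ (ys : List Pt) → sumL ys (λ _ → 0) ≡ 0
              sum-0 []       = refl
              sum-0 (_ ∷ ys) = sum-0 ys

              sum-+ : ∀ (ys : List Pt) (F H : Pt → ℕ) → sumL ys (λ y → F y + H y) ≡ sumL ys F + sumL ys H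
              sum-+ []       F H = refl
              sum-+ (y ∷ ys) F H = trans (cong (F y + H y +_) (sum-+ ys F H)) (middle (F y) (H y) (sumL ys F) (sumL ys H))
                where
                middle : ∀ a b c d → (a + b) + (c + d) ≡ (a + c) + (b + d)
                middle = solve-∀

              sum-𝟙 : ∀ (P : Pt → Set) ys → sumL ys (λ y → 𝟙 (P y)) ≡ length (keep P ys)
              sum-𝟙 P [] = refl
              sum-𝟙 P (y ∷ ys) with em {P y}
              ... | yes _ = cong suc (sum-𝟙 P ys)
              ... | no _  = sum-𝟙 P ys

              keep-cons : ∀ (P : Pt → Set) z zs → length (keep P (z ∷ zs)) ≡ 𝟙 (P z) + length (keep P zs)
              keep-cons P z zs with em {P z}
              ... | yes _ = refl
              ... | no _  = refl

              edges : ∀ M → sumL xs (λ y → length (keep (Hit y) M)) ≤ length M * Δ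
              edges [] = ℕₚ.≤-reflexive (sum-0 xs)
              edges (z ∷ M) = begin
                sumL xs (λ y → length (keep (Hit y) (z ∷ M)))
                  ≤⟨ sumL-mono xs (λ y _ → ℕₚ.≤-reflexive (keep-cons (Hit y) z M)) ⟩
                sumL xs (λ y → 𝟙 (Hit y z) + length (keep (Hit y) M))
                  ≡⟨ sum-+ xs (λ y → 𝟙 (Hit y z)) (λ y → length (keep (Hit y) M)) ⟩
                sumL xs (λ y → 𝟙 (Hit y z)) + sumL xs (λ y → length (keep (Hit y) M))
                  ≤⟨ ℕₚ.+-mono-≤ (ℕₚ.≤-trans (sumL-mono xs (λ y _ → 𝟙-mono λ (a , _) → A-sym a))
                       (ℕₚ.≤-trans (ℕₚ.≤-reflexive (sum-𝟙 (A z) xs)) (degree z u))) (edges M) ⟩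
                Δ + length M * Δ ∎
                where open ℕₚ.≤-Reasoning

              few : sumL xs e ≤ 4 * (k * g) * Δ
              few = ℕₚ.≤-trans (edges (mates x))
                (ℕₚ.*-monoˡ-≤ Δ (ℕₚ.≤-trans (mates-len x) (ℕₚ.≤-reflexive K≡)))

              victims : (Pt → ℕ) → Pt → List Pt
              victims c y with em {c y ≡ 0}
              ... | yes _ = keep (Hit y) (mates x)
              ... | no _  = []

              victims-len : ∀ c ys → length (concatMap (victims c) ys) ≡ sumL ys (gain c)
              victims-len c [] = refl
              victims-len c (y ∷ ys) = trans (Lₚ.length-++ (victims c y)) (cong₂ _+_ each (victims-len c ys))
                where
                each : length (victims c y) ≡ gain c y
                each with em {c y ≡ 0}
                ... | yes _ = refl
                ... | no _  = refl

              hurt-weight : ∀ c → Hurt c x → quarter ≤ weight xs c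
              hurt-weight c (zs , len , uz , a) = subst₂ _≤_ len (victims-len c xs)
                (unique-length uz λ {z} i → found z (All.lookup a i))
                where
                victim : ∀ {y z} → c y ≡ 0 → z ∈ keep (Hit y) (mates x) → z ∈ victims c y
                victim {y} e₀ i with em {c y ≡ 0}
                ... | yes _ = i
                ... | no n  = ⊥-elim (n e₀)
                found : ∀ z → Same x z × Killed c z → z ∈ concatMap (victims c) xs
                found z (s , y , ay , qy , ns , e₀) = ∈-concatMap⁺ (victims c) (lose
                  (covers (out-ball s ay qy))
                  (victim e₀ (∈-keep⁺ (mates x) (∈-mates s)
                    (A-sym ay , (λ s′ → ns (same-trans (same-sym s) s′)) , qy))))

              hurt-rare : ∀ f → # xs (λ c → Hurt c x) f * 2 ℕ.^ (24 * g) ≤ total xs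
              hurt-rare f = ℕₚ.≤-trans
                (ℕₚ.*-monoˡ-≤ (2 ℕ.^ (24 * g)) (#-mono xs hurt-weight f))
                (TailBound.tail Δ 0<Δ e e≤Δ k≡ xs u g few f)

              out inn : List Pt
              out = keep (λ y → ¬ Same x y) xs
              inn = keep (Same x) xs

              partition : ∀ (P : Pt → Set) ys → ys ↭ keep (λ y → ¬ P y) ys ++ keep P ys
              partition P [] = ↭-refl
              partition P (y ∷ ys) with em {P y} | em {¬ P y}
              ... | yes p | yes np = ⊥-elim (np p)
              ... | yes p | no _   = ↭-trans (prep y (partition P ys)) (↭-sym (Permₚ.shift y (keep (λ y → ¬ P y) ys) (keep P ys)))
              ... | no np | yes _  = prep y (partition P ys)
              ... | no np | no nnp = ⊥-elim (nnp np)

              halving : ∀ n → 2 ℕ.^ n * k-1 ℕ.^ (k * n) ≤ k ℕ.^ (k * n)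
              halving n = begin
                2 ℕ.^ n * k-1 ℕ.^ (k * n)      ≡⟨ cong (2 ℕ.^ n *_) (sym (ℕₚ.^-*-assoc k-1 k n)) ⟩
                2 ℕ.^ n * (k-1 ℕ.^ k) ℕ.^ n    ≡⟨ pow-* 2 (k-1 ℕ.^ k) n ⟨
                (2 * k-1 ℕ.^ k) ℕ.^ n          ≤⟨ ℕₚ.^-monoˡ-≤ n (two k-1 1≤k-1) ⟩
                (k ℕ.^ k) ℕ.^ n                ≡⟨ ℕₚ.^-*-assoc k k n ⟩
                k ℕ.^ (k * n)                  ∎
                where
                open ℕₚ.≤-Reasoning
                1≤k-1 : 1 ≤ k-1
                1≤k-1 = ℕ.s≤s⁻¹ (ℕₚ.≤-trans (ℕₚ.*-mono-≤ {2} {64} (s≤s (s≤s z≤n)) 0<Δ) (ℕₚ.≤-reflexive (sym k≡)))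
                two : ∀ p → 1 ≤ p → 2 * p ℕ.^ suc p ≤ suc p ℕ.^ suc p
                two (suc p) _ = double-pred p

              -- Fixing the labels outside the cluster fixes which of its vertices are killed.
              -- Unless the cluster is hurt, at least 3kg are not, and all of these must be
              -- inactive: probability (1 - 1/k)^(3kg) ≤ 2^(-3g).
              inner : ∀ f → # inn (λ c → Stuck c x) f * 2 ℕ.^ (3 * g) ≤ total inn
              inner f with em {Hurt f x}
              ... | yes hurt = ℕₚ.≤-trans (ℕₚ.*-monoˡ-≤ (2 ℕ.^ (3 * g)) none) z≤n
                where
                none : # inn (λ c → Stuck c x) f ≤ 0
                none = ℕₚ.≤-trans (E-mono-on inn {G = λ _ → 0} λ c ag → ℕₚ.≤-reflexive (𝟙-no λ (nh , _) →
                    nh (hurt-outside x (λ y (ns , _) → sym (ag y (λ i → ns (proj₂ (∈-keep⁻ xs i))))) hurt)))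
                  (ℕₚ.≤-reflexive (trans (E-const inn 0 f) (ℕₚ.*-zeroʳ (total inn))))
              ... | no unhurt = ℕₚ.*-cancelʳ-≤ _ _ (k ℕ.^ l) {{ℕ.>-nonZero (ℕₚ.m^n>0 k l)}} (begin
                  # inn (λ c → Stuck c x) f * 2 ℕ.^ (3 * g) * k ℕ.^ l
                    ≤⟨ ℕₚ.*-monoˡ-≤ (k ℕ.^ l) (ℕₚ.*-monoˡ-≤ (2 ℕ.^ (3 * g)) (E-mono-on inn λ c ag → 𝟙-mono (off c ag))) ⟩
                  N * 2 ℕ.^ (3 * g) * k ℕ.^ l                  ≡⟨ arith₁ N (2 ℕ.^ (3 * g)) (k ℕ.^ l) ⟩
                  N * k ℕ.^ l * 2 ℕ.^ (3 * g)                  ≤⟨ ℕₚ.*-monoˡ-≤ (2 ℕ.^ (3 * g)) (nonzero Un inn (keep-unique u) f) ⟩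
                  k-1 ℕ.^ l * total inn * 2 ℕ.^ (3 * g)        ≡⟨ arith₂ (k-1 ℕ.^ l) (total inn) (2 ℕ.^ (3 * g)) ⟩
                  total inn * (2 ℕ.^ (3 * g) * k-1 ℕ.^ l)      ≤⟨ ℕₚ.*-monoʳ-≤ (total inn) powers ⟩
                  total inn * k ℕ.^ l                          ∎)
                where
                open ℕₚ.≤-Reasoning
                Un : Pt → Set
                Un z = ¬ Killed f z
                l = length (keep Un inn)
                N = # inn (λ c → ∀ y → y ∈ inn → Un y → c y ≢ 0) f
                arith₁ : ∀ a b c → a * b * c ≡ a * c * b
                arith₁ = solve-∀
                arith₂ : ∀ a b c → a * b * c ≡ b * (c * a)
                arith₂ = solve-∀
                off : ∀ c → (∀ y → y ∉ inn → c y ≡ f y) → Stuck c x → ∀ y → y ∈ inn → Un y → c y ≢ 0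
                off c ag (_ , none) y i uy e₀ = none (y , s , e₀ , λ kc → uy (killed-local x
                    (λ v (_ , ns , _) → ag v (λ j → ns (proj₂ (∈-keep⁻ xs j)))) s kc))
                  where
                  s : Same x y
                  s = proj₂ (∈-keep⁻ xs i)
                long : k * (3 * g) ≤ l
                long = ℕₚ.+-cancelˡ-≤ (k * g) (k * (3 * g)) l (begin
                  k * g + k * (3 * g)                     ≡⟨ arith₃ k g ⟩
                  4 * (k * g)                             ≡⟨ sym (trans (mates-K q) K≡) ⟩
                  length (mates x)                        ≤⟨ ℕₚ.<⇒≤ (atLeast-or (k * g) (Killed f) (mates-unique x)
                                                               (λ h → unhurt (atLeast-mono (λ (i , kz) → mates-∈ i , kz) h))) ⟩
                  k * g + length (keep Un (mates x))      ≤⟨ ℕₚ.+-monoʳ-≤ (k * g) (unique-length (keep-unique (mates-unique x)) sub) ⟩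
                  k * g + l                               ∎)
                  where
                  arith₃ : ∀ k g → k * g + k * (3 * g) ≡ 4 * (k * g)
                  arith₃ = solve-∀
                  sub : ∀ {z} → z ∈ keep Un (mates x) → z ∈ keep Un inn
                  sub i = let (j , uz) = ∈-keep⁻ (mates x) i
                              s = mates-∈ j
                          in ∈-keep⁺ inn (∈-keep⁺ xs (covers (ball-mono {m = 1} (s≤s z≤n) (ball-edge {J = J} (inj₁ s)))) s) uz
                powers : 2 ℕ.^ (3 * g) * k-1 ℕ.^ l ≤ k ℕ.^ l
                powers = begin
                  2 ℕ.^ (3 * g) * k-1 ℕ.^ l
                    ≡⟨ cong (λ i → 2 ℕ.^ (3 * g) * k-1 ℕ.^ i) (sym (ℕₚ.m+[n∸m]≡n long)) ⟩
                  2 ℕ.^ (3 * g) * k-1 ℕ.^ (k * (3 * g) + r)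
                    ≡⟨ cong (2 ℕ.^ (3 * g) *_) (ℕₚ.^-distribˡ-+-* k-1 (k * (3 * g)) r) ⟩
                  2 ℕ.^ (3 * g) * (k-1 ℕ.^ (k * (3 * g)) * k-1 ℕ.^ r)
                    ≡⟨ ℕₚ.*-assoc (2 ℕ.^ (3 * g)) _ _ ⟨
                  2 ℕ.^ (3 * g) * k-1 ℕ.^ (k * (3 * g)) * k-1 ℕ.^ r
                    ≤⟨ ℕₚ.*-mono-≤ (halving (3 * g)) (ℕₚ.^-monoˡ-≤ r (ℕₚ.n≤1+n k-1)) ⟩
                  k ℕ.^ (k * (3 * g)) * k ℕ.^ r
                    ≡⟨ trans (sym (ℕₚ.^-distribˡ-+-* k (k * (3 * g)) r)) (cong (k ℕ.^_) (ℕₚ.m+[n∸m]≡n long)) ⟩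
                  k ℕ.^ l ∎
                  where r = l ∸ k * (3 * g)

              stuck-ext : Ext (λ c → 𝟙 (Stuck c x))
              stuck-ext h = 𝟙-⇔ (λ st → go h st) (λ st → go (λ y t → sym (h y t)) st)
                where
                go : ∀ {c c′} → (∀ y → ⊤ → c y ≡ c′ y) → Stuck c x → Stuck c′ x
                go h (nh , none) = (λ hurt → nh (hurt-outside x (λ y _ → sym (h y tt)) hurt)) ,
                  λ (z , s , e₀ , nk) → none (z , s , trans (h z tt) e₀ , λ kz → nk (killed-local x (λ y _ → h y tt) s kz))

              stuck-rare : ∀ f → # xs (λ c → Stuck c x) f * 2 ℕ.^ (3 * g) ≤ total xs
              stuck-rare f = begin
                # xs St f * 2 ℕ.^ (3 * g)
                  ≡⟨ cong (_* 2 ℕ.^ (3 * g)) (trans (E-↭ stuck-ext split f) (E-++ out inn _ f)) ⟩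
                E out (# inn St) f * 2 ℕ.^ (3 * g)
                  ≡⟨ trans (ℕₚ.*-comm _ (2 ℕ.^ (3 * g))) (sym (E-* out (2 ℕ.^ (3 * g)) (# inn St) f)) ⟩
                E out (λ c → 2 ℕ.^ (3 * g) * # inn St c) f
                  ≤⟨ E-mono out (λ c → ℕₚ.≤-trans (ℕₚ.≤-reflexive (ℕₚ.*-comm (2 ℕ.^ (3 * g)) _)) (inner c)) f ⟩
                E out (λ _ → total inn) f                     ≡⟨ E-const out (total inn) f ⟩
                total out * total inn                         ≡⟨ sym (ℕₚ.^-distribˡ-+-* k (length out) (length inn)) ⟩
                k ℕ.^ (length out + length inn)               ≡⟨ cong (k ℕ.^_) (sym (trans (Permₚ.↭-length split) (Lₚ.length-++ out))) ⟩
                total xs                                      ∎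
                where
                open ℕₚ.≤-Reasoning
                St : (Pt → ℕ) → Set
                St c = Stuck c x
                split : xs ↭ out ++ inn
                split = partition (Same x) xs

            failing-rare : ∀ f → # xs (λ c → Failing c x) f * 2 ℕ.^ (2 * g) ≤ total xs
            failing-rare f = ℕₚ.*-cancelˡ-≤ 2 (begin
              2 * (# xs (λ c → Failing c x) f * 2 ℕ.^ (2 * g))
                ≤⟨ ℕₚ.*-monoʳ-≤ 2 (ℕₚ.*-monoˡ-≤ (2 ℕ.^ (2 * g)) bound) ⟩
              2 * ((h + s) * 2 ℕ.^ (2 * g))                    ≡⟨ arith h s (2 ℕ.^ (2 * g)) ⟩
              h * 2 ℕ.^ suc (2 * g) + s * 2 ℕ.^ suc (2 * g)
                ≤⟨ ℕₚ.+-mono-≤ (ℕₚ.*-monoʳ-≤ h (ℕₚ.^-monoʳ-≤ 2 (ℕₚ.≤-trans le (ℕₚ.*-monoˡ-≤ g {3} {24} (s≤s (s≤s (s≤s z≤n)))))))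
                               (ℕₚ.*-monoʳ-≤ s (ℕₚ.^-monoʳ-≤ 2 le)) ⟩
              h * 2 ℕ.^ (24 * g) + s * 2 ℕ.^ (3 * g)           ≤⟨ ℕₚ.+-mono-≤ (hurt-rare f) (stuck-rare f) ⟩
              total xs + total xs                              ≡⟨ cong (total xs +_) (sym (ℕₚ.+-identityʳ (total xs))) ⟩
              2 * total xs                                     ∎)
              where
              open ℕₚ.≤-Reasoning
              h = # xs (λ c → Hurt c x) f
              s = # xs (λ c → Stuck c x) f
              arith : ∀ h s p → 2 * ((h + s) * p) ≡ h * (2 * p) + s * (2 * p)
              arith = solve-∀
              le : suc (2 * g) ≤ 3 * g
              le = ℕₚ.+-monoˡ-≤ (2 * g) 0<g
              bound : # xs (λ c → Failing c x) f ≤ h + s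
              bound = ℕₚ.≤-trans
                (#-union xs {P = λ c → Failing c x} {Q = λ c → Hurt c x} (tt ∷ []) (λ _ c → Stuck c x)
                  (λ { c (_ , inj₁ hu) → inj₁ hu ; c (_ , inj₂ st) → inj₂ (tt , here refl , st) }) f)
                (ℕₚ.≤-reflexive (cong (h +_) (ℕₚ.+-identityʳ s)))

          -- Growth of the bad set

          -- The neighbours of failing clusters are included as a buffer: a failing cluster may
          -- already be hurt, and in this way none of its vertices is adjacent to a vertex chosen in
          -- a cluster that is not bad; see `few-dead`.
          Bad : (Pt → ℕ) → Pt → Set
          Bad c x = Clustered x × (Failing c x ⊎ (∃[ y ] (Same x y × (∃[ z ] (A y z × Failing c z)))))

          BadEdge : (Pt → ℕ) → Pt → Pt → Set
          BadEdge c x y = Bad c x × Bad c y × J x y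

          Reach : (Pt → ℕ) → ℕ → Pt → Pt → Set
          Reach c = Ball (BadEdge c)

          -- It limits the growth of the bad set in `n` steps and says nothing about the size of its
          -- components.
          Grow : (Pt → ℕ) → Pt → Set
          Grow c v = Bad c v × AtLeastN M (Reach c n v)

          bad-witness : ∀ {c x} → Bad c x → ∃[ z ] (Ball J 2 x z × Failing c z)
          bad-witness {x = x} (q , inj₁ f) = x , ball-refl 2 , f
          bad-witness (q , inj₂ (y , s , z , a , f)) =
            z , inj₂ (y , inj₁ s , inj₂ (z , inj₂ (clusteredʳ s , proj₁ f , a) , refl)) , f

          reach-bad : ∀ {c v y} m → Bad c v → Reach c m v y → Bad c y
          reach-bad zero    b refl                           = b
          reach-bad (suc m) b (inj₁ refl)                    = b
          reach-bad (suc m) b (inj₂ (z , (_ , bz , _) , r)) = reach-bad m bz r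

          reach-ball : ∀ {c v y} m → Reach c m v y → Ball J m v y
          reach-ball m = ball-map (λ (_ , _ , j) → j) m

          private
            bad-local : ∀ x → (λ c → Bad c x) LocalOn Ball J 4 x
            bad-local x h (q , inj₁ f) = q , inj₁ (failing-local x (λ y b → h y (ball-mono (s≤s (s≤s z≤n)) b)) f)
            bad-local x h (q , inj₂ (y , s , z , a , f)) = q , inj₂ (y , s , z , a , failing-local z
              (λ w b → h w (inj₂ (y , inj₁ s , inj₂ (z , inj₂ (clusteredʳ s , proj₁ f , a) , b)))) f)

            reach-local : ∀ m v y → (λ c → Reach c m v y) LocalOn Ball J (m + 4) v
            reach-local zero    v y h e        = e
            reach-local (suc m) v y h (inj₁ e) = inj₁ e
            reach-local (suc m) v y h (inj₂ (z , (bv , bz , j) , r)) = inj₂ (z ,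
              (bad-local v (λ w b → h w (ball-mono (ℕₚ.m≤n+m 4 (suc m)) b)) bv ,
               bad-local z (λ w b → h w (inj₂ (z , j , ball-mono (ℕₚ.m≤n+m 4 m) b))) bz , j) ,
              reach-local m z y (λ w b → h w (inj₂ (z , j , b))) r)

          ρ : ℕ
          ρ = n + 4

          grow-local : ∀ v → (λ c → Grow c v) LocalOn Ball J ρ v
          grow-local v h (b , many) =
            bad-local v (λ w r → h w (ball-mono (ℕₚ.m≤n+m 4 n) r)) b ,
            atLeast-mono (λ {y} → reach-local n v y h) many

          private
            -- Failing is decided within radius 2, so failures at distance more than 4 are
            -- independent.
            Far : Pt → Pt → Set
            Far x y = ¬ Ball J 4 x y

            far-sym : ∀ {x y} → Far x y → Far y x
            far-sym f b = f (ball-sym J-sym 4 b)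

            jump : Pt → ℕ → Pt
            jump x i = nth (ballList 9 x) i x

            -- A new mark lies within 9 of an old one: at most 4 to the failing witness of a stale
            -- point, 2 to that point, 1 to a fresh neighbour and 2 to its witness.
            a : ℕ
            a = G ℕ.^ 9

            jump-∈ : ∀ {x y} → Ball J 9 x y → ∃[ i ] (i < a × jump x i ≡ y)
            jump-∈ {x} b = let (i , lt , e) = nth-∈ x (∈-ballList 9 b)
                           in i , ℕₚ.<-≤-trans lt (ball-len 9 x) , e

            -- A word is a walk that starts at x, moves to the i-th point of the ball of
            -- radius 9 on reading just i, and marks its position on reading nothing.
            run : Pt → List (Maybe ℕ) → List Pt
            run x []             = []
            run x (nothing ∷ w)  = x ∷ run x w
            run x (just i ∷ w)   = run (jump x i) w

            cursor : Pt → List (Maybe ℕ) → Pt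
            cursor x []            = x
            cursor x (nothing ∷ w) = cursor x w
            cursor x (just i ∷ w)  = cursor (jump x i) w

            run-++ : ∀ x w w′ → run x (w ++ w′) ≡ run x w ++ run (cursor x w) w′
            run-++ x []            w′ = refl
            run-++ x (nothing ∷ w) w′ = cong (x ∷_) (run-++ x w w′)
            run-++ x (just i ∷ w)  w′ = run-++ (jump x i) w w′

            run-split : ∀ x w {u} → u ∈ run x w → ∃[ w₁ ] ∃[ w₂ ] (w ≡ w₁ ++ w₂ × cursor x w₁ ≡ u)
            run-split x (nothing ∷ w) (here refl) = [] , nothing ∷ w , refl , refl
            run-split x (nothing ∷ w) (there i) =
              let (w₁ , w₂ , e , e′) = run-split x w i in nothing ∷ w₁ , w₂ , cong (nothing ∷_) e , e′
            run-split x (just j ∷ w) i =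
              let (w₁ , w₂ , e , e′) = run-split (jump x j) w i in just j ∷ w₁ , w₂ , cong (just j ∷_) e , e′

            Good : (Pt → ℕ) → Pt → List Pt → Set
            Good c v T = AllPairs Far T × All (λ z → Ball J (n + 2) v z × Failing c z) T

            Word : (Pt → ℕ) → Pt → ℕ → Set
            Word c v j = ∃[ w ] (length w ≡ 3 * j × length (run v w) ≡ j × All (Letter a) w × Good c v (run v w))

            -- Three letters are inserted where the walk stands at the old mark: jump to `z`, mark
            -- it, jump back. The rest of the walk is unaffected, which gives the length 3j for j
            -- marks.
            extend : ∀ {c v w z} j → length w ≡ 3 * j → length (run v w) ≡ j → All (Letter a) w →
                     Good c v (run v w) →
                     All (Far z) (run v w) → Ball J (n + 2) v z → Failing c z →
                     ∀ w₁ w₂ → w ≡ w₁ ++ w₂ → Ball J 9 (cursor v w₁) z → Word c v (suc j)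
            extend {c} {v} {w} {z} j lw lr la (ap , al) far bz fz w₁ w₂ refl b9 = go (jump-∈ b9) (jump-∈ (ball-sym J-sym 9 b9))
              where
              go : ∃[ i ] (i < a × jump (cursor v w₁) i ≡ z) → ∃[ i ] (i < a × jump z i ≡ cursor v w₁) → Word c v (suc j)
              go (i , i<a , ei) (i′ , i′<a , ei′) = w₁ ++ just i ∷ nothing ∷ just i′ ∷ w₂ ,
                trans (Lₚ.length-++ w₁) (trans (add-three (length w₁) (length w₂)) (trans (cong (3 +_) (trans (sym (Lₚ.length-++ w₁)) lw)) (sym (ℕₚ.*-suc 3 j)))) ,
                trans (cong length run≡) (trans (Lₚ.length-++ (run v w₁)) (trans (ℕₚ.+-suc (length (run v w₁)) (length (run (cursor v w₁) w₂)))
                  (cong suc (trans (sym (trans (cong length (run-++ v w₁ w₂)) (Lₚ.length-++ (run v w₁)))) lr)))) ,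
                Allₚ.++⁺ (Allₚ.++⁻ˡ w₁ la) (i<a ∷ tt ∷ i′<a ∷ Allₚ.++⁻ʳ w₁ la) ,
                subst (Good c v) (sym run≡)
                  (allPairs-insert (λ {x} {y} → far-sym {x} {y}) (run v w₁) (run (cursor v w₁) w₂)
                    (subst (AllPairs Far) (run-++ v w₁ w₂) ap)
                    (subst (All (Far z)) (run-++ v w₁ w₂) far) ,
                   all-insert (run v w₁) (run (cursor v w₁) w₂) (bz , fz) (subst (All In) (run-++ v w₁ w₂) al))
                where
                In : Pt → Set
                In z = Ball J (n + 2) v z × Failing c z
                add-three : ∀ p q → p + (3 + q) ≡ 3 + (p + q)
                add-three = solve-∀
                tail : run (cursor v w₁) (just i ∷ nothing ∷ just i′ ∷ w₂) ≡ z ∷ run (cursor v w₁) w₂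
                tail = trans (cong (λ y → y ∷ run (jump y i′) w₂) ei) (cong (λ y → z ∷ run y w₂) ei′)
                run≡ : run v (w₁ ++ just i ∷ nothing ∷ just i′ ∷ w₂) ≡ run v w₁ ++ z ∷ run (cursor v w₁) w₂
                run≡ = trans (run-++ v w₁ (just i ∷ nothing ∷ just i′ ∷ w₂)) (cong (run v w₁ ++_) tail)

            module _ {c : Pt → ℕ} {v : Pt} (grow : Grow c v) (m : ℕ) (large : m * G ℕ.^ 6 < M) where
              private
                Fresh : List Pt → Pt → Set
                Fresh T p = ∃[ z ] (Ball J 2 p z × Failing c z × All (Far z) T)

                Near : List Pt → Pt → Set
                Near T p = ∃[ u ] (u ∈ T × Ball J 6 u p × (∀ q z → J p q → Ball J 2 q z → Ball J 9 u z))

                Exit : List Pt → Set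
                Exit T = ∃[ p ] ∃[ q ] (Bad c p × ¬ Fresh T p × J p q × Fresh T q × Ball J n v q)

              stale : ∀ T {p} → Bad c p → ¬ Fresh T p → Near T p
              stale T {p} b nf = go (bad-witness b)
                where
                go : ∃[ z ] (Ball J 2 p z × Failing c z) → Near T p
                go (z , bz , fz) = dne λ none → nf (z , bz , fz , All.tabulate λ {u} i zu →
                    none (u , i , ball-trans 4 (ball-sym J-sym 4 zu) (ball-sym J-sym 2 bz) ,
                      λ q z′ j b′ → ball-trans 4 (ball-sym J-sym 4 zu) (ball-trans 2 (ball-sym J-sym 2 bz) (inj₂ (q , j , b′)))))

              -- On a walk through bad points, the first fresh point has a stale predecessor. That
              -- one is close to a mark, so the next mark is within one jump of an old one.
              exit : ∀ T l d {p y} → Ball J d v p → d + l ≤ n → Bad c p → ¬ Fresh T p → Reach c l p y → Fresh T y → Exit T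
              exit T zero    d bp le b nf refl        f = ⊥-elim (nf f)
              exit T (suc l) d bp le b nf (inj₁ refl) f = ⊥-elim (nf f)
              exit T (suc l) d {p} bp le b nf (inj₂ (q , (_ , bq , j) , r)) f = go em
                where
                go : Dec (Fresh T q) → Exit T
                go (yes fq) = p , q , b , nf , j , fq , ball-mono (ℕₚ.≤-trans (ℕₚ.+-monoʳ-≤ d (s≤s z≤n)) le) (ball-trans d bp (ball-edge {J = J} j))
                go (no nfq) = exit T l (d + 1) (ball-trans d bp (ball-edge {J = J} j))
                    (subst (_≤ n) (sym (ℕₚ.+-assoc d 1 l)) le) bq nfq r f

              -- Stale points lie within 6 of a mark. Fewer than `m` balls of this radius cannot
              -- hold all `M` points reached.
              fresh-∃ : ∀ T → length T < m → ∃[ y ] (Reach c n v y × Fresh T y)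
              fresh-∃ T short = dne λ none → let (zs , len , u , al) = proj₂ grow in
                ℕₚ.<⇒≱ large (subst (_≤ m * G ℕ.^ 6) len (ℕₚ.≤-trans
                  (length-cover T (ballList 6) u (ball-len 6) λ i →
                    let r = All.lookup al i
                        (t , it , b , _) = stale T (reach-bad n (proj₁ grow) r) (λ f → none (_ , r , f))
                    in t , it , ∈-ballList 6 b)
                  (ℕₚ.*-monoˡ-≤ (G ℕ.^ 6) (ℕₚ.<⇒≤ short))))

              word : ∀ j → j ≤ m → Word c v j
              word zero    _  = [] , refl , refl , [] , [] , []
              word (suc j) lt = go (word j (ℕₚ.<⇒≤ lt))
                where
                go : Word c v j → Word c v (suc j)
                go (w , lw , lr , la , good) = start em
                  where
                  T = run v w
                  hop : ∃[ u ] (u ∈ T × (∃[ q ] ∃[ z ] (Ball J n v q × Ball J 2 q z × Failing c z × All (Far z) T × Ball J 9 u z))) →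
                        Word c v (suc j)
                  hop (u , iu , q , z , bq , bz , fz , far , b9) = split (run-split v w iu)
                    where
                    split : ∃[ w₁ ] ∃[ w₂ ] (w ≡ w₁ ++ w₂ × cursor v w₁ ≡ u) → Word c v (suc j)
                    split (w₁ , w₂ , e , e′) = extend {w = w} j lw lr la good far (ball-trans n bq bz) fz w₁ w₂ e
                      (subst (λ u → Ball J 9 u z) (sym e′) b9)
                  leave : Exit T → Word c v (suc j)
                  leave (p , q , bp , nfp , j′ , (z , bz , fz , far) , bq) =
                    let (u , iu , _ , h) = stale T bp nfp in hop (u , iu , q , z , bq , bz , fz , far , h q z j′ bz)
                  start : Dec (Fresh T v) → Word c v (suc j)
                  start (yes (z , b , f , far)) = extend {w = w} j lw lr la good far
                    (ball-mono (ℕₚ.m≤n+m 2 n) b) f [] w refl (ball-mono (s≤s (s≤s z≤n)) b)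
                  start (no nf) =
                    let (y , r , fy) = fresh-∃ T (subst (_< m) (sym lr) lt)
                    in leave (exit T n 0 refl ℕₚ.≤-refl (proj₁ grow) nf r fy)

            all-failing : ∀ {v} xs → Unique xs → (∀ {y} → Ball J ρ v y → y ∈ xs) → ∀ T →
                          AllPairs Far T → All (Ball J (n + 2) v) T → ∀ f →
                          # xs (λ c → All (Failing c) T) f * (2 ℕ.^ (2 * g)) ℕ.^ length T ≤ total xs
            all-failing xs u cov [] [] [] f = ℕₚ.≤-trans (ℕₚ.≤-reflexive (ℕₚ.*-identityʳ _))
              (ℕₚ.≤-trans (E-mono xs (λ c → 𝟙-mono {Q = ⊤} (λ _ → tt)) f)
                (ℕₚ.≤-reflexive (trans (E-cong xs (λ _ → 𝟙-yes tt) f) (trans (E-const xs 1 f) (ℕₚ.*-identityʳ (total xs))))))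
            all-failing {v} xs u cov (x ∷ T) (far ∷ ap) (bx ∷ al) f with em {Clustered x}
            ... | no nq = ℕₚ.≤-trans (ℕₚ.*-monoˡ-≤ _ none) z≤n
              where
              none : # xs (λ c → All (Failing c) (x ∷ T)) f ≤ 0
              none = ℕₚ.≤-trans (E-mono xs {G = λ _ → 0} (λ c → ℕₚ.≤-reflexive (𝟙-no λ { ((q , _) ∷ _) → nq q })) f)
                (ℕₚ.≤-reflexive (trans (E-const xs 0 f) (ℕₚ.*-zeroʳ (total xs))))
            ... | yes q = ℕₚ.*-cancelˡ-≤ (total xs) {{ℕ.>-nonZero (ℕₚ.m^n>0 k (length xs))}} (begin
                total xs * (# xs (λ c → All (Failing c) (x ∷ T)) f * (z * z ℕ.^ length T))
                  ≤⟨ ℕₚ.*-monoʳ-≤ (total xs) (ℕₚ.*-monoˡ-≤ (z * z ℕ.^ length T) (#-mono xs (λ { c (p ∷ ps) → p , ps }) f)) ⟩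
                total xs * (# xs (λ c → Failing c x × All (Failing c) T) f * (z * z ℕ.^ length T))
                  ≡⟨ sym (ℕₚ.*-assoc (total xs) _ _) ⟩
                total xs * # xs (λ c → Failing c x × All (Failing c) T) f * (z * z ℕ.^ length T)
                  ≡⟨ cong (_* (z * z ℕ.^ length T)) (#-independent xs (failing-local x) tail-local disjoint f) ⟩
                p * p′ * (z * z ℕ.^ length T)              ≡⟨ ℕₚ.[m*n]*[o*p]≡[m*o]*[n*p] p p′ z (z ℕ.^ length T) ⟩
                p * z * (p′ * z ℕ.^ length T)
                  ≤⟨ ℕₚ.*-mono-≤ (Bound.failing-rare x q xs u near f) (all-failing xs u cov T ap al f) ⟩
                total xs * total xs ∎)
              where
              open ℕₚ.≤-Reasoning
              z = 2 ℕ.^ (2 * g)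
              p = # xs (λ c → Failing c x) f
              p′ = # xs (λ c → All (Failing c) T) f
              near : ∀ {y} → Ball J 2 x y → y ∈ xs
              near {y} b = cov (subst (λ i → Ball J i v y) (ℕₚ.+-assoc n 2 2) (ball-trans (n + 2) bx b))
              tail-local : (λ c → All (Failing c) T) LocalOn (λ y → ∃[ x′ ] (x′ ∈ T × Ball J 2 x′ y))
              tail-local h al = All.tabulate λ {x′} i → failing-local x′ (λ y b → h y (x′ , i , b)) (All.lookup al i)
              disjoint : ∀ y → y ∈ xs → Ball J 2 x y → ¬ (∃[ x′ ] (x′ ∈ T × Ball J 2 x′ y))
              disjoint y _ b (x′ , i , b′) = All.lookup far i (ball-trans 2 b (ball-sym J-sym 2 b′))

          -- Each word contributes at most 2^(-2gm), by independence of far failures. `Λ` is the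
          -- margin left after the union bound, to be spent on derandomization.
          grow-rare : ∀ m Λ → m * G ℕ.^ 6 < M → suc (G ℕ.^ 9) ℕ.^ (3 * m) * Λ ≤ (2 ℕ.^ (2 * g)) ℕ.^ m →
                      ∀ {v} xs → Unique xs → (∀ {y} → Ball J ρ v y → y ∈ xs) → ∀ f →
                      # xs (λ c → Grow c v) f * Λ ≤ total xs
          grow-rare m Λ large strong {v} xs u cov f = ℕₚ.*-cancelʳ-≤ _ _ W {{ℕ.>-nonZero (ℕₚ.m^n>0 (suc a) (3 * m))}} (begin
              N * Λ * W                                   ≡⟨ arith₁ N Λ W ⟩
              N * (W * Λ)                                 ≤⟨ ℕₚ.*-monoʳ-≤ N strong ⟩
              N * Z                                       ≤⟨ ℕₚ.*-monoˡ-≤ Z bound ⟩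
              sumL ws (λ w → # xs (Event w) f) * Z        ≡⟨ trans (ℕₚ.*-comm _ Z) (sym (sumL-* Z ws _)) ⟩
              sumL ws (λ w → Z * # xs (Event w) f)        ≤⟨ sumL-≤ ws (λ w _ → each w) ⟩
              length ws * total xs                        ≤⟨ ℕₚ.*-monoˡ-≤ (total xs) (length-words a (3 * m)) ⟩
              W * total xs                                ≡⟨ ℕₚ.*-comm W (total xs) ⟩
              total xs * W                                ∎)
            where
            open ℕₚ.≤-Reasoning
            W = suc a ℕ.^ (3 * m)
            Z = (2 ℕ.^ (2 * g)) ℕ.^ m
            N = # xs (λ c → Grow c v) f
            ws = words a (3 * m)
            arith₁ : ∀ a b c → a * b * c ≡ a * (c * b)
            arith₁ = solve-∀
            Event : List (Maybe ℕ) → (Pt → ℕ) → Set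
            Event w c = length (run v w) ≡ m × AllPairs Far (run v w) × All (Ball J (n + 2) v) (run v w) × All (Failing c) (run v w)
            bound : N ≤ sumL ws (λ w → # xs (Event w) f)
            bound = ℕₚ.≤-trans (#-union xs {Q = λ _ → ⊥} ws Event (λ c gr → inj₂ (find c gr)) f)
              (ℕₚ.≤-reflexive (cong (_+ sumL ws (λ w → # xs (Event w) f))
                (trans (E-cong xs (λ _ → 𝟙-no {⊥} id) f) (trans (E-const xs 0 f) (ℕₚ.*-zeroʳ (total xs))))))
              where
              find : ∀ c → Grow c v → ∃[ w ] (w ∈ ws × Event w c)
              find c gr = go (word gr m large m ℕₚ.≤-refl)
                where
                go : Word c v m → ∃[ w ] (w ∈ ws × Event w c)
                go (w , lw , lr , la , ap , al) = w , subst (λ l → w ∈ words a l) lw (∈-words w la) ,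
                    lr , ap , All.map proj₁ al , All.map proj₂ al
            each : ∀ w → Z * # xs (Event w) f ≤ total xs
            each w with em {length (run v w) ≡ m × AllPairs Far (run v w) × All (Ball J (n + 2) v) (run v w)}
            ... | yes (lr , ap , al) = begin
              Z * # xs (Event w) f                           ≤⟨ ℕₚ.*-monoʳ-≤ Z (#-mono xs (λ c (_ , _ , _ , h) → h) f) ⟩
              Z * # xs (λ c → All (Failing c) (run v w)) f   ≡⟨ ℕₚ.*-comm Z _ ⟩
              # xs (λ c → All (Failing c) (run v w)) f * Z   ≡⟨ cong (λ i → # xs (λ c → All (Failing c) (run v w)) f * (2 ℕ.^ (2 * g)) ℕ.^ i) (sym lr) ⟩
              # xs (λ c → All (Failing c) (run v w)) f * (2 ℕ.^ (2 * g)) ℕ.^ length (run v w)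
                ≤⟨ all-failing xs u cov (run v w) ap al f ⟩
              total xs ∎
            ... | no bad = begin
              Z * # xs (Event w) f   ≤⟨ ℕₚ.*-monoʳ-≤ Z (E-mono xs {G = λ _ → 0} (λ c → ℕₚ.≤-reflexive (𝟙-no λ (p , q , r , _) → bad (p , q , r))) f) ⟩
              Z * E xs (λ _ → 0) f   ≡⟨ trans (cong (Z *_) (trans (E-const xs 0 f) (ℕₚ.*-zeroʳ (total xs)))) (ℕₚ.*-zeroʳ Z) ⟩
              0                      ≤⟨ z≤n ⟩
              total xs               ∎

          -- Derandomization

          -- Single Borel labellings are not enough: in a stage, the candidate labelling is built
          -- from the point at which a code is read and varies with it.
          Definable₁ : ((Pt → ℕ) → Pt → Set) → Set₁
          Definable₁ P = ∀ φ → BorelFamily φ → ∀ u → Measurable (λ x → P (φ x) (at u x))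

          Definable₂ : ((Pt → ℕ) → Pt → Pt → Set) → Set₁
          Definable₂ R = ∀ φ → BorelFamily φ → ∀ u v → Measurable (λ x → R (φ x) (at u x) (at v x))

          private
            _∘~_ : ∀ (u : Term) {x y} → at u x ~ y → x ~ y
            u ∘~ r = ~-trans (at-~ u _) r

          killed-def : Definable₁ Killed
          killed-def φ b u = m-∃~ (λ (a , _) → u ∘~ A-~ a) (λ k → m-× (A-bor u (mv k))
            (m-× (at-m (mv k) clustered-bor) (m-× (m-¬ (same-bor u (mv k))) (b (mv k) 0))))

          hurt-def : Definable₁ Hurt
          hurt-def φ b u = m-AtLeastN quarter (λ (s , _) → u ∘~ same-~ s)
            (λ k → m-× (same-bor u (mv k)) (killed-def φ b (mv k)))

          available-def : Definable₁ Available
          available-def φ b u = m-× (b u 0) (m-¬ (killed-def φ b u))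

          failing-def : Definable₁ Failing
          failing-def φ b u = m-× (at-m u clustered-bor) (m-⊎ (hurt-def φ b u)
            (m-× (m-¬ (hurt-def φ b u)) (m-¬ (m-∃~ (λ (s , _) → u ∘~ same-~ s)
              (λ k → m-× (same-bor u (mv k)) (available-def φ b (mv k)))))))

          bad-def : Definable₁ Bad
          bad-def φ b u = m-× (at-m u clustered-bor) (m-⊎ (failing-def φ b u)
            (m-∃~ (λ (s , _) → u ∘~ same-~ s) (λ k → m-× (same-bor u (mv k))
              (m-∃~ (λ (a , _) → mv k ∘~ A-~ a) (λ l → m-× (A-bor (mv k) (mv l)) (failing-def φ b (mv l)))))))

          reach-def : ∀ m → Definable₂ (λ c → Reach c m)
          reach-def zero    φ b u v = bor-≡ u v
          reach-def (suc m) φ b u v = m-⊎ (bor-≡ u v) (m-∃~ (λ ((_ , _ , j) , _) → u ∘~ J-~ j)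
            (λ k → m-× (m-× (bad-def φ b u) (m-× (bad-def φ b (mv k)) (LocalGraph.J-bor 𝓙 u (mv k))))
                       (reach-def m φ b (mv k) v)))

          grow-def : Definable₁ Grow
          grow-def φ b u = m-× (bad-def φ b u) (m-AtLeastN M (λ r → u ∘~ ball-~ J-~ n (reach-ball n r))
            (λ k → reach-def n φ b u (mv k)))

          private
            BorelCount : (Pt → ℕ) → Set₁
            BorelCount h = ∀ j → Measurable (λ x → h x ≡ j)

            count-+ : ∀ {h h′} → BorelCount h → BorelCount h′ → BorelCount (λ x → h x + h′ x)
            count-+ {h} {h′} b b′ j = m-iff (λ { x ((p , q) , refl , refl , e) → e }) (λ x e → (h x , h′ x) , refl , refl , e)
              (m-∃ {I = ℕ × ℕ} λ (p , q) → m-× (b p) (m-× (b′ q) (m-const (p + q ≡ j))))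

            count-sumTo : ∀ l {H : ℕ → Pt → ℕ} → (∀ a → BorelCount (H a)) → BorelCount (λ x → sumTo l (λ a → H a x))
            count-sumTo zero    b j = m-const (0 ≡ j)
            count-sumTo (suc l) b   = count-+ (count-sumTo l b) (b l)

            choose-bor : ∀ {P : Pt → Set} {h h′ : Pt → ℕ} → Measurable P → BorelCount h → BorelCount h′ →
                         BorelCount (λ x → choose (em {P x}) (h x) (h′ x))
            choose-bor {P} {h} {h′} mP b b′ j = m-iff (λ x → to em) (λ x → from em)
              (m-⊎ (m-× mP (b j)) (m-× (m-¬ mP) (b′ j)))
              where
              to : ∀ {x} (d : Dec (P x)) → (P x × h x ≡ j) ⊎ (¬ P x × h′ x ≡ j) → choose d (h x) (h′ x) ≡ j
              to (yes p) (inj₁ (_ , e))  = e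
              to (yes p) (inj₂ (np , _)) = ⊥-elim (np p)
              to (no np) (inj₁ (p , _))  = ⊥-elim (np p)
              to (no np) (inj₂ (_ , e))  = e
              from : ∀ {x} (d : Dec (P x)) → choose d (h x) (h′ x) ≡ j → (P x × h x ≡ j) ⊎ (¬ P x × h′ x ≡ j)
              from (yes p) e = inj₁ (p , e)
              from (no np) e = inj₂ (np , e)

            update-bor : ∀ {φ} → BorelFamily φ → ∀ v a → BorelFamily (λ x → φ x [ at v x ≔ a ])
            update-bor b v a u = choose-bor (bor-≡ v u) (λ j → m-const (a ≡ j)) (b u)

            count-bor : ∀ {P} → Definable₁ P → ∀ u ks φ → BorelFamily φ →
                        BorelCount (λ x → # (moves ks x) (λ c → P c (at u x)) (φ x))
            count-bor {P} d u []       φ b = choose-bor (d φ b u) (λ j → m-const (1 ≡ j)) (λ j → m-const (0 ≡ j))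
            count-bor {P} d u (l ∷ ks) φ b = count-sumTo k λ a → count-bor {P} d u ks (λ x → φ x [ move l x ≔ a ]) (update-bor {φ} b (mv l) a)

          module _ (t : ℕ) (parts : Partition t J ((ρ + ρ) + (ρ + ρ))) where
            open Partition parts

            Open : ℕ → Pt → Pt → Set
            Open i v y = Ball J ρ v y × i ≤ ι y

            Exactly : ℕ → Pt → List Pt → Set
            Exactly i v ys = Unique ys × All (Open i v) ys × (∀ y → Open i v y → y ∈ ys)

            -- After the labels of the parts below i have been chosen, at most one in Λ of the
            -- extensions makes the bad set grow at v.
            Safe : ℕ → ℕ → (Pt → ℕ) → Pt → Set
            Safe i Λ c v = ∃[ ys ] (Exactly i v ys × # ys (λ c → Grow c v) c * Λ ≤ total ys)

            private
              exact : ∀ (P : Pt → Set) v → (∀ {y} → P y → Ball J ρ v y) →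
                      ∃[ ys ] (Unique ys × All P ys × (∀ y → P y → y ∈ ys))
              exact P v h = keep P (nub (ballList ρ v)) , keep-unique (nub-unique (ballList ρ v)) ,
                All.tabulate (λ i → proj₂ (∈-keep⁻ (nub (ballList ρ v)) i)) ,
                λ y p → ∈-keep⁺ (nub (ballList ρ v)) (∈-nub⁺ (ballList ρ v) (∈-ballList ρ (h p))) p

              same-list : ∀ {xs ys : List Pt} → Unique xs → Unique ys → (∀ {x} → x ∈ xs → x ∈ ys) →
                          (∀ {x} → x ∈ ys → x ∈ xs) → xs ↭ ys
              same-list u u′ f f′ = ∼bag⇒↭ (unique∧set⇒bag u u′ (mk⇔ f f′))

              E-irrelevant : ∀ xs {F D} → F DependsOn D → (∀ y → y ∈ xs → ¬ D y) → ∀ f → E xs F f ≡ total xs * F f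
              E-irrelevant []       d h f = sym (ℕₚ.*-identityˡ _)
              E-irrelevant (x ∷ xs) {F} d h f = trans (E-skip x xs d (h x (here refl)) f)
                (trans (cong (k *_) (E-irrelevant xs d (λ y i → h y (there i)) f)) (sym (ℕₚ.*-assoc k (total xs) (F f))))

              grow-dep : ∀ v → (λ c → 𝟙 (Grow c v)) DependsOn Ball J ρ v
              grow-dep v = local-dep (grow-local v)

              safe-local : ∀ i Λ v → (λ c → Safe i Λ c v) LocalOn Ball J ρ v
              safe-local i Λ v h (ys , ex , le) = ys , ex , subst (λ p → p * Λ ≤ total ys)
                (E-dep ys (grow-dep v) (λ y b _ → h y b)) le

              safe-def : ∀ i Λ → Definable₁ (Safe i Λ)
              safe-def i Λ φ b u = m-∃L (λ ((_ , al , _) , _) → All.map (λ (r , _) → u ∘~ ball-~ J-~ ρ r) al)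
                λ ks → m-× (m-× (m-Unique ks) (m-× (m-All ks open-bor)
                  (m-∀~ (λ h → dne λ ¬r → h λ (r , _) → ⊥-elim (¬r (u ∘~ ball-~ J-~ ρ r)))
                        (λ l → m-→ (open-bor l) (m-∈ l ks)))))
                  (m-iff (λ { x (j , refl , le) → subst (λ l → j * Λ ≤ k ℕ.^ l) (sym (Lₚ.length-map (λ k → move k x) ks)) le })
                         (λ x le → h ks x , refl , subst (λ l → h ks x * Λ ≤ k ℕ.^ l) (Lₚ.length-map (λ k → move k x) ks) le)
                         (m-∃ λ j → m-× (count-bor {Grow} grow-def u ks φ b j) (m-const (j * Λ ≤ k ℕ.^ length ks))))
                where
                h : List (List ℕ) → Pt → ℕ
                h ks x = # (moves ks x) (λ c → Grow c (at u x)) (φ x)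
                open-bor : ∀ l → Measurable (λ x → Open i (at u x) (move l x))
                open-bor l = m-× (bor-Ball J-~ (LocalGraph.J-bor 𝓙) ρ u (mv l))
                  (m-iff (λ { x (j , refl , le) → le }) (λ x le → ι (move l x) , refl , le)
                    (m-∃ λ j → m-× (at-m (mv l) (ι-bor j)) (m-const (i ≤ j))))

              d : ℕ
              d = G ℕ.^ (ρ + ρ)

            record State (i Λ : ℕ) : Set₁ where
              field
                c     : Pt → ℕ
                c-bor : BorelLabel c
                safe  : ∀ v → Safe i Λ c v

            private
              module Step (i Λ : ℕ) (0<Λ : 0 < Λ) (s : State i (4 * d * Λ)) where
                open State s

                U : Pred Pt 0ℓ
                U x = ι x ≡ i

                -- Only labels in the part itself change, hence 0. The condition at x concerns all v
                -- within ρ, whose safety is again decided within ρ.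
                open Stage 𝓙 U (ι-bor i) 0 (ρ + ρ) z≤n

                Φ : (Pt → ℕ) → Pt → Set
                Φ c′ x = ∀ v → Ball J ρ x v → Safe (suc i) Λ c′ v

                Φ-bor : ∀ φ → BorelFamily φ → ∀ u → Measurable (λ x → Φ (φ x) (at u x))
                Φ-bor φ b u = m-∀~ (λ h → dne λ ¬r → h λ r → ⊥-elim (¬r (u ∘~ ball-~ J-~ ρ r)))
                  (λ l → m-→ (bor-Ball J-~ (LocalGraph.J-bor 𝓙) ρ u (mv l)) (safe-def (suc i) Λ φ b (mv l)))

                Φ-local : ∀ {c₁ c₂ x} → (∀ w → Ball J (ρ + ρ) x w → c₁ w ≡ c₂ w) → Φ c₁ x → Φ c₂ x
                Φ-local h f v b = safe-local (suc i) Λ v (λ y b′ → h y (ball-trans ρ b b′)) (f v b)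

                module Solve (x : Pt) (ux : U x) (ys : List Pt) (in-ys : ∀ {y} → Class x y → y ∈ ys) where

                  xs : List Pt
                  xs = keep (Class x) (nub ys)

                  xs-unique : Unique xs
                  xs-unique = keep-unique (nub-unique ys)

                  ∈-xs : ∀ {y} → Class x y → y ∈ xs
                  ∈-xs r = ∈-keep⁺ (nub ys) (∈-nub⁺ ys (in-ys r)) r

                  xs-∈ : ∀ {y} → y ∈ xs → Class x y
                  xs-∈ i = proj₂ (∈-keep⁻ (nub ys) i)

                  Ok : Pt → Set
                  Ok v = ∃[ y ] (Class x y × Ball J ρ y v)

                  Risky : Pt → (Pt → ℕ) → Set
                  Risky v c′ = ¬ Safe (suc i) Λ c′ v

                  risky-local : ∀ v → Risky v LocalOn Ball J ρ v
                  risky-local v h ns sf = ns (safe-local (suc i) Λ v (λ y b → sym (h y b)) sf)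

                  -- Markov's inequality. Averaged over the labels of the current class, the
                  -- conditional probability of growth at v is at most 1/(4dΛ); so it exceeds 1/Λ
                  -- with probability at most 1/4d, the bound required by the local lemma.
                  rare : ∀ v → Ok v → 4 * d * # xs (Risky v) c ≤ total xs
                  rare v (y₀ , r₀ , b₀) with safe v
                                           | exact (Open (suc i) v) v proj₁
                                           | exact (λ y → Ball J ρ v y × U y) v proj₁
                  ... | zs , (uz , az , iz) , le | later , ul , al , il | now , un , an , inow =
                      ℕₚ.*-cancelʳ-≤ _ _ T {{ℕ.>-nonZero (ℕₚ.m^n>0 k (length later))}} (begin
                    4 * d * # xs (Risky v) c * T              ≡⟨ ℕₚ.*-assoc (4 * d) _ T ⟩
                    4 * d * (# xs (Risky v) c * T)            ≤⟨ ℕₚ.*-monoʳ-≤ (4 * d) markov ⟩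
                    4 * d * (Λ * E xs H c)                     ≡⟨ cong (λ e → 4 * d * (Λ * e)) marginal ⟩
                    4 * d * (Λ * (total rest * E now H c))     ≡⟨ arith d Λ (total rest) (E now H c) ⟩
                    total rest * (E now H c * (4 * d * Λ))     ≤⟨ ℕₚ.*-monoʳ-≤ (total rest) before ⟩
                    total rest * (total now * T)               ≡⟨ ℕₚ.*-assoc (total rest) (total now) T ⟨
                    total rest * total now * T                 ≡⟨ cong (_* T) xs-total ⟩
                    total xs * T                               ∎)
                    where
                    open ℕₚ.≤-Reasoning
                    T = total later
                    F : (Pt → ℕ) → ℕ
                    F c = 𝟙 (Grow c v)
                    H : (Pt → ℕ) → ℕ
                    H = E later F
                    rest : List Pt
                    rest = keep (λ y → y ∉ now) xs
                    arith : ∀ d Λ r e → 4 * d * (Λ * (r * e)) ≡ r * (e * (4 * d * Λ))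
                    arith = solve-∀
                    H-dep : H DependsOn (λ y → Ball J ρ v y × y ∉ later)
                    H-dep = E-depends later (grow-dep v)
                    markov : # xs (Risky v) c * T ≤ Λ * E xs H c
                    markov = ℕₚ.≤-trans (ℕₚ.≤-reflexive (trans (ℕₚ.*-comm _ T) (sym (E-* xs T _ c))))
                      (ℕₚ.≤-trans (E-mono xs each c) (ℕₚ.≤-reflexive (E-* xs Λ H c)))
                      where
                      each : ∀ g → T * 𝟙 (Risky v g) ≤ Λ * H g
                      each g with em {Risky v g}
                      ... | no _ = ℕₚ.≤-trans (ℕₚ.≤-reflexive (ℕₚ.*-zeroʳ T)) z≤n
                      ... | yes ns = ℕₚ.≤-trans (ℕₚ.≤-reflexive (ℕₚ.*-identityʳ T)) (ℕₚ.≤-trans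
                            (ℕₚ.<⇒≤ (ℕₚ.≰⇒> λ small → ns (later , (ul , al , il) , small))) (ℕₚ.≤-reflexive (ℕₚ.*-comm (H g) Λ)))
                    -- All labels of the current part that matter at v belong to the class of x,
                    -- since two such points are within 2ρ of each other. The average over the class
                    -- is therefore the average over `now`.
                    now⊆xs : ∀ {y} → y ∈ now → y ∈ xs
                    now⊆xs i = let (b , uy) = All.lookup an i
                               in ∈-xs (r₀ ◅◅ ((class-U ux r₀ , uy , ball-mono (ℕₚ.m≤m+n (ρ + ρ) _) (ball-trans ρ b₀ b)) ◅ Star.ε))
                    split : xs ↭ rest ++ now
                    split = same-list xs-unique
                      (Uniqueₚ.++⁺ (keep-unique xs-unique) un (λ (j , j′) → proj₂ (∈-keep⁻ xs j) j′))
                      (λ {y} j → cases y j em)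
                      (λ j → [ (λ j → proj₁ (∈-keep⁻ xs j)) , now⊆xs ]′ (∈-++⁻ rest j))
                      where
                      cases : ∀ y → y ∈ xs → Dec (y ∈ now) → y ∈ rest ++ now
                      cases y j (yes j′) = ∈-++⁺ʳ rest j′
                      cases y j (no n)   = ∈-++⁺ˡ (∈-keep⁺ xs j n)
                    marginal : E xs H c ≡ total rest * E now H c
                    marginal = trans (E-↭ (dep-ext H-dep) split c) (trans (E-++ rest now H c)
                      (E-irrelevant rest (E-depends now H-dep) (λ y j ((b , _) , y∉) →
                        y∉ (inow y (b , class-U ux (xs-∈ (proj₁ (∈-keep⁻ xs j)))))) c))
                    undecided : zs ↭ now ++ later
                    undecided = same-list uz
                      (Uniqueₚ.++⁺ un ul (λ (j , j′) → ℕₚ.<-irrefl refl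
                        (subst (i <_) (proj₂ (All.lookup an j)) (proj₂ (All.lookup al j′)))))
                      (λ j → let (b , i≤) = All.lookup az j in cases b (ℕₚ.m≤n⇒m<n∨m≡n i≤))
                      (λ j → [ (λ j → let (b , e) = All.lookup an j in iz _ (b , ℕₚ.≤-reflexive (sym e))) ,
                               (λ j → let (b , l) = All.lookup al j in iz _ (b , ℕₚ.<⇒≤ l)) ]′ (∈-++⁻ now j))
                      where
                      cases : ∀ {y} → Ball J ρ v y → i < ι y ⊎ i ≡ ι y → y ∈ now ++ later
                      cases b (inj₁ l) = ∈-++⁺ʳ now (il _ (b , l))
                      cases b (inj₂ e) = ∈-++⁺ˡ (inow _ (b , sym e))
                    before : E now H c * (4 * d * Λ) ≤ total now * T
                    before = subst₂ (λ e p → e * (4 * d * Λ) ≤ p)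
                      (trans (E-↭ (dep-ext (grow-dep v)) undecided c) (E-++ now later F c))
                      (trans (cong (k ℕ.^_) (trans (Permₚ.↭-length undecided) (Lₚ.length-++ now)))
                             (ℕₚ.^-distribˡ-+-* k (length now) (length later))) le
                    xs-total : total rest * total now ≡ total xs
                    xs-total = trans (sym (ℕₚ.^-distribˡ-+-* k (length rest) (length now)))
                      (cong (k ℕ.^_) (sym (trans (Permₚ.↭-length split) (Lₚ.length-++ rest))))

                  events : List Pt
                  events = keep Ok (concatMap (ballList ρ) ys)

                  open LocalLemma {Ev = Pt} (s≤s z≤n) xs c d (ℕₚ.m^n>0 G (ρ + ρ)) Ok Risky (Ball J ρ) risky-local
                    (ballList (ρ + ρ)) (ball-len (ρ + ρ))
                    (λ _ _ _ b b′ → ∈-ballList (ρ + ρ) (ball-trans ρ b (ball-sym J-sym ρ b′))) rare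

                  solution : Σ (Pt → ℕ) λ c′ → (∀ w → c′ w ≢ c w → Zone x w) × (∀ y → Class x y → Φ c′ y)
                  solution =
                    let (c′ , avoid , out , _) = local-lemma events (All.tabulate λ j → proj₂ (∈-keep⁻ (concatMap (ballList ρ) ys) j))
                    in c′ , (λ w ne → w , xs-∈ (dne λ w∉ → ne (out w w∉)) , refl) ,
                       λ y r v b → dne (avoid v (∈-keep⁺ (concatMap (ballList ρ) ys)
                         (∈-concatMap⁺ (ballList ρ) (lose (in-ys r) (∈-ballList ρ b))) (y , r , b)))

                next : State (suc i) Λ
                next = finish (stage (finite i) c c-bor Φ Φ-bor Φ-local
                         (λ x ux → Solve.solution x ux (proj₁ (finite i x)) (proj₂ (finite i x))))
                  where
                  finish : Σ (Pt → ℕ) (λ c′ → BorelLabel c′ × (∀ x → U x → Φ c′ x) ×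
                             (∀ w → c′ w ≢ c w → ∃[ y ] (U y × Ball J 0 y w))) → State (suc i) Λ
                  finish (c′ , c′-bor , good , change) = record { c = c′ ; c-bor = c′-bor ; safe = λ v → go v em }
                    where
                    go : ∀ v → Dec (∃[ x ] (U x × Ball J ρ v x)) → Safe (suc i) Λ c′ v
                    go v (yes (x , ux , b)) = good x ux v (ball-sym J-sym ρ b)
                    go v (no none) = keep-safe (safe v)
                      where
                      keep-safe : Safe i (4 * d * Λ) c v → Safe (suc i) Λ c′ v
                      keep-safe (ys , (u , al , il) , le) = ys ,
                        (u , All.map (λ {y} (b , l) → b , ℕₚ.≤∧≢⇒< l (λ e → none (y , sym e , b))) al ,
                         λ y (b , l) → il y (b , ℕₚ.<⇒≤ l)) ,
                        ℕₚ.≤-trans (ℕₚ.*-mono-≤ (ℕₚ.≤-reflexive (E-dep ys (grow-dep v)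
                            (λ y b _ → dne λ ne → let (z , uz , e) = change y ne in none (y , subst U e uz , b))))
                          (ℕₚ.≤-trans (ℕₚ.≤-reflexive (sym (ℕₚ.*-identityˡ Λ)))
                            (ℕₚ.*-monoˡ-≤ Λ (ℕₚ.*-mono-≤ {1} {4} (s≤s z≤n) (ℕₚ.m^n>0 G (ρ + ρ)))))) le

              iterate-steps : ∀ j i → i + j ≡ t → State i (2 * (4 * d) ℕ.^ j) → State t 2
              iterate-steps zero    i e s = subst (λ i → State i 2) (trans (sym (ℕₚ.+-identityʳ i)) e) s
              iterate-steps (suc j) i e s = iterate-steps j (suc i) (trans (sym (ℕₚ.+-suc i j)) e)
                (Step.next i (2 * (4 * d) ℕ.^ j) (ℕₚ.*-mono-< {0} {2} (s≤s z≤n) (ℕₚ.m^n>0 (4 * d) {{ℕ.>-nonZero 0<4d}} j))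
                  (subst (State i) (arith (4 * d) ((4 * d) ℕ.^ j)) s))
                where
                0<4d : 0 < 4 * d
                0<4d = ℕₚ.*-mono-< {0} {4} (s≤s z≤n) (ℕₚ.m^n>0 G (ρ + ρ))
                arith : ∀ x y → 2 * (x * y) ≡ x * (2 * y)
                arith = solve-∀

            activation : ∀ m → m * G ℕ.^ 6 < M →
              suc (G ℕ.^ 9) ℕ.^ (3 * m) * (2 * (4 * G ℕ.^ (ρ + ρ)) ℕ.^ t) ≤ (2 ℕ.^ (2 * g)) ℕ.^ m →
              Σ (Pt → ℕ) λ c → BorelLabel c × (∀ v → ¬ Grow c v)
            activation m large strong = finish (iterate-steps t 0 refl start)
              where
              start : State 0 (2 * (4 * d) ℕ.^ t)
              start = record
                { c = λ _ → 0 ; c-bor = λ l → m-const (0 ≡ l)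
                ; safe = λ v → let (ys , u , al , il) = exact (Open 0 v) v proj₁
                               in ys , (u , al , il) ,
                                  grow-rare m (2 * (4 * d) ℕ.^ t) large strong ys u (λ b → il _ (b , z≤n)) (λ _ → 0)
                }
              finish : State t 2 → Σ (Pt → ℕ) λ c → BorelLabel c × (∀ v → ¬ Grow c v)
              finish s = c , c-bor , λ v → none v (safe v)
                where
                open State s
                none : ∀ v → Safe t 2 c v → ¬ Grow c v
                -- No label is open any more, so the conditional probability is 0 or 1, and the
                -- final margin 2 excludes 1.
                none v ([] , _ , le) gr = ℕₚ.<⇒≱ (s≤s (s≤s z≤n)) (subst (λ i → i * 2 ≤ 1) (𝟙-yes gr) le)
                none v (y ∷ ys , (_ , (_ , t≤) ∷ _ , _) , _) gr = ℕₚ.<⇒≱ (ι< y) t≤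

        open Random

        -- The choice of a vertex in each cluster
        module Picks (r : ℕ) (r≤n : twice r ≤ n) (M≤ : M ≤ (64 * g) ℕ.^ r) where

          module _ (c : Pt → ℕ) (c-bor : BorelLabel c) (no-growth : ∀ v → ¬ Grow c v)
                   (t : ℕ) (parts : Partition t J ((n + 3) + (n + 3))) where
            open Partition parts

            private
              c-family : BorelFamily (λ _ → c)
              c-family u l = at-m u (c-bor l)

              0<quarter : 0 < quarter
              0<quarter = ℕₚ.*-mono-< {0} {suc k-1} {0} {g} (s≤s z≤n) 0<g

              failing-same : ∀ {x y} → Same x y → Failing c x → Failing c y
              failing-same s (q , f) = clusteredʳ s , go f
                where
                hurt : Hurt c _ → Hurt c _
                hurt = atLeast-mono λ (s′ , kz) → same-trans (same-sym s) s′ , kz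
                go : _ → _
                go (inj₁ h) = inj₁ (hurt h)
                go (inj₂ (nh , none)) = inj₂
                  ((λ h → nh (atLeast-mono (λ (s′ , kz) → same-trans s s′ , kz) h)) ,
                   λ (z , s′ , av) → none (z , same-trans s s′ , av))

              bad-same : ∀ {x y} → Same x y → Bad c x → Bad c y
              bad-same s (q , inj₁ f)            = clusteredʳ s , inj₁ (failing-same s f)
              bad-same s (q , inj₂ (y , s′ , h)) = clusteredʳ s , inj₂ (y , same-trans (same-sym s) s′ , h)

            -- In a cluster that is not bad, the least available vertex is chosen.
            First : Pt → Set
            First x = Clustered x × ¬ Bad c x × Available c x × (∀ z → Same x z → Available c z → z ≢ x → x ≺ z)

            Alive : Pt → Set
            Alive x = Bad c x × (∀ y → First y → ¬ A x y)

            private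
              first-∃ : ∀ {x} → Clustered x → ¬ Bad c x → ∃[ z ] (Same x z × First z)
              first-∃ {x} q nb = go (dne λ none → nb (q , inj₁ (q , inj₂ (nh , none))))
                where
                nh : ¬ Hurt c x
                nh h = nb (q , inj₁ (q , inj₁ h))
                go : ∃[ z ] (Same x z × Available c z) → ∃[ z ] (Same x z × First z)
                go (z , s , av) =
                  let (m , (s′ , av′) , h) = minimum {λ z → Same x z × Available c z} (mates x) (λ (s , _) → ∈-mates s) (s , av)
                  in m , s′ , clusteredʳ s′ , (λ b → nb (bad-same (same-sym s′) b)) , av′ ,
                     λ w sw avw ne → h w (same-trans s′ sw , avw) ne

              -- In different clusters an active neighbour would have killed x; inside a cluster the
              -- least available vertex is unique.
              first-independent : ∀ {x y} → First x → First y → ¬ A x y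
              first-independent {x} {y} (_ , _ , avx , hx) (qy , _ , avy , hy) a with em {Same x y}
              ... | no ns = proj₂ avx (y , a , qy , ns , proj₁ avy)
              ... | yes s with em {x ≡ y}
              ... | yes refl = A-irrefl a
              ... | no ne = ≺-irrefl (≺-trans (hx y s avy (ne ∘ sym)) (hy x (same-sym s) avx ne))

              first-bor : Measurable First
              first-bor = m-× clustered-bor (m-× (m-¬ (bad-def (λ _ → c) c-family self))
                (m-× (available-def (λ _ → c) c-family self)
                  (m-∀~ (λ h → dne λ ns → h λ s → ⊥-elim (ns (same-~ s)))
                    (λ l → m-→ (same-bor self (mv l)) (m-→ (available-def (λ _ → c) c-family (mv l))
                      (m-→ (m-¬ (bor-≡ (mv l) self)) (bor-≺ self (mv l))))))))

              alive-bor : ∀ u → Measurable (λ x → Alive (at u x))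
              alive-bor u = at-m u (m-× (bad-def (λ _ → c) c-family self)
                (m-∀~ (λ h → dne λ ns → h λ _ a → ns (A-~ a))
                  (λ l → m-→ (at-m (mv l) first-bor) (m-¬ (A-bor self (mv l))))))

              DeadByFirst : Pt → Set
              DeadByFirst z = ∃[ y ] (First y × A z y)

              -- A failing cluster has only bad neighbours, in which no first vertex is chosen, so
              -- it loses nothing. Otherwise first vertices are active and each lost vertex is
              -- killed; a quarter of those would mean that the cluster is hurt.
              few-dead : ∀ {x} → Bad c x → ¬ AtLeastN quarter (λ z → Same x z × DeadByFirst z)
              few-dead {x} b (zs , len , u , al) with em {Failing c x}
              ... | yes f = none zs (subst (0 <_) (sym len) 0<quarter) al
                where
                none : ∀ zs → 0 < length zs → ¬ All (λ z → Same x z × DeadByFirst z) zs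
                none (z ∷ _) _ ((s , y , (qy , nby , _) , a) ∷ _) =
                  nby (qy , inj₂ (y , same-refl qy , z , A-sym a , failing-same s f))
              ... | no nf = nf (proj₁ b , inj₁ (zs , len , u , All.map dead al))
                where
                dead : ∀ {z} → Same x z × DeadByFirst z → Same x z × Killed c z
                dead (s , y , (qy , nby , (ey , _) , _) , a) =
                  s , y , a , qy , (λ s′ → nby (bad-same (same-trans s s′) b)) , ey

            Picked : (Pt → ℕ) → Pt → Set
            Picked p w = p w ≡ 1

            Resolved : (Pt → ℕ) → Pt → Set
            Resolved p x = ∃[ w ] (Same x w × Picked p w)

            -- Separation in `J` combines two demands: at most one pick in a cluster, and no
            -- `A`-edge between picks of different clusters.
            Isolated : (Pt → ℕ) → Pt → Set
            Isolated p w = (Picked p w → Alive w) × (∀ w′ → J w w′ → Picked p w → Picked p w′ → w ≡ w′)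

            private
              -- Only the picks in the unpruned clusters of In are discarded: a pruned cluster has lost too many
              -- vertices to the remaining picks, while the others can be re-picked at once by the local lemma.
              data Pruned (p : Pt → ℕ) (In : Pt → Set) (v : Pt) : Set where
                pruned : AtLeastN quarter (λ z → Same v z × (∃[ w ] (Picked p w × A z w × (¬ In w ⊎ Pruned p In w)))) →
                         Pruned p In v

              -- Re-picking the bad clusters near one class

              module Resolve (p : Pt → ℕ) (iso : ∀ w → Isolated p w)
                             (C : Pt → Set) (ys : List Pt) (in-ys : ∀ {y} → C y → y ∈ ys) where

                In : Pt → Set
                In w = ∃[ y ] (C y × Reach c n y w)

                Layer : ℕ → Pt → List Pt → Set
                Layer j y ls = (64 * g) ℕ.^ j ≤ length ls × AllPairs (λ v w → ¬ Same v w) ls ×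
                               All (λ w → Pruned p In w × Reach c (twice j) y w) ls

                Dead : Pt → Set
                Dead z = ∃[ w ] (Picked p w × A z w × (¬ In w ⊎ Pruned p In w))

                Killed-by : List Pt → List Pt → Set
                Killed-by ls zs = length zs ≡ length ls * quarter × Unique zs × (∀ {z} → z ∈ zs → ∃[ v ] (v ∈ ls × Same v z × Dead z))

                killed : ∀ {ls} → AllPairs (λ v w → ¬ Same v w) ls → All (Pruned p In) ls → ∃[ zs ] Killed-by ls zs
                killed ap pr = separated-union (λ s s′ → same-trans s (same-sym s′)) ap (All.map (λ { (pruned h) → h }) pr)

                -- Each pruned cluster has lost kg = 64Δg vertices to picks, and a pick has at most
                -- Δ neighbours. So there are 64g times as many picks, each two bad steps further:
                -- one inside the cluster and one along the edge. Picks being isolated, they lie in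
                -- different clusters.
                extend-layer : ∀ {j y ls zs} → C y → Bad c y → twice (suc j) ≤ n → Layer j y ls → Killed-by ls zs → ∃[ ls′ ] Layer (suc j) y ls′
                extend-layer {j} {y} {ls} {zs} cy by le (big , ap , al) (len , u , h) =
                  ls′ , enough , separate , All.tabulate (λ i → proj₂ (props i))
                  where
                  Found : Pt → Set
                  Found w = ∃[ z ] (z ∈ zs × A z w × Picked p w × (¬ In w ⊎ Pruned p In w))
                  ls′ : List Pt
                  ls′ = keep Found (nub (concatMap nbA zs))
                  props : ∀ {w} → w ∈ ls′ → Picked p w × Pruned p In w × Reach c (twice (suc j)) y w
                  props {w} i = go (proj₂ (∈-keep⁻ (nub (concatMap nbA zs)) i))
                    where
                    go : Found w → Picked p w × Pruned p In w × Reach c (twice (suc j)) y w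
                    go (z , iz , a , pw , d) = pw , in-pruned d , reached (h iz)
                      where
                      bw : Bad c w
                      bw = proj₁ (proj₁ (iso w) pw)
                      reached : ∃[ v ] (v ∈ ls × Same v z × Dead z) → Reach c (twice (suc j)) y w
                      reached (v , iv , s , _) = subst (λ i → Reach c i y w) (ℕₚ.+-comm (twice j) 2) (ball-trans (twice j) rv
                        (inj₂ (z , (bv , bad-same s bv , inj₁ s) ,
                          inj₂ (w , (bad-same s bv , bw , inj₂ (clusteredʳ s , proj₁ bw , a)) , refl))))
                        where
                        rv : Reach c (twice j) y v
                        rv = proj₂ (All.lookup al iv)
                        bv : Bad c v
                        bv = reach-bad (twice j) by rv
                      in-pruned : ¬ In w ⊎ Pruned p In w → Pruned p In w
                      -- Up to radius n every pick reached lies in `In`, so it can only count as a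
                      -- loss because its own cluster is pruned, and the branching goes on.
                      in-pruned (inj₁ nin) = ⊥-elim (nin (y , cy , ball-mono le (reached (h iz))))
                      in-pruned (inj₂ pr)  = pr
                  zs-cover : ∀ {z} → z ∈ zs → ∃[ w ] (w ∈ ls′ × z ∈ nbA w)
                  zs-cover {z} iz = go (h iz)
                    where
                    go : ∃[ v ] (v ∈ ls × Same v z × Dead z) → ∃[ w ] (w ∈ ls′ × z ∈ nbA w)
                    go (_ , _ , _ , w , pw , a , d) = w ,
                      ∈-keep⁺ (nub (concatMap nbA zs)) (∈-nub⁺ (concatMap nbA zs)
                        (∈-concatMap⁺ nbA (lose iz (nbA-all a)))) (z , iz , a , pw , d) ,
                      nbA-all (A-sym a)
                  enough : (64 * g) ℕ.^ suc j ≤ length ls′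
                  enough = ℕₚ.*-cancelʳ-≤ _ _ Δ {{ℕ.>-nonZero 0<Δ}} (begin
                    64 * g * (64 * g) ℕ.^ j * Δ      ≡⟨ arith g ((64 * g) ℕ.^ j) Δ ⟩
                    (64 * g) ℕ.^ j * (64 * Δ * g)    ≡⟨ cong (λ k → (64 * g) ℕ.^ j * (k * g)) (sym k≡) ⟩
                    (64 * g) ℕ.^ j * quarter         ≤⟨ ℕₚ.*-monoˡ-≤ quarter big ⟩
                    length ls * quarter              ≡⟨ sym len ⟩
                    length zs                        ≤⟨ length-cover ls′ nbA u nbA-len zs-cover ⟩
                    length ls′ * Δ                   ∎)
                    where
                    open ℕₚ.≤-Reasoning
                    arith : ∀ g p Δ → 64 * g * p * Δ ≡ p * (64 * Δ * g)
                    arith = solve-∀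
                  separate : AllPairs (λ v w → ¬ Same v w) ls′
                  separate = go ls′ (keep-unique (nub-unique (concatMap nbA zs))) (λ i → proj₁ (props i))
                    where
                    go : ∀ ls → Unique ls → (∀ {w} → w ∈ ls → Picked p w) → AllPairs (λ v w → ¬ Same v w) ls
                    go [] [] _ = []
                    go (v ∷ ls) (n ∷ u) h = All.tabulate (λ i s → All.lookup n i
                        (proj₂ (iso v) _ (inj₁ s) (h (here refl)) (h (there i)))) ∷ go ls u (h ∘ there)

                next-layer : ∀ {j y ls} → C y → Bad c y → twice (suc j) ≤ n → Layer j y ls → ∃[ ls′ ] Layer (suc j) y ls′
                next-layer {j} cy by le l@(_ , ap , al) =
                  let (_ , k) = killed ap (All.map proj₁ al) in extend-layer {j} cy by le l k

                layers : ∀ {y} → C y → Bad c y → Pruned p In y → ∀ j → twice j ≤ n → ∃[ ls ] Layer j y ls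
                layers {y} cy by pr zero    _  = y ∷ [] , ℕₚ.≤-refl , [] ∷ [] , (pr , refl) ∷ []
                layers     cy by pr (suc j) le = next-layer {j} cy by le (proj₂ (layers cy by pr j (ℕₚ.≤-trans (ℕₚ.m≤n+m (twice j) 2) le)))

                -- After r layers, within 2r ≤ n bad steps, there would be (64g)^r ≥ M clusters,
                -- which `no-growth` forbids.
                not-pruned : ∀ {y} → C y → Bad c y → ¬ Pruned p In y
                not-pruned {y} cy by pr = go (layers cy by pr r r≤n)
                  where
                  distinct : ∀ {ls} → AllPairs (λ v w → ¬ Same v w) ls → All Clustered ls → Unique ls
                  distinct [] [] = []
                  distinct (ns ∷ ap) (q ∷ qs) = All.map (λ { ns refl → ns (same-refl q) }) ns ∷ distinct ap qs
                  go : ¬ (∃[ ls ] Layer r y ls)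
                  go (ls , big , ap , al) = no-growth y (by , atLeast ls (ℕₚ.≤-trans M≤ big)
                    (distinct ap (All.map (λ (_ , rv) → proj₁ (reach-bad (twice r) by rv)) al)) (All.map (λ (_ , rw) → ball-mono r≤n rw) al))

                -- The clusters to be re-picked.
                Free : Pt → Set
                Free e = ∃[ w ] (Cl e w × Bad c w × In w × ¬ Pruned p In w)

                k′ : ℕ
                k′ = 2 * quarter

                Blocked : Pt → Set
                Blocked z = ∃[ w ] (Picked p w × ¬ (∃[ e ] (Free e × Cl e w)) × A z w)

                -- Of the four quarters, less than one is lost to the first vertices by `few-dead`,
                -- and less than one to the picks that are kept, as the cluster is not pruned. Two
                -- remain.
                options : ∀ e → Free e → AtLeastN k′ (λ z → Cl e z × Alive z × ¬ Blocked z)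
                options e (w , cw , bw , iw , npw) = atLeast open-list enough (keep-unique (keep-unique (mates-unique w)))
                    (All.tabulate λ {z} i →
                      let (i′ , nb) = ∈-keep⁻ alive-list i
                          (i″ , nd) = ∈-keep⁻ (mates w) i′
                          s = mates-∈ i″
                      in member s , (bad-same s bw , λ y fy a → nd (y , fy , a)) , nb)
                  where
                  member : ∀ {z} → Same w z → Cl e z
                  member {z} (e′ , c₁ , c₂) = subst (λ e → Cl e z) (cl-centre c₁ cw) c₂
                  alive-list open-list : List Pt
                  alive-list = keep (λ z → ¬ DeadByFirst z) (mates w)
                  open-list = keep (λ z → ¬ Blocked z) alive-list
                  few-blocked : ¬ AtLeastN quarter (λ z → z ∈ alive-list × Blocked z)
                  few-blocked h = npw (pruned (atLeast-mono (λ (i , v , pv , nf , a) →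
                    mates-∈ (proj₁ (∈-keep⁻ (mates w) i)) , v , pv , a , outside v pv nf em em) h))
                    where
                    outside : ∀ v → Picked p v → ¬ (∃[ e ] (Free e × Cl e v)) → Dec (In v) → Dec (Pruned p In v) → ¬ In v ⊎ Pruned p In v
                    outside v pv nf (no ni)  _         = inj₁ ni
                    outside v pv nf _        (yes pr)  = inj₂ pr
                    -- Within `In` and unpruned, the cluster of the pick would itself be re-picked,
                    -- so this pick is not among those kept.
                    outside v pv nf (yes iv) (no npr) =
                      let bv = proj₁ (proj₁ (iso v) pv)
                          (e′ , ce) = proj₁ bv
                      in ⊥-elim (nf (e′ , (v , ce , bv , iv , npr) , ce))
                  enough : k′ ≤ length open-list
                  enough = ℕₚ.+-cancelˡ-≤ (2 * quarter) k′ (length open-list) (begin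
                    2 * quarter + 2 * quarter                    ≡⟨ arith₁ quarter ⟩
                    4 * quarter                                  ≡⟨ sym (trans (mates-K (e , cw)) K≡) ⟩
                    length (mates w)                             ≤⟨ ℕₚ.<⇒≤ (atLeast-or quarter DeadByFirst (mates-unique w)
                                                                      (λ h → few-dead bw (atLeast-mono (λ (i , d) → mates-∈ i , d) h))) ⟩
                    quarter + length alive-list                  ≤⟨ ℕₚ.+-monoʳ-≤ quarter (ℕₚ.<⇒≤
                                                                      (atLeast-or quarter Blocked (keep-unique (mates-unique w)) few-blocked)) ⟩
                    quarter + (quarter + length open-list)       ≡⟨ arith₂ quarter (length open-list) ⟩
                    2 * quarter + length open-list               ∎)
                    where
                    open ℕₚ.≤-Reasoning
                    arith₁ : ∀ q → 2 * q + 2 * q ≡ 4 * q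
                    arith₁ = solve-∀
                    arith₂ : ∀ q l → q + (q + l) ≡ 2 * q + l
                    arith₂ = solve-∀

                private
                  L′ : ∀ e → Dec (Free e) → List Pt
                  L′ e (yes fe) = proj₁ (options e fe)
                  L′ e (no _)   = []

                L : Pt → List Pt
                L e = L′ e em

                L-len : ∀ e → length (L e) ≤ k′
                L-len e = go em
                  where
                  go : ∀ d → length (L′ e d) ≤ k′
                  go (yes fe) = ℕₚ.≤-reflexive (proj₁ (proj₂ (options e fe)))
                  go (no _)   = z≤n

                L-unique : ∀ e → Unique (L e)
                L-unique e = go em
                  where
                  go : ∀ d → Unique (L′ e d)
                  go (yes fe) = proj₁ (proj₂ (proj₂ (options e fe)))
                  go (no _)   = []

                L-full : ∀ {e} → Free e → length (L e) ≡ k′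
                L-full {e} fe = go em
                  where
                  go : ∀ d → length (L′ e d) ≡ k′
                  go (yes fe) = proj₁ (proj₂ (options e fe))
                  go (no nf)  = ⊥-elim (nf fe)

                L-∈ : ∀ {e z} → z ∈ L e → Cl e z × Alive z × ¬ Blocked z
                L-∈ {e} {z} = go em
                  where
                  go : ∀ d → z ∈ L′ e d → Cl e z × Alive z × ¬ Blocked z
                  go (yes fe) i = All.lookup (proj₂ (proj₂ (proj₂ (options e fe)))) i

                centre′ : ∀ z → Dec (Clustered z) → Pt
                centre′ z (yes (e , _)) = e
                centre′ z (no _)        = z

                centre : Pt → Pt
                centre z = centre′ z em

                centre-≡ : ∀ {e z} → Cl e z → centre z ≡ e
                centre-≡ {e} {z} ce = go em
                  where
                  go : ∀ d → centre′ z d ≡ e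
                  go (yes (e′ , ce′)) = cl-centre ce′ ce
                  go (no nq)          = ⊥-elim (nq (e , ce))

                es : List Pt
                es = keep Free (nub (map centre (concatMap (ballList n) ys)))

                es-unique : Unique es
                es-unique = keep-unique (nub-unique (map centre (concatMap (ballList n) ys)))

                free-∈ : ∀ {e} → Free e → e ∈ es
                free-∈ {e} fe@(w , cw , _ , (y , cy , rw) , _) = ∈-keep⁺ (nub (map centre balls))
                  (∈-nub⁺ (map centre balls) (subst (_∈ map centre balls) (centre-≡ cw)
                    (∈-map⁺ centre (∈-concatMap⁺ (ballList n) (lose (in-ys cy) (∈-ballList n (reach-ball n rw))))))) fe
                  where
                  balls : List Pt
                  balls = concatMap (ballList n) ys

                open Counting {Pt} k′
                open Marginals {Pt} k′

                pick : (Pt → ℕ) → Pt → Pt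
                pick f e = nth (L e) (f e) e

                Both : Pt × Pt → (Pt → ℕ) → Set
                Both (z , z′) f = pick f (centre z) ≡ z × pick f (centre z′) ≡ z′

                Vars : Pt × Pt → Pt → Set
                Vars (z , z′) e = centre z ≡ e ⊎ centre z′ ≡ e

                Ok : Pt × Pt → Set
                Ok (z , z′) = z ∈ L (centre z) × z′ ∈ L (centre z′) × Free (centre z) × Free (centre z′) ×
                              A z z′ × centre z ≢ centre z′

                pairs : Pt → List (Pt × Pt)
                pairs z = concatMap (λ z′ → (z , z′) ∷ (z′ , z) ∷ []) (nbA z)

                clashes : Pt × Pt → List (Pt × Pt)
                clashes (z , z′) = concatMap pairs (L (centre z) ++ L (centre z′))

                -- Two lists of `k′` vertices can be involved, each vertex has at most Δ neighbours,
                -- and each edge counts in both orders.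
                d : ℕ
                d = (k′ + k′) * (Δ * 2)

                clashes-len : ∀ ev → length (clashes ev) ≤ d
                clashes-len (z , z′) = ℕₚ.≤-trans (len pairs pairs-len (L (centre z) ++ L (centre z′)))
                  (ℕₚ.*-monoˡ-≤ (Δ * 2) (subst (_≤ k′ + k′) (sym (Lₚ.length-++ (L (centre z))))
                    (ℕₚ.+-mono-≤ (L-len (centre z)) (L-len (centre z′)))))
                  where
                  len : ∀ {X Y : Set} {m} (f : X → List Y) → (∀ x → length (f x) ≤ m) → ∀ xs → length (concatMap f xs) ≤ length xs * m
                  len f h [] = z≤n
                  len {m = m} f h (x ∷ xs) = subst (_≤ m + length xs * m) (sym (Lₚ.length-++ (f x))) (ℕₚ.+-mono-≤ (h x) (len f h xs))
                  pairs-len : ∀ x → length (pairs x) ≤ Δ * 2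
                  pairs-len x = ℕₚ.≤-trans (len (λ z′ → (x , z′) ∷ (z′ , x) ∷ []) (λ _ → ℕₚ.≤-refl) (nbA x)) (ℕₚ.*-monoˡ-≤ 2 (nbA-len x))

                in-clashes : ∀ {ev z₁ z₂} → z₁ ∈ L (centre (proj₁ ev)) ++ L (centre (proj₂ ev)) → A z₁ z₂ →
                             (z₁ , z₂) ∈ clashes ev × (z₂ , z₁) ∈ clashes ev
                in-clashes {ev} {z₁} {z₂} i a = at-pair (here refl) , at-pair (there (here refl))
                  where
                  at-pair : ∀ {q} → q ∈ (z₁ , z₂) ∷ (z₂ , z₁) ∷ [] → q ∈ clashes ev
                  at-pair j = ∈-concatMap⁺ pairs (lose i
                    (∈-concatMap⁺ (λ z′ → (z₁ , z′) ∷ (z′ , z₁) ∷ []) (lose (nbA-all a) j)))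

                shared : ∀ {ev ev′ e} → Ok ev → Ok ev′ → e ∈ es → Vars ev e → Vars ev′ e → ev′ ∈ clashes ev
                shared {z , z′} {z₁ , z₂} _ (i₁ , i₂ , _ , _ , a , _) _ v (inj₁ e₁) =
                  proj₁ (in-clashes {z , z′} (side v) a)
                  where
                  side : Vars (z , z′) _ → z₁ ∈ L (centre z) ++ L (centre z′)
                  side (inj₁ e₀) = ∈-++⁺ˡ (subst (λ e → z₁ ∈ L e) (trans e₁ (sym e₀)) i₁)
                  side (inj₂ e₀) = ∈-++⁺ʳ (L (centre z)) (subst (λ e → z₁ ∈ L e) (trans e₁ (sym e₀)) i₁)
                shared {z , z′} {z₁ , z₂} _ (i₁ , i₂ , _ , _ , a , _) _ v (inj₂ e₂) =
                  proj₂ (in-clashes {z , z′} (side v) (A-sym a))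
                  where
                  side : Vars (z , z′) _ → z₂ ∈ L (centre z) ++ L (centre z′)
                  side (inj₁ e₀) = ∈-++⁺ˡ (subst (λ e → z₂ ∈ L e) (trans e₂ (sym e₀)) i₂)
                  side (inj₂ e₀) = ∈-++⁺ʳ (L (centre z)) (subst (λ e → z₂ ∈ L e) (trans e₂ (sym e₀)) i₂)

                both-local : ∀ ev → Both ev LocalOn Vars ev
                both-local (z , z′) h (p₁ , p₂) =
                  trans (cong (λ i → nth (L (centre z)) i (centre z)) (sym (h _ (inj₁ refl)))) p₁ ,
                  trans (cong (λ i → nth (L (centre z′)) i (centre z′)) (sym (h _ (inj₂ refl)))) p₂

                -- The two clusters are different, so their picks are independent and the clash has
                -- probability at most 1/k′². Since k′ = 128Δg, this suffices for 4d = 16k′Δ.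
                rare : ∀ ev → Ok ev → 4 * d * # es (Both ev) (λ _ → 0) ≤ total es
                rare (z , z′) (_ , _ , fe , fe′ , _ , ne) = ℕₚ.≤-trans (ℕₚ.*-monoˡ-≤ N 4d≤) (ℕₚ.*-cancelˡ-≤ T {{ℕ.>-nonZero 0<T}} (begin
                    T * (k′ * k′ * N)                        ≡⟨ arith T k′ N ⟩
                    T * N * (k′ * k′)                        ≡⟨ cong (_* (k′ * k′)) (#-independent es (one z) (one z′) (λ e _ p q → ne (trans p (sym q))) (λ _ → 0)) ⟩
                    N₁ * N₂ * (k′ * k′)                      ≡⟨ ℕₚ.[m*n]*[o*p]≡[m*o]*[n*p] N₁ N₂ k′ k′ ⟩
                    N₁ * k′ * (N₂ * k′)                      ≤⟨ ℕₚ.*-mono-≤ (marginal z fe) (marginal z′ fe′) ⟩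
                    T * T                                    ∎))
                  where
                  open ℕₚ.≤-Reasoning
                  T = total es
                  N = # es (Both (z , z′)) (λ _ → 0)
                  N₁ = # es (λ f → pick f (centre z) ≡ z) (λ _ → 0)
                  N₂ = # es (λ f → pick f (centre z′) ≡ z′) (λ _ → 0)
                  0<k′ : 0 < k′
                  0<k′ = ℕₚ.*-mono-< {0} {2} (s≤s z≤n) 0<quarter
                  0<T : 0 < T
                  0<T = ℕₚ.m^n>0 k′ {{ℕ.>-nonZero 0<k′}} (length es)
                  arith : ∀ T k N → T * (k * k * N) ≡ T * N * (k * k)
                  arith = solve-∀
                  one : ∀ z → (λ f → pick f (centre z) ≡ z) LocalOn (λ e → centre z ≡ e)
                  one z h e = trans (cong (λ i → nth (L (centre z)) i (centre z)) (sym (h _ refl))) e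
                  marginal : ∀ z → Free (centre z) → # es (λ f → pick f (centre z) ≡ z) (λ _ → 0) * k′ ≤ T
                  marginal z fe = single es es-unique (free-∈ fe) (λ a → nth (L (centre z)) a (centre z) ≡ z)
                    (λ {a} {b} la lb ea eb → nth-injective (centre z) (L-unique (centre z))
                      (subst (a <_) (sym (L-full fe)) la) (subst (b <_) (sym (L-full fe)) lb) (trans ea (sym eb))) (λ _ → 0)
                  4d≤ : 4 * d ≤ k′ * k′
                  4d≤ = begin
                    4 * ((k′ + k′) * (Δ * 2))    ≡⟨ arith₂ k′ Δ ⟩
                    k′ * (16 * Δ)                ≤⟨ ℕₚ.*-monoʳ-≤ k′ (begin
                      16 * Δ                       ≤⟨ ℕₚ.*-monoˡ-≤ Δ (ℕₚ.m≤m+n 16 112) ⟩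
                      128 * Δ                      ≡⟨ sym (ℕₚ.*-identityʳ (128 * Δ)) ⟩
                      128 * Δ * 1                  ≤⟨ ℕₚ.*-monoʳ-≤ (128 * Δ) 0<g ⟩
                      128 * Δ * g                  ≡⟨ arith₃ Δ g ⟩
                      2 * (64 * Δ * g)             ≡⟨ cong (λ k → 2 * (k * g)) (sym k≡) ⟩
                      k′                           ∎) ⟩
                    k′ * k′                      ∎
                    where
                    arith₂ : ∀ k Δ → 4 * ((k + k) * (Δ * 2)) ≡ k * (16 * Δ)
                    arith₂ = solve-∀
                    arith₃ : ∀ Δ g → 128 * Δ * g ≡ 2 * (64 * Δ * g)
                    arith₃ = solve-∀

                0<d : 0 < d
                0<d = ℕₚ.*-mono-< {0} {k′ + k′} (ℕₚ.<-≤-trans (ℕₚ.*-mono-< {0} {2} (s≤s z≤n) 0<quarter) (ℕₚ.m≤m+n k′ k′))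
                  (ℕₚ.*-mono-< {0} {Δ} {0} {2} 0<Δ (s≤s z≤n))

                open LocalLemma {Ev = Pt × Pt} (ℕₚ.*-mono-< {0} {2} (s≤s z≤n) 0<quarter) es (λ _ → 0) d 0<d Ok Both Vars both-local
                  clashes clashes-len (λ {ev} {ev′} {e} → shared {ev} {ev′} {e}) rare

                events : List (Pt × Pt)
                events = keep Ok (concatMap pairs (concatMap L es))

                avoid : ∃[ f ] ((∀ ev → ev ∈ events → ¬ Both ev f) × (∀ e → e ∉ es → f e ≡ 0) × (∀ e → e ∈ es → f e < k′))
                avoid = local-lemma events (All.tabulate λ i → proj₂ (∈-keep⁻ (concatMap pairs (concatMap L es)) i))

                module Repick (f : Pt → ℕ) (good : ∀ ev → ev ∈ events → ¬ Both ev f) (small : ∀ e → e ∈ es → f e < k′) where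

                  chosen-∈ : ∀ {e} → Free e → pick f e ∈ L e
                  chosen-∈ {e} fe = nth-inside (L e) e (subst (f e <_) (sym (L-full fe)) (small e (free-∈ fe)))

                  InFree : Pt → Set
                  InFree w = ∃[ e ] (Free e × Cl e w)

                  new′ : ∀ w → Dec (InFree w) → ℕ
                  new′ w (yes (e , _)) = choose (em {pick f e ≡ w}) 1 0
                  new′ w (no _)        = p w

                  new : Pt → ℕ
                  new w = new′ w em

                  new-old : ∀ {w} → ¬ InFree w → new w ≡ p w
                  new-old {w} nf = go em
                    where
                    go : ∀ d → new′ w d ≡ p w
                    go (yes y) = ⊥-elim (nf y)
                    go (no _)  = refl

                  new-free : ∀ {w e} → Free e → Cl e w → Picked new w → pick f e ≡ w
                  new-free {w} {e} fe ce = go em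
                    where
                    sel : ∀ {P : Set} (d : Dec P) → choose d 1 0 ≡ 1 → P
                    sel (yes x) _ = x
                    go : ∀ d → new′ w d ≡ 1 → pick f e ≡ w
                    go (yes (e′ , _ , ce′)) eq = subst (λ e → pick f e ≡ w) (cl-centre ce′ ce) (sel em eq)
                    go (no nf) _ = ⊥-elim (nf (e , fe , ce))

                  new-chosen : ∀ {e} → Free e → Picked new (pick f e)
                  new-chosen {e} fe = go em
                    where
                    sel : ∀ {P : Set} (d : Dec P) → P → choose d 1 0 ≡ 1
                    sel (yes _) _ = refl
                    sel (no n) x  = ⊥-elim (n x)
                    ce : Cl e (pick f e)
                    ce = proj₁ (L-∈ (chosen-∈ fe))
                    go : ∀ d → new′ (pick f e) d ≡ 1
                    go (yes (e′ , _ , ce′)) = sel em (cong (pick f) (cl-centre ce′ ce))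
                    go (no nf) = ⊥-elim (nf (e , fe , ce))

                  free-same : ∀ {w w′} → Same w w′ → InFree w → InFree w′
                  free-same {w′ = w′} (_ , c₁ , c₂) (e , fe , ce) = e , fe , subst (λ e → Cl e w′) (sym (cl-centre ce c₁)) c₂

                  new-in-L : ∀ {w} → (q : InFree w) → Picked new w → w ∈ L (proj₁ q)
                  new-in-L (e , fe , ce) pw = subst (_∈ L e) (new-free fe ce pw) (chosen-∈ fe)

                  new-alive : ∀ w → Dec (InFree w) → Picked new w → Alive w
                  new-alive w (yes q) pw = proj₁ (proj₂ (L-∈ (new-in-L q pw)))
                  new-alive w (no nf) pw = proj₁ (iso w) (trans (sym (new-old nf)) pw)

                  -- New picks come from the lists `L`, in which every neighbour of a kept pick has
                  -- been omitted as `Blocked`.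
                  mixed : ∀ {w w′} → InFree w → ¬ InFree w′ → J w w′ → Picked new w → Picked new w′ → ⊥
                  mixed q nf (inj₁ s) pw pw′ = nf (free-same s q)
                  mixed q nf (inj₂ (_ , _ , a)) pw pw′ =
                    proj₂ (proj₂ (L-∈ (new-in-L q pw))) (_ , trans (sym (new-old nf)) pw′ , nf , a)

                  separate : ∀ w w′ → Dec (InFree w) → Dec (InFree w′) → J w w′ → Picked new w → Picked new w′ → w ≡ w′
                  separate w w′ (no nf) (no nf′) j pw pw′ =
                    proj₂ (iso w) w′ j (trans (sym (new-old nf)) pw) (trans (sym (new-old nf′)) pw′)
                  separate w w′ (yes q) (no nf′) j pw pw′ = ⊥-elim (mixed q nf′ j pw pw′)
                  separate w w′ (no nf) (yes q′) j pw pw′ = ⊥-elim (mixed q′ nf (J-sym j) pw′ pw)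
                  separate w w′ (yes (e , fe , ce)) (yes (e′ , fe′ , ce′)) j pw pw′ = go em j
                    where
                    go : Dec (e ≡ e′) → J w w′ → w ≡ w′
                    go (yes refl) _ = trans (sym (new-free fe ce pw)) (new-free fe′ ce′ pw′)
                    go (no ne) (inj₁ (e″ , c₁ , c₂)) = ⊥-elim (ne (trans (cl-centre ce c₁) (cl-centre c₂ ce′)))
                    go (no ne) (inj₂ (_ , _ , a)) = ⊥-elim (good (w , w′) listed
                        (subst (λ e → pick f e ≡ w) (sym (centre-≡ ce)) (new-free fe ce pw) ,
                         subst (λ e → pick f e ≡ w′) (sym (centre-≡ ce′)) (new-free fe′ ce′ pw′)))
                      where
                      iw : w ∈ L e
                      iw = new-in-L (e , fe , ce) pw
                      iw′ : w′ ∈ L e′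
                      iw′ = new-in-L (e′ , fe′ , ce′) pw′
                      ok : Ok (w , w′)
                      ok = subst (λ e → w ∈ L e) (sym (centre-≡ ce)) iw , subst (λ e → w′ ∈ L e) (sym (centre-≡ ce′)) iw′ ,
                           subst Free (sym (centre-≡ ce)) fe , subst Free (sym (centre-≡ ce′)) fe′ , a ,
                           λ eq → ne (trans (sym (centre-≡ ce)) (trans eq (centre-≡ ce′)))
                      listed : (w , w′) ∈ events
                      listed = ∈-keep⁺ (concatMap pairs (concatMap L es))
                        (∈-concatMap⁺ pairs (lose (∈-concatMap⁺ L (lose (free-∈ fe) iw))
                          (∈-concatMap⁺ (λ z′ → (w , z′) ∷ (z′ , w) ∷ []) (lose (nbA-all a) (here refl))))) ok

                  new-resolved : ∀ {e w} → Free e → Cl e w → Resolved new w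
                  new-resolved {e} fe ce = pick f e , (e , ce , proj₁ (L-∈ (chosen-∈ fe))) , new-chosen fe

                  still-resolved : ∀ w → Dec (InFree w) → Resolved p w → Resolved new w
                  still-resolved w (yes (e , fe , ce)) _ = new-resolved fe ce
                  still-resolved w (no nf) (v , s , pv) =
                    v , s , trans (new-old (λ q → nf (free-same (same-sym s) q))) pv

                  class-resolved : ∀ {y} → C y → Bad c y → Resolved new y
                  class-resolved {y} cy by = let (e , ce) = proj₁ by in
                    new-resolved (y , ce , by , (y , cy , ball-refl n) , not-pruned cy by) ce

                  changes : ∀ w → new w ≢ p w → ∃[ y ] (C y × Ball J (n + 1) y w)
                  changes w ne = go (dne λ nf → ne (new-old nf))
                    where
                    go : InFree w → ∃[ y ] (C y × Ball J (n + 1) y w)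
                    go (e , (v , cv , _ , (y , cy , rv) , _) , cw) =
                      y , cy , ball-trans n (reach-ball n rv) (ball-edge {J = J} (inj₁ (e , cv , cw)))

                solution : Σ (Pt → ℕ) λ p′ → (∀ w → Isolated p′ w) × (∀ w → Resolved p w → Resolved p′ w) ×
                           (∀ {y} → C y → Bad c y → Resolved p′ y) × (∀ w → p′ w ≢ p w → ∃[ y ] (C y × Ball J (n + 1) y w))
                solution = let (f , good , _ , small) = avoid
                               module R = Repick f good small
                           in R.new , (λ w → R.new-alive w em , λ w′ → R.separate w w′ em em) ,
                              (λ w → R.still-resolved w em) , R.class-resolved , R.changes

              record PickState (i : ℕ) : Set₁ where
                field
                  p     : Pt → ℕ
                  p-bor : BorelLabel p
                  iso   : ∀ w → Isolated p w
                  done  : ∀ x → Bad c x → ι x < i → Resolved p x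

              -- Re-picking for a whole part

              module PickStep (i : ℕ) (s : PickState i) where
                open PickState s

                U : Pred Pt 0ℓ
                U x = ι x ≡ i

                n+1≤n+3 : n + 1 ≤ n + 3
                n+1≤n+3 = ℕₚ.+-monoʳ-≤ n (s≤s z≤n)

                -- Re-picked clusters are met after n steps and one more leads to any of their
                -- points: n + 1. `Kept` may be affected one step beyond, at n + 2, and it looks one
                -- step further.
                open Stage 𝓙 U (ι-bor i) (n + 1) (n + 3) n+1≤n+3

                Kept : (Pt → ℕ) → Pt → Set
                Kept p′ w = Isolated p′ w × (Resolved p w → Resolved p′ w)

                Φ : (Pt → ℕ) → Pt → Set
                Φ p′ x = (Bad c x → Resolved p′ x) × (∀ w → Ball J (n + 2) x w → Kept p′ w)

                resolved-def : ∀ φ → BorelFamily φ → ∀ u → Measurable (λ x → Resolved (φ x) (at u x))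
                resolved-def φ b u = m-∃~ (λ {x} (s , _) → ~-trans (at-~ u x) (same-~ s)) (λ l → m-× (same-bor u (mv l)) (b (mv l) 1))

                Φ-bor : ∀ φ → BorelFamily φ → ∀ u → Measurable (λ x → Φ (φ x) (at u x))
                Φ-bor φ b u = m-× (m-→ (bad-def (λ _ → c) c-family u) (resolved-def φ b u))
                  (m-∀~ (λ {x} h → dne λ nr → h λ r → ⊥-elim (nr (~-trans (at-~ u x) (ball-~ J-~ (n + 2) r))))
                    (λ l → m-→ (bor-Ball J-~ (LocalGraph.J-bor 𝓙) (n + 2) u (mv l)) (m-×
                      (m-× (m-→ (b (mv l) 1) (alive-bor (mv l)))
                           (m-∀~ (λ {x} h → dne λ nr → h λ j → ⊥-elim (nr (~-trans (at-~ (mv l) x) (J-~ j))))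
                             (λ l′ → m-→ (LocalGraph.J-bor 𝓙 (mv l) (mv l′)) (m-→ (b (mv l) 1) (m-→ (b (mv l′) 1) (bor-≡ (mv l) (mv l′)))))))
                      (m-→ (resolved-def (λ _ → p) (λ u l → at-m u (p-bor l)) (mv l)) (resolved-def φ b (mv l))))))

                Φ-local : ∀ {c₁ c₂ x} → (∀ w → Ball J (n + 3) x w → c₁ w ≡ c₂ w) → Φ c₁ x → Φ c₂ x
                Φ-local {c₁} {c₂} {x} h (res , kept) =
                  (λ b → move-resolved x (ball-refl (n + 2)) (res b)) , λ w b →
                    let ((al , is) , keeps) = kept w b
                    in ((λ pw → al (trans (same w b) pw)) ,
                        λ w′ j pw pw′ → is w′ j (trans (same w b) pw) (trans (h w′ (one w w′ b j)) pw′)) ,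
                       λ rw → move-resolved w b (keeps rw)
                  where
                  one : ∀ w w′ → Ball J (n + 2) x w → J w w′ → Ball J (n + 3) x w′
                  one w w′ b j = subst (λ m → Ball J m x w′) (ℕₚ.+-assoc n 2 1) (ball-trans (n + 2) b (ball-edge {J = J} j))
                  same : ∀ w → Ball J (n + 2) x w → c₁ w ≡ c₂ w
                  same w b = h w (ball-mono (ℕₚ.+-monoʳ-≤ n (s≤s (s≤s z≤n))) b)
                  move-resolved : ∀ w → Ball J (n + 2) x w → Resolved c₁ w → Resolved c₂ w
                  move-resolved w b (v , sv , pv) = v , sv , trans (sym (h v (one w v b (inj₁ sv)))) pv

                solve : ∀ x → U x → Σ (Pt → ℕ) λ p′ → (∀ w → p′ w ≢ p w → Zone x w) × (∀ y → Class x y → Φ p′ y)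
                solve x ux = go (finite i x)
                  where
                  go : ∃[ ys ] (∀ {y} → Class x y → y ∈ ys) →
                       Σ (Pt → ℕ) λ p′ → (∀ w → p′ w ≢ p w → Zone x w) × (∀ y → Class x y → Φ p′ y)
                  go (ys , in-ys) = found (Resolve.solution p iso (Class x) ys in-ys)
                    where
                    found : Σ (Pt → ℕ) (λ p′ → (∀ w → Isolated p′ w) × (∀ w → Resolved p w → Resolved p′ w) ×
                              (∀ {y} → Class x y → Bad c y → Resolved p′ y) ×
                              (∀ w → p′ w ≢ p w → ∃[ y ] (Class x y × Ball J (n + 1) y w))) →
                            Σ (Pt → ℕ) λ p′ → (∀ w → p′ w ≢ p w → Zone x w) × (∀ y → Class x y → Φ p′ y)
                    found (p′ , iso′ , keeps , solved , changes) =
                      p′ , changes , λ y r → (λ b → solved r b) , λ w _ → iso′ w , keeps w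

                next : PickState (suc i)
                next = finish (stage (finite i) p p-bor Φ Φ-bor Φ-local solve)
                  where
                  finish : Σ (Pt → ℕ) (λ p′ → BorelLabel p′ × (∀ x → U x → Φ p′ x) ×
                             (∀ w → p′ w ≢ p w → ∃[ y ] (U y × Ball J (n + 1) y w))) → PickState (suc i)
                  finish (p′ , p′-bor , good , change) = record
                    { p = p′ ; p-bor = p′-bor ; iso = λ w → proj₁ (kept w em) ; done = done′ }
                    where
                    Touched : Pt → Set
                    Touched w = ∃[ y ] (U y × Ball J (n + 2) y w)
                    same : ∀ {w v} → ¬ Touched w → w ≡ v ⊎ J w v → p′ v ≡ p v
                    same {w} {v} nt h = dne λ ne → let (y , uy , b) = change v ne in nt (y , uy , near y b h)
                      where
                      near : ∀ y → Ball J (n + 1) y v → w ≡ v ⊎ J w v → Ball J (n + 2) y w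
                      near y b (inj₁ refl) = ball-mono (ℕₚ.+-monoʳ-≤ n (s≤s z≤n)) b
                      near y b (inj₂ j) = subst (λ m → Ball J m y w) (ℕₚ.+-assoc n 1 1) (ball-trans (n + 1) b (ball-edge {J = J} (J-sym j)))
                    kept : ∀ w → Dec (Touched w) → Kept p′ w
                    kept w (yes (y , uy , b)) = proj₂ (good y uy) w b
                    kept w (no nt) =
                      ((λ pw → proj₁ (iso w) (trans (sym (same nt (inj₁ refl))) pw)) ,
                       λ w′ j pw pw′ → proj₂ (iso w) w′ j (trans (sym (same nt (inj₁ refl))) pw) (trans (sym (same nt (inj₂ j))) pw′)) ,
                      λ (v , sv , pv) → v , sv , trans (same nt (inj₂ (inj₁ sv))) pv
                    done′ : ∀ x → Bad c x → ι x < suc i → Resolved p′ x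
                    done′ x b (s≤s le) = go (ℕₚ.m≤n⇒m<n∨m≡n le)
                      where
                      go : ι x < i ⊎ ι x ≡ i → Resolved p′ x
                      go (inj₁ lt) = proj₂ (kept x em) (done x b lt)
                      go (inj₂ e)  = proj₁ (good x e) b

              states : ∀ i → PickState i
              states zero = record
                { p = λ _ → 0 ; p-bor = λ l → m-const (0 ≡ l) ; iso = λ w → (λ ()) , λ _ _ () ; done = λ x b () }
              states (suc i) = PickStep.next i (states i)

            abstract
              selection : Σ (Pred Pt 0ℓ) λ I → Measurable I × (∀ {x y} → I x → I y → ¬ A x y) ×
                          (∀ x → Clustered x → ∃[ w ] (Same x w × I w))
              selection = finish (states t)
                where
                finish : PickState t → Σ (Pred Pt 0ℓ) λ I → Measurable I × (∀ {x y} → I x → I y → ¬ A x y) ×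
                                   (∀ x → Clustered x → ∃[ w ] (Same x w × I w))
                finish s = (λ x → First x ⊎ Picked p x) , m-⊎ first-bor (p-bor 1) , independent , λ x q → cases x q em
                  where
                  open PickState s
                  independent : ∀ {x y} → First x ⊎ Picked p x → First y ⊎ Picked p y → ¬ A x y
                  independent (inj₁ fx) (inj₁ fy) a = first-independent fx fy a
                  independent (inj₁ fx) (inj₂ py) a = proj₂ (proj₁ (iso _) py) _ fx (A-sym a)
                  independent (inj₂ px) (inj₁ fy) a = proj₂ (proj₁ (iso _) px) _ fy a
                  independent {x} {y} (inj₂ px) (inj₂ py) a = A-irrefl (subst (A x) (sym x≡y) a)
                    where
                    x≡y : x ≡ y
                    x≡y = proj₂ (iso x) y (inj₂ (proj₁ (proj₁ (proj₁ (iso x) px)) , proj₁ (proj₁ (proj₁ (iso y) py)) , a)) px py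
                  cases : ∀ x → Clustered x → Dec (Bad c x) → ∃[ w ] (Same x w × (First w ⊎ Picked p w))
                  cases x q (yes b) = let (w , s , pw) = done x b (ι< x) in w , s , inj₂ pw
                  cases x q (no nb) = let (w , s , fw) = first-∃ q nb in w , s , inj₁ fw

    -- The combinatorial theorem on a frame

    module _
      (H A B : Graph Pt)
      (H-~ : ∀ {x y} → Adj H x y → x ~ y)
      (A⊆H : ∀ {x y} → Adj A x y → Adj H x y)
      (B⊆H : ∀ {x y} → Adj B x y → Adj H x y)
      (A-bor : Bor₂ (Adj A)) (B-bor : Bor₂ (Adj B))
      (nbH : Pt → List Pt) (nbH-all : ∀ {x y} → Adj H x y → y ∈ nbH x)
      (Δ : ℕ) (0<Δ : 0 < Δ)
      (nbA : Pt → List Pt) (nbA-all : ∀ {x y} → Adj A x y → y ∈ nbA x) (nbA-len : ∀ x → length (nbA x) ≤ Δ)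
      (t : ℕ) (1≤t : 1 ≤ t)
      (partition : ∀ {J} m → (∀ {x y} → J x y → Ball (Adj H) m x y) → ∀ N → Partition t J N)
      (L : ℕ) (2≤L : 2 ≤ L) (Δ<2^L : Δ < 2 ℕ.^ L)
      (e₆ e₈ e₁₄ : ℕ) (e₆≡ : e₆ ≡ 6) (e₈≡ : e₈ ≡ 8) (e₁₄≡ : e₁₄ ≡ 14)
      (large : ∀ x → AtLeastN (2 ℕ.^ e₈ * Δ * (2 ℕ.^ e₁₄ * L)) (Star (Adj B) x))
      where
      private
        module 𝓒 = Constants Δ L t 2≤L Δ<2^L 1≤t e₆ e₈ e₁₄ e₆≡ e₈≡ e₁₄≡

        k-1 : ℕ
        k-1 = ℕ.pred (64 * Δ)

        k≡ : suc k-1 ≡ 64 * Δ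
        k≡ = ℕₚ.suc-pred (64 * Δ) {{ℕ.>-nonZero (ℕₚ.*-mono-< {0} {64} (s≤s z≤n) 0<Δ)}}

        0<g : 0 < 𝓒.g
        0<g = ℕₚ.*-mono-< {0} {2 ℕ.^ e₁₄} {0} {L} (ℕₚ.m^n>0 2 e₁₄) (ℕₚ.≤-trans (s≤s z≤n) 2≤L)

        0<K : 0 < 𝓒.K
        0<K = ℕₚ.*-mono-< {0} {2 ℕ.^ e₈ * Δ} (ℕₚ.*-mono-< {0} {2 ℕ.^ e₈} (ℕₚ.m^n>0 2 e₈) 0<Δ) 0<g

        2^e₈ : 2 ℕ.^ e₈ ≡ 4 * 64
        2^e₈ = cong (2 ℕ.^_) e₈≡

        K≡ : 𝓒.K ≡ 4 * (suc k-1 * 𝓒.g)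
        K≡ = trans (cong (λ c → c * Δ * 𝓒.g) {2 ℕ.^ e₈} {4 * 64} 2^e₈)
          (trans (arith 4 64 Δ 𝓒.g) (cong (λ k → 4 * (k * 𝓒.g)) (sym k≡)))
          where
          arith : ∀ a b Δ g → a * b * Δ * g ≡ a * (b * Δ * g)
          arith = solve-∀

        2^e₆ : 2 ℕ.^ e₆ ≡ 64
        2^e₆ = cong (2 ℕ.^_) e₆≡

        M≤ : 𝓒.M ≤ (64 * 𝓒.g) ℕ.^ 𝓒.r
        M≤ = subst (λ c → 𝓒.M ≤ (c * 𝓒.g) ℕ.^ 𝓒.r) {2 ℕ.^ e₆} {64} 2^e₆ 𝓒.M≤

        B-~ : ∀ {x y} → Adj B x y → x ~ y
        B-~ b = H-~ (B⊆H b)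

        𝓑 : LocalGraph
        𝓑 = record { J = Adj B ; J-sym = symmetric B ; J-~ = B-~ ; J-bor = B-bor
                   ; nb = nbH ; nb-all = λ b → nbH-all (B⊆H b) }

        clusters : Clustering (Adj B) 𝓒.K
        clusters = clustering 𝓑 𝓒.K 0<K large t
          (partition 1 (λ b → ball-edge {J = Adj H} (B⊆H b)) ((𝓒.K + 𝓒.K) + (𝓒.K + 𝓒.K)))

        𝓢 : Setting
        𝓢 = record
          { A = Adj A ; A-sym = symmetric A ; A-irrefl = irreflexive A refl ; A-~ = λ a → H-~ (A⊆H a) ; A-bor = A-bor
          ; Δ = Δ ; nbA = nbA ; nbA-all = nbA-all ; nbA-len = nbA-len
          ; J₂ = Adj B ; J₂-~ = B-~ ; K = 𝓒.K ; 0<K = 0<K ; clusters = clusters }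

        open Clustering clusters using (cl-ball; cl-centre; dense)
        J Same : Pt → Pt → Set
        J = OnSetting.J 𝓢
        Same = OnSetting.Same 𝓢
        Clustered : Pt → Set
        Clustered = OnSetting.Clustered 𝓢

        J-ball : ∀ {x y} → J x y → Ball (Adj H) (𝓒.K + 𝓒.K) x y
        J-ball (inj₁ (e , p , q)) = ball-trans 𝓒.K
          (ball-sym (symmetric H) 𝓒.K (ball-map B⊆H 𝓒.K (cl-ball p))) (ball-map B⊆H 𝓒.K (cl-ball q))
        J-ball (inj₂ (_ , _ , a)) = ball-mono (ℕₚ.≤-trans 0<K (ℕₚ.m≤m+n 𝓒.K 𝓒.K)) (ball-edge {J = Adj H} (A⊆H a))

        n : ℕ
        n = twice 𝓒.r

        active : Σ (Pt → ℕ) λ c → BorelLabel c × (∀ v → ¬ OnSetting.Process.Random.Grow 𝓢 k-1 𝓒.g 0<g 0<Δ k≡ K≡ n 𝓒.M c v)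
        active = OnSetting.Process.Random.activation 𝓢 k-1 𝓒.g 0<g 0<Δ k≡ K≡ n 𝓒.M t
          (partition (𝓒.K + 𝓒.K) J-ball ((𝓒.ρ + 𝓒.ρ) + (𝓒.ρ + 𝓒.ρ))) 𝓒.m 𝓒.large 𝓒.strong

      independent-section : Σ (Pred Pt 0ℓ) λ I → Measurable I × Independent A I × CompleteSection B I
      independent-section = finish active
        where
        finish : Σ (Pt → ℕ) (λ c → BorelLabel c × (∀ v → ¬ OnSetting.Process.Random.Grow 𝓢 k-1 𝓒.g 0<g 0<Δ k≡ K≡ n 𝓒.M c v)) →
                 Σ (Pred Pt 0ℓ) λ I → Measurable I × Independent A I × CompleteSection B I
        finish (c , c-bor , no-growth) = complete (OnSetting.Process.Picks.selection 𝓢 k-1 𝓒.g 0<g 0<Δ k≡ K≡ n 𝓒.M 𝓒.r ℕₚ.≤-refl M≤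
            c c-bor no-growth t (partition (𝓒.K + 𝓒.K) J-ball ((n + 3) + (n + 3))))
          where
          complete : Σ (Pred Pt 0ℓ) (λ I → Measurable I × (∀ {x y} → I x → I y → ¬ Adj A x y) ×
                       (∀ x → Clustered x → ∃[ w ] (Same x w × I w))) →
                     Σ (Pred Pt 0ℓ) λ I → Measurable I × Independent A I × CompleteSection B I
          complete (I , I-m , indep , meets) = I , I-m , indep , λ v →
            let (y , w , vy , yw) = dense v
                (w′ , (y′ , p , q) , iw′) = meets w (y , yw)
            in w′ , vy ◅◅ subst (λ y → Star (Adj B) y w′) (cl-centre p yw) (ball-star 𝓒.K (cl-ball q)) , iw′

  -- Partitions from the asymptotic separation index

  module Separability (X : StandardBorelSpace) (G : Graph (StandardBorelSpace.Carrier X)) where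
    open StandardBorelSpace X using (Carrier; Measurable)

    suffix : ∀ {u v w p} → Path G w v p → u ∈ p → ∃[ p′ ] (Path G u v p′ × length p′ ≤ length p)
    suffix Path.stop               (here refl) = _ , Path.stop , ℕₚ.≤-refl
    suffix π@(Path.step _ _ _)     (here refl) = _ , π , ℕₚ.≤-refl
    suffix (Path.step _ π _)       (there i)   =
      let (p′ , π′ , le) = suffix π i in p′ , π′ , ℕₚ.≤-trans le (ℕₚ.n≤1+n _)

    -- Balls count walks, while powers of a graph are defined by paths. When a step returns to a
    -- vertex of the path, the loop is cut off by `suffix`.
    ball-joined : ∀ N {u v} → Ball (Adj G) N u v → JoinedWithin G N u v
    ball-joined zero    refl        = _ , Path.stop , ℕₚ.≤-refl
    ball-joined (suc N) (inj₁ refl) = _ , Path.stop , s≤s z≤n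
    ball-joined (suc N) {u} (inj₂ (w , e , b)) = go (ball-joined N b)
      where
      go : JoinedWithin G N w _ → JoinedWithin G (suc N) u _
      go (p , π , le) with em {u ∈ p}
      ... | yes i = let (p′ , π′ , le′) = suffix π i in p′ , π′ , ℕₚ.≤-trans le′ (ℕₚ.m≤n⇒m≤1+n le)
      ... | no n  = u ∷ p , Path.step e π n , s≤s le

    module _ (n₀ : ℕ) (asi : ∀ R → ∃[ s ] (SeparationIndexIs X (G Defs.^ R) s × s ≤ n₀)) where

      record Parts (R : ℕ) : Set₁ where
        field
          s      : ℕ
          s≤     : s ≤ n₀
          part   : Fin (suc s) → Pred Carrier 0ℓ
          part-m : ∀ i → Measurable (part i)
          index  : Carrier → Fin (suc s)
          in-part : ∀ x → part (index x) x
          unique : ∀ {i x} → part i x → i ≡ index x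
          finite : ∀ i x → part i x → ∃[ ys ] (∀ {y} →
                   Star (λ a b → part i a × part i b × Ball (Adj G) R a b) x y → y ∈ ys)

      parts : ∀ R → Parts R
      parts R = make (proj₂ (asi R))
        where
        make : ∀ {s} → SeparationIndexIs X (G Defs.^ R) s × s ≤ n₀ → Parts R
        make {s} (((𝒰 , fin) , _) , s≤n₀) = record
          { s = s ; s≤ = s≤n₀ ; part = part ; part-m = measurable
          ; index = λ x → proj₁ (covers x) ; in-part = λ x → proj₂ (covers x)
          ; unique = λ {i} {x} p → disjoint p (proj₂ (covers x))
          ; finite = finite }
          where
          open BorelPartition 𝒰
          finite : ∀ i x → part i x → ∃[ ys ] (∀ {y} →
                   Star (λ a b → part i a × part i b × Ball (Adj G) R a b) x y → y ∈ ys)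
          finite i x px = let (_ , xs , _ , cover) = fin i (x ⊣ [ px ])
                          in map underlying xs , λ r → let (py , r′) = lift px r in ∈-map⁺ underlying (cover r′)
            where
            lift : ∀ {x y} (px : part i x) → Star (λ a b → part i a × part i b × Ball (Adj G) R a b) x y →
                   Σ (part i y) λ py → Star (Adj ((G Defs.^ R) Defs.[ part i ])) (x ⊣ [ px ]) (y ⊣ [ py ])
            lift px Star.ε = px , Star.ε
            lift {x} px (_◅_ {j = z} (_ , pz , b) r) = extend em (lift pz r)
              where
              extend : Dec (x ≡ z) → Σ (part i _) (λ py → Star (Adj ((G Defs.^ R) Defs.[ part i ])) (z ⊣ [ pz ]) (_ ⊣ [ py ])) →
                       Σ (part i _) λ py → Star (Adj ((G Defs.^ R) Defs.[ part i ])) (x ⊣ [ px ]) (_ ⊣ [ py ])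
              -- A ball contains its centre, whereas powers of a graph have no loops; trivial steps
              -- are dropped.
              extend (yes refl) (py , r′) = py , r′
              extend (no x≢z)   (py , r′) = py , (x≢z , ball-joined R b) ◅ r′

      -- Any two neighbours of x are at distance at most 2, so each part of a partition for
      -- the square of G contains finitely many of them.
      locally-finite : ∀ x → ∃[ ys ] (∀ {y} → Adj G x y → y ∈ ys)
      locally-finite x = concatMap (λ i → proj₁ (list i em)) (allFin _) , λ {y} e →
          ∈-concatMap⁺ (λ i → proj₁ (list i em)) (lose (∈-allFin (index y)) (proj₂ (list (index y) em) e (in-part y)))
        where
        open Parts (parts 2)
        list : ∀ i → Dec (∃[ w ] (Adj G x w × part i w)) → ∃[ ys ] (∀ {y} → Adj G x y → part i y → y ∈ ys)
        list i (no none) = [] , λ e p → ⊥-elim (none (_ , e , p))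
        list i (yes (w , e , p)) = let (ys , cover) = finite i w p in ys , λ {y} e′ p′ →
          cover ((p , p′ , inj₂ (x , symmetric G e , inj₂ (y , e′ , refl))) ◅ Star.ε)

    ball-flatten : ∀ {J : Carrier → Carrier → Set} m → (∀ {x y} → J x y → Ball (Adj G) m x y) →
                   ∀ N {x y} → Ball J N x y → Ball (Adj G) (N * m) x y
    ball-flatten m f zero    refl        = refl
    ball-flatten m f (suc N) (inj₁ refl) = ball-refl (m + N * m)
    ball-flatten m f (suc N) (inj₂ (z , j , b)) = ball-trans m (f j) (ball-flatten m f N b)

    module _ (n₀ : ℕ) (asi : ∀ R → ∃[ s ] (SeparationIndexIs X (G Defs.^ R) s × s ≤ n₀))
             (mG : BorelAdjacency X G) where

      frame : Frame
      frame = component-frame X G mG (locally-finite n₀ asi)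

      -- For every `m` and `N` the number of parts is n₀ + 1: steps of `J` are short walks in `G`,
      -- and the power N * m of `G` has separation index at most n₀. This uniformity lets the
      -- constants depend on the number of parts.
      partition : ∀ {J : Carrier → Carrier → Set} m → (∀ {x y} → J x y → Ball (Adj G) m x y) →
                  ∀ N → OnFrame.Stages.Partition frame (suc n₀) J N
      partition {J} m f N = record
        { ι      = ι
        ; ι-bor  = λ l → bor l em
        ; ι<     = λ x → ℕₚ.<-≤-trans (Fₚ.toℕ<n (index x)) (s≤s s≤)
        ; finite = λ i x → fin i x em
        }
        where
        open Parts (parts n₀ asi (N * m))
        open Meas (StandardBorelSpace.space X)
        ι : Carrier → ℕ
        ι x = F.toℕ (index x)
        bor : ∀ l → Dec (∃[ i ] F.toℕ i ≡ l) → Measurable (λ x → ι x ≡ l)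
        bor l (yes (i , eq)) = m-iff (λ x p → trans (cong F.toℕ (sym (unique p))) eq)
          (λ x e → subst (λ i → part i x) (Fₚ.toℕ-injective (trans e (sym eq))) (in-part x)) (part-m i)
        bor l (no none) = m-iff (λ x ()) (λ x e → none (index x , e)) (m-const ⊥)
        Link : ℕ → Carrier → Carrier → Set
        Link i x y = ι x ≡ i × ι y ≡ i × Ball J N x y
        fin : ∀ i x → Dec (ι x ≡ i) → ∃[ ys ] (∀ {y} → Star (Link i) x y → y ∈ ys)
        fin i x (no ne) = x ∷ [] , λ { Star.ε → here refl ; ((e , _) ◅ _) → ⊥-elim (ne e) }
        fin i x (yes refl) = let (ys , cover) = finite (index x) x (in-part x) in ys , λ r → cover (Star.map move r)
          where
          move : ∀ {a b} → Link i a b → part (index x) a × part (index x) b × Ball (Adj G) (N * m) a b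
          move {a} {b} (ea , eb , bl) =
            subst (λ i → part i a) (Fₚ.toℕ-injective ea) (in-part a) ,
            subst (λ i → part i b) (Fₚ.toℕ-injective eb) (in-part b) , ball-flatten m f N bl

  -- From the hypotheses on the graphs to the combinatorial theorem

  private
    -- The constant of the theorem arises here as 25 = 3 + 8 + 14: three bits for log Δ > L/8, eight
    -- for K = 4 * 64Δ * g, and fourteen for g = 2^14 L.
    large-component : ∀ {V : Set} (P : Pred V 0ℓ) e e₈ e₁₄ → e ≡ 3 + (e₈ + e₁₄) →
      ∀ Δ j → 1 ≤ j → 2 ℕ.^ j ≤ Δ → AtLeast ((2 ℕ.^ e * Δ) · log Δ) P →
      AtLeastN (2 ℕ.^ e₈ * Δ * (2 ℕ.^ e₁₄ * suc j)) P
    large-component P e e₈ e₁₄ e≡ Δ j 1≤j le (xs , u , al , bound) = atLeast xs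
      (size-bound e e₈ e₁₄ e≡ Δ (suc j) (length xs)
        (multiple-bound (log Δ) {suc j} {7} (2 ℕ.^ e * Δ) (length xs) (log-lower Δ j 1≤j le) bound)) u al

    bits : ∀ Δ → 2 ≤ Δ → ∃[ j ] (1 ≤ j × 2 ℕ.^ j ≤ Δ × Δ < 2 ℕ.^ suc j)
    bits Δ 2≤Δ with least (λ m → Δ < 2 ℕ.^ m) {Δ} (n<2^n Δ)
    ... | zero        , lt , _ = ⊥-elim (ℕₚ.<⇒≱ lt (ℕₚ.≤-trans (s≤s z≤n) 2≤Δ))
    ... | suc zero    , lt , _ = ⊥-elim (ℕₚ.<⇒≱ lt 2≤Δ)
    ... | suc (suc i) , lt , l = suc i , s≤s z≤n , ℕₚ.≮⇒≥ (l (suc i) ℕₚ.≤-refl) , lt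

  independent-complete-section :
      (X : StandardBorelSpace) →
      (H G₁ G₂ : BorelGraph X) →
      LocallyCountable (graph H) →
      asi H <∞ →
      IsSpanningSubgraphOf G₁ H →
      IsSpanningSubgraphOf G₂ H →
      (Δ : ℕ) →
      2 ℕ.≤ Δ →
      MaxDegreeAtMost Δ (graph G₁) →
      (∀ v → AtLeast ((2 ℕ.^ 25 ℕ.* Δ) · log Δ) (Component (graph G₂) v)) →
      ∃[ I ] (StandardBorelSpace.Measurable X I × Independent (graph G₁) I × CompleteSection (graph G₂) I)
  independent-complete-section X H G₁ G₂ _ (n₀ , asi≤ , _) G₁⊆H G₂⊆H Δ 2≤Δ degree large = finish (bits Δ 2≤Δ)
    where
    open Separability X (graph H)
    𝓕 : Frame
    𝓕 = frame n₀ asi≤ (borel H)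
    finish : ∃[ j ] (1 ≤ j × 2 ℕ.^ j ≤ Δ × Δ < 2 ℕ.^ suc j) →
             ∃[ I ] (StandardBorelSpace.Measurable X I × Independent (graph G₁) I × CompleteSection (graph G₂) I)
    finish (j , 1≤j , 2^j≤Δ , Δ<2^j+1) = OnFrame.independent-section 𝓕 (graph H) (graph G₁) (graph G₂)
      (λ e → e ◅ Star.ε) G₁⊆H G₂⊆H (FrameOps.pullback 𝓕 (borel G₁)) (FrameOps.pullback 𝓕 (borel G₂))
      (λ x → proj₁ (locally-finite n₀ asi≤ x)) (λ {x} → proj₂ (locally-finite n₀ asi≤ x))
      Δ (ℕₚ.≤-trans (s≤s z≤n) 2≤Δ)
      (λ x → proj₁ (degree x)) (λ {x} → proj₂ (proj₂ (degree x))) (λ x → proj₁ (proj₂ (degree x)))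
      (suc n₀) (s≤s z≤n) (partition n₀ asi≤ (borel H))
      (suc j) (s≤s 1≤j) Δ<2^j+1 6 8 14 refl refl refl
      (λ x → large-component (Component (graph G₂) x) 25 8 14 refl Δ j 1≤j 2^j≤Δ (large x))

theorem1p53 : (∀ {ℓ} → ExcludedMiddle ℓ) →
    (X : StandardBorelSpace) →
    (H G₁ G₂ : BorelGraph X) →
    LocallyCountable (graph H) →
    asi H <∞ →
    IsSpanningSubgraphOf G₁ H →
    IsSpanningSubgraphOf G₂ H →
    (Δ : ℕ) →
    2 ℕ.≤ Δ →
    MaxDegreeAtMost Δ (graph G₁) →
    (∀ v → AtLeast ((2 ℕ.^ 25 ℕ.* Δ) · log Δ) (Component (graph G₂) v)) →
    ∃[ I ] (StandardBorelSpace.Measurable X I × Independent (graph G₁) I × CompleteSection (graph G₂) I)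
theorem1p53 em = Development.independent-complete-section em em
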